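{- Let $d\geq0$, $n\geq1$, and let $\eta$ be a multiset of $n+1$ non-negative integers. (i) $\mathbb{Q}[x_1,\ldots,x_{n+1}]_d$ is the direct sum of the three spaces $\operatorname{Ext}\,\mathbb{Q}[x_1,\ldots,x_n]_d$, $\operatorname{LE}\,\mathbb{Q}[x_1,\ldots,x_n]_{d-n}$ and $e_{n+1}\mathbb{Q}[x_1,\ldots,x_{n+1}]_{d-n-1}$. (ii) Suppose $0\in\eta$, and let $\eta\setminus\{0\}$ be $\eta$ with one copy of $0$ removed. Then the intersection of $\mathbb{Q}[x_1,\ldots,x_{n+1}]_\eta$ with the first summand of (i) is $\operatorname{Ext}\,\mathbb{Q}[x_1,\ldots,x_n]_{\eta\setminus\{0\}}$. If $\eta$ contains $0$ more than once, this is all of $\mathbb{Q}[x_1,\ldots,x_{n+1}]_\eta$. (iii) Suppose $0\in\eta$ and all entries of $\eta\setminus\{0\}$ are positive, and let $\mu$ be the multiset of $n$ integers obtained by subtracting $1$ from each element of $\eta\setminus\{0\}$. Then the second summand of (i) intersects $\mathbb{Q}[x_1,\ldots,x_{n+1}]_\eta$ in $\operatorname{LE}\,\mathbb{Q}[x_1,\ldots,x_n]_\mu$. (iv) Suppose all elements of $\eta$ are positive, and let $\mu$ be obtained by subtracting $1$ from each entry, a multiset of $n+1$ integers. Then the third summand of (i) intersects $\mathbb{Q}[x_1,\ldots,x_{n+1}]_\eta$ in $e_{n+1}\mathbb{Q}[x_1,\ldots,x_{n+1}]_\mu$.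
   Context: $S_m$ acts on $\mathbb{Q}[x_1,\ldots,x_m]$ by permuting variables. $\mathbb{Q}[x_1,\ldots,x_m]_d$ is the degree-$d$ homogeneous part, and it is $0$ if $d<0$. For a multiset $\mu$ of $m$ non-negative integers, $\mathbb{Q}[x_1,\ldots,x_m]_\mu$ is the span of the monomials whose multiset of exponents of $x_1,\ldots,x_m$ is $\mu$. $e_{n+1}=x_1\cdots x_{n+1}$. Tableaux: $\operatorname{SSYT}(\lambda)$ is the set of semistandard fillings of $\lambda$ by non-negative integers (rows weakly increasing, columns strictly increasing). $\operatorname{SSYT}_d(\lambda)$ and $\operatorname{SSYT}_\mu(\lambda)$ are those with entry sum $d$, respectively content (multiset of entries) $\mu$. Specht polynomials: for $T$ a filling of $\lambda\vdash m$ by $1,\ldots,m$, $\varepsilon_T=\sum_{\sigma\in C(T)}\sum_{\tau\in R(T)}\operatorname{sgn}(\sigma)\sigma\tau$ (column and row stabilizers). $p_{M,T}=\prod x_i^{h_i}$, where $h_i$ is the entry of $M$ in the box of $T$ containing $i$; $s_{M,T}$ is the order of the stabilizer of $p_{M,T}$ in $R(T)$; $F_{M,T}=\varepsilon_Tp_{M,T}/s_{M,T}$; and $V_M$ is the span of all $F_{M,T}$. It is known that $\mathbb{Q}[x_1,\ldots,x_m]_d=\bigoplus_{\lambda\vdash m}\bigoplus_{M\in\operatorname{SSYT}_d(\lambda)}V_M$. The operations $M\hat+v$: for $\lambda\vdash n$ and $M\in\operatorname{SSYT}(\lambda)$, - let $S\in\operatorname{SYT}(\lambda)$ be the standardization of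 $M$; - let $J(M)$ be the multiset $\{j_1,\ldots,j_m\}$, where $m$ is the maximal entry of $M$ and $j_h$ is the number of entries of $M$ smaller than $h$; - for a multiset $J$ and a standard tableau $S'$, let $\operatorname{ct}_J(S')$ put into the box of $S'$ containing $p$ the number of elements of $J$ (with multiplicity) smaller than $p$; - let $\operatorname{ev}$ be Schützenberger evacuation; - $\operatorname{EC}(\lambda)$ is the set of boxes outside $\lambda$ whose addition gives a partition $\lambda+v$; - for $v\in\operatorname{EC}(\lambda)$, let $\operatorname{ev}S+v$ be $\operatorname{ev}S$ with $v$ added and filled with $n+1$, and $S\tilde+v=\operatorname{ev}(\operatorname{ev}S+v)$; - $\delta_{M,v}=0$ if $v$ lies in a row strictly below the row containing $n$ in $\operatorname{ev}S$, and $\delta_{M,v}=1$ otherwise; - with $J_+=\{j+1:j\in J(M)\}$, set $M\hat+v=\operatorname{ct}_{J_+}(S\tilde+v)$ if $\delta_{M,v}=1$, and $M\hat+v=\operatorname{ct}_{J_+\cup\{1\}}(S\tilde+v)$ (multiset union) if $\delta_{M,v}=0$. Extension and lower enlargement: - $\operatorname{Ext}V_M=\bigoplus_{v\in\operatorname{EC}(\lambda),\,\delta_{M,v}=1}V_{M\hat+v}$ and $\operatorname{LE}V_M=\bigoplus_{v\in\operatorname{EC}(\lambda),\,\delta_{M,v}=0}V_{M\hat+v}$; these are subspaces of $\mathbb{Q}[x_1,\ldots,x_{n+1}]$. - $\operatorname{Ext}\,\mathbb{Q}[x_1,\ldots,x_n]_d=\bigoplus_{\lambda\vdash n}\bigoplus_{M\in\operatorname{SSYT}_d(\lambda)}\operatorname{Ext}V_M$,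 and similarly for $\operatorname{LE}$ and for the spaces with index a content $\mu$ (summing over $\operatorname{SSYT}_\mu(\lambda)$). -}

module Defs where

open import Data.Bool using (Bool; true; false; if_then_else_; _∧_; _∨_; not)
open import Data.Nat using (ℕ; zero; suc; _+_; _∸_; _≡ᵇ_; _<ᵇ_; _≤ᵇ_; pred)
open import Data.Integer using (ℤ; +_)
open import Data.Rational using (ℚ; 0ℚ; 1ℚ; -_; _/_) renaming (_+_ to _+ℚ_; _*_ to _*ℚ_)
open import Data.Maybe using (Maybe; just; nothing)
open import Data.Product using (_×_; _,_; proj₁; proj₂; Σ)
open import Data.Nat.ListAction using (sum)
open import Data.List using (List; []; _∷_; map; length; concat; concatMap; _++_; upTo; filterᵇ; foldr; zip; replicate)
open import Data.List.Relation.Unary.All using (All)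
open import Data.List.Membership.Propositional using (_∈_)
open import Data.List.Relation.Binary.Permutation.Propositional using (_↭_)
open import Data.Vec using (Vec; tabulate; toList)
open import Data.Fin using (Fin; toℕ)
open import Relation.Binary.PropositionalEquality using (_≡_; _≢_)

nth : {A : Set} → List A → ℕ → Maybe A
nth []       _       = nothing
nth (x ∷ xs) zero    = just x
nth (x ∷ xs) (suc i) = nth xs i

count : {A : Set} → (A → Bool) → List A → ℕ
count p xs = length (filterᵇ p xs)

allᵇ : {A : Set} → (A → Bool) → List A → Bool
allᵇ p = foldr (λ x b → p x ∧ b) true

anyᵇ : {A : Set} → (A → Bool) → List A → Bool
anyᵇ p = foldr (λ x b → p x ∨ b) false

eqList : List ℕ → List ℕ → Bool
eqList []       []       = true
eqList (x ∷ xs) (y ∷ ys) = (x ≡ᵇ y) ∧ eqList xs ys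
eqList _        _        = false

maxL : List ℕ → ℕ
maxL = foldr (λ x m → if m <ᵇ x then x else m) 0

oneTo : ℕ → List ℕ
oneTo m = map suc (upTo m)

indexed : {A : Set} → List A → List (ℕ × A)
indexed xs = zip (upTo (length xs)) xs

-- Tableaux: lists of rows (row 0 on top), cells addressed (row , column),
-- both 0-based.

Tab : Set
Tab = List (List ℕ)

shape : Tab → List ℕ
shape = map length

entries : Tab → List ℕ
entries = concat

sumTab : Tab → ℕ
sumTab T = sum (entries T)

entryAt : Tab → ℕ × ℕ → Maybe ℕ
entryAt T (r , c) with nth T r
... | nothing  = nothing
... | just row = nth row c

setL : List ℕ → ℕ → ℕ → List ℕ
setL []       _       _ = []
setL (x ∷ xs) zero    a = a ∷ xs
setL (x ∷ xs) (suc i) a = x ∷ setL xs i a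

setEntry : Tab → ℕ × ℕ → ℕ → Tab
setEntry []         _             _ = []
setEntry (row ∷ T)  (zero , c)    a = setL row c a ∷ T
setEntry (row ∷ T)  (suc r , c)   a = row ∷ setEntry T (r , c) a

dropLast : List ℕ → List ℕ
dropLast []           = []
dropLast (x ∷ [])     = []
dropLast (x ∷ y ∷ xs) = x ∷ dropLast (y ∷ xs)

nonEmpty : List ℕ → Bool
nonEmpty [] = false
nonEmpty (_ ∷ _) = true

removeLastIn : Tab → ℕ → Tab
removeLastIn T r = filterᵇ nonEmpty (go T r)
  where
  go : Tab → ℕ → Tab
  go []        _       = []
  go (row ∷ T) zero    = dropLast row ∷ T
  go (row ∷ T) (suc r) = row ∷ go T r

addCell : Tab → ℕ → ℕ → Tab
addCell []        _       a = (a ∷ []) ∷ []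
addCell (row ∷ T) zero    a = (row ++ (a ∷ [])) ∷ T
addCell (row ∷ T) (suc r) a = row ∷ addCell T r a

posOf : Tab → ℕ → Maybe (ℕ × ℕ)
posOf T a = foldr step nothing (indexed T)
  where
  inRow : ℕ → List ℕ → Maybe (ℕ × ℕ)
  inRow r row = foldr (λ ic m → if proj₂ ic ≡ᵇ a then just (r , proj₁ ic) else m)
                      nothing (indexed row)
  step : ℕ × List ℕ → Maybe (ℕ × ℕ) → Maybe (ℕ × ℕ)
  step (r , row) m with inRow r row
  ... | just p  = just p
  ... | nothing = m

rowOf : Tab → ℕ → Maybe ℕ
rowOf T a with posOf T a
... | just (r , _) = just r
... | nothing      = nothing

colOf : Tab → ℕ → Maybe ℕ
colOf T a with posOf T a
... | just (_ , c) = just c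
... | nothing      = nothing

eqMaybe : Maybe ℕ → Maybe ℕ → Bool
eqMaybe (just a) (just b) = a ≡ᵇ b
eqMaybe nothing  nothing  = true
eqMaybe _        _        = false

weaklyDecr : List ℕ → Bool
weaklyDecr []           = true
weaklyDecr (x ∷ [])     = true
weaklyDecr (x ∷ y ∷ xs) = (y ≤ᵇ x) ∧ weaklyDecr (y ∷ xs)

weaklyIncr : List ℕ → Bool
weaklyIncr []           = true
weaklyIncr (x ∷ [])     = true
weaklyIncr (x ∷ y ∷ xs) = (x ≤ᵇ y) ∧ weaklyIncr (y ∷ xs)

isPartition : List ℕ → Bool
isPartition λ' = allᵇ (λ k → 0 <ᵇ k) λ' ∧ weaklyDecr λ'

strictlyBelow : List ℕ → List ℕ → Bool
strictlyBelow _        []       = true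
strictlyBelow []       (_ ∷ _)  = false
strictlyBelow (x ∷ xs) (y ∷ ys) = (x <ᵇ y) ∧ strictlyBelow xs ys

colsStrict : Tab → Bool
colsStrict []              = true
colsStrict (r ∷ [])        = true
colsStrict (r ∷ r' ∷ rs)   = strictlyBelow r r' ∧ colsStrict (r' ∷ rs)

isSSYT : Tab → Bool
isSSYT M = isPartition (shape M) ∧ allᵇ weaklyIncr M ∧ colsStrict M

-- Standardization of an SSYT (equal entries numbered from left to right)

standardize : Tab → Tab
standardize M = map stdRow (indexed M)
  where
  es : List ℕ
  es = entries M
  cells : List (ℕ × ℕ × ℕ)          -- (value , column , row)
  cells = concatMap (λ rr → map (λ ce → proj₂ ce , proj₁ ce , proj₁ rr) (indexed (proj₂ rr))) (indexed M)
  label : ℕ → ℕ → ℕ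
  label e c = count (λ x → x <ᵇ e) es
            + count (λ vcr → (proj₁ vcr ≡ᵇ e) ∧ (proj₁ (proj₂ vcr) ≤ᵇ c)) cells
  stdRow : ℕ × List ℕ → List ℕ
  stdRow (_ , row) = map (λ ce → label (proj₂ ce) (proj₁ ce)) (indexed row)

JM : Tab → List ℕ
JM M = map (λ h → count (λ x → x <ᵇ h) (entries M)) (oneTo (maxL (entries M)))

ct : List ℕ → Tab → Tab
ct J S = map (map (λ p → count (λ j → j <ᵇ p) J)) S

-- forward slide of the hole at cell h; fuel bounds the number of moves.
-- Returns the new tableau and the cell removed from the shape.
slide : ℕ → Tab → ℕ × ℕ → Tab × (ℕ × ℕ)
slide zero    T (i , j) = removeLastIn T i , (i , j)
slide (suc f) T (i , j) with entryAt T (i , suc j) | entryAt T (suc i , j)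
... | nothing | nothing = removeLastIn T i , (i , j)
... | just a  | nothing = slide f (setEntry T (i , j) a) (i , suc j)
... | nothing | just b  = slide f (setEntry T (i , j) b) (suc i , j)
... | just a  | just b  = if a <ᵇ b then slide f (setEntry T (i , j) a) (i , suc j)
                                  else slide f (setEntry T (i , j) b) (suc i , j)

-- evacuation: repeatedly delete the (minimal) entry in the corner cell (0,0)
-- and slide; the cell vacated at step k (k = 1..N) receives N+1-k.
evacuation : Tab → Tab
evacuation S = go N S S
  where
  N : ℕ
  N = length (entries S)
  go : ℕ → Tab → Tab → Tab
  go zero    T R = R
  go (suc k) T R with slide N T (0 , 0)
  ... | T' , c = go k T' (setEntry R c (suc k))
  -- at step N+1-(suc k) the label is N+1-(N+1-(suc k)) = suc k

-- EC(λ): cells (row , column) outside λ whose addition gives a partition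
EC : List ℕ → List (ℕ × ℕ)
EC λ' = go λ' 0 nothing
  where
  go : List ℕ → ℕ → Maybe ℕ → List (ℕ × ℕ)
  go []       r nothing  = (r , 0) ∷ []
  go []       r (just p) = if 0 <ᵇ p then (r , 0) ∷ [] else []
  go (x ∷ xs) r nothing  = (r , x) ∷ go xs (suc r) (just x)
  go (x ∷ xs) r (just p) = (if x <ᵇ p then (r , x) ∷ [] else []) ++ go xs (suc r) (just x)

evPlus : Tab → ℕ × ℕ → Tab
evPlus S (r , _) = addCell (evacuation S) r (suc (length (entries S)))

tildePlus : Tab → ℕ × ℕ → Tab
tildePlus S v = evacuation (evPlus S v)

-- δ_{M,v}: false (δ = 0) iff v lies strictly below the row of n in ev S
deltaᵇ : Tab → ℕ × ℕ → Bool
deltaᵇ M (r , _) with rowOf (evacuation (standardize M)) (length (entries M))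
... | just rn = not (rn <ᵇ r)
... | nothing = true

hatPlus : Tab → ℕ × ℕ → Tab
hatPlus M v = ct J' (tildePlus (standardize M) v)
  where
  J+ : List ℕ
  J+ = map suc (JM M)
  J' : List ℕ
  J' = if deltaᵇ M v then J+ else 1 ∷ J+

-- Polynomials over ℚ in m variables: finite lists of terms (exponent
-- vector , coefficient); the exponent of x_{i+1} is at index i.

Poly : ℕ → Set
Poly m = List (Vec ℕ m × ℚ)

coeff : {m : ℕ} → Poly m → Vec ℕ m → ℚ
coeff p α = foldr (λ t s → if eqList (toList (proj₁ t)) (toList α) then proj₂ t +ℚ s else s) 0ℚ p

_≈P_ : {m : ℕ} → Poly m → Poly m → Set
p ≈P q = ∀ α → coeff p α ≡ coeff q α

infix 4 _≈P_

_+P_ : {m : ℕ} → Poly m → Poly m → Poly m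
p +P q = p ++ q

scaleP : {m : ℕ} → ℚ → Poly m → Poly m
scaleP c = map (λ t → proj₁ t , c *ℚ proj₂ t)

sumP : {m : ℕ} → List (Poly m) → Poly m
sumP = concat

-- multiplication by e_m = x_1 ⋯ x_m
mulE : {m : ℕ} → Poly m → Poly m
mulE = map (λ t → Data.Vec.map suc (proj₁ t) , proj₂ t)

-- Q[x_1..x_m]_d (d ∈ ℤ; zero space for d < 0): homogeneous of degree d
Hom : (m : ℕ) → ℤ → Poly m → Set
Hom m d p = ∀ α → coeff p α ≢ 0ℚ → + sum (toList α) ≡ d

HasContent : (m : ℕ) → List ℕ → Poly m → Set
HasContent m η p = ∀ α → coeff p α ≢ 0ℚ → toList α ↭ η

-- Permutations of {1..m} as lists of images: σ(i) = i-th element (1-based)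

insertions : ℕ → List ℕ → List (List ℕ)
insertions x []       = (x ∷ []) ∷ []
insertions x (y ∷ ys) = (x ∷ y ∷ ys) ∷ map (y ∷_) (insertions x ys)

perms : List ℕ → List (List ℕ)
perms []       = [] ∷ []
perms (x ∷ xs) = concatMap (insertions x) (perms xs)

Sym : ℕ → List (List ℕ)
Sym m = perms (oneTo m)

applyPerm : List ℕ → ℕ → ℕ
applyPerm σ i with nth σ (pred i)
... | just j  = j
... | nothing = i

inversions : List ℕ → ℕ
inversions []       = 0
inversions (x ∷ xs) = count (λ y → y <ᵇ x) xs + inversions xs

even : ℕ → Bool
even zero          = true
even (suc zero)    = false
even (suc (suc n)) = even n

sgn : List ℕ → ℚ
sgn σ = if even (inversions σ) then 1ℚ else - 1ℚ

-- σ · x^α = ∏ x_{σ(i)}^{α_i}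
actMon : {m : ℕ} → List ℕ → Vec ℕ m → Vec ℕ m
actMon {m} σ α = tabulate (λ k → sum (map (λ iv → if applyPerm σ (suc (proj₁ iv)) ≡ᵇ suc (toℕ k) then proj₂ iv else 0)
                                           (indexed (toList α))))

rowStab : ℕ → Tab → List (List ℕ)
rowStab m T = filterᵇ (λ σ → allᵇ (λ i → eqMaybe (rowOf T (applyPerm σ i)) (rowOf T i)) (oneTo m)) (Sym m)

colStab : ℕ → Tab → List (List ℕ)
colStab m T = filterᵇ (λ σ → allᵇ (λ i → eqMaybe (colOf T (applyPerm σ i)) (colOf T i)) (oneTo m)) (Sym m)

IsFilling : ℕ → List ℕ → Tab → Set
IsFilling m λ' T = (shape T ≡ λ') × (entries T ↭ oneTo m)

pMT : (m : ℕ) → Tab → Tab → Vec ℕ m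
pMT m M T = tabulate (λ i → ent (posOf T (suc (toℕ i))))
  where
  ent : Maybe (ℕ × ℕ) → ℕ
  ent nothing  = 0
  ent (just c) with entryAt M c
  ... | just e  = e
  ... | nothing = 0

sMT : (m : ℕ) → Tab → Tab → ℕ
sMT m M T = count (λ τ → eqList (toList (actMon τ α)) (toList α)) (rowStab m T)
  where α = pMT m M T

invℕ : ℕ → ℚ
invℕ zero    = 0ℚ
invℕ (suc k) = + 1 / suc k

-- F_{M,T} = ε_T p_{M,T} / s_{M,T},  ε_T = Σ_{σ∈C(T)} Σ_{τ∈R(T)} sgn(σ) σ τ
FMT : (m : ℕ) → Tab → Tab → Poly m
FMT m M T = concatMap (λ σ → map (λ τ → actMon σ (actMon τ α) , sgn σ *ℚ invℕ (sMT m M T)) (rowStab m T))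
                      (colStab m T)
  where α = pMT m M T

InV : (m : ℕ) → Tab → Poly m → Set
InV m M p = Σ (List (Tab × ℚ)) λ L →
              All (λ tc → IsFilling m (shape M) (proj₁ tc)) L ×
              (p ≈P sumP (map (λ tc → scaleP (proj₂ tc) (FMT m M (proj₁ tc))) L))

-- Ext and LE of Q[x_1..x_n]_d / Q[x_1..x_n]_μ, as subspaces of
-- Q[x_1..x_{n+1}]: the sum of the V_{M +̂ v} over λ ⊢ n, M ∈ SSYT(λ)
-- satisfying `cond` (degree or content), v ∈ EC(λ) with δ_{M,v} = b.

record Piece (n : ℕ) (cond : Tab → Set) (b : Bool) : Set where
  field
    M       : Tab
    v       : ℕ × ℕ
    q       : Poly (suc n)
    ssyt    : isSSYT M ≡ true
    size    : sum (shape M) ≡ n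
    cnd     : cond M
    addable : v ∈ EC (shape M)
    dlt     : deltaᵇ M v ≡ b
    inV     : InV (suc n) (hatPlus M v) q

ExtLE : (n : ℕ) → (Tab → Set) → Bool → Poly (suc n) → Set
ExtLE n cond b p = Σ (List (Piece n cond b)) λ L → p ≈P sumP (map Piece.q L)

DegCond : ℤ → Tab → Set
DegCond d M = + sumTab M ≡ d

ContCond : List ℕ → Tab → Set
ContCond μ M = entries M ↭ μ

ExtDeg : (n : ℕ) → ℤ → Poly (suc n) → Set
ExtDeg n d = ExtLE n (DegCond d) true

LEDeg : (n : ℕ) → ℤ → Poly (suc n) → Set
LEDeg n d = ExtLE n (DegCond d) false

ExtCont : (n : ℕ) → List ℕ → Poly (suc n) → Set
ExtCont n μ = ExtLE n (ContCond μ) true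

LECont : (n : ℕ) → List ℕ → Poly (suc n) → Set
LECont n μ = ExtLE n (ContCond μ) false

EDeg : (m : ℕ) → ℤ → Poly m → Set
EDeg m d p = Σ (Poly m) λ q → Hom m d q × (p ≈P mulE q)

ECont : (m : ℕ) → List ℕ → Poly m → Set
ECont m μ p = Σ (Poly m) λ q → HasContent m μ q × (p ≈P mulE q)

DirectSum3 : (m : ℕ) → (W A B C : Poly m → Set) → Set
DirectSum3 m W A B C =
  (∀ p → A p → W p) × (∀ p → B p → W p) × (∀ p → C p → W p) ×
  (∀ p → W p → Σ (Poly m) λ a → Σ (Poly m) λ b → Σ (Poly m) λ c →
        A a × B b × C c × (p ≈P a +P (b +P c))) ×
  (∀ a b c a' b' c' → A a → B b → C c → A a' → B b' → C c' →
        a +P (b +P c) ≈P a' +P (b' +P c') → (a ≈P a') × (b ≈P b') × (c ≈P c'))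

_≐_ : {m : ℕ} → (Poly m → Set) → (Poly m → Set) → Set
U ≐ W = ∀ p → (U p → W p) × (W p → U p)

_∩_ : {m : ℕ} → (Poly m → Set) → (Poly m → Set) → Poly m → Set
(U ∩ W) p = U p × W p

remove0 : List ℕ → List ℕ
remove0 []          = []
remove0 (zero ∷ xs) = xs
remove0 (suc k ∷ xs) = suc k ∷ remove0 xs

{-# OPTIONS --safe #-}
-- By the straightening law (Garnir relations) and Gram–Schmidt orthogonalization
-- the space of a content η is spanned by the F_{N,T} with N semistandard of
-- content η, and by von Neumann's lemma the sum of the V_N is direct.  Running
-- the evacuations backwards shows that every semistandard N containing 0 is
-- M +̂ v for some M and v.  Its content is 0 together with the entries of M,
-- increased by 1 if δ_{M,v} = 0; and δ_{M,v} = 1 if and only if 2 is in the first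
-- row of the standardization of N, because evacuation reverses descents.  So Ext
-- and LE are spanned by disjoint families of spaces V_N, which together give all
-- monomials with some exponent 0, and the other monomials are the multiples of
-- e_{n+1}.  Parts (ii)–(iv) follow as all spaces are sums of their content parts.
module Submission where

open import Defs
open import Function using (_∘_; id; case_of_; mk⇔; Equivalence)
open import Data.Bool using (Bool; true; false; if_then_else_; _∧_; _∨_; not; T)
import Data.Bool.Properties as 𝔹
open import Data.Nat using (ℕ; zero; suc; pred; _+_; _*_; _∸_; _^_; _≤_; _<_; _≥_; z≤n; s≤s; z<s; s<s; _≡ᵇ_; _<ᵇ_; _≤ᵇ_; _≤?_; _<?_)
import Data.Nat.Properties as ℕ
open import Data.Nat.ListAction using (sum)
open import Data.Nat.Induction using (<-wellFounded)
open import Induction.WellFounded using (Acc; acc)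
import Data.Integer as ℤ
import Data.Integer.Properties as ℤ
open import Data.Rational using (ℚ; 0ℚ; 1ℚ; NonZero; NonNegative; ≢-nonZero; 1/_) renaming (_+_ to _+ℚ_; _*_ to _*ℚ_; -_ to -ℚ_; _≤_ to _≤ℚ_)
import Data.Rational as ℚ
import Data.Rational.Properties as ℚ
open import Data.Rational.Solver using (module +-*-Solver)
open import Data.Maybe using (Maybe; just; nothing)
import Data.Maybe as Maybe
open import Data.Maybe.Properties using (just-injective)
open import Data.Product using (_×_; _,_; proj₁; proj₂; Σ; ∃; ∃₂)
open import Data.Sum using (_⊎_; inj₁; inj₂; [_,_]′)
import Data.Sum as Sum
open import Data.Empty using (⊥; ⊥-elim)
open import Data.Unit using (⊤; tt)
open import Data.Fin using (Fin; zero; suc; toℕ; fromℕ<)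
import Data.Fin.Properties as Fin
open import Data.Vec using (Vec; []; _∷_; lookup; tabulate; toList; allFin)
import Data.Vec as Vec
import Data.Vec.Properties as Vec
open import Data.List using (List; []; _∷_; [_]; map; length; concat; concatMap; _++_; upTo; filterᵇ; foldr; zip)
import Data.List as List
import Data.List.Properties as List
open import Data.List.Membership.Propositional using (_∈_; _∉_)
import Data.List.Membership.Propositional.Properties as ∈
open import Data.List.Membership.Propositional.Properties.WithK using (unique∧set⇒bag)
open import Data.List.Relation.Binary.BagAndSetEquality using (∼bag⇒↭)
open import Data.List.Relation.Unary.Any using (Any; here; there)
open import Data.List.Relation.Unary.All using (All; []; _∷_)
import Data.List.Relation.Unary.All as All
import Data.List.Relation.Unary.All.Properties as All
open import Data.List.Relation.Unary.AllPairs using (AllPairs; []; _∷_)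
open import Data.List.Relation.Unary.Unique.Propositional using (Unique)
import Data.List.Relation.Unary.Unique.Propositional.Properties as Unique
open import Data.List.Relation.Binary.Permutation.Propositional using (_↭_; ↭-refl; ↭-sym; ↭-trans; ↭-reflexive; prep; swap; refl; trans)
import Data.List.Relation.Binary.Permutation.Propositional.Properties as ↭
open import Relation.Nullary using (¬_; Dec; yes; no; does; contradiction)
open import Relation.Nullary.Decidable using (_×-dec_; _⊎-dec_; ¬?; map′; _→-dec_)
open import Relation.Binary.PropositionalEquality using (_≡_; _≢_; _≗_; refl; sym; cong; cong₂; subst; subst₂; module ≡-Reasoning) renaming (trans to infixr 4.5 _∙_)
open import Relation.Binary.Definitions using (tri<; tri≈; tri>)
import Data.List.Relation.Unary.AllPairs.Properties as AllPairs
import Data.Nat.Solver as ℕSolver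
open import Data.Nat.ListAction.Properties using (sum-↭)
import Data.List.Relation.Unary.Any as Any∃

-- Spanning is obtained without counting dimensions. A function on the orbit of an exponent vector
-- that is orthogonal to all translates of the symmetrized semistandard monomials must vanish: its
-- antisymmetrization along any set partition of the variables vanishes, by downward induction on a
-- measure `μ` of the partition, and for the partition into singletons the antisymmetrization is the
-- function itself. Straightening enters because a Garnir relation is an antisymmetrization along a
-- partition of larger `μ`. Two statistics control all triangularity: `Φ`, the sum of entry times
-- column, which column permutations preserve and row sorting raises, and the sum of the row indices
-- of a shape, a numerical substitute for the dominance order in von Neumann's lemma. The inner
-- product makes different shapes orthogonal, so only tableaux of one shape have to be separated,
-- and `Φ` does that. Evacuation is studied on the sequence of boxes in the order of their entries,
-- where a slide is one pass over a list and descents can be compared entry by entry.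

-- Finite sums of rationals

module Sums where

  infix 3 ∑

  ∑ : ∀ {A : Set} → List A → (A → ℚ) → ℚ
  ∑ []       f = 0ℚ
  ∑ (x ∷ xs) f = f x +ℚ ∑ xs f

  syntax ∑ xs (λ x → e) = ∑[ x ← xs ] e

  -- The Iverson bracket. Conditions become factors, so that a sum over a subgroup can run over all
  -- permutations.
  iv : {P : Set} → Dec P → ℚ
  iv (yes _) = 1ℚ
  iv (no  _) = 0ℚ

  iv-yes : {P : Set} (d : Dec P) → P → iv d ≡ 1ℚ
  iv-yes (yes _) p = refl
  iv-yes (no ¬p) p = contradiction p ¬p

  iv-no : {P : Set} (d : Dec P) → ¬ P → iv d ≡ 0ℚ
  iv-no (yes p) ¬p = contradiction p ¬p
  iv-no (no _)  ¬p = refl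

  iv-cong : {P Q : Set} (d : Dec P) (e : Dec Q) → (P → Q) → (Q → P) → iv d ≡ iv e
  iv-cong (yes p) e f g = sym (iv-yes e (f p))
  iv-cong (no ¬p) e f g = sym (iv-no e (¬p ∘ g))

  private variable
    A B : Set

  ∑-cong∈ : (xs : List A) {f g : A → ℚ} → (∀ {x} → x ∈ xs → f x ≡ g x) → ∑ xs f ≡ ∑ xs g
  ∑-cong∈ []       h = refl
  ∑-cong∈ (x ∷ xs) h = cong₂ _+ℚ_ (h (here refl)) (∑-cong∈ xs (h ∘ there))

  ∑-cong : (xs : List A) {f g : A → ℚ} → f ≗ g → ∑ xs f ≡ ∑ xs g
  ∑-cong xs h = ∑-cong∈ xs (λ {x} _ → h x)

  ∑-0 : (xs : List A) {f : A → ℚ} → (∀ {x} → x ∈ xs → f x ≡ 0ℚ) → ∑ xs f ≡ 0ℚ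
  ∑-0 []       h = refl
  ∑-0 (x ∷ xs) h = cong₂ _+ℚ_ (h (here refl)) (∑-0 xs (h ∘ there))

  ∑-+ : (xs : List A) (f g : A → ℚ) → ∑ xs (λ x → f x +ℚ g x) ≡ ∑ xs f +ℚ ∑ xs g
  ∑-+ []       f g = refl
  ∑-+ (x ∷ xs) f g = cong (f x +ℚ g x +ℚ_) (∑-+ xs f g) ∙
    solve 4 (λ a b c d → (a :+ b) :+ (c :+ d) := (a :+ c) :+ (b :+ d)) refl (f x) (g x) (∑ xs f) (∑ xs g)
    where open +-*-Solver

  ∑-*ˡ : (xs : List A) (q : ℚ) (f : A → ℚ) → ∑ xs (λ x → q *ℚ f x) ≡ q *ℚ ∑ xs f
  ∑-*ˡ []       q f = sym (ℚ.*-zeroʳ q)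
  ∑-*ˡ (x ∷ xs) q f = cong (q *ℚ f x +ℚ_) (∑-*ˡ xs q f) ∙ sym (ℚ.*-distribˡ-+ q (f x) (∑ xs f))

  ∑-*ʳ : (xs : List A) (f : A → ℚ) (q : ℚ) → ∑ xs (λ x → f x *ℚ q) ≡ ∑ xs f *ℚ q
  ∑-*ʳ xs f q = ∑-cong xs (λ x → ℚ.*-comm (f x) q) ∙ ∑-*ˡ xs q f ∙ ℚ.*-comm q _

  ∑-map : (h : A → B) (xs : List A) (f : B → ℚ) → ∑ (map h xs) f ≡ ∑ xs (f ∘ h)
  ∑-map h []       f = refl
  ∑-map h (x ∷ xs) f = cong (f (h x) +ℚ_) (∑-map h xs f)

  ∑-++ : (xs ys : List A) (f : A → ℚ) → ∑ (xs ++ ys) f ≡ ∑ xs f +ℚ ∑ ys f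
  ∑-++ []       ys f = sym (ℚ.+-identityˡ _)
  ∑-++ (x ∷ xs) ys f = cong (f x +ℚ_) (∑-++ xs ys f) ∙ sym (ℚ.+-assoc (f x) _ _)

  ∑-concatMap : (h : A → List B) (xs : List A) (f : B → ℚ) → ∑ (concatMap h xs) f ≡ ∑ xs (λ x → ∑ (h x) f)
  ∑-concatMap h []       f = refl
  ∑-concatMap h (x ∷ xs) f = ∑-++ (h x) (concatMap h xs) f ∙ cong (∑ (h x) f +ℚ_) (∑-concatMap h xs f)

  ∑-swap : (xs : List A) (ys : List B) (f : A → B → ℚ) →
           ∑ xs (λ x → ∑ ys (f x)) ≡ ∑ ys (λ y → ∑ xs (λ x → f x y))
  ∑-swap []       ys f = sym (∑-0 ys (λ _ → refl))
  ∑-swap (x ∷ xs) ys f = cong (∑ ys (f x) +ℚ_) (∑-swap xs ys f) ∙ sym (∑-+ ys (f x) _)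

  ∑-↭ : {xs ys : List A} (f : A → ℚ) → xs ↭ ys → ∑ xs f ≡ ∑ ys f
  ∑-↭ f refl         = refl
  ∑-↭ f (prep x p)   = cong (f x +ℚ_) (∑-↭ f p)
  ∑-↭ f (swap x y p) = cong (λ s → f x +ℚ (f y +ℚ s)) (∑-↭ f p) ∙
    solve 3 (λ a b c → a :+ (b :+ c) := b :+ (a :+ c)) refl (f x) (f y) _
    where open +-*-Solver
  ∑-↭ f (trans p q)  = ∑-↭ f p ∙ ∑-↭ f q

  ∑-single : (xs : List A) {x : A} {f : A → ℚ} → Unique xs → x ∈ xs → (∀ {y} → y ∈ xs → y ≢ x → f y ≡ 0ℚ) → ∑ xs f ≡ f x
  ∑-single (x ∷ xs) {f = f} (p ∷ u) (here refl) h = cong (f x +ℚ_) (∑-0 xs (λ q → h (there q) (λ e → All.lookup p q (sym e)))) ∙ ℚ.+-identityʳ _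
  ∑-single (x ∷ xs) (p ∷ u) (there q) h = cong₂ _+ℚ_ (h (here refl) (All.lookup p q)) (∑-single xs u q (h ∘ there)) ∙ ℚ.+-identityˡ _

  ∑-filterᵇ : (p : A → Bool) (xs : List A) (f : A → ℚ) →
              ∑ (filterᵇ p xs) f ≡ ∑ xs (λ x → if p x then f x else 0ℚ)
  ∑-filterᵇ p []       f = refl
  ∑-filterᵇ p (x ∷ xs) f with p x
  ... | true  = cong (f x +ℚ_) (∑-filterᵇ p xs f)
  ... | false = ∑-filterᵇ p xs f ∙ sym (ℚ.+-identityˡ _)

  ∑-≥0 : (xs : List A) {f : A → ℚ} → (∀ {x} → x ∈ xs → 0ℚ ≤ℚ f x) → 0ℚ ≤ℚ ∑ xs f
  ∑-≥0 []       h = ℚ.≤-refl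
  ∑-≥0 (x ∷ xs) h = ℚ.+-mono-≤ (h (here refl)) (∑-≥0 xs (h ∘ there))

  private
    +-zero-split : ∀ {a b} → 0ℚ ≤ℚ a → 0ℚ ≤ℚ b → a +ℚ b ≡ 0ℚ → a ≡ 0ℚ × b ≡ 0ℚ
    +-zero-split {a} {b} a≥0 b≥0 eq =
        ℚ.≤-antisym (subst₂ _≤ℚ_ (ℚ.+-identityʳ a) eq (ℚ.+-monoʳ-≤ a b≥0)) a≥0
      , ℚ.≤-antisym (subst₂ _≤ℚ_ (ℚ.+-identityˡ b) eq (ℚ.+-monoˡ-≤ b a≥0)) b≥0

  -- Nonnegative terms cannot cancel. This makes the inner product on an orbit definite and shows
  -- that certain counts are not 0.
  ∑-≡0⇒≡0 : (xs : List A) {f : A → ℚ} → (∀ {x} → x ∈ xs → 0ℚ ≤ℚ f x) → ∑ xs f ≡ 0ℚ →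
            ∀ {x} → x ∈ xs → f x ≡ 0ℚ
  ∑-≡0⇒≡0 (x ∷ xs) h eq (here refl) = proj₁ (+-zero-split (h (here refl)) (∑-≥0 xs (h ∘ there)) eq)
  ∑-≡0⇒≡0 (x ∷ xs) h eq (there i)   =
    ∑-≡0⇒≡0 xs (h ∘ there) (proj₂ (+-zero-split (h (here refl)) (∑-≥0 xs (h ∘ there)) eq)) i

  square-≥0 : ∀ q → 0ℚ ≤ℚ q *ℚ q
  square-≥0 q with ℚ.≤-total 0ℚ q
  ... | inj₁ q≥0 = ℚ.nonNegative⁻¹ (q *ℚ q) {{ℚ.nonNeg*nonNeg⇒nonNeg q {{ℚ.nonNegative q≥0}} q {{ℚ.nonNegative q≥0}}}}
  ... | inj₂ q≤0 = subst (0ℚ ≤ℚ_) (solve 1 (λ a → (:- a) :* (:- a) := a :* a) refl q)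
                     (ℚ.nonNegative⁻¹ (-ℚ q *ℚ -ℚ q) {{ℚ.nonNeg*nonNeg⇒nonNeg (-ℚ q) {{nn}} (-ℚ q) {{nn}}}})
    where
    open +-*-Solver
    nn : NonNegative (-ℚ q)
    nn = ℚ.nonNegative (ℚ.neg-antimono-≤ q≤0)

  *-≡0 : ∀ p q → p *ℚ q ≡ 0ℚ → p ≢ 0ℚ → q ≡ 0ℚ
  *-≡0 p q eq p≢0 = sym (ℚ.*-identityˡ q) ∙ cong (_*ℚ q) (sym (ℚ.*-inverseˡ p)) ∙ ℚ.*-assoc (1/ p) p q ∙
                    cong (1/ p *ℚ_) eq ∙ ℚ.*-zeroʳ (1/ p)
    where instance
      p-nonZero : NonZero p
      p-nonZero = ≢-nonZero p≢0

  square-≡0 : ∀ q → q *ℚ q ≡ 0ℚ → q ≡ 0ℚ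
  square-≡0 q eq with q ℚ.≟ 0ℚ
  ... | yes q≡0 = q≡0
  ... | no  q≢0 = *-≡0 q q eq q≢0

  -- Division by 2; this turns antisymmetry under a transposition into vanishing.
  x≡-x⇒x≡0 : ∀ q → q ≡ -ℚ q → q ≡ 0ℚ
  x≡-x⇒x≡0 q eq = *-≡0 (1ℚ +ℚ 1ℚ) q
    (ℚ.*-distribʳ-+ q 1ℚ 1ℚ ∙ cong₂ _+ℚ_ (ℚ.*-identityˡ q) (ℚ.*-identityˡ q ∙ eq) ∙ ℚ.+-inverseʳ q) (λ ())

open Sums

-- Permutations as vectors of images

module Permutations where

  -- Permutations of a finite set, as vectors of images

  private variable
    C : Set
    m n k : ℕ

  infixl 7 _⊙_

  -- Reindexing; for C = Fin m this is composition, and (σ u)(α) = u (α ⊙ σ) is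
  -- the left action of permutations on coefficient functions.
  opaque
    _⊙_ : Vec C m → Vec (Fin m) n → Vec C n
    α ⊙ σ = tabulate (λ i → lookup α (lookup σ i))

    lookup-⊙ : (α : Vec C m) (σ : Vec (Fin m) n) (i : Fin n) → lookup (α ⊙ σ) i ≡ lookup α (lookup σ i)
    lookup-⊙ α σ = Vec.lookup∘tabulate _

  vec-ext : {α β : Vec C m} → (∀ i → lookup α i ≡ lookup β i) → α ≡ β
  vec-ext {α = α} {β} h = sym (Vec.tabulate∘lookup α) ∙ Vec.tabulate-cong h ∙ Vec.tabulate∘lookup β

  ⊙-assoc : (α : Vec C m) (σ : Vec (Fin m) n) (τ : Vec (Fin n) k) → (α ⊙ σ) ⊙ τ ≡ α ⊙ (σ ⊙ τ)
  ⊙-assoc α σ τ = vec-ext λ i → lookup-⊙ (α ⊙ σ) τ i ∙ lookup-⊙ α σ (lookup τ i) ∙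
    sym (lookup-⊙ α (σ ⊙ τ) i ∙ cong (lookup α) (lookup-⊙ σ τ i))

  ⊙-identityʳ : (α : Vec C m) → α ⊙ allFin m ≡ α
  ⊙-identityʳ α = vec-ext λ i → lookup-⊙ α (allFin _) i ∙ cong (lookup α) (Vec.lookup-allFin i)

  ⊙-identityˡ : (σ : Vec (Fin m) n) → allFin m ⊙ σ ≡ σ
  ⊙-identityˡ σ = vec-ext λ i → lookup-⊙ (allFin _) σ i ∙ Vec.lookup-allFin _

  record IsPerm {m : ℕ} (σ : Vec (Fin m) m) : Set where
    constructor mkPerm
    field injective : ∀ i j → lookup σ i ≡ lookup σ j → i ≡ j

  open IsPerm public

  idx : Fin m → ℕ
  idx i = suc (toℕ i)

  -- A missed value `y` could be punched out of the codomain, which would leave an injection of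
  -- `Fin (suc m)` into `Fin m`.
  finite-surjective : (f : Fin m → Fin m) → (∀ i j → f i ≡ f j → i ≡ j) → ∀ y → ∃ λ x → f x ≡ y
  finite-surjective {suc m} f inj y with Fin.any? (λ x → f x Fin.≟ y)
  ... | yes p = p
  ... | no ¬p = contradiction (Fin.injective⇒≤ {f = g} (λ {i} {j} → g-inj {i} {j})) (ℕ.<⇒≱ (ℕ.n<1+n m))
    where
    g : Fin (suc m) → Fin m
    g x = Fin.punchOut {i = y} {j = f x} (λ eq → ¬p (x , sym eq))
      where import Data.Fin as Fin
    g-inj : ∀ {i j} → g i ≡ g j → i ≡ j
    g-inj {i} {j} eq = inj i j (Fin.punchOut-injective {i = y} {f i} {f j} _ _ eq)

  -- The default `k` makes `inv` total; it is reached only for vectors that are not permutations.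
  preimage : Vec (Fin m) m → Fin m → Fin m
  preimage σ k with Fin.any? (λ i → lookup σ i Fin.≟ k)
  ... | yes (i , _) = i
  ... | no  _       = k

  opaque
    inv : Vec (Fin m) m → Vec (Fin m) m
    inv σ = tabulate (preimage σ)

    lookup-inv : (σ : Vec (Fin m) m) → IsPerm σ → ∀ k → lookup σ (lookup (inv σ) k) ≡ k
    lookup-inv σ p k = cong (lookup σ) (Vec.lookup∘tabulate (preimage σ) k) ∙ lem
      where
      lem : lookup σ (preimage σ k) ≡ k
      lem with Fin.any? (λ i → lookup σ i Fin.≟ k)
      ... | yes (i , eq) = eq
      ... | no ¬q        = contradiction (finite-surjective (lookup σ) (injective p) k) ¬q

  inv-lookup : (σ : Vec (Fin m) m) → IsPerm σ → ∀ k → lookup (inv σ) (lookup σ k) ≡ k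
  inv-lookup σ p k = injective p _ _ (lookup-inv σ p (lookup σ k))

  inverseʳ : (σ : Vec (Fin m) m) → IsPerm σ → σ ⊙ inv σ ≡ allFin m
  inverseʳ σ p = vec-ext λ i → lookup-⊙ σ (inv σ) i ∙ lookup-inv σ p i ∙ sym (Vec.lookup-allFin i)

  inverseˡ : (σ : Vec (Fin m) m) → IsPerm σ → inv σ ⊙ σ ≡ allFin m
  inverseˡ σ p = vec-ext λ i → lookup-⊙ (inv σ) σ i ∙ inv-lookup σ p i ∙ sym (Vec.lookup-allFin i)

  ⊙-inv : (α : Vec C m) (σ : Vec (Fin m) m) → IsPerm σ → (α ⊙ σ) ⊙ inv σ ≡ α
  ⊙-inv α σ p = ⊙-assoc α σ (inv σ) ∙ cong (α ⊙_) (inverseʳ σ p) ∙ ⊙-identityʳ α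

  inv-⊙ : (α : Vec C m) (σ : Vec (Fin m) m) → IsPerm σ → (α ⊙ inv σ) ⊙ σ ≡ α
  inv-⊙ α σ p = ⊙-assoc α (inv σ) σ ∙ cong (α ⊙_) (inverseˡ σ p) ∙ ⊙-identityʳ α

  perm-id : IsPerm (allFin m)
  perm-id = mkPerm λ i j eq → sym (Vec.lookup-allFin i) ∙ eq ∙ Vec.lookup-allFin j

  perm-⊙ : {σ τ : Vec (Fin m) m} → IsPerm σ → IsPerm τ → IsPerm (σ ⊙ τ)
  perm-⊙ {σ = σ} {τ} p q = mkPerm λ i j eq → injective q i j (injective p _ _ (sym (lookup-⊙ σ τ i) ∙ eq ∙ lookup-⊙ σ τ j))

  perm-inv : {σ : Vec (Fin m) m} → IsPerm σ → IsPerm (inv σ)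
  perm-inv {σ = σ} p = mkPerm λ i j eq → sym (lookup-inv σ p i) ∙ cong (lookup σ) eq ∙ lookup-inv σ p j

  inv-inv : (σ : Vec (Fin m) m) → IsPerm σ → inv (inv σ) ≡ σ
  inv-inv σ p = sym (⊙-identityˡ _) ∙ cong (_⊙ inv (inv σ)) (sym (inverseʳ σ p)) ∙ ⊙-inv σ (inv σ) (perm-inv {σ = σ} p)

  nth-toList : (v : Vec C m) (i : Fin m) → nth (toList v) (toℕ i) ≡ just (lookup v i)
  nth-toList (x ∷ v) zero    = refl
  nth-toList (x ∷ v) (suc i) = nth-toList v i

  -- The fallback `i` makes `fromL` total; rearrangements of `oneTo m` never reach it.
  toFin : Fin m → ℕ → Fin m
  toFin {m} i k with k <? m
  ... | yes k<m = fromℕ< k<m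
  ... | no  _   = i

  toFin-toℕ : (i : Fin m) {k : ℕ} → k < m → toℕ (toFin i k) ≡ k
  toFin-toℕ {m} i {k} k<m with k <? m
  ... | yes p = Fin.toℕ-fromℕ< p
  ... | no ¬p = contradiction k<m ¬p

  opaque
    fromL : List ℕ → Vec (Fin m) m
    fromL σ = tabulate λ i → toFin i (pred (applyPerm σ (suc (toℕ i))))

    lookup-fromL : (σ : List ℕ) (i : Fin m) → lookup (fromL σ) i ≡ toFin i (pred (applyPerm σ (idx i)))
    lookup-fromL σ i = Vec.lookup∘tabulate _ i

  toL : Vec (Fin m) m → List ℕ
  toL v = toList (Vec.map idx v)

  applyPerm-just : ∀ σ i {j} → nth σ (pred i) ≡ just j → applyPerm σ i ≡ j
  applyPerm-just σ i eq with nth σ (pred i)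
  applyPerm-just σ i refl | just j = refl

  applyPerm-toL : (v : Vec (Fin m) m) (i : Fin m) → applyPerm (toL v) (suc (toℕ i)) ≡ suc (toℕ (lookup v i))
  applyPerm-toL v i = applyPerm-just (toL v) (suc (toℕ i))
    (nth-toList (Vec.map idx v) i ∙ cong just (Vec.lookup-map i idx v))

  fromL-toL : (v : Vec (Fin m) m) → fromL (toL v) ≡ v
  fromL-toL v = vec-ext λ i → lookup-fromL (toL v) i ∙
    Fin.toℕ-injective (cong (λ k → toℕ (toFin i (pred k))) (applyPerm-toL v i) ∙ toFin-toℕ i (Fin.toℕ<n (lookup v i)))

  ∈-oneTo⁻ : ∀ {k} → k ∈ oneTo m → ∃ λ (i : Fin m) → k ≡ suc (toℕ i)
  ∈-oneTo⁻ {m} p with ∈.∈-map⁻ suc p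
  ... | j , j∈ , refl = fromℕ< (∈.∈-upTo⁻ j∈) , cong suc (sym (Fin.toℕ-fromℕ< (∈.∈-upTo⁻ j∈)))

  ∈-oneTo⁺ : (i : Fin m) → suc (toℕ i) ∈ oneTo m
  ∈-oneTo⁺ i = ∈.∈-map⁺ suc (∈.∈-upTo⁺ (Fin.toℕ<n i))

  oneTo-unique : ∀ m → Unique (oneTo m)
  oneTo-unique m = Unique.map⁺ ℕ.suc-injective (Unique.upTo⁺ m)

  length-oneTo : ∀ m → length (oneTo m) ≡ m
  length-oneTo m = List.length-map suc (upTo m) ∙ List.length-upTo m

  list-vec : (xs : List C) → length xs ≡ m → ∃ λ (v : Vec C m) → toList v ≡ xs
  list-vec xs refl = Vec.fromList xs , Vec.toList∘fromList xs

  Fin-vec : (v : Vec ℕ m) → (∀ i → ∃ λ (j : Fin n) → lookup v i ≡ suc (toℕ j)) → ∃ λ (w : Vec (Fin n) m) → Vec.map idx w ≡ v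
  Fin-vec []      h = [] , refl
  Fin-vec (x ∷ v) h with h zero | Fin-vec v (h ∘ suc)
  ... | j , eq | w , eq′ = j ∷ w , cong₂ _∷_ (sym eq) eq′

  lookup∈toList : (v : Vec C m) (i : Fin m) → lookup v i ∈ toList v
  lookup∈toList (x ∷ v) zero    = here refl
  lookup∈toList (x ∷ v) (suc i) = there (lookup∈toList v i)

  ∈toList⁻ : (v : Vec C m) {x : C} → x ∈ toList v → ∃ λ i → lookup v i ≡ x
  ∈toList⁻ (y ∷ v) (here refl) = zero , refl
  ∈toList⁻ (y ∷ v) (there p) with ∈toList⁻ v p
  ... | i , eq = suc i , eq

  toL-surjective : {σ : List ℕ} → σ ↭ oneTo m → ∃ λ (v : Vec (Fin m) m) → toL v ≡ σ
  toL-surjective {m} {σ} p with list-vec σ (↭.↭-length p ∙ length-oneTo m)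
  ... | v , refl with Fin-vec v (λ i → ∈-oneTo⁻ (↭.∈-resp-↭ p (lookup∈toList v i)))
  ... | w , refl = w , refl

  toL-fromL : {σ : List ℕ} → σ ↭ oneTo m → toL (fromL {m} σ) ≡ σ
  toL-fromL p with toL-surjective p
  ... | v , refl = cong toL (fromL-toL v)

  unique-lookup : (v : Vec C m) → Unique (toList v) → ∀ i j → lookup v i ≡ lookup v j → i ≡ j
  unique-lookup (x ∷ v) (p ∷ u) zero    zero    eq = refl
  unique-lookup (x ∷ v) (p ∷ u) zero    (suc j) eq = contradiction eq (All.lookup p (lookup∈toList v j))
  unique-lookup (x ∷ v) (p ∷ u) (suc i) zero    eq = contradiction (sym eq) (All.lookup p (lookup∈toList v i))
  unique-lookup (x ∷ v) (p ∷ u) (suc i) (suc j) eq = cong suc (unique-lookup v u i j eq)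

  lookup-unique : (v : Vec C m) → (∀ i j → lookup v i ≡ lookup v j → i ≡ j) → Unique (toList v)
  lookup-unique []      h = []
  lookup-unique (x ∷ v) h = All.tabulate (λ p eq → lem (∈toList⁻ v p) eq) ∷ lookup-unique v (λ i j eq → Fin.suc-injective (h (suc i) (suc j) eq))
    where
    lem : ∀ {y} → (∃ λ i → lookup v i ≡ y) → x ≢ y
    lem (i , eq) eq′ with () ← h zero (suc i) (eq′ ∙ sym eq)

  unique-↭ : {xs ys : List C} → Unique xs → Unique ys → (∀ {x} → x ∈ xs → x ∈ ys) → (∀ {x} → x ∈ ys → x ∈ xs) → xs ↭ ys
  unique-↭ u v f g = ∼bag⇒↭ (unique∧set⇒bag u v (mk⇔ f g))

  Unique-resp-↭ : {xs ys : List C} → xs ↭ ys → Unique xs → Unique ys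
  Unique-resp-↭ refl u = u
  Unique-resp-↭ (prep x p) (q ∷ u) = ↭.All-resp-↭ p q ∷ Unique-resp-↭ p u
  Unique-resp-↭ (swap x y p) ((x≢y ∷ q) ∷ (q′ ∷ u)) =
    ((λ eq → x≢y (sym eq)) ∷ ↭.All-resp-↭ p q′) ∷ ↭.All-resp-↭ p q ∷ Unique-resp-↭ p u
  Unique-resp-↭ (trans p q) u = Unique-resp-↭ q (Unique-resp-↭ p u)

  toL-lookup : (v : Vec (Fin m) m) (i : Fin m) → lookup (Vec.map idx v) i ≡ suc (toℕ (lookup v i))
  toL-lookup v i = Vec.lookup-map i idx v

  toL-↭ : (v : Vec (Fin m) m) → IsPerm v → toL v ↭ oneTo m
  toL-↭ {m} v p = unique-↭ (lookup-unique _ inj) (oneTo-unique m) to from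
    where
    inj : ∀ i j → lookup (Vec.map idx v) i ≡ lookup (Vec.map idx v) j → i ≡ j
    inj i j eq = injective p i j (Fin.toℕ-injective (ℕ.suc-injective (sym (toL-lookup v i) ∙ eq ∙ toL-lookup v j)))
    to : ∀ {x} → x ∈ toL v → x ∈ oneTo m
    to q with ∈toList⁻ _ q
    ... | i , refl = subst (_∈ oneTo m) (sym (toL-lookup v i)) (∈-oneTo⁺ (lookup v i))
    from : ∀ {x} → x ∈ oneTo m → x ∈ toL v
    from q with ∈-oneTo⁻ q
    ... | i , refl with finite-surjective (lookup v) (injective p) i
    ... | j , refl = subst (_∈ toL v) (toL-lookup v j) (lookup∈toList _ j)

  perm-fromL : {σ : List ℕ} → σ ↭ oneTo m → IsPerm (fromL {m} σ)
  perm-fromL {m} p with toL-surjective p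
  ... | v , refl rewrite fromL-toL v = mkPerm λ i j eq → unique-lookup _ (Unique-resp-↭ (↭-sym p) (oneTo-unique m)) i j
          (toL-lookup v i ∙ cong idx eq ∙ sym (toL-lookup v j))

  ∈-insertions⁻ : ∀ x ys {zs} → zs ∈ insertions x ys → zs ↭ x ∷ ys
  ∈-insertions⁻ x [] (here refl) = refl
  ∈-insertions⁻ x (y ∷ ys) (here refl) = refl
  ∈-insertions⁻ x (y ∷ ys) (there p) with ∈.∈-map⁻ (y ∷_) p
  ... | zs , q , refl = ↭-trans (prep y (∈-insertions⁻ x ys q)) (swap y x refl)

  ∈-insertions⁺ : ∀ x as bs → as ++ x ∷ bs ∈ insertions x (as ++ bs)
  ∈-insertions⁺ x []       []       = here refl
  ∈-insertions⁺ x []       (b ∷ bs) = here refl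
  ∈-insertions⁺ x (a ∷ as) bs       = there (∈.∈-map⁺ (a ∷_) (∈-insertions⁺ x as bs))

  ∈-perms⁻ : ∀ xs {zs} → zs ∈ perms xs → zs ↭ xs
  ∈-perms⁻ []       (here refl) = refl
  ∈-perms⁻ (x ∷ xs) p with ∈.∈-concat⁻′ (map (insertions x) (perms xs)) p
  ... | ws , q , r with ∈.∈-map⁻ (insertions x) r
  ... | ys , s , refl = ↭-trans (∈-insertions⁻ x ys q) (prep x (∈-perms⁻ xs s))

  ∈-perms⁺ : ∀ xs {zs} → zs ↭ xs → zs ∈ perms xs
  ∈-perms⁺ []       p rewrite ↭.↭-empty-inv p = here refl
  ∈-perms⁺ (x ∷ xs) p with ∈.∈-∃++ (↭.∈-resp-↭ (↭-sym p) (here refl))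
  ... | as , bs , refl = ∈.∈-concat⁺′ (∈-insertions⁺ x as bs)
          (∈.∈-map⁺ (insertions x) (∈-perms⁺ xs (↭.drop-∷ (↭-trans (↭-sym (↭.shift x as bs)) p))))

  private
    -- Deleting `x` undoes every insertion of `x` into a list avoiding `x`, so insertions into
    -- different lists give different results.
    del : ℕ → List ℕ → List ℕ
    del x []       = []
    del x (y ∷ ys) = if y ≡ᵇ x then ys else y ∷ del x ys

    ≡ᵇ-refl : ∀ x → (x ≡ᵇ x) ≡ true
    ≡ᵇ-refl zero    = refl
    ≡ᵇ-refl (suc x) = ≡ᵇ-refl x

    ≢⇒≡ᵇ : ∀ {x y} → x ≢ y → (x ≡ᵇ y) ≡ false
    ≢⇒≡ᵇ {x} {y} x≢y with x ≡ᵇ y in eq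
    ... | true  = contradiction (ℕ.≡ᵇ⇒≡ x y (subst T (sym eq) tt)) x≢y
    ... | false = refl

    del-insertion : ∀ x ys {zs} → All (x ≢_) ys → zs ∈ insertions x ys → del x zs ≡ ys
    del-insertion x []       h (here refl) rewrite ≡ᵇ-refl x = refl
    del-insertion x (y ∷ ys) h (here refl) rewrite ≡ᵇ-refl x = refl
    del-insertion x (y ∷ ys) (x≢y ∷ h) (there p) with ∈.∈-map⁻ (y ∷_) p
    ... | zs , q , refl rewrite ≢⇒≡ᵇ (λ eq → x≢y (sym eq)) = cong (y ∷_) (del-insertion x ys h q)

    insertions-unique : ∀ x ys → All (x ≢_) ys → Unique (insertions x ys)
    insertions-unique x []       h         = [] ∷ []
    insertions-unique x (y ∷ ys) (x≢y ∷ h) =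
      All.tabulate (λ p → lem (∈.∈-map⁻ (y ∷_) p)) ∷ Unique.map⁺ List.∷-injectiveʳ (insertions-unique x ys h)
      where
      lem : ∀ {zs} → (∃ λ ws → ws ∈ insertions x ys × zs ≡ y ∷ ws) → x ∷ y ∷ ys ≢ zs
      lem (ws , _ , refl) eq = x≢y (List.∷-injectiveˡ eq)

  perms-unique : ∀ xs → Unique xs → Unique (perms xs)
  perms-unique []       u       = [] ∷ []
  perms-unique (x ∷ xs) (h ∷ u) = go (perms xs) (perms-unique xs u) (All.tabulate λ p → ↭.All-resp-↭ (↭-sym (∈-perms⁻ xs p)) h)
    where
    go : ∀ yss → Unique yss → All (All (x ≢_)) yss → Unique (concatMap (insertions x) yss)
    go []         u       h = []
    go (ys ∷ yss) (q ∷ u) (h ∷ hs) = Unique.++⁺ (insertions-unique x ys h) (go yss u hs) disj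
      where
      disj : ∀ {zs} → ¬ (zs ∈ insertions x ys × zs ∈ concatMap (insertions x) yss)
      disj (p , p′) with ∈.∈-concat⁻′ (map (insertions x) yss) p′
      ... | ws , r , s with ∈.∈-map⁻ (insertions x) s
      ... | ys′ , t , refl = All.lookup q t (sym (del-insertion x ys h p) ∙ del-insertion x ys′ (All.lookup hs t) r)

  opaque
    -- The list `Sym m` as vectors, so that sums over the filtered lists in `FMT` can be rewritten
    -- term by term.
    els : ∀ m → List (Vec (Fin m) m)
    els m = map fromL (Sym m)

    els≡ : ∀ m → els m ≡ map fromL (Sym m)
    els≡ m = refl

    ∈-els⁻ : {σ : Vec (Fin m) m} → σ ∈ els m → IsPerm σ
    ∈-els⁻ {m} p with ∈.∈-map⁻ fromL p
    ... | σ , q , refl = perm-fromL (∈-perms⁻ (oneTo m) q)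

    ∈-els⁺ : {σ : Vec (Fin m) m} → IsPerm σ → σ ∈ els m
    ∈-els⁺ {m} {σ} p = subst (_∈ els m) (fromL-toL σ) (∈.∈-map⁺ fromL (∈-perms⁺ (oneTo m) (toL-↭ σ p)))

    els-unique : ∀ m → Unique (els m)
    els-unique m = go (Sym m) (λ {σ} p → ∈-perms⁻ (oneTo m) p) (perms-unique (oneTo m) (oneTo-unique m))
      where
      go : ∀ σs → (∀ {σ} → σ ∈ σs → σ ↭ oneTo m) → Unique σs → Unique (map (fromL {m}) σs)
      go []       h u = []
      go (σ ∷ σs) h (p ∷ u) = All.tabulate (λ q → lem (∈.∈-map⁻ fromL q)) ∷ go σs (h ∘ there) u
        where
        lem : ∀ {y : Vec (Fin m) m} → (∃ λ τ → τ ∈ σs × y ≡ fromL τ) → fromL σ ≢ y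
        lem (τ , q , refl) eq = All.lookup p q (sym (toL-fromL (h (here refl))) ∙ cong toL eq ∙ toL-fromL (h (there q)))

  -- A map with a two-sided inverse on permutations only rearranges `els m`, because that list is
  -- complete and free of repetitions.
  ∑-reindex : (f g : Vec (Fin m) m → Vec (Fin m) m) →
              (∀ {σ} → IsPerm σ → IsPerm (f σ)) → (∀ {σ} → IsPerm σ → IsPerm (g σ)) →
              (∀ {σ} → IsPerm σ → f (g σ) ≡ σ) → (∀ {σ} → IsPerm σ → g (f σ) ≡ σ) →
              (h : Vec (Fin m) m → ℚ) → ∑ (els m) (h ∘ f) ≡ ∑ (els m) h
  ∑-reindex {m} f g pf pg fg gf h = sym (∑-map f (els m) h) ∙ ∑-↭ h
    (unique-↭ (go (els m) ∈-els⁻ (els-unique m)) (els-unique m)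
      (λ p → let σ , q , eq = ∈.∈-map⁻ f p in subst (_∈ els m) (sym eq) (∈-els⁺ (pf (∈-els⁻ q))))
      (λ p → subst (_∈ map f (els m)) (fg (∈-els⁻ p)) (∈.∈-map⁺ f (∈-els⁺ (pg (∈-els⁻ p))))))
    where
    go : ∀ σs → (∀ {σ} → σ ∈ σs → IsPerm σ) → Unique σs → Unique (map f σs)
    go []       h u = []
    go (σ ∷ σs) h (p ∷ u) = All.tabulate (λ q → lem (∈.∈-map⁻ f q)) ∷ go σs (h ∘ there) u
      where
      lem : ∀ {y} → (∃ λ τ → τ ∈ σs × y ≡ f τ) → f σ ≢ y
      lem (τ , q , refl) eq = All.lookup p q (sym (gf (h (here refl))) ∙ cong g eq ∙ gf (h (there q)))

  ∑-shiftˡ : {σ : Vec (Fin m) m} → IsPerm σ → (h : Vec (Fin m) m → ℚ) → (∑[ π ← els m ] h (σ ⊙ π)) ≡ ∑ (els m) h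
  ∑-shiftˡ {σ = σ} p = ∑-reindex (σ ⊙_) (inv σ ⊙_) (perm-⊙ p) (perm-⊙ (perm-inv p))
    (λ {π} _ → sym (⊙-assoc σ (inv σ) π) ∙ cong (_⊙ π) (inverseʳ σ p) ∙ ⊙-identityˡ π)
    (λ {π} _ → sym (⊙-assoc (inv σ) σ π) ∙ cong (_⊙ π) (inverseˡ σ p) ∙ ⊙-identityˡ π)

  ∑-shiftʳ : {σ : Vec (Fin m) m} → IsPerm σ → (h : Vec (Fin m) m → ℚ) → (∑[ π ← els m ] h (π ⊙ σ)) ≡ ∑ (els m) h
  ∑-shiftʳ {σ = σ} p = ∑-reindex (_⊙ σ) (_⊙ inv σ) (λ q → perm-⊙ q p) (λ q → perm-⊙ q (perm-inv p))
    (λ {π} _ → inv-⊙ π σ p) (λ {π} _ → ⊙-inv π σ p)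

  ∑-inv : (h : Vec (Fin m) m → ℚ) → ∑ (els m) (h ∘ inv) ≡ ∑ (els m) h
  ∑-inv = ∑-reindex inv inv perm-inv perm-inv (λ {σ} → inv-inv σ) (λ {σ} → inv-inv σ)

  infix 4 _↭?_

  _↭?_ : (xs ys : List ℕ) → Dec (xs ↭ ys)
  xs ↭? ys = map′ (∈-perms⁻ ys) (∈-perms⁺ ys) (xs ∈? perms ys)
    where open import Data.List.Membership.DecPropositional (List.≡-dec ℕ._≟_) using (_∈?_)

open Permutations

-- Signs of permutations

module Signs where

  sg : ℕ → ℚ
  sg k = if even k then 1ℚ else -ℚ 1ℚ

  even-suc : ∀ k → even (suc k) ≡ not (even k)
  even-suc zero          = refl
  even-suc (suc zero)    = refl
  even-suc (suc (suc k)) = even-suc k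

  sg-suc : ∀ k → sg (suc k) ≡ -ℚ sg k
  sg-suc k rewrite even-suc k with even k
  ... | true  = refl
  ... | false = refl

  sg-+ : ∀ j k → sg (j + k) ≡ sg j *ℚ sg k
  sg-+ zero    k = sym (ℚ.*-identityˡ (sg k))
  sg-+ (suc j) k = sg-suc (j + k) ∙ cong -ℚ_ (sg-+ j k) ∙ ℚ.neg-distribˡ-* (sg j) (sg k) ∙ cong (_*ℚ sg k) (sym (sg-suc j))

  sg-square : ∀ k → sg k *ℚ sg k ≡ 1ℚ
  sg-square k with even k
  ... | true  = refl
  ... | false = refl

  count-∷ : ∀ {A : Set} (p : A → Bool) x xs → count p (x ∷ xs) ≡ (if p x then 1 else 0) + count p xs
  count-∷ p x xs with p x
  ... | true  = refl
  ... | false = refl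

  count-↭ : ∀ {A : Set} (p : A → Bool) {xs ys} → xs ↭ ys → count p xs ≡ count p ys
  count-↭ p refl = refl
  count-↭ p {x ∷ xs} {x ∷ ys} (prep x r) = count-∷ p x xs ∙ cong ((if p x then 1 else 0) +_) (count-↭ p r) ∙ sym (count-∷ p x ys)
  count-↭ p {x ∷ y ∷ xs} {y ∷ x ∷ ys} (swap x y r)
    rewrite count-∷ p x (y ∷ xs) | count-∷ p y xs | count-∷ p y (x ∷ ys) | count-∷ p x ys | count-↭ p r
    with p x | p y
  ... | true  | true  = refl
  ... | true  | false = refl
  ... | false | true  = refl
  ... | false | false = refl
  count-↭ p (trans r s) = count-↭ p r ∙ count-↭ p s

  <ᵇ-true : ∀ {x y} → x < y → (x <ᵇ y) ≡ true
  <ᵇ-true {x} {y} p with x <ᵇ y | ℕ.<⇒<ᵇ p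
  ... | true | _ = refl

  <ᵇ-false : ∀ {x y} → ¬ x < y → (x <ᵇ y) ≡ false
  <ᵇ-false {x} {y} p with x <ᵇ y in eq
  ... | true  = contradiction (ℕ.<ᵇ⇒< x y (subst T (sym eq) tt)) p
  ... | false = refl

  private
    one : Bool → ℕ
    one b = if b then 1 else 0

    sg-one-swap : ∀ {x y} → x ≢ y → sg (one (y <ᵇ x)) ≡ -ℚ sg (one (x <ᵇ y))
    sg-one-swap {x} {y} x≢y with ℕ.<-cmp x y
    ... | tri< a _ c rewrite <ᵇ-true a | <ᵇ-false c = refl
    ... | tri≈ _ b _ = contradiction b x≢y
    ... | tri> a _ c rewrite <ᵇ-true c | <ᵇ-false a = refl

    sgL : List ℕ → ℚ
    sgL xs = sg (inversions xs)

    sgL-∷ : ∀ x xs → sgL (x ∷ xs) ≡ sg (count (_<ᵇ x) xs) *ℚ sgL xs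
    sgL-∷ x xs = sg-+ (count (_<ᵇ x) xs) (inversions xs)

    -- Both tails have equally many entries below `x` and below `y`, so only the inversion of the
    -- pair itself changes. Each side carries the sign of the other tail, which saves a division.
    sgL-swap : ∀ {x y xs ys} → x ≢ y → count (_<ᵇ x) xs ≡ count (_<ᵇ x) ys → count (_<ᵇ y) xs ≡ count (_<ᵇ y) ys →
               sgL (x ∷ y ∷ xs) *ℚ sgL ys ≡ -ℚ (sgL (y ∷ x ∷ ys) *ℚ sgL xs)
    sgL-swap {x} {y} {xs} {ys} x≢y ex ey
      rewrite sgL-∷ x (y ∷ xs) | sgL-∷ y (x ∷ ys) | sgL-∷ y xs | sgL-∷ x ys
            | count-∷ (_<ᵇ x) y xs | count-∷ (_<ᵇ y) x ys | ex | ey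
            | sg-+ (one (y <ᵇ x)) (count (_<ᵇ x) ys) | sg-+ (one (x <ᵇ y)) (count (_<ᵇ y) ys)
            | sg-one-swap x≢y =
      solve 5 (λ s a b u v → (:- s :* a) :* (b :* u) :* v := :- (s :* b :* (a :* v) :* u)) refl
        (sg (one (x <ᵇ y))) (sg (count (_<ᵇ x) ys)) (sg (count (_<ᵇ y) ys)) (sgL xs) (sgL ys)
      where open +-*-Solver

    -- The sign of `f` can be read off from any arrangement `xs` of its arguments, since a
    -- rearrangement changes the signs of `xs` and of its image alike. Comparing the increasing
    -- arrangement with `toL τ` gives multiplicativity of the sign.
    sgL-ratio : (f : ℕ → ℕ) {xs ys : List ℕ} → xs ↭ ys → Unique xs → Unique (map f xs) →
                sgL (map f xs) *ℚ sgL xs ≡ sgL (map f ys) *ℚ sgL ys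
    sgL-ratio f refl u v = refl
    sgL-ratio f {x ∷ xs} {x ∷ ys} (prep x p) (_ ∷ u) (_ ∷ v)
      rewrite sgL-∷ (f x) (map f xs) | sgL-∷ (f x) (map f ys) | sgL-∷ x xs | sgL-∷ x ys
            | count-↭ (_<ᵇ f x) (↭.map⁺ f p) | count-↭ (_<ᵇ x) p =
      solve 4 (λ a b c d → (a :* b) :* (c :* d) := (a :* c) :* (b :* d)) refl A (sgL (map f xs)) B (sgL xs) ∙
      cong ((A *ℚ B) *ℚ_) (sgL-ratio f p u v) ∙
      solve 4 (λ a b c d → (a :* c) :* (b :* d) := (a :* b) :* (c :* d)) refl A (sgL (map f ys)) B (sgL ys)
      where
      open +-*-Solver
      A = sg (count (_<ᵇ f x) (map f ys))
      B = sg (count (_<ᵇ x) ys)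
    sgL-ratio f {x ∷ y ∷ xs} {y ∷ x ∷ ys} (swap x y p) ((x≢y ∷ _) ∷ _ ∷ u) ((fx≢fy ∷ _) ∷ _ ∷ v) = begin
      -- The signs of the tails are inserted as squares, equal to 1, so that `sgL-swap` applies to
      -- both factors.
      a *ℚ b ≡⟨ lem ⟩
      (a *ℚ d′) *ℚ (b *ℚ d) *ℚ (d′ *ℚ d) ≡⟨ cong₂ (λ p q → p *ℚ q *ℚ (d′ *ℚ d)) (sgL-swap fx≢fy (cf (f x)) (cf (f y))) (sgL-swap x≢y (c x) (c y)) ⟩
      -ℚ (a′ *ℚ e′) *ℚ -ℚ (b′ *ℚ e) *ℚ (d′ *ℚ d) ≡⟨ cong (-ℚ (a′ *ℚ e′) *ℚ -ℚ (b′ *ℚ e) *ℚ_) (sym (sgL-ratio f p u v)) ⟩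
      -ℚ (a′ *ℚ e′) *ℚ -ℚ (b′ *ℚ e) *ℚ (e′ *ℚ e) ≡⟨ lem′ ⟩
      a′ *ℚ b′ ∎
      where
      open ≡-Reasoning
      open +-*-Solver
      cf = λ z → count-↭ (_<ᵇ z) (↭.map⁺ f p)
      c  = λ z → count-↭ (_<ᵇ z) p
      a  = sgL (f x ∷ f y ∷ map f xs)
      b  = sgL (x ∷ y ∷ xs)
      a′ = sgL (f y ∷ f x ∷ map f ys)
      b′ = sgL (y ∷ x ∷ ys)
      d′ = sgL (map f ys)
      d  = sgL ys
      e′ = sgL (map f xs)
      e  = sgL xs
      sq : ∀ zs → sgL zs *ℚ sgL zs ≡ 1ℚ
      sq zs = sg-square (inversions zs)
      lem : a *ℚ b ≡ (a *ℚ d′) *ℚ (b *ℚ d) *ℚ (d′ *ℚ d)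
      lem = sym (solve 4 (λ a b d′ d → (a :* d′) :* (b :* d) :* (d′ :* d) := a :* b :* ((d′ :* d′) :* (d :* d))) refl a b d′ d ∙
                 cong₂ (λ p q → a *ℚ b *ℚ (p *ℚ q)) (sq (map f ys)) (sq ys) ∙ ℚ.*-identityʳ _)
      lem′ : -ℚ (a′ *ℚ e′) *ℚ -ℚ (b′ *ℚ e) *ℚ (e′ *ℚ e) ≡ a′ *ℚ b′
      lem′ = solve 4 (λ a b d′ d → :- (a :* d′) :* :- (b :* d) :* (d′ :* d) := a :* b :* ((d′ :* d′) :* (d :* d))) refl a′ b′ e′ e ∙
                 cong₂ (λ p q → a′ *ℚ b′ *ℚ (p *ℚ q)) (sq (map f xs)) (sq xs) ∙ ℚ.*-identityʳ _
    sgL-ratio f (trans p q) u v = sgL-ratio f p u v ∙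
      sgL-ratio f q (Unique-resp-↭ p u) (Unique-resp-↭ (↭.map⁺ f p) v)

    inversions-sorted : ∀ {xs} → AllPairs _<_ xs → inversions xs ≡ 0
    inversions-sorted []      = refl
    inversions-sorted {x ∷ xs} (p ∷ ps) = cong₂ _+_ (none p) (inversions-sorted ps)
      where
      none : ∀ {ys} → All (x <_) ys → count (_<ᵇ x) ys ≡ 0
      none []      = refl
      none {y ∷ ys} (q ∷ qs) rewrite <ᵇ-false (ℕ.<⇒≯ q) = none qs

    sgL-oneTo : ∀ m → sgL (oneTo m) ≡ 1ℚ
    sgL-oneTo m rewrite inversions-sorted {oneTo m} (AllPairs.map⁺ (AllPairs.applyUpTo⁺₁ id m (λ p _ → s<s p))) = refl

  private variable
    m : ℕ

  sgnV : Vec (Fin m) m → ℚ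
  sgnV σ = sgn (toL σ)

  sgnV-square : (σ : Vec (Fin m) m) → sgnV σ *ℚ sgnV σ ≡ 1ℚ
  sgnV-square σ = sg-square (inversions (toL σ))

  private
    toList-ext : (v : Vec ℕ m) (xs : List ℕ) (f : ℕ → ℕ) (w : Vec ℕ m) → xs ≡ toList w → (∀ i → lookup v i ≡ f (lookup w i)) → toList v ≡ map f xs
    toList-ext v _ f w refl h = cong toList (vec-ext {β = Vec.map f w} λ i → h i ∙ sym (Vec.lookup-map i f w)) ∙ Vec.toList-map f w

  oneTo≡ : ∀ m → oneTo m ≡ toList (tabulate {n = m} idx)
  oneTo≡ m = go m id
    where
    go : ∀ m (f : ℕ → ℕ) → map (1 +_) (List.applyUpTo f m) ≡ toList (tabulate {n = m} (λ i → 1 + f (toℕ i)))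
    go zero    f = refl
    go (suc m) f = cong (1 + f 0 ∷_) (go m (λ k → f (1 + k)))

  toL-⊙ : (σ τ : Vec (Fin m) m) → toL (σ ⊙ τ) ≡ map (applyPerm (toL σ)) (toL τ)
  toL-⊙ σ τ = toList-ext _ _ _ (Vec.map idx τ) refl λ i →
    toL-lookup (σ ⊙ τ) i ∙ cong idx (lookup-⊙ σ τ i) ∙ sym (applyPerm-toL σ (lookup τ i)) ∙
    cong (applyPerm (toL σ)) (sym (toL-lookup τ i))

  toL-oneTo : (σ : Vec (Fin m) m) → toL σ ≡ map (applyPerm (toL σ)) (oneTo m)
  toL-oneTo {m} σ = toList-ext _ _ _ (tabulate idx) (oneTo≡ m) λ i →
    toL-lookup σ i ∙ sym (applyPerm-toL σ i) ∙ cong (applyPerm (toL σ)) (sym (Vec.lookup∘tabulate idx i))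

  private
    sgnV-ratio : (σ : Vec (Fin m) m) → IsPerm σ → {xs : List ℕ} → xs ↭ oneTo m →
                 sgL (map (applyPerm (toL σ)) xs) *ℚ sgL xs ≡ sgnV σ
    sgnV-ratio {m} σ p {xs} q = sgL-ratio f q (Unique-resp-↭ (↭-sym q) (oneTo-unique m)) u ∙
      cong₂ _*ℚ_ (cong sgL (sym (toL-oneTo σ))) (sgL-oneTo m) ∙ ℚ.*-identityʳ _
      where
      f = applyPerm (toL σ)
      u : Unique (map f xs)
      u = Unique-resp-↭ (↭.map⁺ f (↭-sym q)) (subst Unique (toL-oneTo σ)
            (Unique-resp-↭ (↭-sym (toL-↭ σ p)) (oneTo-unique m)))

  sgnV-⊙ : {σ τ : Vec (Fin m) m} → IsPerm σ → IsPerm τ → sgnV (σ ⊙ τ) ≡ sgnV σ *ℚ sgnV τ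
  sgnV-⊙ {σ = σ} {τ} p q = sym (ℚ.*-identityʳ _) ∙ cong (sgnV (σ ⊙ τ) *ℚ_) (sym (sgnV-square τ)) ∙
    sym (ℚ.*-assoc (sgnV (σ ⊙ τ)) (sgnV τ) (sgnV τ)) ∙
    cong (_*ℚ sgnV τ) (cong (λ xs → sgL xs *ℚ sgnV τ) (toL-⊙ σ τ) ∙ sgnV-ratio σ p (toL-↭ τ q))

  sgnV-id : sgnV (allFin m) ≡ 1ℚ
  sgnV-id {m} = cong sgn (cong toList (vec-ext {α = Vec.map idx (allFin m)} λ i → Vec.lookup-map i idx (allFin m) ∙ cong idx (Vec.lookup-allFin i) ∙
    sym (Vec.lookup∘tabulate idx i)) ∙ sym (oneTo≡ m)) ∙ sgL-oneTo m

  sgnV-inv : {σ : Vec (Fin m) m} → IsPerm σ → sgnV (inv σ) ≡ sgnV σ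
  sgnV-inv {m} {σ} p = sym (ℚ.*-identityˡ _) ∙ cong (_*ℚ sgnV (inv σ)) (sym (sgnV-square σ)) ∙ ℚ.*-assoc (sgnV σ) _ _ ∙
    cong (sgnV σ *ℚ_) (sym (sgnV-⊙ p (perm-inv p)) ∙ cong sgnV (inverseʳ σ p) ∙ sgnV-id {m}) ∙ ℚ.*-identityʳ _

  tr : Fin m → Fin m → Fin m → Fin m
  tr x y i with i Fin.≟ x | i Fin.≟ y
  ... | yes _ | _     = y
  ... | no  _ | yes _ = x
  ... | no  _ | no  _ = i

  tr-x : (x y : Fin m) → tr x y x ≡ y
  tr-x x y with x Fin.≟ x
  ... | yes _ = refl
  ... | no ¬p = contradiction refl ¬p

  tr-y : (x y : Fin m) → tr x y y ≡ x
  tr-y x y with y Fin.≟ x | y Fin.≟ y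
  ... | yes p | _     = p
  ... | no  _ | yes _ = refl
  ... | no  _ | no ¬p = contradiction refl ¬p

  tr-≢ : (x y : Fin m) {i : Fin m} → i ≢ x → i ≢ y → tr x y i ≡ i
  tr-≢ x y {i} p q with i Fin.≟ x | i Fin.≟ y
  ... | yes r | _     = contradiction r p
  ... | no  _ | yes r = contradiction r q
  ... | no  _ | no  _ = refl

  tr-case : (x y i : Fin m) → (i ≡ x × tr x y i ≡ y) ⊎ (i ≡ y × tr x y i ≡ x) ⊎ (i ≢ x × i ≢ y × tr x y i ≡ i)
  tr-case x y i with i Fin.≟ x | i Fin.≟ y
  ... | yes p | _     = inj₁ (p , refl)
  ... | no  _ | yes p = inj₂ (inj₁ (p , refl))
  ... | no  p | no  q = inj₂ (inj₂ (p , q , refl))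

  tr-involutive : (x y i : Fin m) → tr x y (tr x y i) ≡ i
  tr-involutive x y i with tr-case x y i
  ... | inj₁ (refl , eq)            = cong (tr x y) eq ∙ tr-y x y
  ... | inj₂ (inj₁ (refl , eq))     = cong (tr x y) eq ∙ tr-x x y
  ... | inj₂ (inj₂ (p , q , eq))    = cong (tr x y) eq ∙ eq

  trV : Fin m → Fin m → Vec (Fin m) m
  trV x y = tabulate (tr x y)

  lookup-trV : (x y i : Fin m) → lookup (trV x y) i ≡ tr x y i
  lookup-trV x y = Vec.lookup∘tabulate (tr x y)

  perm-tr : (x y : Fin m) → IsPerm (trV x y)
  perm-tr x y = mkPerm λ i j eq → sym (tr-involutive x y i) ∙
    cong (tr x y) (sym (lookup-trV x y i) ∙ eq ∙ lookup-trV x y j) ∙ tr-involutive x y j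

  -- `sgnV-ratio` permits any listing of the numbers. In one that begins with `x` and `y`, the
  -- transposition exchanges the first two entries and fixes the rest.
  sgnV-tr : {x y : Fin m} → x ≢ y → sgnV (trV x y) ≡ -ℚ 1ℚ
  sgnV-tr {m} {x} {y} x≢y with ∈.∈-∃++ (∈-oneTo⁺ x)
  ... | as , bs , eq with ∈.∈-∃++ y∈
    where
    y∈ : idx y ∈ as ++ bs
    y∈ with ↭.∈-resp-↭ (↭-trans (↭-reflexive eq) (↭.shift (idx x) as bs)) (∈-oneTo⁺ y)
    ... | here p  = contradiction (Fin.toℕ-injective (ℕ.suc-injective (sym p))) x≢y
    ... | there p = p
  ... | cs , ds , eq′ = sym (sgnV-ratio (trV x y) (perm-tr x y) (↭-sym perm)) ∙
    cong (λ zs → sgL zs *ℚ sgL (idx x ∷ idx y ∷ rest)) (cong₂ _∷_ (f-x) (cong₂ _∷_ f-y (f-rest rest (λ p → p)))) ∙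
    lem
    where
    rest = cs ++ ds
    perm : oneTo m ↭ idx x ∷ idx y ∷ rest
    perm = ↭-trans (↭-reflexive eq) (↭-trans (↭.shift (idx x) as bs) (prep (idx x) (↭-trans (↭-reflexive eq′) (↭.shift (idx y) cs ds))))
    u : Unique (idx x ∷ idx y ∷ rest)
    u = Unique-resp-↭ perm (oneTo-unique m)
    f = applyPerm (toL (trV x y))
    f-tr : ∀ i → f (idx i) ≡ idx (tr x y i)
    f-tr i = applyPerm-toL (trV x y) i ∙ cong idx (lookup-trV x y i)
    f-x : f (idx x) ≡ idx y
    f-x = f-tr x ∙ cong idx (tr-x x y)
    f-y : f (idx y) ≡ idx x
    f-y = f-tr y ∙ cong idx (tr-y x y)
    f-one : ∀ {k} → k ∈ rest → f k ≡ k
    f-one {k} p with ∈-oneTo⁻ (↭.∈-resp-↭ (↭-sym perm) (there (there p))) | u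
    ... | i , refl | (_ ∷ nx) ∷ ny ∷ _ = f-tr i ∙ cong idx (tr-≢ x y
             (λ eq → All.lookup nx p (cong idx (sym eq))) (λ eq → All.lookup ny p (cong idx (sym eq))))
    f-rest : ∀ zs → (∀ {z} → z ∈ zs → z ∈ rest) → map f zs ≡ zs
    f-rest []       h = refl
    f-rest (z ∷ zs) h = cong₂ _∷_ (f-one (h (here refl))) (f-rest zs (h ∘ there))
    lem : sgL (idx y ∷ idx x ∷ rest) *ℚ sgL (idx x ∷ idx y ∷ rest) ≡ -ℚ 1ℚ
    lem = begin
      a *ℚ b                        ≡⟨ sym (ℚ.*-identityʳ _) ⟩
      a *ℚ b *ℚ 1ℚ                  ≡⟨ cong (a *ℚ b *ℚ_) (sym (sg-square (inversions rest))) ⟩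
      a *ℚ b *ℚ (c *ℚ c)            ≡⟨ solve 3 (λ a b c → a :* b :* (c :* c) := (b :* c) :* (a :* c)) refl a b c ⟩
      (b *ℚ c) *ℚ (a *ℚ c)          ≡⟨ cong (_*ℚ (a *ℚ c)) (sgL-swap (λ eq → x≢y (Fin.toℕ-injective (ℕ.suc-injective eq))) refl refl) ⟩
      -ℚ (a *ℚ c) *ℚ (a *ℚ c)       ≡⟨ solve 2 (λ a c → :- (a :* c) :* (a :* c) := :- ((a :* a) :* (c :* c))) refl a c ⟩
      -ℚ ((a *ℚ a) *ℚ (c *ℚ c))     ≡⟨ cong₂ (λ p q → -ℚ (p *ℚ q)) (sg-square (inversions (idx y ∷ idx x ∷ rest))) (sg-square (inversions rest)) ⟩
      -ℚ 1ℚ                         ∎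
      where
      open ≡-Reasoning
      open +-*-Solver
      a = sgL (idx y ∷ idx x ∷ rest)
      b = sgL (idx x ∷ idx y ∷ rest)
      c = sgL rest

  fix-lookup : (ℓ : Vec ℕ m) {σ : Vec (Fin m) m} → ℓ ⊙ σ ≡ ℓ → ∀ i → lookup ℓ (lookup σ i) ≡ lookup ℓ i
  fix-lookup ℓ {σ} e i = sym (lookup-⊙ ℓ σ i) ∙ cong (λ v → lookup v i) e

  lookup-fix : (ℓ : Vec ℕ m) {σ : Vec (Fin m) m} → (∀ i → lookup ℓ (lookup σ i) ≡ lookup ℓ i) → ℓ ⊙ σ ≡ ℓ
  lookup-fix ℓ {σ} h = vec-ext λ i → lookup-⊙ ℓ σ i ∙ h i

  tr-fix : (ℓ : Vec ℕ m) {x y : Fin m} → lookup ℓ x ≡ lookup ℓ y → ℓ ⊙ trV x y ≡ ℓ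
  tr-fix ℓ {x} {y} e = lookup-fix ℓ λ i → cong (lookup ℓ) (lookup-trV x y i) ∙ lem i
    where
    lem : ∀ i → lookup ℓ (tr x y i) ≡ lookup ℓ i
    lem i with tr-case x y i
    ... | inj₁ (refl , eq)          = cong (lookup ℓ) eq ∙ sym e
    ... | inj₂ (inj₁ (refl , eq))   = cong (lookup ℓ) eq ∙ e
    ... | inj₂ (inj₂ (_ , _ , eq))  = cong (lookup ℓ) eq

open Signs

-- Row symmetrizers, column antisymmetrizers and the inner product of an orbit

module Symmetrizers where

  -- Symmetrizers, acting on coefficient functions

  private variable
    m : ℕ

  Fun : ℕ → Set
  Fun m = Vec ℕ m → ℚ

  infix 4 _≟V_

  _≟V_ : (α β : Vec ℕ m) → Dec (α ≡ β)
  _≟V_ = Vec.≡-dec ℕ._≟_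

  stab : Vec ℕ m → Vec (Fin m) m → ℚ
  stab ℓ σ = iv (ℓ ⊙ σ ≟V ℓ)

  -- Because of `χ-square` these are characters with values 1 and -1; row symmetrizers and column
  -- antisymmetrizers share one theory in this way.
  record IsChar (χ : Vec (Fin m) m → ℚ) : Set where
    field
      χ-⊙      : ∀ {σ τ} → IsPerm σ → IsPerm τ → χ (σ ⊙ τ) ≡ χ σ *ℚ χ τ
      χ-inv    : ∀ {σ} → IsPerm σ → χ (inv σ) ≡ χ σ
      χ-square : ∀ σ → χ σ *ℚ χ σ ≡ 1ℚ

  open IsChar

  sgn-char : IsChar (sgnV {m})
  sgn-char = record { χ-⊙ = sgnV-⊙ ; χ-inv = sgnV-inv ; χ-square = sgnV-square }

  𝟙 : Vec (Fin m) m → ℚ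
  𝟙 _ = 1ℚ

  𝟙-char : IsChar (𝟙 {m})
  𝟙-char = record { χ-⊙ = λ _ _ → refl ; χ-inv = λ _ → refl ; χ-square = λ _ → refl }

  act : Vec (Fin m) m → Fun m → Fun m
  act π u α = u (α ⊙ π)

  -- The sum over the stabilizer of the labelling `ℓ`, twisted by `χ`. If `ℓ` gives the rows or the
  -- columns of a tableau, the stabilizer is its row group or its column group.
  K : (Vec (Fin m) m → ℚ) → Vec ℕ m → Fun m → Fun m
  K {m} χ ℓ u α = ∑[ σ ← els m ] (stab ℓ σ *ℚ χ σ) *ℚ u (α ⊙ σ)

  κ ρ : Vec ℕ m → Fun m → Fun m
  κ = K sgnV
  ρ = K 𝟙

  act-⊙ : (σ τ : Vec (Fin m) m) (u : Fun m) → act σ (act τ u) ≗ act (σ ⊙ τ) u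
  act-⊙ σ τ u α = cong u (⊙-assoc α σ τ)

  K-cong : ∀ χ (ℓ : Vec ℕ m) {u v : Fun m} → u ≗ v → K χ ℓ u ≗ K χ ℓ v
  K-cong χ ℓ h α = ∑-cong (els _) λ σ → cong (stab ℓ σ *ℚ χ σ *ℚ_) (h (α ⊙ σ))

  module _ {A : Set} (c : A → ℚ) (F : A → Fun m) where
    K-∑ : ∀ χ ℓ (L : List A) → K χ ℓ (λ α → ∑[ g ← L ] c g *ℚ F g α) ≗ λ α → ∑[ g ← L ] c g *ℚ K χ ℓ (F g) α
    K-∑ χ ℓ L α = begin
      (∑[ σ ← els _ ] (w σ *ℚ (∑[ g ← L ] c g *ℚ F g (α ⊙ σ)))) ≡⟨ ∑-cong (els _) (λ σ → sym (∑-*ˡ L (w σ) _)) ⟩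
      (∑[ σ ← els _ ] (∑[ g ← L ] w σ *ℚ (c g *ℚ F g (α ⊙ σ)))) ≡⟨ ∑-swap (els _) L _ ⟩
      (∑[ g ← L ] (∑[ σ ← els _ ] w σ *ℚ (c g *ℚ F g (α ⊙ σ)))) ≡⟨ ∑-cong L (λ g → ∑-cong (els _) (λ σ → solve 3 (λ a b c → a :* (b :* c) := b :* (a :* c)) refl (w σ) (c g) (F g (α ⊙ σ)))) ⟩
      (∑[ g ← L ] (∑[ σ ← els _ ] c g *ℚ (w σ *ℚ F g (α ⊙ σ)))) ≡⟨ ∑-cong L (λ g → ∑-*ˡ (els _) (c g) _) ⟩
      (∑[ g ← L ] c g *ℚ K χ ℓ (F g) α) ∎
      where
      open ≡-Reasoning
      open +-*-Solver
      w : Vec (Fin m) m → ℚ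
      w σ = stab ℓ σ *ℚ χ σ

  K-*ˡ : ∀ χ (ℓ : Vec ℕ m) q (u : Fun m) → K χ ℓ (λ α → q *ℚ u α) ≗ λ α → q *ℚ K χ ℓ u α
  K-*ˡ χ ℓ q u α = ∑-cong (els _) (λ σ → solve 3 (λ a b c → a :* (b :* c) := b :* (a :* c)) refl (stab ℓ σ *ℚ χ σ) q (u (α ⊙ σ))) ∙ ∑-*ˡ (els _) q _
    where open +-*-Solver

  stab-⊙ʳ : (ℓ : Vec ℕ m) {σ : Vec (Fin m) m} → ℓ ⊙ σ ≡ ℓ → IsPerm σ → ∀ τ → stab ℓ (τ ⊙ σ) ≡ stab ℓ τ
  stab-⊙ʳ ℓ {σ} e p τ = iv-cong (_ ≟V _) (_ ≟V _)
    (λ q → sym (⊙-inv (ℓ ⊙ τ) σ p) ∙ cong (_⊙ inv σ) (⊙-assoc ℓ τ σ ∙ q ∙ sym e) ∙ ⊙-inv ℓ σ p)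
    (λ q → sym (⊙-assoc ℓ τ σ) ∙ cong (_⊙ σ) q ∙ e)

  stab-⊙ˡ : (ℓ : Vec ℕ m) {σ : Vec (Fin m) m} → ℓ ⊙ σ ≡ ℓ → ∀ τ → stab ℓ (σ ⊙ τ) ≡ stab ℓ τ
  stab-⊙ˡ ℓ {σ} e τ = iv-cong (_ ≟V _) (_ ≟V _)
    (λ q → cong (_⊙ τ) (sym e) ∙ ⊙-assoc ℓ σ τ ∙ q)
    (λ q → sym (⊙-assoc ℓ σ τ) ∙ cong (_⊙ τ) e ∙ q)

  stab-fix-inv : (ℓ : Vec ℕ m) {σ : Vec (Fin m) m} → IsPerm σ → ℓ ⊙ σ ≡ ℓ → ℓ ⊙ inv σ ≡ ℓ
  stab-fix-inv ℓ {σ} p e = cong (_⊙ inv σ) (sym e) ∙ ⊙-inv ℓ σ p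

  stab-inv : (ℓ : Vec ℕ m) {σ : Vec (Fin m) m} → IsPerm σ → stab ℓ (inv σ) ≡ stab ℓ σ
  stab-inv ℓ {σ} p = iv-cong (_ ≟V _) (_ ≟V _)
    (λ q → cong (ℓ ⊙_) (sym (inv-inv σ p)) ∙ stab-fix-inv ℓ (perm-inv p) q) (stab-fix-inv ℓ p)

  module _ {χ : Vec (Fin m) m → ℚ} (isChar : IsChar χ) where

    private
      cancel : ∀ σ x → χ σ *ℚ (χ σ *ℚ x) ≡ x
      cancel σ x = sym (ℚ.*-assoc (χ σ) (χ σ) x) ∙ cong (_*ℚ x) (χ-square isChar σ) ∙ ℚ.*-identityˡ x

    K-act : ∀ (ℓ : Vec ℕ m) {σ} → IsPerm σ → ℓ ⊙ σ ≡ ℓ → ∀ u → K χ ℓ (act σ u) ≗ λ α → χ σ *ℚ K χ ℓ u α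
    K-act ℓ {σ} p e u α = sym (cancel σ _) ∙ cong (χ σ *ℚ_) (sym (∑-*ˡ (els _) (χ σ) _) ∙ ∑-cong∈ (els m) eq ∙
        ∑-shiftʳ p (λ π → (stab ℓ π *ℚ χ π) *ℚ u (α ⊙ π)))
      where
      open +-*-Solver
      eq : ∀ {τ} → τ ∈ els m → χ σ *ℚ ((stab ℓ τ *ℚ χ τ) *ℚ u ((α ⊙ τ) ⊙ σ)) ≡ (stab ℓ (τ ⊙ σ) *ℚ χ (τ ⊙ σ)) *ℚ u (α ⊙ (τ ⊙ σ))
      eq {τ} q =
        solve 4 (λ a b c d → a :* (b :* c :* d) := b :* (c :* a) :* d) refl (χ σ) (stab ℓ τ) (χ τ) (u ((α ⊙ τ) ⊙ σ)) ∙
        sym (cong₂ _*ℚ_ (cong₂ _*ℚ_ (stab-⊙ʳ ℓ e p τ) (χ-⊙ isChar (∈-els⁻ q) p)) (cong u (sym (⊙-assoc α τ σ))))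

    act-K : ∀ (ℓ : Vec ℕ m) {σ} → IsPerm σ → ℓ ⊙ σ ≡ ℓ → ∀ u → act σ (K χ ℓ u) ≗ λ α → χ σ *ℚ K χ ℓ u α
    act-K ℓ {σ} p e u α = sym (cancel σ _) ∙ cong (χ σ *ℚ_) (sym (∑-*ˡ (els _) (χ σ) _) ∙ ∑-cong∈ (els m) eq ∙
        ∑-shiftˡ p (λ π → (stab ℓ π *ℚ χ π) *ℚ u (α ⊙ π)))
      where
      open +-*-Solver
      eq : ∀ {τ} → τ ∈ els m → χ σ *ℚ ((stab ℓ τ *ℚ χ τ) *ℚ u ((α ⊙ σ) ⊙ τ)) ≡ (stab ℓ (σ ⊙ τ) *ℚ χ (σ ⊙ τ)) *ℚ u (α ⊙ (σ ⊙ τ))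
      eq {τ} q =
        solve 4 (λ a b c d → a :* (b :* c :* d) := b :* (a :* c) :* d) refl (χ σ) (stab ℓ τ) (χ τ) (u ((α ⊙ σ) ⊙ τ)) ∙
        sym (cong₂ _*ℚ_ (cong₂ _*ℚ_ (stab-⊙ˡ ℓ e τ) (χ-⊙ isChar p (∈-els⁻ q))) (cong u (sym (⊙-assoc α σ τ))))

    -- Conjugation by `π` carries the stabilizer of `ℓ ⊙ π` to that of `ℓ`, and `χ` is constant on
    -- conjugates.
    act-K-conj : ∀ (ℓ : Vec ℕ m) {π} → IsPerm π → ∀ u → act π (K χ (ℓ ⊙ π) u) ≗ K χ ℓ (act π u)
    act-K-conj ℓ {π} p u α =
      ∑-cong∈ (els m) eq ∙
      ∑-shiftˡ p (λ σ → (stab ℓ (σ ⊙ inv π) *ℚ χ (σ ⊙ inv π)) *ℚ u ((α ⊙ (σ ⊙ inv π)) ⊙ π)) ∙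
      ∑-shiftʳ (perm-inv p) (λ σ → (stab ℓ σ *ℚ χ σ) *ℚ u ((α ⊙ σ) ⊙ π))
      where
      stab-eq : ∀ τ → stab (ℓ ⊙ π) τ ≡ stab ℓ ((π ⊙ τ) ⊙ inv π)
      stab-eq τ = iv-cong (_ ≟V _) (_ ≟V _)
        (λ q → sym (⊙-assoc ℓ (π ⊙ τ) (inv π)) ∙ cong (_⊙ inv π) (sym (⊙-assoc ℓ π τ) ∙ q) ∙ ⊙-inv ℓ π p)
        (λ q → ⊙-assoc ℓ π τ ∙ sym (inv-⊙ (ℓ ⊙ (π ⊙ τ)) π p) ∙ cong (_⊙ π) (⊙-assoc ℓ (π ⊙ τ) (inv π) ∙ q))
      χ-eq : ∀ {τ} → IsPerm τ → χ τ ≡ χ ((π ⊙ τ) ⊙ inv π)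
      χ-eq {τ} q = sym (χ-⊙ isChar (perm-⊙ p q) (perm-inv p) ∙ cong₂ _*ℚ_ (χ-⊙ isChar p q) (χ-inv isChar p) ∙
        ℚ.*-comm _ (χ π) ∙ cancel π (χ τ))
      eq : ∀ {τ} → τ ∈ els m → (stab (ℓ ⊙ π) τ *ℚ χ τ) *ℚ u ((α ⊙ π) ⊙ τ) ≡
           (stab ℓ ((π ⊙ τ) ⊙ inv π) *ℚ χ ((π ⊙ τ) ⊙ inv π)) *ℚ u ((α ⊙ ((π ⊙ τ) ⊙ inv π)) ⊙ π)
      eq {τ} q = cong₂ _*ℚ_ (cong₂ _*ℚ_ (stab-eq τ) (χ-eq (∈-els⁻ q)))
        (cong u (⊙-assoc α π τ ∙ sym (inv-⊙ (α ⊙ (π ⊙ τ)) π p) ∙ cong (_⊙ π) (⊙-assoc α (π ⊙ τ) (inv π))))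

  -- The transposition of `x` and `y` fixes `act π (ρ r u)`, as its conjugate by `π` preserves `r`.
  -- It also preserves `c`, so `κ c` turns it into a sign, and the result equals its own negative.
  collision : (c r : Vec ℕ m) {π : Vec (Fin m) m} → IsPerm π → {x y : Fin m} → x ≢ y →
              lookup c x ≡ lookup c y → lookup (r ⊙ inv π) x ≡ lookup (r ⊙ inv π) y →
              ∀ u α → κ c (act π (ρ r u)) α ≡ 0ℚ
  collision {m} c r {π} p {x} {y} x≢y cx≡cy rx≡ry u α = x≡-x⇒x≡0 _ (begin
    κ c w α                        ≡⟨ K-cong sgnV c fixed α ⟩
    κ c (act t w) α                ≡⟨ K-act sgn-char c (perm-tr x y) (tr-fix c cx≡cy) w α ⟩
    sgnV t *ℚ κ c w α              ≡⟨ cong (_*ℚ κ c w α) (sgnV-tr x≢y) ⟩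
    -ℚ 1ℚ *ℚ κ c w α               ≡⟨ sym (ℚ.neg-distribˡ-* 1ℚ (κ c w α)) ⟩
    -ℚ (1ℚ *ℚ κ c w α)             ≡⟨ cong -ℚ_ (ℚ.*-identityˡ (κ c w α)) ⟩
    -ℚ κ c w α                     ∎)
    where
    open ≡-Reasoning
    t = trV x y
    w = act π (ρ r u)
    s = inv π ⊙ (t ⊙ π)
    s-perm : IsPerm s
    s-perm = perm-⊙ (perm-inv p) (perm-⊙ (perm-tr x y) p)
    s-fix : r ⊙ s ≡ r
    s-fix = sym (⊙-assoc r (inv π) (t ⊙ π)) ∙ sym (⊙-assoc (r ⊙ inv π) t π) ∙ cong (_⊙ π) (tr-fix (r ⊙ inv π) rx≡ry) ∙ inv-⊙ r π p
    π⊙s : π ⊙ s ≡ t ⊙ π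
    π⊙s = sym (⊙-assoc π (inv π) (t ⊙ π)) ∙ cong (_⊙ (t ⊙ π)) (inverseʳ π p) ∙ ⊙-identityˡ _
    fixed : w ≗ act t w
    fixed β = sym (ℚ.*-identityˡ _) ∙ sym (act-K 𝟙-char r s-perm s-fix u (β ⊙ π)) ∙
      cong (ρ r u) (⊙-assoc β π s ∙ cong (β ⊙_) π⊙s ∙ sym (⊙-assoc β t π))

  δ : Vec ℕ m → Fun m
  δ α β = iv (β ≟V α)

  act-δ : (α : Vec ℕ m) {π : Vec (Fin m) m} → IsPerm π → act π (δ α) ≗ δ (α ⊙ inv π)
  act-δ α {π} p β = iv-cong (_ ≟V _) (_ ≟V _)
    (λ q → sym (⊙-inv β π p) ∙ cong (_⊙ inv π) q)
    (λ q → cong (_⊙ π) q ∙ inv-⊙ α π p)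

  -- Summing over all permutations counts each vector of the orbit of `α₀` equally often, namely
  -- once for every element of the stabilizer of `α₀`. So this is, up to a factor, the standard
  -- product of functions on the orbit.
  module InnerProduct (α₀ : Vec ℕ m) where

    infix 8 ⟪_,_⟫

    ⟪_,_⟫ : Fun m → Fun m → ℚ
    ⟪ u , v ⟫ = ∑[ π ← els m ] u (α₀ ⊙ π) *ℚ v (α₀ ⊙ π)

    ⟪⟫-cong : ∀ {u u′ v v′} → u ≗ u′ → v ≗ v′ → ⟪ u , v ⟫ ≡ ⟪ u′ , v′ ⟫
    ⟪⟫-cong h k = ∑-cong (els m) λ π → cong₂ _*ℚ_ (h _) (k _)

    ⟪⟫-sym : ∀ u v → ⟪ u , v ⟫ ≡ ⟪ v , u ⟫
    ⟪⟫-sym u v = ∑-cong (els m) λ π → ℚ.*-comm (u (α₀ ⊙ π)) _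

    ⟪⟫-∑ʳ : ∀ {A : Set} u (c : A → ℚ) (F : A → Fun m) L → ⟪ u , (λ α → ∑[ g ← L ] c g *ℚ F g α) ⟫ ≡ (∑[ g ← L ] c g *ℚ ⟪ u , F g ⟫)
    ⟪⟫-∑ʳ u c F L = ∑-cong (els m) (λ π → sym (∑-*ˡ L (u (α₀ ⊙ π)) _)) ∙ ∑-swap (els m) L _ ∙
      ∑-cong L (λ g → ∑-cong (els m) (λ π → solve 3 (λ a b c → a :* (b :* c) := b :* (a :* c)) refl (u (α₀ ⊙ π)) (c g) (F g (α₀ ⊙ π))) ∙ ∑-*ˡ (els m) (c g) _)
      where open +-*-Solver

    ⟪⟫-*ʳ : ∀ u q v → ⟪ u , (λ α → q *ℚ v α) ⟫ ≡ q *ℚ ⟪ u , v ⟫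
    ⟪⟫-*ʳ u q v = ∑-cong (els m) (λ π → solve 3 (λ a b c → a :* (b :* c) := b :* (a :* c)) refl (u (α₀ ⊙ π)) q (v (α₀ ⊙ π))) ∙ ∑-*ˡ (els m) q _
      where open +-*-Solver

    ⟪⟫-+ʳ : ∀ u v w → ⟪ u , (λ α → v α +ℚ w α) ⟫ ≡ ⟪ u , v ⟫ +ℚ ⟪ u , w ⟫
    ⟪⟫-+ʳ u v w = ∑-cong (els m) (λ π → ℚ.*-distribˡ-+ (u (α₀ ⊙ π)) _ _) ∙ ∑-+ (els m) _ _

    ⟪⟫-0ʳ : ∀ u {v} → (∀ α → v α ≡ 0ℚ) → ⟪ u , v ⟫ ≡ 0ℚ
    ⟪⟫-0ʳ u h = ∑-0 (els m) (λ {π} _ → cong (u (α₀ ⊙ π) *ℚ_) (h _) ∙ ℚ.*-zeroʳ (u (α₀ ⊙ π)))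

    act-adjoint : ∀ {σ} → IsPerm σ → ∀ u v → ⟪ act σ u , v ⟫ ≡ ⟪ u , act (inv σ) v ⟫
    act-adjoint {σ} p u v = ∑-cong (els m) (λ π → cong₂ (λ a b → u a *ℚ v b) (⊙-assoc α₀ π σ)
        (sym (⊙-inv (α₀ ⊙ π) σ p) ∙ cong (_⊙ inv σ) (⊙-assoc α₀ π σ))) ∙
      ∑-shiftʳ p (λ π → u (α₀ ⊙ π) *ℚ v ((α₀ ⊙ π) ⊙ inv σ))

    -- The adjoint of a permutation is its inverse, and inversion maps the stabilizer to itself
    -- without changing `χ`.
    K-adjoint : ∀ {χ} → IsChar χ → ∀ ℓ u v → ⟪ K χ ℓ u , v ⟫ ≡ ⟪ u , K χ ℓ v ⟫
    K-adjoint {χ} isChar ℓ u v = ⟪⟫-sym (K χ ℓ u) v ∙ ⟪⟫-∑ʳ v (λ σ → stab ℓ σ *ℚ χ σ) (λ σ → act σ u) (els m) ∙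
      ∑-cong∈ (els m) (λ {σ} q → cong₂ _*ℚ_ (cong₂ _*ℚ_ (sym (stab-inv ℓ (∈-els⁻ q))) (sym (χ-inv isChar (∈-els⁻ q))))
         (⟪⟫-sym v (act σ u) ∙ act-adjoint (∈-els⁻ q) u v)) ∙
      ∑-inv (λ σ → (stab ℓ σ *ℚ χ σ) *ℚ ⟪ u , act σ v ⟫) ∙
      sym (⟪⟫-∑ʳ u (λ σ → stab ℓ σ *ℚ χ σ) (λ σ → act σ v) (els m))

    ⟪⟫-definite : ∀ u → ⟪ u , u ⟫ ≡ 0ℚ → ∀ {π} → IsPerm π → u (α₀ ⊙ π) ≡ 0ℚ
    ⟪⟫-definite u h p = square-≡0 _ (∑-≡0⇒≡0 (els m) (λ {π} _ → square-≥0 (u (α₀ ⊙ π))) h (∈-els⁺ p))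

open Symmetrizers

-- Semistandard fillings and triangularity with respect to `Φ`

module Sorting where

  private variable
    m : ℕ

  opaque
    sumF : (Fin m → ℕ) → ℕ
    sumF f = sum (toList (tabulate f))

    sumF-cong : {f g : Fin m → ℕ} → f ≗ g → sumF f ≡ sumF g
    sumF-cong h = cong (sum ∘ toList) (Vec.tabulate-cong h)

    sumF-mono : {f g : Fin m → ℕ} → (∀ i → f i ≤ g i) → sumF f ≤ sumF g
    sumF-mono {zero}  h = z≤n
    sumF-mono {suc m} h = ℕ.+-mono-≤ (h zero) (sumF-mono (h ∘ suc))

    sumF-mono-≡ : {f g : Fin m → ℕ} → (∀ i → f i ≤ g i) → sumF f ≡ sumF g → f ≗ g
    sumF-mono-≡ {suc m} {f} {g} h eq = λ where
        zero    → e0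
        (suc i) → sumF-mono-≡ (h ∘ suc) (ℕ.+-cancelˡ-≡ (f zero) _ _ (eq ∙ cong (_+ sumF (g ∘ suc)) (sym e0))) i
      where
      e0 : f zero ≡ g zero
      e0 = ℕ.≤-antisym (h zero) (ℕ.+-cancelʳ-≤ (sumF (f ∘ suc)) (g zero) (f zero)
        (ℕ.≤-trans (ℕ.+-monoʳ-≤ (g zero) (sumF-mono (h ∘ suc))) (ℕ.≤-reflexive (sym eq))))

    ≤-sumF : (f : Fin m → ℕ) (i : Fin m) → f i ≤ sumF f
    ≤-sumF f zero    = ℕ.m≤m+n (f zero) _
    ≤-sumF f (suc i) = ℕ.≤-trans (≤-sumF (f ∘ suc) i) (ℕ.m≤n+m _ (f zero))

    sumF-*ʳ : (f : Fin m → ℕ) (k : ℕ) → sumF (λ i → f i * k) ≡ sumF f * k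
    sumF-*ʳ {zero}  f k = refl
    sumF-*ʳ {suc m} f k = cong (f zero * k +_) (sumF-*ʳ (f ∘ suc) k) ∙ sym (ℕ.*-distribʳ-+ k (f zero) _)

    sumF-perm : {σ : Vec (Fin m) m} → IsPerm σ → (f : Fin m → ℕ) → sumF (λ i → f (lookup σ i)) ≡ sumF f
    sumF-perm {m} {σ} p f = cong sum (lem σ) ∙ sum-↭ (↭.map⁺ f σ↭) ∙ cong sum (sym (lem (allFin m)) ∙
        cong toList (Vec.tabulate-cong (λ i → cong f (Vec.lookup-allFin i))))
      where
      open import Data.Nat.ListAction.Properties using (sum-↭)
      lem : (v : Vec (Fin m) m) → toList (tabulate (λ i → f (lookup v i))) ≡ map f (toList v)
      lem v = cong toList (vec-ext (λ i → Vec.lookup∘tabulate _ i ∙ sym (Vec.lookup-map i f v))) ∙ Vec.toList-map f v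
      σ↭ : toList σ ↭ toList (allFin m)
      σ↭ = unique-↭ (lookup-unique σ (injective p)) (lookup-unique (allFin m) (injective perm-id))
        (λ {x} _ → subst (_∈ toList (allFin m)) (Vec.lookup-allFin x) (lookup∈toList (allFin m) x))
        (λ {x} _ → let i , eq = finite-surjective (lookup σ) (injective p) x in subst (_∈ toList σ) eq (lookup∈toList σ i))

    mask : Fin m → (Fin m → ℕ) → Fin m → ℕ
    mask x f i with i Fin.≟ x
    ... | yes _ = 0
    ... | no  _ = f i

    mask-≢ : {x i : Fin m} (f : Fin m → ℕ) → i ≢ x → mask x f i ≡ f i
    mask-≢ {x = x} {i} f p with i Fin.≟ x
    ... | yes e = contradiction e p
    ... | no  _ = refl

    mask-cong : {x : Fin m} {f g : Fin m → ℕ} → (∀ i → i ≢ x → f i ≡ g i) → mask x f ≗ mask x g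
    mask-cong {x = x} h i with i Fin.≟ x
    ... | yes _ = refl
    ... | no  p = h i p

    sumF-mask : (x : Fin m) (f : Fin m → ℕ) → sumF f ≡ f x + sumF (mask x f)
    sumF-mask zero    f = cong (f zero +_) (sumF-cong {f = f ∘ suc} {λ i → mask zero f (suc i)} λ i → sym (mask-≢ {x = zero} f λ ()))
    sumF-mask (suc x) f = cong (f zero +_) (sumF-mask x (f ∘ suc)) ∙ sym (ℕ.+-assoc (f zero) _ _) ∙
      cong (_+ sumF (mask x (f ∘ suc))) (ℕ.+-comm (f zero) _) ∙ ℕ.+-assoc (f (suc x)) _ _ ∙
      cong (f (suc x) +_) (cong₂ _+_ (sym (mask-≢ {x = suc x} f λ ())) (sumF-cong lem))
      where
      lem : ∀ i → mask x (f ∘ suc) i ≡ mask (suc x) f (suc i)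
      lem i with i Fin.≟ x
      ... | yes refl = refl
      ... | no  p    = refl

    sumF-two-points : {x y : Fin m} → x ≢ y → (f g : Fin m → ℕ) → (∀ i → i ≢ x → i ≢ y → f i ≡ g i) →
                      f x + f y < g x + g y → sumF f < sumF g
    sumF-two-points {x = x} {y} x≢y f g h lt = subst₂ _<_ (sym (dec f)) (sym (dec g))
      (subst (λ s → f x + f y + s < g x + g y + sumF (mask y (mask x g))) (sym eq) (ℕ.+-monoˡ-< _ lt))
      where
      dec : ∀ f → sumF f ≡ f x + f y + sumF (mask y (mask x f))
      dec f = sumF-mask x f ∙ cong (f x +_) (sumF-mask y (mask x f) ∙ cong (_+ sumF (mask y (mask x f))) (mask-≢ f (λ e → x≢y (sym e)))) ∙
        sym (ℕ.+-assoc (f x) (f y) _)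
      eq : sumF (mask y (mask x f)) ≡ sumF (mask y (mask x g))
      eq = sumF-cong (mask-cong λ i i≢y → lem i i≢y)
        where
        lem : ∀ i → i ≢ y → mask x f i ≡ mask x g i
        lem i i≢y with i Fin.≟ x
        ... | yes _   = refl
        ... | no  i≢x = h i i≢x i≢y

  -- The boxes of a Young diagram, labelled by Fin m: r and c list the row and
  -- the column of each box.

  record Diagram (r c : Vec ℕ m) : Set where
    field
      cell-inj : ∀ x y → lookup r x ≡ lookup r y → lookup c x ≡ lookup c y → x ≡ y
      up       : ∀ x {i} → lookup r x ≡ suc i → ∃ λ y → lookup r y ≡ i × lookup c y ≡ lookup c x
      left     : ∀ x {j} → lookup c x ≡ suc j → ∃ λ y → lookup c y ≡ j × lookup r y ≡ lookup r x

  open Diagram public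

  transpose : {r c : Vec ℕ m} → Diagram r c → Diagram c r
  transpose D = record { cell-inj = λ x y p q → cell-inj D x y q p ; up = left D ; left = up D }

  RowWeak ColStrict : (r c α : Vec ℕ m) → Set
  RowWeak   r c α = ∀ x y → lookup r x ≡ lookup r y → lookup c x < lookup c y → lookup α x ≤ lookup α y
  ColStrict r c α = ∀ x y → lookup c x ≡ lookup c y → lookup r x < lookup r y → lookup α x < lookup α y

  SSYT : (r c α : Vec ℕ m) → Set
  SSYT r c α = RowWeak r c α × ColStrict r c α

  ColStrict⇒Weak : {r c α : Vec ℕ m} → ColStrict r c α → RowWeak c r α
  ColStrict⇒Weak h x y p q = ℕ.<⇒≤ (h x y p q)

  -- Entry times column, summed over the boxes. It is constant under column permutations and raised
  -- by sorting rows, and it orders the fillings in all triangularity arguments.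
  Φ : (c α : Vec ℕ m) → ℕ
  Φ c α = sumF λ i → lookup α i * lookup c i

  Φ-invariant : (c α : Vec ℕ m) {σ : Vec (Fin m) m} → IsPerm σ → c ⊙ σ ≡ c → Φ c (α ⊙ σ) ≡ Φ c α
  Φ-invariant c α {σ} p e = sumF-cong (λ i → cong₂ _*_ (lookup-⊙ α σ i) (cong (λ v → lookup v i) (sym e) ∙ lookup-⊙ c σ i)) ∙
    sumF-perm p (λ i → lookup α i * lookup c i)

  sumF-⊙ : (α : Vec ℕ m) {σ : Vec (Fin m) m} → IsPerm σ → sumF (lookup (α ⊙ σ)) ≡ sumF (lookup α)
  sumF-⊙ α {σ} p = sumF-cong (lookup-⊙ α σ) ∙ sumF-perm p (lookup α)

  Φ-bound : (c α : Vec ℕ m) → Φ c α ≤ sumF (lookup α) * sumF (lookup c)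
  Φ-bound c α = ℕ.≤-trans (sumF-mono (λ i → ℕ.*-monoʳ-≤ (lookup α i) (≤-sumF (lookup c) i)))
    (ℕ.≤-reflexive (sumF-*ʳ (lookup α) (sumF (lookup c))))

  exchange : ∀ {a b p q} → a < b → p < q → b * p + a * q < a * p + b * q
  exchange {a} {b} {p} {q} a<b p<q with ℕ.m≤n⇒∃[o]m+o≡n a<b | ℕ.m≤n⇒∃[o]m+o≡n p<q
  -- The two sides differ by `(1 + k) * (1 + l)`. The 1 in its expansion gives strictness, and
  -- `k + l + k * l` is the slack.
  ... | k , refl | l , refl = ℕ.m+n≤o⇒m≤o (suc _) {k + l + k * l} (ℕ.≤-reflexive (solve 4
        (λ a k p l → con 1 :+ ((con 1 :+ a :+ k) :* p :+ a :* (con 1 :+ p :+ l)) :+ (k :+ l :+ k :* l)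
           := a :* p :+ (con 1 :+ a :+ k) :* (con 1 :+ p :+ l)) refl a k p l))
    where
    open ℕSolver.+-*-Solver

  Φ-exchange : (c α : Vec ℕ m) {x y : Fin m} → lookup α y < lookup α x → lookup c x < lookup c y →
               Φ c α < Φ c (α ⊙ trV x y)
  Φ-exchange c α {x} {y} a<b p<q = sumF-two-points (λ { refl → ℕ.<-irrefl refl p<q }) (λ i → lookup α i * lookup c i) (λ i → lookup (α ⊙ trV x y) i * lookup c i)
    (λ i i≢x i≢y → cong (_* lookup c i) (sym (at i ∙ cong (lookup α) (tr-≢ x y i≢x i≢y))))
    (subst (lookup α x * lookup c x + lookup α y * lookup c y <_) (cong₂ _+_ (cong (_* lookup c x) (sym (at x ∙ cong (lookup α) (tr-x x y))))
                             (cong (_* lookup c y) (sym (at y ∙ cong (lookup α) (tr-y x y))))) (exchange a<b p<q))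
    where
    at : ∀ i → lookup (α ⊙ trV x y) i ≡ lookup α (tr x y i)
    at i = lookup-⊙ α (trV x y) i ∙ cong (lookup α) (lookup-trV x y i)

  module _ {r c : Vec ℕ m} (D : Diagram r c) where

    leftwards : ∀ x {j} → j ≤ lookup c x → ∃ λ y → lookup c y ≡ j × lookup r y ≡ lookup r x
    leftwards x {j} j≤ = go (lookup c x ∸ j) x (sym (ℕ.m+[n∸m]≡n j≤))
      where
      go : ∀ k x → lookup c x ≡ j + k → ∃ λ y → lookup c y ≡ j × lookup r y ≡ lookup r x
      go zero    x e = x , e ∙ ℕ.+-identityʳ j , refl
      go (suc k) x e with left D x (e ∙ ℕ.+-suc j k)
      ... | y , e₁ , e₂ with go k y e₁
      ... | z , e₃ , e₄ = z , e₃ , e₄ ∙ e₂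

    adjacent⇒RowWeak : (α : Vec ℕ m) → (∀ x y → lookup r x ≡ lookup r y → lookup c y ≡ suc (lookup c x) → lookup α x ≤ lookup α y) →
                       RowWeak r c α
    adjacent⇒RowWeak α h x y rx≡ry c< = go (lookup c y ∸ suc (lookup c x)) y rx≡ry (sym (ℕ.m+[n∸m]≡n c<))
      where
      go : ∀ k y → lookup r x ≡ lookup r y → lookup c y ≡ suc (lookup c x) + k → lookup α x ≤ lookup α y
      go zero    y e e′ = h x y e (e′ ∙ ℕ.+-identityʳ _)
      go (suc k) y e e′ with left D y (e′ ∙ ℕ.+-suc _ k)
      ... | z , e₁ , e₂ = ℕ.≤-trans (go k z (e ∙ sym e₂) e₁) (h z y e₂ (e′ ∙ ℕ.+-suc _ k ∙ cong suc (sym e₁)))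

    -- Bubble sort of the rows. Each exchange of neighbours raises `Φ`, which is bounded in terms of
    -- the content; this yields both termination and the last component.
    row-sort : (α : Vec ℕ m) → ∃ λ σ → IsPerm σ × r ⊙ σ ≡ r × RowWeak r c (α ⊙ σ) × (α ⊙ σ ≡ α ⊎ Φ c α < Φ c (α ⊙ σ))
    row-sort α = go α (<-wellFounded _)
      where
      go : ∀ α → Acc _<_ (sumF (lookup α) * sumF (lookup c) ∸ Φ c α) →
           ∃ λ σ → IsPerm σ × r ⊙ σ ≡ r × RowWeak r c (α ⊙ σ) × (α ⊙ σ ≡ α ⊎ Φ c α < Φ c (α ⊙ σ))
      go α (acc rs) with Fin.any? (λ x → Fin.any? (λ y → (lookup r x ℕ.≟ lookup r y) ×-dec (lookup c y ℕ.≟ suc (lookup c x)) ×-dec (lookup α y <? lookup α x)))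
      ... | no ¬v = allFin m , perm-id , ⊙-identityʳ r , subst (RowWeak r c) (sym (⊙-identityʳ α))
              (adjacent⇒RowWeak α λ x y e₁ e₂ → ℕ.≮⇒≥ λ lt → ¬v (x , y , e₁ , e₂ , lt)) , inj₁ (⊙-identityʳ α)
      ... | yes (x , y , e₁ , e₂ , lt) with go (α ⊙ trV x y) (rs (subst (λ s → s * sumF (lookup c) ∸ Φ c (α ⊙ trV x y) < sumF (lookup α) * sumF (lookup c) ∸ Φ c α)
                (sym (sumF-⊙ α (perm-tr x y))) (ℕ.∸-monoʳ-< up′ (subst (λ s → Φ c (α ⊙ trV x y) ≤ s * sumF (lookup c)) (sumF-⊙ α (perm-tr x y)) (Φ-bound c (α ⊙ trV x y))))))
        where
        up′ : Φ c α < Φ c (α ⊙ trV x y)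
        up′ = Φ-exchange c α lt (ℕ.≤-reflexive (sym e₂))
      ... | σ , p , e , w , d = trV x y ⊙ σ , perm-⊙ (perm-tr x y) p , sym (⊙-assoc r (trV x y) σ) ∙ cong (_⊙ σ) (tr-fix r e₁) ∙ e ,
              subst (RowWeak r c) (⊙-assoc α (trV x y) σ) w , inj₂ (subst (λ v → Φ c α < Φ c v) (⊙-assoc α (trV x y) σ) (lem d))
        where
        lem : ((α ⊙ trV x y) ⊙ σ ≡ α ⊙ trV x y ⊎ Φ c (α ⊙ trV x y) < Φ c ((α ⊙ trV x y) ⊙ σ)) → Φ c α < Φ c ((α ⊙ trV x y) ⊙ σ)
        lem (inj₁ e) = subst (λ v → Φ c α < Φ c v) (sym e) (Φ-exchange c α lt (ℕ.≤-reflexive (sym e₂)))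
        lem (inj₂ l) = ℕ.<-trans (Φ-exchange c α lt (ℕ.≤-reflexive (sym e₂))) l

    -- The boxes of a row with entries at most α x are an initial segment, whose
    -- length is determined by the multiset of entries of the row.
    private
      sorted-≤ : (α : Vec ℕ m) {τ : Vec (Fin m) m} → IsPerm τ → r ⊙ τ ≡ r → RowWeak r c α → RowWeak r c (α ⊙ τ) →
                 ∀ x → lookup (α ⊙ τ) x ≤ lookup α x
      sorted-≤ α {τ} p e w w′ x = ℕ.≮⇒≥ λ lt → contradiction (Fin.injective⇒≤ (λ {i} {j} → f-inj lt {i} {j})) (ℕ.<⇒≱ (ℕ.n<1+n (lookup c x)))
        where
        box : Fin (suc (lookup c x)) → Fin m
        box j = proj₁ (leftwards x (ℕ.≤-pred (Fin.toℕ<n j)))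
        box-c : ∀ j → lookup c (box j) ≡ toℕ j
        box-c j = proj₁ (proj₂ (leftwards x (ℕ.≤-pred (Fin.toℕ<n j))))
        box-r : ∀ j → lookup r (box j) ≡ lookup r x
        box-r j = proj₂ (proj₂ (leftwards x (ℕ.≤-pred (Fin.toℕ<n j))))
        box-α : ∀ j → lookup α (box j) ≤ lookup α x
        box-α j with lookup c (box j) <? lookup c x
        ... | yes lt = w _ _ (box-r j) lt
        ... | no ¬lt = ℕ.≤-reflexive (cong (lookup α) (cell-inj D _ _ (box-r j)
                (ℕ.≤-antisym (subst (_≤ lookup c x) (sym (box-c j)) (ℕ.≤-pred (Fin.toℕ<n j))) (ℕ.≮⇒≥ ¬lt))))
        pre : Fin (suc (lookup c x)) → Fin m
        pre j = lookup (inv τ) (box j)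
        pre-r : ∀ j → lookup r x ≡ lookup r (pre j)
        pre-r j = sym (sym (fix-lookup r e (pre j)) ∙ cong (lookup r) (lookup-inv τ p (box j)) ∙ box-r j)
        pre-α : ∀ j → lookup (α ⊙ τ) (pre j) ≤ lookup α x
        pre-α j = subst (_≤ lookup α x) (sym (lookup-⊙ α τ (pre j) ∙ cong (lookup α) (lookup-inv τ p (box j)))) (box-α j)
        pre-c : lookup α x < lookup (α ⊙ τ) x → ∀ j → lookup c (pre j) < lookup c x
        pre-c lt j with lookup c (pre j) <? lookup c x
        ... | yes q = q
        ... | no ¬q with ℕ.m≤n⇒m<n∨m≡n (ℕ.≮⇒≥ ¬q)
        ... | inj₁ q  = contradiction (ℕ.≤-trans (w′ x (pre j) (pre-r j) q) (pre-α j)) (ℕ.<⇒≱ lt)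
        ... | inj₂ q  = contradiction (subst (λ y → lookup (α ⊙ τ) y ≤ lookup α x) (sym (cell-inj D _ _ (pre-r j) q)) (pre-α j)) (ℕ.<⇒≱ lt)
        f : lookup α x < lookup (α ⊙ τ) x → Fin (suc (lookup c x)) → Fin (lookup c x)
        f lt j = fromℕ< (pre-c lt j)
        f-inj : ∀ lt {i j} → f lt i ≡ f lt j → i ≡ j
        f-inj lt {i} {j} eq = Fin.toℕ-injective (sym (box-c i) ∙ cong (lookup c) (injective (perm-inv p) (box i) (box j)
          (cell-inj D _ _ (sym (pre-r i) ∙ pre-r j) (sym (Fin.toℕ-fromℕ< (pre-c lt i)) ∙ cong toℕ eq ∙ Fin.toℕ-fromℕ< (pre-c lt j)))) ∙ box-c j)

    sorted-unique : (α : Vec ℕ m) {τ : Vec (Fin m) m} → IsPerm τ → r ⊙ τ ≡ r → RowWeak r c α → RowWeak r c (α ⊙ τ) → α ⊙ τ ≡ α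
    sorted-unique α {τ} p e w w′ = vec-ext λ x → ℕ.≤-antisym (sorted-≤ α p e w w′ x)
      (subst (λ v → lookup v x ≤ lookup (α ⊙ τ) x) (⊙-inv α τ p)
        (sorted-≤ (α ⊙ τ) (perm-inv p) (stab-fix-inv r p e) w′ (subst (RowWeak r c) (sym (⊙-inv α τ p)) w) x))

    -- Sorting the rows of `α ⊙ τ` leads back to `α`, because sorted arrangements are unique, and
    -- sorting raises `Φ` unless it changes nothing.
    rearrangement : (α : Vec ℕ m) {τ : Vec (Fin m) m} → IsPerm τ → r ⊙ τ ≡ r → RowWeak r c α → α ⊙ τ ≡ α ⊎ Φ c (α ⊙ τ) < Φ c α
    rearrangement α {τ} p e w =
      let σ , q , e′ , w′ , d = row-sort (α ⊙ τ)
          eq = ⊙-assoc α τ σ ∙ sorted-unique α (perm-⊙ p q) (sym (⊙-assoc r τ σ) ∙ cong (_⊙ σ) e ∙ e′) w (subst (RowWeak r c) (⊙-assoc α τ σ) w′)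
      in Sum.map (λ d′ → sym d′ ∙ eq) (subst (λ v → Φ c (α ⊙ τ) < Φ c v) eq) d

  -- The coefficients of `ε_T` applied to the monomial with exponents `α`: a Specht polynomial
  -- before division by the order of the stabilizer.
  E : (r c α : Vec ℕ m) → Fun m
  E r c α = κ c (ρ r (δ α))

  module _ {r c : Vec ℕ m} (D : Diagram r c) where

    private
      Dᵀ = transpose D

    col-sort : (α : Vec ℕ m) → (∀ x y → x ≢ y → lookup c x ≡ lookup c y → lookup α x ≢ lookup α y) →
               ∃ λ σ → IsPerm σ × c ⊙ σ ≡ c × ColStrict r c (α ⊙ σ)
    col-sort α inj with row-sort Dᵀ α
    ... | σ , p , e , w , _ = σ , p , e , λ x y cx≡cy lt → ℕ.≤∧≢⇒< (w x y cx≡cy lt) λ eq →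
            inj (lookup σ x) (lookup σ y) (λ q → ℕ.<-irrefl (cong (lookup r) (injective p x y q)) lt)
              (fix-lookup c e x ∙ cx≡cy ∙ sym (fix-lookup c e y))
              (sym (lookup-⊙ α σ x) ∙ eq ∙ lookup-⊙ α σ y)

    row-≤ : (α : Vec ℕ m) → ColStrict r c α → ∀ x → lookup r x ≤ lookup α x
    row-≤ α s x = go (lookup r x) x refl
      where
      go : ∀ k x → lookup r x ≡ k → lookup r x ≤ lookup α x
      go zero    x e = subst (_≤ lookup α x) (sym e) z≤n
      go (suc k) x e with up D x e
      ... | y , e₁ , e₂ = subst (_≤ lookup α x) (cong suc e₁ ∙ sym e)
              (ℕ.≤-trans (s≤s (go k y e₁)) (s y x e₂ (subst₂ _<_ (sym e₁) (sym e) (ℕ.n<1+n k))))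

    -- Once the columns of `r′` are sorted, strictness forces the label of each box to be at least
    -- its row. So `r` has the least sum among these labellings, and only its column rearrangements
    -- attain it. Comparing such sums replaces the dominance order.
    no-collision : (r′ : Vec ℕ m) → (∀ x y → x ≢ y → lookup c x ≡ lookup c y → lookup r′ x ≢ lookup r′ y) →
                   sumF (lookup r) ≤ sumF (lookup r′) ×
                   (sumF (lookup r) ≡ sumF (lookup r′) → ∃ λ σ → IsPerm σ × c ⊙ σ ≡ c × r′ ⊙ σ ≡ r)
    no-collision r′ inj with col-sort r′ inj
    ... | σ , p , e , s =
        subst (sumF (lookup r) ≤_) (sumF-⊙ r′ p) (sumF-mono (row-≤ (r′ ⊙ σ) s))
      , λ eq → σ , p , e , vec-ext λ i → sym (sumF-mono-≡ (row-≤ (r′ ⊙ σ) s) (eq ∙ sym (sumF-⊙ r′ p)) i)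

    private
      -- Undoing `τ` shows that a column rearrangement of `β` is a row rearrangement of `α`. The
      -- first has the same `Φ` as `β`, the second a smaller one than `α` unless it is `α` itself;
      -- then `α` and `β` are column-equivalent with sorted columns, hence equal.
      key : (α β : Vec ℕ m) → SSYT r c α → SSYT r c β → ∀ {σ τ} → IsPerm σ → IsPerm τ → c ⊙ σ ≡ c → r ⊙ τ ≡ r → (β ⊙ σ) ⊙ τ ≡ α →
            (β ≡ α × β ⊙ σ ≡ β) ⊎ Φ c β < Φ c α
      key α β (w , s) (w′ , s′) {σ} {τ} p q e e′ eq = Sum.map fixed moved (rearrangement D α (perm-inv q) (stab-fix-inv r q e′) w)
        where
        back : α ⊙ inv τ ≡ β ⊙ σ
        back = cong (_⊙ inv τ) (sym eq) ∙ ⊙-inv (β ⊙ σ) τ q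
        fixed : α ⊙ inv τ ≡ α → β ≡ α × β ⊙ σ ≡ β
        fixed h = sym β≡ ∙ β⊙σ , β≡
          where
          β⊙σ : β ⊙ σ ≡ α
          β⊙σ = sym back ∙ h
          β≡ : β ⊙ σ ≡ β
          β≡ = sorted-unique Dᵀ β p e (ColStrict⇒Weak {r = r} {c} {β} s′) (subst (RowWeak c r) (sym β⊙σ) (ColStrict⇒Weak {r = r} {c} {α} s))
        moved : Φ c (α ⊙ inv τ) < Φ c α → Φ c β < Φ c α
        moved = subst (_< Φ c α) (cong (Φ c) back ∙ Φ-invariant c β p e)

    private
      terms : (α β : Vec ℕ m) {σ : Vec (Fin m) m} → (∀ τ → IsPerm τ → r ⊙ τ ≡ r → (β ⊙ σ) ⊙ τ ≢ α) → ρ r (δ α) (β ⊙ σ) ≡ 0ℚ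
      terms α β {σ} h = ∑-0 (els m) λ {τ} q → lem τ (∈-els⁻ q)
        where
        lem : ∀ τ → IsPerm τ → (stab r τ *ℚ 1ℚ) *ℚ δ α ((β ⊙ σ) ⊙ τ) ≡ 0ℚ
        lem τ p with r ⊙ τ ≟V r
        ... | yes e = cong (1ℚ *ℚ 1ℚ *ℚ_) (iv-no ((β ⊙ σ) ⊙ τ ≟V α) (h τ p e))
        ... | no  _ = ℚ.*-zeroˡ (δ α ((β ⊙ σ) ⊙ τ))

    -- A nonzero term of the double sum needs a column and a row permutation that together carry `β`
    -- to `α`; `key` excludes this.
    E-triangular : (α β : Vec ℕ m) → SSYT r c α → SSYT r c β → β ≢ α → ¬ Φ c β < Φ c α → E r c α β ≡ 0ℚ
    E-triangular α β s s′ ne nlt = ∑-0 (els m) λ {σ} q → lem σ (∈-els⁻ q)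
      where
      lem : ∀ σ → IsPerm σ → (stab c σ *ℚ sgnV σ) *ℚ ρ r (δ α) (β ⊙ σ) ≡ 0ℚ
      lem σ p with c ⊙ σ ≟V c
      ... | yes e = cong (1ℚ *ℚ sgnV σ *ℚ_) (terms α β λ τ q e′ eq → [ ne ∘ proj₁ , nlt ]′ (key α β s s′ p q e e′ eq)) ∙ ℚ.*-zeroʳ (1ℚ *ℚ sgnV σ)
      ... | no  _ = cong (_*ℚ ρ r (δ α) (β ⊙ σ)) (ℚ.*-zeroˡ (sgnV σ)) ∙ ℚ.*-zeroˡ (ρ r (δ α) (β ⊙ σ))

    -- By `key`, a contributing column permutation fixes `α`, whose columns are strict, so it is the
    -- identity. No sign is left, and the remaining terms are nonnegative.
    E-diagonal : (α : Vec ℕ m) → SSYT r c α → E r c α α ≡ ρ r (δ α) α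
    E-diagonal α s = ∑-single (els m) (els-unique m) (∈-els⁺ perm-id) (λ {σ} q ne → lem σ (∈-els⁻ q) ne) ∙
        cong₂ _*ℚ_ (cong₂ _*ℚ_ (iv-yes (c ⊙ allFin m ≟V c) (⊙-identityʳ c)) (sgnV-id {m})) (cong (ρ r (δ α)) (⊙-identityʳ α)) ∙ ℚ.*-identityˡ _
      where
      lem : ∀ σ → IsPerm σ → σ ≢ allFin m → (stab c σ *ℚ sgnV σ) *ℚ ρ r (δ α) (α ⊙ σ) ≡ 0ℚ
      lem σ p ne with c ⊙ σ ≟V c
      ... | no  _ = cong (_*ℚ ρ r (δ α) (α ⊙ σ)) (ℚ.*-zeroˡ (sgnV σ)) ∙ ℚ.*-zeroˡ (ρ r (δ α) (α ⊙ σ))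
      ... | yes e = cong (1ℚ *ℚ sgnV σ *ℚ_) (terms α α λ τ q e′ eq → [ (λ z → ne (σ≡id e (proj₂ z))) , ℕ.<-irrefl refl ]′ (key α α s s p q e e′ eq)) ∙ ℚ.*-zeroʳ (1ℚ *ℚ sgnV σ)
        where
        σ≡id : c ⊙ σ ≡ c → α ⊙ σ ≡ α → σ ≡ allFin m
        σ≡id e f = vec-ext λ i → cell-inj D _ _ (row i (fix-lookup c e i) (fix-lookup α f i)) (fix-lookup c e i) ∙ sym (Vec.lookup-allFin i)
          where
          row : ∀ i → lookup c (lookup σ i) ≡ lookup c i → lookup α (lookup σ i) ≡ lookup α i → lookup r (lookup σ i) ≡ lookup r i
          row i ce αe with ℕ.<-cmp (lookup r (lookup σ i)) (lookup r i)
          ... | tri< a _ _ = contradiction αe (ℕ.<⇒≢ (proj₂ s _ _ ce a))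
          ... | tri≈ _ b _ = b
          ... | tri> _ _ a = contradiction (sym αe) (ℕ.<⇒≢ (proj₂ s _ _ (sym ce) a))

    E-diagonal-≢0 : (α : Vec ℕ m) → SSYT r c α → E r c α α ≢ 0ℚ
    E-diagonal-≢0 α s eq = contradiction
        (sym (cong₂ _*ℚ_ (cong (_*ℚ 1ℚ) (iv-yes (r ⊙ allFin m ≟V r) (⊙-identityʳ r))) (iv-yes (α ⊙ allFin m ≟V α) (⊙-identityʳ α))) ∙
         ∑-≡0⇒≡0 (els m) (λ {τ} _ → nn τ) (sym (E-diagonal α s) ∙ eq) (∈-els⁺ perm-id)) λ ()
      where
      iv-≥0 : ∀ {P : Set} (d : Dec P) → 0ℚ ≤ℚ iv d
      iv-≥0 (yes _) = ℚ.nonNegative⁻¹ 1ℚ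
      iv-≥0 (no  _) = ℚ.≤-refl
      nn : ∀ τ → 0ℚ ≤ℚ (stab r τ *ℚ 1ℚ) *ℚ δ α (α ⊙ τ)
      nn τ = subst (λ z → 0ℚ ≤ℚ z *ℚ δ α (α ⊙ τ)) (sym (ℚ.*-identityʳ (stab r τ)))
        (ℚ.nonNegative⁻¹ _ {{ℚ.nonNeg*nonNeg⇒nonNeg (stab r τ) {{ℚ.nonNegative (iv-≥0 (r ⊙ τ ≟V r))}} (δ α (α ⊙ τ)) {{ℚ.nonNegative (iv-≥0 (α ⊙ τ ≟V α))}}}})

open Sorting

-- Orthogonality of different shapes and independence within a shape

module SymmetrizerImages where

  private variable
    m : ℕ

  ∑-− : ∀ {X : Set} (L : List X) (f g : X → ℚ) (q : ℚ) → (∑[ x ← L ] f x) ≡ (∑[ x ← L ] f x +ℚ -ℚ (q *ℚ g x)) +ℚ q *ℚ ∑ L g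
  ∑-− L f g q = sym (cong (_+ℚ q *ℚ ∑ L g) (∑-+ L f (λ x → -ℚ (q *ℚ g x)) ∙ cong (∑ L f +ℚ_)
      (∑-cong L (λ x → ℚ.neg-distribˡ-* q (g x)) ∙ ∑-*ˡ L (-ℚ q) g)) ∙
    solve 3 (λ a b c → (a :+ (:- b) :* c) :+ b :* c := a) refl (∑ L f) q (∑ L g))
    where open +-*-Solver

  -- By triangularity every function of `α x` on `L` is a combination of the functions
  -- `E r c (α x) β`, so the functional `S`, which kills these, kills it too. Arguing with `f`
  -- instead of the weights avoids collecting the terms with equal `α x`.
  module Independence {r c : Vec ℕ m} (D : Diagram r c) {X : Set} (L : List X) (α : X → Vec ℕ m) (w : X → ℚ)
                      (good : ∀ {x} → x ∈ L → SSYT r c (α x))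
                      (rel : ∀ β → SSYT r c β → (∃ λ x → x ∈ L × α x ≡ β) → (∑[ x ← L ] w x *ℚ E r c (α x) β) ≡ 0ℚ) where

    private
      Respects : (X → ℚ) → Set
      Respects f = ∀ {x y} → x ∈ L → y ∈ L → α x ≡ α y → f x ≡ f y

      Below : ℕ → (X → ℚ) → Set
      Below b f = ∀ {x} → x ∈ L → Φ c (α x) < b → f x ≡ 0ℚ

      S : (X → ℚ) → ℚ
      S f = ∑[ x ← L ] w x *ℚ f x

      B : ℕ
      B = suc (foldr (λ x b → Φ c (α x) + b) 0 L)

      Φ<B : ∀ {x} → x ∈ L → Φ c (α x) < B
      Φ<B p = s≤s (go L p)
        where
        go : ∀ L {x} → x ∈ L → Φ c (α x) ≤ foldr (λ x b → Φ c (α x) + b) 0 L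
        go (x ∷ L) (here refl) = ℕ.m≤m+n _ _
        go (x ∷ L) (there p)   = ℕ.≤-trans (go L p) (ℕ.m≤n+m _ (Φ c (α x)))

      -- Clears the values of `f` at level `b` of `Φ`, one filling of `Y` at a time. The subtracted
      -- multiple of `E` affects other fillings only at higher levels.
      level : ∀ b → (∀ f → Respects f → Below (suc b) f → S f ≡ 0ℚ) →
              ∀ Y → (∀ {y} → y ∈ Y → y ∈ L) → ∀ f → Respects f → Below b f →
              (∀ {x} → x ∈ L → Φ c (α x) ≡ b → f x ≡ 0ℚ ⊎ ∃ λ y → y ∈ Y × α x ≡ α y) → S f ≡ 0ℚ
      level b next [] sub f res low mid = next f res λ {x} p lt → lem p (ℕ.m≤n⇒m<n∨m≡n (ℕ.≤-pred lt))
        where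
        lem : ∀ {x} → x ∈ L → (Φ c (α x) < b ⊎ Φ c (α x) ≡ b) → f x ≡ 0ℚ
        lem p (inj₁ lt) = low p lt
        lem p (inj₂ eq) with mid p eq
        ... | inj₁ z = z
      level b next (y ∷ Y) sub f res low mid with Φ c (α y) ℕ.≟ b
      ... | no ne  = level b next Y (sub ∘ there) f res low mid′
        where
        mid′ : ∀ {x} → x ∈ L → Φ c (α x) ≡ b → f x ≡ 0ℚ ⊎ ∃ λ y → y ∈ Y × α x ≡ α y
        mid′ p eq with mid p eq
        ... | inj₁ z                    = inj₁ z
        ... | inj₂ (_ , here refl , e)  = contradiction (cong (Φ c) (sym e) ∙ eq) ne
        ... | inj₂ (y′ , there i , e)   = inj₂ (y′ , i , e)
      ... | yes Φy = ∑-cong L (λ x → refl) ∙ Sf ∙ cong₂ _+ℚ_ (level b next Y (sub ∘ there) f₁ res₁ low₁ mid₁)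
                       (cong (q *ℚ_) (rel (α y) ss (y , y∈ , refl)) ∙ ℚ.*-zeroʳ q)
        where
        open +-*-Solver
        y∈ = sub (here refl)
        ss = good y∈
        s = E r c (α y) (α y)
        instance
          s-nonZero : NonZero s
          s-nonZero = ≢-nonZero (E-diagonal-≢0 D (α y) ss)
        q = f y *ℚ 1/ s
        f₁ : X → ℚ
        f₁ x = f x +ℚ -ℚ (q *ℚ E r c (α x) (α y))
        Sf : S f ≡ S f₁ +ℚ q *ℚ (∑[ x ← L ] w x *ℚ E r c (α x) (α y))
        Sf = ∑-− L (λ x → w x *ℚ f x) (λ x → w x *ℚ E r c (α x) (α y)) q ∙
          cong (_+ℚ q *ℚ (∑[ x ← L ] w x *ℚ E r c (α x) (α y))) (∑-cong L λ x →
            solve 4 (λ a b c d → a :* b :+ (:- (c :* (a :* d))) := a :* (b :+ (:- (c :* d)))) refl (w x) (f x) q (E r c (α x) (α y)))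
        res₁ : Respects f₁
        res₁ p p′ e = cong₂ (λ a v → a +ℚ -ℚ (q *ℚ E r c v (α y))) (res p p′ e) e
        drop-E : ∀ {x} → x ∈ L → α y ≢ α x → ¬ Φ c (α y) < Φ c (α x) → f₁ x ≡ f x
        drop-E {x} p ne nlt = cong (λ z → f x +ℚ -ℚ (q *ℚ z)) (E-triangular D (α x) (α y) (good p) ss ne nlt) ∙
          solve 2 (λ a b → a :+ (:- (b :* con 0ℚ)) := a) refl (f x) q
        low₁ : Below b f₁
        low₁ {x} p lt = drop-E p (λ e → ℕ.<-irrefl (cong (Φ c) (sym e) ∙ Φy) lt)
          (λ lt′ → ℕ.<-asym lt (subst (_< Φ c (α x)) Φy lt′)) ∙ low p lt
        mid₁ : ∀ {x} → x ∈ L → Φ c (α x) ≡ b → f₁ x ≡ 0ℚ ⊎ ∃ λ y → y ∈ Y × α x ≡ α y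
        mid₁ {x} p eq with α x ≟V α y
        ... | yes e = inj₁ (cong₂ (λ a v → a +ℚ -ℚ (q *ℚ E r c v (α y))) (res p y∈ e) e ∙ cong (λ z → f y +ℚ -ℚ z)
                (ℚ.*-assoc (f y) (1/ s) s ∙ cong (f y *ℚ_) (ℚ.*-inverseˡ s) ∙ ℚ.*-identityʳ (f y)) ∙ ℚ.+-inverseʳ (f y))
        ... | no ne with mid p eq
        ... | inj₁ z                    = inj₁ (same ∙ z)
          where same = drop-E p (λ e → ne (sym e)) (λ lt → ℕ.<-irrefl (Φy ∙ sym eq) lt)
        ... | inj₂ (_ , here refl , e)  = contradiction e ne
        ... | inj₂ (y′ , there i , e)   = inj₂ (y′ , i , e)

      descend : ∀ k b → B ≤ b + k → ∀ f → Respects f → Below b f → S f ≡ 0ℚ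
      descend zero    b le f res low = ∑-0 L λ {x} p → cong (w x *ℚ_) (low p (ℕ.<-≤-trans (Φ<B p) (ℕ.≤-trans le (ℕ.≤-reflexive (ℕ.+-identityʳ b))))) ∙ ℚ.*-zeroʳ (w x)
      descend (suc k) b le f res low = level b (descend k (suc b) (ℕ.≤-trans le (ℕ.≤-reflexive (ℕ.+-suc b k)))) L id f res low (λ {x} p _ → inj₂ (x , p , refl))

    independent : ∀ f → Respects f → S f ≡ 0ℚ
    independent f res = descend B 0 ℕ.≤-refl f res (λ _ ())

  isPerm? : (σ : Vec (Fin m) m) → Dec (IsPerm σ)
  isPerm? σ = map′ mkPerm injective (Fin.all? λ i → Fin.all? λ j → (lookup σ i Fin.≟ lookup σ j) →-dec (i Fin.≟ j))

  module _ {r c : Vec ℕ m} (D : Diagram r c) where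

    private
      NoCollision : Vec ℕ m → Set
      NoCollision r′ = ∀ x y → x ≢ y → lookup c x ≡ lookup c y → lookup r′ x ≢ lookup r′ y

      collision? : ∀ r′ → (∃ λ x → ∃ λ y → x ≢ y × lookup c x ≡ lookup c y × lookup r′ x ≡ lookup r′ y) ⊎ NoCollision r′
      collision? r′ with Fin.any? (λ x → Fin.any? (λ y → ¬? (x Fin.≟ y) ×-dec (lookup c x ℕ.≟ lookup c y) ×-dec (lookup r′ x ℕ.≟ lookup r′ y)))
      ... | yes p = inj₁ p
      ... | no ¬p = inj₂ λ x y ne e e′ → ¬p (x , y , ne , e , e′)

    -- von Neumann's lemma
    κ-act-ρ : ∀ {π} → IsPerm π → ∀ r′ →
        (∀ u β → κ c (act π (ρ r′ u)) β ≡ 0ℚ)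
      ⊎ (sumF (lookup r) ≤ sumF (lookup r′) × (sumF (lookup r) ≡ sumF (lookup r′) → ∃ λ σ → IsPerm σ × c ⊙ σ ≡ c × (r′ ⊙ inv π) ⊙ σ ≡ r))
    κ-act-ρ {π} p r′ with collision? (r′ ⊙ inv π)
    ... | inj₁ (x , y , ne , e , e′) = inj₁ (collision c r′ p ne e e′)
    ... | inj₂ nc with no-collision D (r′ ⊙ inv π) nc
    ... | le , eq = inj₂ (subst (sumF (lookup r) ≤_) (sumF-⊙ r′ (perm-inv p)) le , λ e → eq (e ∙ sym (sumF-⊙ r′ (perm-inv p))))

    private
      -- After a collision the scalar is 0. Otherwise `π` is `σ ⊙ τ` with `σ` preserving columns and
      -- `τ` preserving rows, and the scalar is the sign of `σ`. It is chosen before the proof that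
      -- `π` is a permutation, so that it can stand in the sum `scalar`.
      κ-act-ρ-scalar : ∀ π → ∃ λ t → IsPerm π → ∀ u β → κ c (act π (ρ r u)) β ≡ t *ℚ κ c (ρ r u) β
      κ-act-ρ-scalar π with isPerm? π
      ... | no ¬p = 0ℚ , λ p → contradiction p ¬p
      ... | yes p with κ-act-ρ p r
      ... | inj₁ z = 0ℚ , λ _ u β → z u β ∙ sym (ℚ.*-zeroˡ (κ c (ρ r u) β))
      ... | inj₂ (_ , h) with h refl
      ... | σ , q , e , e′ = sgnV σ , λ _ u β →
            K-cong sgnV c (λ γ → cong (λ v → ρ r u (γ ⊙ v)) (sym π≡) ∙ sym (act-⊙ σ τ (ρ r u) γ) ∙ act-K 𝟙-char r τ-perm τ-fix u (γ ⊙ σ) ∙ ℚ.*-identityˡ (ρ r u (γ ⊙ σ))) β ∙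
            K-act sgn-char c q e (ρ r u) β
        where
        τ = inv σ ⊙ π
        τ-perm : IsPerm τ
        τ-perm = perm-⊙ (perm-inv q) p
        π≡ : σ ⊙ τ ≡ π
        π≡ = sym (⊙-assoc σ (inv σ) π) ∙ cong (_⊙ π) (inverseʳ σ q) ∙ ⊙-identityˡ π
        τ-fix : r ⊙ τ ≡ r
        τ-fix = sym (⊙-assoc r (inv σ) π) ∙ cong (λ v → (v ⊙ inv σ) ⊙ π) (sym e′) ∙ cong (_⊙ π) (⊙-inv (r ⊙ inv π) σ q) ∙ inv-⊙ r π p

    scalar : Vec (Fin m) m → ℚ
    scalar π = ∑[ σ ← els m ] (stab c σ *ℚ sgnV σ) *ℚ proj₁ (κ-act-ρ-scalar (π ⊙ σ))

    κ-act-κρ : ∀ {π} → IsPerm π → ∀ u β → κ c (act π (κ c (ρ r u))) β ≡ scalar π *ℚ κ c (ρ r u) β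
    κ-act-κρ {π} p u β = K-∑ (λ σ → stab c σ *ℚ sgnV σ) (λ σ → act π (act σ (ρ r u))) sgnV c (els m) β ∙
      ∑-cong∈ (els m) (λ {σ} q → cong (stab c σ *ℚ sgnV σ *ℚ_)
        (K-cong sgnV c (act-⊙ π σ (ρ r u)) β ∙ proj₂ (κ-act-ρ-scalar (π ⊙ σ)) (perm-⊙ p (∈-els⁻ q)) u β) ∙
        sym (ℚ.*-assoc (stab c σ *ℚ sgnV σ) (proj₁ (κ-act-ρ-scalar (π ⊙ σ))) (κ c (ρ r u) β))) ∙
      ∑-*ʳ (els m) (λ σ → (stab c σ *ℚ sgnV σ) *ℚ proj₁ (κ-act-ρ-scalar (π ⊙ σ))) (κ c (ρ r u) β)

  T-does : {P : Set} (d : Dec P) → T (does d) → P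
  T-does (yes p) _ = p

  if-does : {P : Set} (d : Dec P) {x : ℚ} → (¬ P → x ≡ 0ℚ) → x ≡ (if does d then x else 0ℚ)
  if-does (yes p) h = refl
  if-does (no ¬p) h = h ¬p

  record Term (A : Set) (m : ℕ) : Set where
    constructor term
    field
      coef : ℚ
      by   : Vec (Fin m) m
      perm : IsPerm by
      gen  : A

  open Term

  -- `canonical` asks for one labelled diagram per shape: conjugate row labellings coincide, and so
  -- do their columns. Other fillings of the shape enter through the permutations in the terms.
  module Directness
    (α₀ : Vec ℕ m) {A : Set} (rr cc αα : A → Vec ℕ m)
    (D : ∀ a → Diagram (rr a) (cc a)) (ss : ∀ a → SSYT (rr a) (cc a) (αα a))
    (content : ∀ a → ∃ λ π → IsPerm π × αα a ≡ α₀ ⊙ π)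
    (canonical : ∀ a b {σ} → IsPerm σ → rr b ⊙ σ ≡ rr a → rr b ≡ rr a × cc b ≡ cc a)
    where

    open InnerProduct α₀

    G : A → Fun m
    G a = E (rr a) (cc a) (αα a)

    SameShape : A → A → Set
    SameShape a b = rr b ≡ rr a × cc b ≡ cc a

    sameShape? : ∀ a b → Dec (SameShape a b)
    sameShape? a b = (rr b ≟V rr a) ×-dec (cc b ≟V cc a)

    private
      -- By von Neumann's lemma a summand that does not vanish would force equal sums of row indices
      -- and conjugate row labellings, hence the same shape.
      kill : ∀ a b → ¬ SameShape a b → sumF (lookup (rr b)) ≤ sumF (lookup (rr a)) →
             ∀ {π} → IsPerm π → ∀ β → κ (cc a) (act π (G b)) β ≡ 0ℚ
      kill a b ne le {π} p β = K-∑ (λ σ → stab (cc b) σ *ℚ sgnV σ) (λ σ → act π (act σ (ρ (rr b) (δ (αα b))))) sgnV (cc a) (els m) β ∙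
        ∑-0 (els m) (λ {σ} q → cong (stab (cc b) σ *ℚ sgnV σ *ℚ_) (K-cong sgnV (cc a) (act-⊙ π σ (ρ (rr b) (δ (αα b)))) β ∙ zero′ (perm-⊙ p (∈-els⁻ q)) β) ∙
          ℚ.*-zeroʳ (stab (cc b) σ *ℚ sgnV σ))
        where
        zero′ : ∀ {π} → IsPerm π → ∀ β → κ (cc a) (act π (ρ (rr b) (δ (αα b)))) β ≡ 0ℚ
        zero′ {π} p β with κ-act-ρ (D a) p (rr b)
        ... | inj₁ z = z (δ (αα b)) β
        ... | inj₂ (le′ , h) with h (ℕ.≤-antisym le′ le)
        ... | σ , q , _ , e = contradiction (canonical a b (perm-⊙ (perm-inv p) q) (sym (⊙-assoc (rr b) (inv π) σ) ∙ e)) ne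

      orthogonal′ : ∀ a b → ¬ SameShape a b → sumF (lookup (rr b)) ≤ sumF (lookup (rr a)) →
                    ∀ {π} → IsPerm π → ⟪ G a , act π (G b) ⟫ ≡ 0ℚ
      orthogonal′ a b ne le {π} p = K-adjoint sgn-char (cc a) (ρ (rr a) (δ (αα a))) (act π (G b)) ∙ ⟪⟫-0ʳ (ρ (rr a) (δ (αα a))) (kill a b ne le p)

    -- The antisymmetrizer of the shape whose sum of row indices is not smaller is moved to the
    -- other side, where it gives 0. Symmetry of the product allows this choice.
    orthogonal : ∀ a b → ¬ SameShape a b → ∀ {π τ} → IsPerm π → IsPerm τ → ⟪ act π (G a) , act τ (G b) ⟫ ≡ 0ℚ
    orthogonal a b ne {π} {τ} p q with ℕ.≤-total (sumF (lookup (rr b))) (sumF (lookup (rr a)))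
    ... | inj₁ le = act-adjoint p (G a) (act τ (G b)) ∙ ⟪⟫-cong {u = G a} (λ _ → refl) (act-⊙ (inv π) τ (G b)) ∙ orthogonal′ a b ne le (perm-⊙ (perm-inv p) q)
    ... | inj₂ le = ⟪⟫-sym (act π (G a)) (act τ (G b)) ∙ act-adjoint q (G b) (act π (G a)) ∙ ⟪⟫-cong {u = G b} (λ _ → refl) (act-⊙ (inv τ) π (G a)) ∙
          orthogonal′ b a (λ (e , e′) → ne (sym e , sym e′)) le (perm-⊙ (perm-inv q) p)

    V : List (Term A m) → (A → ℚ) → Fun m
    V L f β = ∑[ t ← L ] (coef t *ℚ f (gen t)) *ℚ act (by t) (G (gen t)) β

    one : A → ℚ
    one _ = 1ℚ

    module _ (L : List (Term A m)) (vanish : ∀ {π} → IsPerm π → V L one (α₀ ⊙ π) ≡ 0ℚ)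
             (f : A → ℚ) (f-ext : ∀ a b → SameShape a b → αα b ≡ αα a → f b ≡ f a) where

      private module Shape (a : A) where

        r = rr a
        c = cc a

        S : Term A m → Bool
        S t = does (sameShape? a (gen t))

        Lₛ = filterᵇ S L

        inS : ∀ {t} → t ∈ Lₛ → SameShape a (gen t)
        inS {t} p = T-does (sameShape? a (gen t)) (proj₂ (∈.∈-filter⁻ (𝔹.T? ∘ S) {xs = L} p))

        restrict : ∀ u g → (∀ b → ¬ SameShape a b → ∀ {π} → IsPerm π → ⟪ u , act π (G b) ⟫ ≡ 0ℚ) → ⟪ u , V L g ⟫ ≡ ⟪ u , V Lₛ g ⟫
        restrict u g h = ⟪⟫-∑ʳ u (λ t → coef t *ℚ g (gen t)) (λ t → act (by t) (G (gen t))) L ∙ ∑-cong L lem ∙ sym (∑-filterᵇ S L _) ∙ sym (⟪⟫-∑ʳ u (λ t → coef t *ℚ g (gen t)) (λ t → act (by t) (G (gen t))) Lₛ)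
          where
          lem : ∀ t → (coef t *ℚ g (gen t)) *ℚ ⟪ u , act (by t) (G (gen t)) ⟫ ≡ (if S t then (coef t *ℚ g (gen t)) *ℚ ⟪ u , act (by t) (G (gen t)) ⟫ else 0ℚ)
          lem t = if-does (sameShape? a (gen t)) λ ne →
            cong (coef t *ℚ g (gen t) *ℚ_) (h (gen t) ne (perm t)) ∙ ℚ.*-zeroʳ (coef t *ℚ g (gen t))

        orth-Vₛ : ∀ g b → ¬ SameShape a b → ∀ {π} → IsPerm π → ⟪ V Lₛ g , act π (G b) ⟫ ≡ 0ℚ
        orth-Vₛ g b ne {π} p = ⟪⟫-sym (V Lₛ g) (act π (G b)) ∙ ⟪⟫-∑ʳ (act π (G b)) (λ t → coef t *ℚ g (gen t)) (λ t → act (by t) (G (gen t))) Lₛ ∙ ∑-0 Lₛ λ {t} q →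
          cong (coef t *ℚ g (gen t) *ℚ_) (orthogonal b (gen t) (λ (e , e′) → ne (sym e ∙ proj₁ (inS q) , sym e′ ∙ proj₂ (inS q))) p (perm t)) ∙ ℚ.*-zeroʳ (coef t *ℚ g (gen t))

        -- The terms of one shape are orthogonal to all other terms. So their sum has the same
        -- product with itself as with the complete sum, which vanishes on the orbit.
        Vₛ-vanish : ∀ {π} → IsPerm π → V Lₛ one (α₀ ⊙ π) ≡ 0ℚ
        Vₛ-vanish = ⟪⟫-definite (V Lₛ one) (sym (restrict (V Lₛ one) one (orth-Vₛ one)) ∙
          ∑-0 (els m) (λ {π} q → cong (V Lₛ one (α₀ ⊙ π) *ℚ_) (vanish (∈-els⁻ q)) ∙ ℚ.*-zeroʳ (V Lₛ one (α₀ ⊙ π))))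

        G-shape : ∀ {t} → t ∈ Lₛ → ∀ β → G (gen t) β ≡ E r c (αα (gen t)) β
        G-shape p β = cong₂ (λ x y → E x y _ β) (proj₁ (inS p)) (proj₂ (inS p))

        -- `κ c` turns a translate of a generator into a multiple of the generator. What remains is
        -- a combination of functions `E r c α` on one diagram, where triangularity applies.
        κV : ∀ {π} → IsPerm π → ∀ g β → κ c (act (inv π) (V Lₛ g)) β ≡
             (∑[ t ← Lₛ ] (coef t *ℚ scalar (D a) (inv π ⊙ by t)) *ℚ (g (gen t) *ℚ E r c (αα (gen t)) β))
        κV {π} p g β = K-∑ (λ t → coef t *ℚ g (gen t)) (λ t → act (inv π) (act (by t) (G (gen t)))) sgnV c Lₛ β ∙ ∑-cong∈ Lₛ λ {t} q →
          cong (coef t *ℚ g (gen t) *ℚ_) (K-cong sgnV c (λ γ → act-⊙ (inv π) (by t) (G (gen t)) γ ∙ G-shape q (γ ⊙ (inv π ⊙ by t))) β ∙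
            κ-act-κρ (D a) (perm-⊙ (perm-inv p) (perm t)) (δ (αα (gen t))) β) ∙
          solve 4 (λ a b c d → (a :* b) :* (c :* d) := (a :* c) :* (b :* d)) refl (coef t) (g (gen t)) (scalar (D a) (inv π ⊙ by t)) (E r c (αα (gen t)) β)
          where open +-*-Solver

        -- With all weights 1 the combination vanishes by `Vₛ-vanish`, and `independent` carries
        -- this over to the weights `f`.
        κV-vanish : ∀ {π} → IsPerm π → ∀ β → κ c (act (inv π) (V Lₛ f)) β ≡ 0ℚ
        κV-vanish {π} p β = κV p f β ∙ independent (λ t → f (gen t) *ℚ E r c (αα (gen t)) β)
            (λ {t} {t′} q q′ e → cong₂ (λ x y → x *ℚ E r c y β) (f-ext (gen t′) (gen t)
              (proj₁ (inS q) ∙ sym (proj₁ (inS q′)) , proj₂ (inS q) ∙ sym (proj₂ (inS q′))) e) e)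
          where
          rel : ∀ β → SSYT r c β → (∃ λ t → t ∈ Lₛ × αα (gen t) ≡ β) → (∑[ t ← Lₛ ] (coef t *ℚ scalar (D a) (inv π ⊙ by t)) *ℚ E r c (αα (gen t)) β) ≡ 0ℚ
          rel β _ (t , _ , refl) with content (gen t)
          ... | τ , q , e = ∑-cong Lₛ (λ t′ → cong (coef t′ *ℚ scalar (D a) (inv π ⊙ by t′) *ℚ_) (sym (ℚ.*-identityˡ _))) ∙ sym (κV p one β) ∙
                ∑-0 (els m) λ {σ} q′ → cong (stab c σ *ℚ sgnV σ *ℚ_) (cong (V Lₛ one) (cong (λ v → (v ⊙ σ) ⊙ inv π) e ∙ cong (_⊙ inv π) (⊙-assoc α₀ τ σ) ∙ ⊙-assoc α₀ (τ ⊙ σ) (inv π)) ∙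
                  Vₛ-vanish (perm-⊙ (perm-⊙ q (∈-els⁻ q′)) (perm-inv p))) ∙ ℚ.*-zeroʳ (stab c σ *ℚ sgnV σ)
          open Independence (D a) Lₛ (λ t → αα (gen t)) (λ t → coef t *ℚ scalar (D a) (inv π ⊙ by t))
            (λ {t} q → subst₂ (λ x y → SSYT x y (αα (gen t))) (proj₁ (inS q)) (proj₂ (inS q)) (ss (gen t))) rel

        orth-V : ∀ {π} → IsPerm π → ⟪ act π (G a) , V L f ⟫ ≡ 0ℚ
        orth-V {π} p = restrict (act π (G a)) f (λ b ne q → orthogonal a b ne p q) ∙ act-adjoint p (G a) (V Lₛ f) ∙
          K-adjoint sgn-char c (ρ r (δ (αα a))) (act (inv π) (V Lₛ f)) ∙ ⟪⟫-0ʳ (ρ r (δ (αα a))) (κV-vanish p)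

      -- Directness in the form that weights depending only on the tableau may be put on a vanishing
      -- combination. The weighted sum is orthogonal to every translate of a generator; being a
      -- combination of such translates, it is orthogonal to itself.
      direct : ∀ {π} → IsPerm π → V L f (α₀ ⊙ π) ≡ 0ℚ
      direct = ⟪⟫-definite (V L f) (⟪⟫-∑ʳ (V L f) (λ t → coef t *ℚ f (gen t)) (λ t → act (by t) (G (gen t))) L ∙ ∑-0 L λ {t} _ →
        cong (coef t *ℚ f (gen t) *ℚ_) (⟪⟫-sym (V L f) (act (by t) (G (gen t))) ∙ Shape.orth-V (gen t) (perm t)) ∙ ℚ.*-zeroʳ (coef t *ℚ f (gen t)))

open SymmetrizerImages

-- Positions of entries, and the diagram of a filling

module Positions where

  private variable
    C : Set
    m : ℕ

  nth-∈ : (xs : List C) {i : ℕ} {a : C} → nth xs i ≡ just a → a ∈ xs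
  nth-∈ (x ∷ xs) {zero}  refl = here refl
  nth-∈ (x ∷ xs) {suc i} eq   = there (nth-∈ xs eq)

  ∈-nth : {xs : List C} {a : C} → a ∈ xs → ∃ λ i → nth xs i ≡ just a
  ∈-nth (here refl) = 0 , refl
  ∈-nth (there p) with ∈-nth p
  ... | i , eq = suc i , eq

  nth-< : (xs : List C) {i : ℕ} {a : C} → nth xs i ≡ just a → i < length xs
  nth-< (x ∷ xs) {zero}  eq = z<s
  nth-< (x ∷ xs) {suc i} eq = s<s (nth-< xs eq)

  <-nth : (xs : List C) {i : ℕ} → i < length xs → ∃ λ a → nth xs i ≡ just a
  <-nth (x ∷ xs) {zero}  _       = x , refl
  <-nth (x ∷ xs) {suc i} (s≤s p) = <-nth xs p

  nth-unique : {xs : List C} → Unique xs → ∀ {i j a} → nth xs i ≡ just a → nth xs j ≡ just a → i ≡ j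
  nth-unique {xs = x ∷ xs} (p ∷ u) {zero}  {zero}  e    f    = refl
  nth-unique {xs = x ∷ xs} (p ∷ u) {zero}  {suc j} refl f    = contradiction refl (All.lookup p (nth-∈ xs f))
  nth-unique {xs = x ∷ xs} (p ∷ u) {suc i} {zero}  e    refl = contradiction refl (All.lookup p (nth-∈ xs e))
  nth-unique {xs = x ∷ xs} (p ∷ u) {suc i} {suc j} e    f    = cong suc (nth-unique u e f)

  Unique-++⁻ : (xs : List C) {ys : List C} → Unique (xs ++ ys) → Unique xs × Unique ys × (∀ {z} → z ∈ xs → z ∉ ys)
  Unique-++⁻ []       u       = [] , u , λ ()
  Unique-++⁻ (x ∷ xs) (p ∷ u) with Unique-++⁻ xs u
  ... | u₁ , u₂ , d = All.++⁻ˡ xs p ∷ u₁ , u₂ , λ where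
      (here refl) q → All.lookup (All.++⁻ʳ xs p) q refl
      (there r)   q → d r q

  entryAt-∈ : ∀ T {r c a} → entryAt T (r , c) ≡ just a → a ∈ entries T
  entryAt-∈ (row ∷ T) {zero}  {c} eq = ∈.∈-++⁺ˡ (nth-∈ row eq)
  entryAt-∈ (row ∷ T) {suc r} eq = ∈.∈-++⁺ʳ row (entryAt-∈ T {r} eq)

  ∈-entryAt : ∀ T {a} → a ∈ entries T → ∃ λ p → entryAt T p ≡ just a
  ∈-entryAt (row ∷ T) q with ∈.∈-++⁻ row q
  ... | inj₁ q′ = let c , e = ∈-nth q′ in (0 , c) , e
  ... | inj₂ q′ with ∈-entryAt T q′
  ... | (r , c) , e = (suc r , c) , e

  entryAt-injective : ∀ T → Unique (entries T) → ∀ {p q a} → entryAt T p ≡ just a → entryAt T q ≡ just a → p ≡ q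
  entryAt-injective (row ∷ T) u {zero , c} {zero , d} e f = cong (0 ,_) (nth-unique (proj₁ (Unique-++⁻ row u)) e f)
  entryAt-injective (row ∷ T) u {zero , c} {suc s , d} e f =
    contradiction (entryAt-∈ T {s} f) (proj₂ (proj₂ (Unique-++⁻ row u)) (nth-∈ row e))
  entryAt-injective (row ∷ T) u {suc r , c} {zero , d} e f =
    contradiction (entryAt-∈ T {r} e) (proj₂ (proj₂ (Unique-++⁻ row u)) (nth-∈ row f))
  entryAt-injective (row ∷ T) u {suc r , c} {suc s , d} e f with entryAt-injective T (proj₁ (proj₂ (Unique-++⁻ row u))) {r , c} {s , d} e f
  ... | refl = refl

  private
    -- Together with `posR`, a structurally recursive form of `posOf`, without lists of indices.
    findC : ℕ → List ℕ → Maybe ℕ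
    findC a []       = nothing
    findC a (x ∷ xs) = if x ≡ᵇ a then just 0 else Maybe.map suc (findC a xs)

    posR : ℕ → Tab → Maybe (ℕ × ℕ)
    posR a []        = nothing
    posR a (row ∷ T) with findC a row
    ... | just c  = just (0 , c)
    ... | nothing = Maybe.map (λ (r , c) → suc r , c) (posR a T)

    inRow≡ : ∀ a (r : ℕ) row (f : ℕ → ℕ) →
             foldr (λ ic m → if proj₂ ic ≡ᵇ a then just (r , proj₁ ic) else m) nothing (zip (List.applyUpTo f (length row)) row)
             ≡ Maybe.map (λ c → r , f c) (findC a row)
    inRow≡ a r []        f = refl
    inRow≡ a r (x ∷ row) f with x ≡ᵇ a
    ... | true  = refl
    ... | false = inRow≡ a r row (f ∘ suc) ∙ sym (map-∘ (findC a row))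
      where
      map-∘ : ∀ m → Maybe.map (λ c → r , f c) (Maybe.map suc m) ≡ Maybe.map (λ c → r , f (suc c)) m
      map-∘ nothing  = refl
      map-∘ (just _) = refl

    fold-rows : ∀ a (step : ℕ × List ℕ → Maybe (ℕ × ℕ) → Maybe (ℕ × ℕ)) →
                (∀ r row c m → findC a row ≡ just c → step (r , row) m ≡ just (r , c)) →
                (∀ r row m → findC a row ≡ nothing → step (r , row) m ≡ m) →
                ∀ T (f : ℕ → ℕ) → foldr step nothing (zip (List.applyUpTo f (length T)) T) ≡ Maybe.map (λ (r , c) → f r , c) (posR a T)
    fold-rows a step h₁ h₂ []        f = refl
    fold-rows a step h₁ h₂ (row ∷ T) f with findC a row in eq
    ... | just c  = h₁ (f 0) row c _ eq
    ... | nothing = h₂ (f 0) row _ eq ∙ fold-rows a step h₁ h₂ T (f ∘ suc) ∙ sym (map-∘ (posR a T))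
      where
      map-∘ : ∀ m → Maybe.map (λ (r , c) → f r , c) (Maybe.map (λ (r , c) → suc r , c) m) ≡ Maybe.map (λ (r , c) → f (suc r) , c) m
      map-∘ nothing  = refl
      map-∘ (just _) = refl

    mutual
      -- the local function step of posOf, recovered by unification
      stepOf : Tab → ℕ → ℕ × List ℕ → Maybe (ℕ × ℕ) → Maybe (ℕ × ℕ)
      stepOf = _

      posOf≡fold : ∀ T a → posOf T a ≡ foldr (stepOf T a) nothing (indexed T)
      posOf≡fold T a = refl

    posOf≡posR : ∀ T a → posOf T a ≡ posR a T
    posOf≡posR T a = posOf≡fold T a ∙ fold-rows a (stepOf T a) found missing T id ∙ map-id (posR a T)
      where
      map-id : ∀ m → Maybe.map (λ (r , c) → id r , c) m ≡ m
      map-id nothing  = refl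
      map-id (just _) = refl
      found : ∀ r row c m → findC a row ≡ just c → stepOf T a (r , row) m ≡ just (r , c)
      found r row c m eq rewrite inRow≡ a r row id | eq = refl
      missing : ∀ r row m → findC a row ≡ nothing → stepOf T a (r , row) m ≡ m
      missing r row m eq rewrite inRow≡ a r row id | eq = refl

    findC-just : ∀ a row {c} → findC a row ≡ just c → nth row c ≡ just a
    findC-just a (x ∷ row) eq with x ≡ᵇ a in e
    findC-just a (x ∷ row) refl | true = cong just (ℕ.≡ᵇ⇒≡ x a (subst T (sym e) tt))
    ... | false with findC a row in e′
    findC-just a (x ∷ row) refl | false | just c = findC-just a row e′

    findC-nothing : ∀ a row → findC a row ≡ nothing → a ∉ row
    findC-nothing a (x ∷ row) eq p with x ≡ᵇ a in e
    findC-nothing a (x ∷ row) eq (here refl) | false = contradiction (sym e ∙ 𝔹.T-≡ .Equivalence.to (ℕ.≡⇒≡ᵇ a a refl)) λ ()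
    findC-nothing a (x ∷ row) eq (there p) | false with findC a row in e′
    ... | nothing = findC-nothing a row e′ p

    posR-just : ∀ a T {r c} → posR a T ≡ just (r , c) → entryAt T (r , c) ≡ just a
    posR-just a (row ∷ T) eq with findC a row in e
    posR-just a (row ∷ T) refl | just c = findC-just a row e
    ... | nothing with posR a T in e′
    posR-just a (row ∷ T) refl | nothing | just (r , c) = posR-just a T e′

    posR-nothing : ∀ a T → posR a T ≡ nothing → a ∉ entries T
    posR-nothing a (row ∷ T) eq p with findC a row in e
    ... | nothing with posR a T in e′
    ... | nothing with ∈.∈-++⁻ row p
    ... | inj₁ q = findC-nothing a row e q
    ... | inj₂ q = posR-nothing a T e′ q

  posOf-just : ∀ T {a p} → posOf T a ≡ just p → entryAt T p ≡ just a
  posOf-just T {a} eq = posR-just a T (sym (posOf≡posR T a) ∙ eq)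

  posOf-∈ : ∀ T {a} → a ∈ entries T → ∃ λ p → posOf T a ≡ just p
  posOf-∈ T {a} p with posOf T a in eq
  ... | just q  = q , refl
  ... | nothing = contradiction p (posR-nothing a T (sym (posOf≡posR T a) ∙ eq))

  posOf-entryAt : ∀ T → Unique (entries T) → ∀ {a p} → entryAt T p ≡ just a → posOf T a ≡ just p
  posOf-entryAt T u {a} {p} e with posOf-∈ T (entryAt-∈ T {proj₁ p} e)
  ... | q , eq = eq ∙ cong just (entryAt-injective T u (posOf-just T eq) e)

  rowOf-just : ∀ T {a r c} → posOf T a ≡ just (r , c) → rowOf T a ≡ just r
  rowOf-just T eq rewrite eq = refl

  colOf-just : ∀ T {a r c} → posOf T a ≡ just (r , c) → colOf T a ≡ just c
  colOf-just T eq rewrite eq = refl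

  entryAt-left : ∀ T {r c a} → entryAt T (r , suc c) ≡ just a → ∃ λ b → entryAt T (r , c) ≡ just b
  entryAt-left (row ∷ T) {zero}  {c} eq = <-nth row (ℕ.<-trans (ℕ.n<1+n c) (nth-< row eq))
  entryAt-left (row ∷ T) {suc r} eq = entryAt-left T {r} eq

  ∧-true : ∀ {a b} → a ∧ b ≡ true → a ≡ true × b ≡ true
  ∧-true {true} {true} _ = refl , refl

  ≤ᵇ-true : ∀ {a b} → (a ≤ᵇ b) ≡ true → a ≤ b
  ≤ᵇ-true {a} {b} e = ℕ.≤ᵇ⇒≤ a b (subst T (sym e) tt)

  <ᵇ-true⁻ : ∀ {a b} → (a <ᵇ b) ≡ true → a < b
  <ᵇ-true⁻ {a} {b} e = ℕ.<ᵇ⇒< a b (subst T (sym e) tt)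

  entryAt-up : ∀ T → weaklyDecr (shape T) ≡ true → ∀ {r c a} → entryAt T (suc r , c) ≡ just a → ∃ λ b → entryAt T (r , c) ≡ just b
  entryAt-up (row ∷ row′ ∷ T) w {zero}  {c} eq = <-nth row (ℕ.<-≤-trans (nth-< row′ eq) (≤ᵇ-true (proj₁ (∧-true w))))
  entryAt-up (row ∷ row′ ∷ T) w {suc r} eq = entryAt-up (row′ ∷ T) (proj₂ (∧-true {length row′ ≤ᵇ length row} w)) {r} eq

  record Filling (m : ℕ) (T : Tab) : Set where
    field
      numbers   : entries T ↭ oneTo m
      partition : isPartition (shape T) ≡ true

    unique : Unique (entries T)
    unique = Unique-resp-↭ (↭-sym numbers) (oneTo-unique m)

    decreasing : weaklyDecr (shape T) ≡ true
    decreasing = proj₂ (∧-true {allᵇ (λ k → 0 <ᵇ k) (shape T)} partition)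

  -- The default is not met for the numbers that occur in a filling.
  posOrigin : Maybe (ℕ × ℕ) → ℕ × ℕ
  posOrigin (just p) = p
  posOrigin nothing  = 0 , 0

  rowV colV : (m : ℕ) → Tab → Vec ℕ m
  rowV m T = tabulate λ i → proj₁ (posOrigin (posOf T (idx i)))
  colV m T = tabulate λ i → proj₂ (posOrigin (posOf T (idx i)))

  module _ {T : Tab} (F : Filling m T) where

    open Filling F

    cell : Fin m → ℕ × ℕ
    cell i = lookup (rowV m T) i , lookup (colV m T) i

    posOf-cell : ∀ i → posOf T (idx i) ≡ just (cell i)
    posOf-cell i with posOf-∈ T (↭.∈-resp-↭ (↭-sym numbers) (∈-oneTo⁺ i))
    ... | p , eq = eq ∙ cong just (sym (cong₂ _,_ (Vec.lookup∘tabulate _ i ∙ cong (proj₁ ∘ posOrigin) eq)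
                                                 (Vec.lookup∘tabulate _ i ∙ cong (proj₂ ∘ posOrigin) eq)))

    entryAt-cell : ∀ i → entryAt T (cell i) ≡ just (idx i)
    entryAt-cell i = posOf-just T (posOf-cell i)

    cell-entryAt : ∀ {p a} → entryAt T p ≡ just a → ∃ λ i → a ≡ idx i × cell i ≡ p
    cell-entryAt {p} e with ∈-oneTo⁻ (↭.∈-resp-↭ numbers (entryAt-∈ T {proj₁ p} e))
    ... | i , refl = i , refl , entryAt-injective T unique (entryAt-cell i) e

    diagram : Diagram (rowV m T) (colV m T)
    diagram .cell-inj x y e f = Fin.toℕ-injective (ℕ.suc-injective (just-injective
      (sym (entryAt-cell x) ∙ cong (entryAt T) (cong₂ _,_ e f) ∙ entryAt-cell y)))
    diagram .up x {i} e with entryAt-up T decreasing {i} (subst (λ r → entryAt T (r , lookup (colV m T) x) ≡ just (idx x)) e (entryAt-cell x))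
    ... | b , e′ with cell-entryAt e′
    ... | y , _ , f = y , cong proj₁ f , cong proj₂ f
    diagram .left x {j} e with entryAt-left T {lookup (rowV m T) x} (subst (λ c → entryAt T (lookup (rowV m T) x , c) ≡ just (idx x)) e (entryAt-cell x))
    ... | b , e′ with cell-entryAt e′
    ... | y , _ , f = y , cong proj₂ f , cong proj₁ f

open Positions

-- Coefficients of Specht polynomials

module Coefficients where

  private variable
    m : ℕ

  ≡ᵇ-true : ∀ {a b} → (a ≡ᵇ b) ≡ true → a ≡ b
  ≡ᵇ-true {a} {b} e = ℕ.≡ᵇ⇒≡ a b (subst T (sym e) tt)

  ≡ᵇ-refl : ∀ a → (a ≡ᵇ a) ≡ true
  ≡ᵇ-refl zero    = refl
  ≡ᵇ-refl (suc a) = ≡ᵇ-refl a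

  ≢⇒≡ᵇ : ∀ {a b} → a ≢ b → (a ≡ᵇ b) ≡ false
  ≢⇒≡ᵇ {a} {b} ne with a ≡ᵇ b in e
  ... | true  = contradiction (≡ᵇ-true e) ne
  ... | false = refl

  eqList-true : ∀ {xs ys} → eqList xs ys ≡ true → xs ≡ ys
  eqList-true {[]}     {[]}     e = refl
  eqList-true {x ∷ xs} {y ∷ ys} e = cong₂ _∷_ (≡ᵇ-true (proj₁ (∧-true e))) (eqList-true (proj₂ (∧-true {x ≡ᵇ y} e)))

  eqList-refl : ∀ xs → eqList xs xs ≡ true
  eqList-refl []       = refl
  eqList-refl (x ∷ xs) rewrite ≡ᵇ-refl x = eqList-refl xs

  toList-inj : {α β : Vec ℕ m} → toList α ≡ toList β → α ≡ β
  toList-inj {α = []}    {[]}    e = refl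
  toList-inj {α = x ∷ α} {y ∷ β} e = cong₂ _∷_ (List.∷-injectiveˡ e) (toList-inj (List.∷-injectiveʳ e))

  coeff≡∑ : (p : Poly m) (β : Vec ℕ m) → coeff p β ≡ (∑[ t ← p ] proj₂ t *ℚ δ (proj₁ t) β)
  coeff≡∑ []            β = refl
  coeff≡∑ ((α , q) ∷ p) β with eqList (toList α) (toList β) in e
  ... | true  = cong₂ _+ℚ_ (sym (cong (q *ℚ_) (iv-yes (β ≟V α) (sym (toList-inj (eqList-true e)))) ∙ ℚ.*-identityʳ q)) (coeff≡∑ p β)
  ... | false = coeff≡∑ p β ∙ sym (cong (_+ℚ (∑[ t ← p ] proj₂ t *ℚ δ (proj₁ t) β))
                  (cong (q *ℚ_) (iv-no (β ≟V α) (λ { refl → contradiction (sym (eqList-refl (toList β)) ∙ e) λ () })) ∙ ℚ.*-zeroʳ q) ∙ ℚ.+-identityˡ _)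

  coeff-++ : (p q : Poly m) (β : Vec ℕ m) → coeff (p ++ q) β ≡ coeff p β +ℚ coeff q β
  coeff-++ p q β = coeff≡∑ (p ++ q) β ∙ ∑-++ p q _ ∙ sym (cong₂ _+ℚ_ (coeff≡∑ p β) (coeff≡∑ q β))

  coeff-scale : (c : ℚ) (p : Poly m) (β : Vec ℕ m) → coeff (scaleP c p) β ≡ c *ℚ coeff p β
  coeff-scale c p β = coeff≡∑ (scaleP c p) β ∙ ∑-map _ p _ ∙ ∑-cong p (λ t → ℚ.*-assoc c (proj₂ t) _) ∙ ∑-*ˡ p c _ ∙ cong (c *ℚ_) (sym (coeff≡∑ p β))

  coeff-sumP : {X : Set} (f : X → Poly m) (L : List X) (β : Vec ℕ m) → coeff (sumP (map f L)) β ≡ (∑[ x ← L ] coeff (f x) β)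
  coeff-sumP f []      β = refl
  coeff-sumP f (x ∷ L) β = coeff-++ (f x) (sumP (map f L)) β ∙ cong (coeff (f x) β +ℚ_) (coeff-sumP f L β)

  opaque
    unfolding sumF

    sumF-zip : (g : ℕ × ℕ → ℕ) (h : ℕ → ℕ) (α : Vec ℕ m) →
               sum (map g (zip (List.applyUpTo h (length (toList α))) (toList α))) ≡ sumF (λ i → g (h (toℕ i) , lookup α i))
    sumF-zip g h []      = refl
    sumF-zip g h (a ∷ α) = cong (g (h 0 , a) +_) (sumF-zip g (h ∘ suc) α)

    sumF-0 : {f : Fin m → ℕ} → (∀ i → f i ≡ 0) → sumF f ≡ 0
    sumF-0 {zero}  h = refl
    sumF-0 {suc m} h = cong₂ _+_ (h zero) (sumF-0 (h ∘ suc))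

    sumF-single : (f : Fin m → ℕ) (x : Fin m) → (∀ i → i ≢ x → f i ≡ 0) → sumF f ≡ f x
    sumF-single f zero    h = cong (f zero +_) (sumF-0 (λ i → h (suc i) λ ())) ∙ ℕ.+-identityʳ _
    sumF-single f (suc x) h = cong₂ _+_ (h zero λ ()) (sumF-single (f ∘ suc) x (λ i ne → h (suc i) (ne ∘ Fin.suc-injective)))

  -- The image has at `k` the exponent of the unique index that `v` sends to `k`; all other summands
  -- in `actMon` are 0.
  actMon-toL : (v : Vec (Fin m) m) → IsPerm v → (α : Vec ℕ m) → actMon (toL v) α ≡ α ⊙ inv v
  actMon-toL {m} v p α = vec-ext λ k → Vec.lookup∘tabulate _ k ∙ sumF-zip (g k) id α ∙
      sumF-single (λ i → g k (toℕ i , lookup α i)) (lookup (inv v) k) (off k) ∙ on k ∙ sym (lookup-⊙ α (inv v) k)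
    where
    g : Fin m → ℕ × ℕ → ℕ
    g k iv = if applyPerm (toL v) (suc (proj₁ iv)) ≡ᵇ suc (toℕ k) then proj₂ iv else 0
    on : ∀ k → g k (toℕ (lookup (inv v) k) , lookup α (lookup (inv v) k)) ≡ lookup α (lookup (inv v) k)
    on k rewrite applyPerm-toL v (lookup (inv v) k) | lookup-inv v p k | ≡ᵇ-refl (toℕ k) = refl
    off : ∀ k i → i ≢ lookup (inv v) k → g k (toℕ i , lookup α i) ≡ 0
    off k i ne rewrite applyPerm-toL v i | ≢⇒≡ᵇ {toℕ (lookup v i)} {toℕ k} (λ e → ne (sym (inv-lookup v p i) ∙ cong (lookup (inv v)) (Fin.toℕ-injective e))) = refl

  allᵇ-true : ∀ {A : Set} (p : A → Bool) xs → allᵇ p xs ≡ true → ∀ {x} → x ∈ xs → p x ≡ true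
  allᵇ-true p (x ∷ xs) e (here refl) = proj₁ (∧-true e)
  allᵇ-true p (x ∷ xs) e (there q)   = allᵇ-true p xs (proj₂ (∧-true {p x} e)) q

  true-allᵇ : ∀ {A : Set} (p : A → Bool) xs → (∀ {x} → x ∈ xs → p x ≡ true) → allᵇ p xs ≡ true
  true-allᵇ p []       h = refl
  true-allᵇ p (x ∷ xs) h rewrite h (here refl) = true-allᵇ p xs (h ∘ there)

  private
    stabᵇ : ℕ → (ℕ → Maybe ℕ) → List ℕ → Bool
    stabᵇ m f σ = allᵇ (λ i → eqMaybe (f (applyPerm σ i)) (f i)) (oneTo m)

    stabᵇ-⇔ : (f : ℕ → Maybe ℕ) (ℓ : Vec ℕ m) → (∀ i → f (idx i) ≡ just (lookup ℓ i)) → (v : Vec (Fin m) m) →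
              (stabᵇ m f (toL v) ≡ true → ℓ ⊙ v ≡ ℓ) × (ℓ ⊙ v ≡ ℓ → stabᵇ m f (toL v) ≡ true)
    stabᵇ-⇔ {m} f ℓ h v = (λ e → lookup-fix ℓ λ i → ≡ᵇ-true (sym (at i) ∙ allᵇ-true _ (oneTo m) e (∈-oneTo⁺ i))) ,
        λ e → true-allᵇ _ (oneTo m) λ q → let i , eq = ∈-oneTo⁻ q in
          subst (λ k → eqMaybe (f (applyPerm (toL v) k)) (f k) ≡ true) (sym eq)
            (at i ∙ cong (_≡ᵇ lookup ℓ i) (fix-lookup ℓ e i) ∙ ≡ᵇ-refl (lookup ℓ i))
      where
      at : ∀ i → eqMaybe (f (applyPerm (toL v) (idx i))) (f (idx i)) ≡ (lookup ℓ (lookup v i) ≡ᵇ lookup ℓ i)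
      at i rewrite applyPerm-toL v i | h i | h (lookup v i) = refl

    if-stab : (f : ℕ → Maybe ℕ) (ℓ : Vec ℕ m) → (∀ i → f (idx i) ≡ just (lookup ℓ i)) → (v : Vec (Fin m) m) (x : ℚ) →
              (if stabᵇ m f (toL v) then x else 0ℚ) ≡ stab ℓ v *ℚ x
    if-stab {m} f ℓ h v x with stabᵇ m f (toL v) in e
    ... | true  = sym (cong (_*ℚ x) (iv-yes (ℓ ⊙ v ≟V ℓ) (proj₁ (stabᵇ-⇔ f ℓ h v) e)) ∙ ℚ.*-identityˡ x)
    ... | false = sym (cong (_*ℚ x) (iv-no (ℓ ⊙ v ≟V ℓ) (λ q → contradiction (sym (proj₂ (stabᵇ-⇔ f ℓ h v) q) ∙ e) λ ())) ∙ ℚ.*-zeroˡ x)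

    ∑-Sym-stab : (f : ℕ → Maybe ℕ) (ℓ : Vec ℕ m) → (∀ i → f (idx i) ≡ just (lookup ℓ i)) → (g : List ℕ → ℚ) →
                 ∑ (filterᵇ (stabᵇ m f) (Sym m)) g ≡ (∑[ v ← els m ] stab ℓ v *ℚ g (toL v))
    ∑-Sym-stab {m} f ℓ h g = ∑-filterᵇ (stabᵇ m f) (Sym m) g ∙
      ∑-cong∈ (Sym m) (λ {σ} q → cong (λ τ → if stabᵇ m f τ then g τ else 0ℚ) (sym (toL-fromL (∈-perms⁻ (oneTo m) q))) ∙ if-stab f ℓ h (fromL σ) (g (toL (fromL σ)))) ∙
      sym (∑-map fromL (Sym m) (λ v → stab ℓ v *ℚ g (toL v))) ∙ cong (λ es → ∑[ v ← es ] stab ℓ v *ℚ g (toL v)) (sym (els≡ m))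

  private
    ∈-filterᵇ : ∀ {A : Set} (p : A → Bool) {xs x} → x ∈ xs → p x ≡ true → x ∈ filterᵇ p xs
    ∈-filterᵇ p q e = ∈.∈-filter⁺ (𝔹.T? ∘ p) q (subst T (sym e) tt)

    nonzero : ∀ {A : Set} {xs : List A} {x} → x ∈ xs → length xs ≢ 0
    nonzero (here _)  ()
    nonzero (there _) ()

    invℕ-≢0 : ∀ k → k ≢ 0 → invℕ k ≢ 0ℚ
    invℕ-≢0 zero    h = contradiction refl h
    invℕ-≢0 (suc k) h e = contradiction (ℚ.positive⁻¹ (ℤ.+ 1 ℚ./ suc k) {{ℚ.normalize-pos 1 (suc k)}}) (ℚ.<-irrefl (sym e))

  module _ {T : Tab} (F : Filling m T) where

    private
      rV = rowV m T
      cV = colV m T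

      rowOf-cell : ∀ i → rowOf T (idx i) ≡ just (lookup rV i)
      rowOf-cell i = rowOf-just T (posOf-cell F i)

      colOf-cell : ∀ i → colOf T (idx i) ≡ just (lookup cV i)
      colOf-cell i = colOf-just T (posOf-cell F i)

    -- `FMT` sums over filtered lists of permutations, `E` over all permutations with indicators.
    -- The action on monomials becomes an action on the argument `β` by `act-δ`.
    coeff-F : ∀ M β → coeff (FMT m M T) β ≡ invℕ (sMT m M T) *ℚ E rV cV (pMT m M T) β
    coeff-F M β = begin
      coeff (FMT m M T) β                                                                    ≡⟨ coeff≡∑ (FMT m M T) β ⟩
      ∑ (FMT m M T) (λ t → proj₂ t *ℚ δ (proj₁ t) β)                                          ≡⟨ ∑-concatMap _ (colStab m T) _ ⟩
      ∑ (colStab m T) (λ σ → ∑ (map (term′ σ) (rowStab m T)) (λ t → proj₂ t *ℚ δ (proj₁ t) β)) ≡⟨ ∑-cong (colStab m T) (λ σ → ∑-map (term′ σ) (rowStab m T) _) ⟩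
      ∑ (colStab m T) (λ σ → ∑ (rowStab m T) (λ τ → g σ τ))                                   ≡⟨ ∑-Sym-stab (colOf T) cV colOf-cell _ ⟩
      ∑ (els m) (λ v → stab cV v *ℚ ∑ (rowStab m T) (g (toL v)))                              ≡⟨ ∑-cong∈ (els m) (λ {v} q → inner v (∈-els⁻ q)) ⟩
      ∑ (els m) (λ v → s *ℚ ((stab cV v *ℚ sgnV v) *ℚ ρ rV (δ α) (β ⊙ v)))                    ≡⟨ ∑-*ˡ (els m) s _ ⟩
      s *ℚ E rV cV α β                                                                        ∎
      where
      open ≡-Reasoning
      α = pMT m M T
      s = invℕ (sMT m M T)
      term′ : List ℕ → List ℕ → Vec ℕ m × ℚ
      term′ σ τ = actMon σ (actMon τ α) , sgn σ *ℚ s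
      g : List ℕ → List ℕ → ℚ
      g σ τ = (sgn σ *ℚ s) *ℚ δ (actMon σ (actMon τ α)) β
      mon : ∀ v w → IsPerm v → IsPerm w → δ (actMon (toL v) (actMon (toL w) α)) β ≡ δ α ((β ⊙ v) ⊙ w)
      mon v w p q = cong (λ z → δ z β) (cong (actMon (toL v)) (actMon-toL w q α) ∙ actMon-toL v p (α ⊙ inv w)) ∙
        sym (act-δ (α ⊙ inv w) p β) ∙ sym (act-δ α q (β ⊙ v))
      inner : ∀ v → IsPerm v → stab cV v *ℚ ∑ (rowStab m T) (g (toL v)) ≡ s *ℚ ((stab cV v *ℚ sgnV v) *ℚ ρ rV (δ α) (β ⊙ v))
      inner v p = cong (stab cV v *ℚ_) (∑-Sym-stab (rowOf T) rV rowOf-cell (g (toL v)) ∙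
          ∑-cong∈ (els m) (λ {w} q → cong (λ z → stab rV w *ℚ ((sgnV v *ℚ s) *ℚ z)) (mon v w p (∈-els⁻ q)) ∙
            solve 4 (λ a b c d → a :* ((b :* c) :* d) := (b :* c) :* ((a :* con 1ℚ) :* d)) refl (stab rV w) (sgnV v) s (δ α ((β ⊙ v) ⊙ w))) ∙
          ∑-*ˡ (els m) (sgnV v *ℚ s) _) ∙
        solve 4 (λ a b c d → a :* ((b :* c) :* d) := c :* ((a :* b) :* d)) refl (stab cV v) (sgnV v) s (ρ rV (δ α) (β ⊙ v))
        where open +-*-Solver

    -- The identity stabilizes the monomial, so the order is not 0 and the default value of `invℕ`
    -- is avoided.
    invℕ-sMT-≢0 : ∀ M → invℕ (sMT m M T) ≢ 0ℚ
    invℕ-sMT-≢0 M = invℕ-≢0 _ (nonzero (∈-filterᵇ _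
        (∈-filterᵇ (stabᵇ m (rowOf T)) (∈-perms⁺ (oneTo m) (toL-↭ (allFin m) perm-id)) (proj₂ (stabᵇ-⇔ (rowOf T) rV rowOf-cell (allFin m)) (⊙-identityʳ rV)))
        (cong (λ z → eqList (toList z) (toList α)) (actMon-toL (allFin m) perm-id α ∙ inv-id) ∙ eqList-refl (toList α))))
      where
      α = pMT m M T
      inv-id : α ⊙ inv (allFin m) ≡ α
      inv-id = cong (_⊙ inv (allFin m)) (sym (⊙-identityʳ α)) ∙ ⊙-inv α (allFin m) perm-id

  private
    mutual
      -- the entry of pMT, a local function, recovered by unification
      pMT-entry : (m : ℕ) → Tab → Tab → Fin m → ℕ
      pMT-entry = _

      pMT≡tabulate : ∀ m M T → pMT m M T ≡ tabulate (pMT-entry m M T)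
      pMT≡tabulate m M T = refl

    pMT-entry-just : ∀ M T (i : Fin m) {p e} → posOf T (idx i) ≡ just p → entryAt M p ≡ just e → pMT-entry m M T i ≡ e
    pMT-entry-just M T i eq eq′ rewrite eq | eq′ = refl

  lookup-pMT : ∀ M T (i : Fin m) {p e} → posOf T (idx i) ≡ just p → entryAt M p ≡ just e → lookup (pMT m M T) i ≡ e
  lookup-pMT {m} M T i eq eq′ = Vec.lookup∘tabulate (pMT-entry m M T) i ∙ pMT-entry-just M T i eq eq′

open Coefficients

-- Semistandard tableaux and exponent vectors

module Tableaux where

  private variable
    C : Set
    m : ℕ

  true-≤ᵇ : ∀ {a b} → a ≤ b → (a ≤ᵇ b) ≡ true
  true-≤ᵇ p = 𝔹.T-≡ .Equivalence.to (ℕ.≤⇒≤ᵇ p)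

  weaklyIncr-elim : ∀ xs → weaklyIncr xs ≡ true → ∀ {c a b} → nth xs c ≡ just a → nth xs (suc c) ≡ just b → a ≤ b
  weaklyIncr-elim (x ∷ y ∷ xs) w {zero}  refl refl = ≤ᵇ-true (proj₁ (∧-true w))
  weaklyIncr-elim (x ∷ y ∷ xs) w {suc c} e    f    = weaklyIncr-elim (y ∷ xs) (proj₂ (∧-true {x ≤ᵇ y} w)) {c} e f

  weaklyIncr-intro : ∀ xs → (∀ c {a b} → nth xs c ≡ just a → nth xs (suc c) ≡ just b → a ≤ b) → weaklyIncr xs ≡ true
  weaklyIncr-intro []           h = refl
  weaklyIncr-intro (x ∷ [])     h = refl
  weaklyIncr-intro (x ∷ y ∷ xs) h = cong₂ _∧_ (true-≤ᵇ (h 0 refl refl)) (weaklyIncr-intro (y ∷ xs) (λ c → h (suc c)))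

  strictlyBelow-elim : ∀ xs ys → strictlyBelow xs ys ≡ true → ∀ {c a b} → nth xs c ≡ just a → nth ys c ≡ just b → a < b
  strictlyBelow-elim (x ∷ xs) (y ∷ ys) w {zero}  refl refl = <ᵇ-true⁻ (proj₁ (∧-true w))
  strictlyBelow-elim (x ∷ xs) (y ∷ ys) w {suc c} e    f    = strictlyBelow-elim xs ys (proj₂ (∧-true {x <ᵇ y} w)) {c} e f

  strictlyBelow-intro : ∀ xs ys → length ys ≤ length xs → (∀ c {a b} → nth xs c ≡ just a → nth ys c ≡ just b → a < b) → strictlyBelow xs ys ≡ true
  strictlyBelow-intro []       []       le       h = refl
  strictlyBelow-intro (x ∷ xs) []       le       h = refl
  strictlyBelow-intro (x ∷ xs) (y ∷ ys) (s≤s le) h = cong₂ _∧_ (<ᵇ-true (h 0 refl refl)) (strictlyBelow-intro xs ys le (λ c → h (suc c)))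

  RowsWeak ColsStrict : Tab → Set
  RowsWeak   M = ∀ r c {a b} → entryAt M (r , c) ≡ just a → entryAt M (r , suc c) ≡ just b → a ≤ b
  ColsStrict M = ∀ r c {a b} → entryAt M (r , c) ≡ just a → entryAt M (suc r , c) ≡ just b → a < b

  isSSYT-partition : ∀ M → isSSYT M ≡ true → isPartition (shape M) ≡ true
  isSSYT-partition M s = proj₁ (∧-true s)

  isSSYT-rows : ∀ M → isSSYT M ≡ true → RowsWeak M
  isSSYT-rows M s = go M (proj₁ (∧-true (proj₂ (∧-true {isPartition (shape M)} s))))
    where
    go : ∀ M → allᵇ weaklyIncr M ≡ true → RowsWeak M
    go (row ∷ M) w zero    c = weaklyIncr-elim row (proj₁ (∧-true w)) {c}
    go (row ∷ M) w (suc r) c = go M (proj₂ (∧-true {weaklyIncr row} w)) r c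

  isSSYT-cols : ∀ M → isSSYT M ≡ true → ColsStrict M
  isSSYT-cols M s = go M (proj₂ (∧-true {allᵇ weaklyIncr M} (proj₂ (∧-true {isPartition (shape M)} s))))
    where
    go : ∀ M → colsStrict M ≡ true → ColsStrict M
    go (row ∷ row′ ∷ M) w zero    c = strictlyBelow-elim row row′ (proj₁ (∧-true w)) {c}
    go (row ∷ row′ ∷ M) w (suc r) c = go (row′ ∷ M) (proj₂ (∧-true {strictlyBelow row row′} w)) r c

  isSSYT-intro : ∀ M → isPartition (shape M) ≡ true → RowsWeak M → ColsStrict M → isSSYT M ≡ true
  isSSYT-intro M p rw cs = cong₂ _∧_ p (cong₂ _∧_ (rows M rw) (cols M (proj₂ (∧-true {allᵇ (λ k → 0 <ᵇ k) (shape M)} p)) cs))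
    where
    rows : ∀ M → RowsWeak M → allᵇ weaklyIncr M ≡ true
    rows []        h = refl
    rows (row ∷ M) h = cong₂ _∧_ (weaklyIncr-intro row (h 0)) (rows M (λ r → h (suc r)))
    cols : ∀ M → weaklyDecr (shape M) ≡ true → ColsStrict M → colsStrict M ≡ true
    cols []               w h = refl
    cols (row ∷ [])       w h = refl
    cols (row ∷ row′ ∷ M) w h = cong₂ _∧_ (strictlyBelow-intro row row′ (≤ᵇ-true (proj₁ (∧-true w))) (h 0))
      (cols (row′ ∷ M) (proj₂ (∧-true {length row′ ≤ᵇ length row} w)) (λ r → h (suc r)))

  map-entryAt : (f : ℕ → ℕ) → ∀ T p → entryAt (map (map f) T) p ≡ Maybe.map f (entryAt T p)
  map-entryAt f []        p           = refl
  map-entryAt f (row ∷ T) (zero  , c) = go row c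
    where
    go : ∀ xs c → nth (map f xs) c ≡ Maybe.map f (nth xs c)
    go []       c       = refl
    go (x ∷ xs) zero    = refl
    go (x ∷ xs) (suc c) = go xs c
  map-entryAt f (row ∷ T) (suc r , c) = map-entryAt f T (r , c)

  map-entryAt-just : (f : ℕ → ℕ) → ∀ T {p a} → entryAt T p ≡ just a → entryAt (map (map f) T) p ≡ just (f a)
  map-entryAt-just f T {p} e = map-entryAt f T p ∙ cong (Maybe.map f) e

  map-entryAt-just⁻ : (f : ℕ → ℕ) → ∀ T {p b} → entryAt (map (map f) T) p ≡ just b → ∃ λ a → entryAt T p ≡ just a × b ≡ f a
  map-entryAt-just⁻ f T {p} e with entryAt T p | sym (map-entryAt f T p) ∙ e
  ... | just a | refl = a , refl , refl

  map-shape : (f : ℕ → ℕ) → ∀ T → shape (map (map f) T) ≡ shape T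
  map-shape f []        = refl
  map-shape f (row ∷ T) = cong₂ _∷_ (List.length-map f row) (map-shape f T)

  map-entries : (f : ℕ → ℕ) → ∀ T → entries (map (map f) T) ≡ map f (entries T)
  map-entries f T = List.concat-map T

  entryAt-shape : ∀ {T T′} → shape T ≡ shape T′ → ∀ {p a} → entryAt T p ≡ just a → ∃ λ b → entryAt T′ p ≡ just b
  entryAt-shape {row ∷ T} {row′ ∷ T′} e {zero  , c} eq = <-nth row′ (subst (c <_) (List.∷-injectiveˡ e) (nth-< row eq))
  entryAt-shape {row ∷ T} {row′ ∷ T′} e {suc r , c} eq = entryAt-shape {T} {T′} (List.∷-injectiveʳ e) {r , c} eq

  -- Indexing from 1, so that it can be mapped over the entries of a filling; the default is 0.
  at : Vec ℕ m → ℕ → ℕ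
  at α k with nth (toList α) (pred k)
  ... | just a  = a
  ... | nothing = 0

  at-idx : (α : Vec ℕ m) (i : Fin m) → at α (idx i) ≡ lookup α i
  at-idx α i rewrite nth-toList α i = refl

  module _ {T : Tab} (F : Filling m T) where

    open Filling F

    pMT-cell : ∀ {M} → shape M ≡ shape T → ∀ i → entryAt M (cell F i) ≡ just (lookup (pMT m M T) i)
    pMT-cell {M} e i with entryAt-shape {T} {M} (sym e) (entryAt-cell F i)
    ... | a , eq = eq ∙ cong just (sym (lookup-pMT M T i (posOf-cell F i) eq))

    pMT-SSYT : ∀ {M} → shape M ≡ shape T → isSSYT M ≡ true → SSYT (rowV m T) (colV m T) (pMT m M T)
    pMT-SSYT {M} e s = adjacent⇒RowWeak (diagram F) (pMT m M T) rows , cols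
      where
      α = pMT m M T
      rows : ∀ x y → lookup (rowV m T) x ≡ lookup (rowV m T) y → lookup (colV m T) y ≡ suc (lookup (colV m T) x) → lookup α x ≤ lookup α y
      rows x y e₁ e₂ = isSSYT-rows M s (lookup (rowV m T) x) (lookup (colV m T) x) (pMT-cell e x)
        (subst (λ p → entryAt M p ≡ just (lookup α y)) (cong₂ _,_ (sym e₁) e₂) (pMT-cell e y))
      strict : ∀ k x y → lookup (colV m T) x ≡ lookup (colV m T) y → lookup (rowV m T) y ≡ suc (lookup (rowV m T) x) + k → lookup α x < lookup α y
      strict zero x y e₁ e₂ = isSSYT-cols M s (lookup (rowV m T) x) (lookup (colV m T) x) (pMT-cell e x)
        (subst (λ p → entryAt M p ≡ just (lookup α y)) (cong₂ _,_ (e₂ ∙ ℕ.+-identityʳ _) (sym e₁)) (pMT-cell e y))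
      strict (suc k) x y e₁ e₂ with up (diagram F) y (e₂ ∙ ℕ.+-suc _ k)
      ... | z , f₁ , f₂ = ℕ.<-trans (strict k x z (e₁ ∙ sym f₂) f₁) (strict zero z y f₂ (e₂ ∙ ℕ.+-suc _ k ∙ cong suc (sym f₁) ∙ sym (ℕ.+-identityʳ _)))
      cols : ColStrict (rowV m T) (colV m T) α
      cols x y e₁ lt = strict (lookup (rowV m T) y ∸ suc (lookup (rowV m T) x)) x y e₁ (sym (ℕ.m+[n∸m]≡n lt))

    -- Inverse to `pMT`, which turns a tableau on the shape of `T` into its exponent vector.
    fill : Vec ℕ m → Tab
    fill α = map (map (at α)) T

    fill-shape : ∀ α → shape (fill α) ≡ shape T
    fill-shape α = map-shape (at α) T

    fill-cell : ∀ α i → entryAt (fill α) (cell F i) ≡ just (lookup α i)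
    fill-cell α i = map-entryAt-just (at α) T (entryAt-cell F i) ∙ cong just (at-idx α i)

    pMT-fill : ∀ α → pMT m (fill α) T ≡ α
    pMT-fill α = vec-ext λ i → lookup-pMT (fill α) T i (posOf-cell F i) (fill-cell α i)

    fill-entries : ∀ α → entries (fill α) ↭ toList α
    fill-entries α = ↭-trans (↭-reflexive (map-entries (at α) T)) (↭-trans (↭.map⁺ (at α) numbers) (↭-reflexive
      (cong (map (at α)) (oneTo≡ m) ∙ sym (Vec.toList-map (at α) (tabulate idx)) ∙
       cong toList (vec-ext {β = α} λ i → Vec.lookup-map i (at α) (tabulate idx) ∙ cong (at α) (Vec.lookup∘tabulate idx i) ∙ at-idx α i))))

    private
      fill-cell⁻ : ∀ α {p a} → entryAt (fill α) p ≡ just a → ∃ λ i → cell F i ≡ p × a ≡ lookup α i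
      fill-cell⁻ α {p} e with map-entryAt-just⁻ (at α) T {p} e
      ... | b , e′ , refl with cell-entryAt F e′
      ... | i , refl , eq = i , eq , at-idx α i

    fill-SSYT : ∀ α → SSYT (rowV m T) (colV m T) α → isSSYT (fill α) ≡ true
    fill-SSYT α (w , s) = isSSYT-intro (fill α) (cong isPartition (fill-shape α) ∙ partition) rows cols
      where
      rows : RowsWeak (fill α)
      rows r c e f with fill-cell⁻ α {r , c} e | fill-cell⁻ α {r , suc c} f
      ... | i , p , refl | j , q , refl = w i j (cong proj₁ p ∙ sym (cong proj₁ q)) (subst₂ _<_ (sym (cong proj₂ p)) (sym (cong proj₂ q)) (ℕ.n<1+n c))
      cols : ColsStrict (fill α)
      cols r c e f with fill-cell⁻ α {r , c} e | fill-cell⁻ α {suc r , c} f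
      ... | i , p , refl | j , q , refl = s i j (cong proj₂ p ∙ sym (cong proj₂ q)) (subst₂ _<_ (sym (cong proj₁ p)) (sym (cong proj₁ q)) (ℕ.n<1+n r))

  private
    rowOfF : (ℕ → Maybe ℕ) → ℕ → List ℕ
    rowOfF g zero    = []
    rowOfF g (suc k) with g 0
    ... | nothing = []
    ... | just a  = a ∷ rowOfF (g ∘ suc) k

    Closed : (ℕ → Maybe ℕ) → Set
    Closed g = ∀ c {a} → g (suc c) ≡ just a → ∃ λ b → g c ≡ just b

    closed-0 : ∀ {g} → Closed g → g 0 ≡ nothing → ∀ c → g c ≡ nothing
    closed-0 {g} cl e zero = e
    closed-0 {g} cl e (suc c) with g (suc c) in e′
    ... | nothing = refl
    ... | just a with cl c e′
    ... | b , f = contradiction (sym f ∙ closed-0 cl e c) λ ()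

    nth-rowOfF : ∀ g B → Closed g → (∀ c → B ≤ c → g c ≡ nothing) → ∀ c → nth (rowOfF g B) c ≡ g c
    nth-rowOfF g zero    cl bd c = sym (bd c z≤n)
    nth-rowOfF g (suc B) cl bd c with g 0 in e
    ... | nothing = sym (closed-0 cl e c)
    nth-rowOfF g (suc B) cl bd zero    | just a = sym e
    nth-rowOfF g (suc B) cl bd (suc c) | just a = nth-rowOfF (g ∘ suc) B (λ c → cl (suc c)) (λ c p → bd (suc c) (s≤s p)) c

    rowOfF-pos : ∀ g {B a} → g 0 ≡ just a → (0 <ᵇ length (rowOfF g (suc B))) ≡ true
    rowOfF-pos g e with g 0
    rowOfF-pos g e | just _ = refl

  -- The two numbers bound rows and columns and serve as fuel. Rows, and the tableau, end at the
  -- first missing entry, which is correct for a down-closed support.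
  tabOf : (ℕ → ℕ → Maybe ℕ) → ℕ → ℕ → Tab
  tabOf f zero    B = []
  tabOf f (suc R) B with f 0 0
  ... | nothing = []
  ... | just _  = rowOfF (f 0) B ∷ tabOf (f ∘ suc) R B

  nth-length : (xs ys : List C) → (∀ c {a} → nth ys c ≡ just a → ∃ λ b → nth xs c ≡ just b) → length ys ≤ length xs
  nth-length xs       []       h = z≤n
  nth-length []       (y ∷ ys) h with h 0 refl
  ... | _ , ()
  nth-length (x ∷ xs) (y ∷ ys) h = s≤s (nth-length xs ys (λ c → h (suc c)))

  record DownClosed (f : ℕ → ℕ → Maybe ℕ) (R B : ℕ) : Set where
    field
      leftC  : ∀ r c {a} → f r (suc c) ≡ just a → ∃ λ b → f r c ≡ just b
      upC    : ∀ r c {a} → f (suc r) c ≡ just a → ∃ λ b → f r c ≡ just b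
      boundR : ∀ r c {a} → f r c ≡ just a → r < R
      boundC : ∀ r c {a} → f r c ≡ just a → c < B

  open DownClosed

  private
    no-just : ∀ {m : Maybe ℕ} → (∀ {a} → m ≢ just a) → m ≡ nothing
    no-just {nothing} h = refl
    no-just {just a}  h = contradiction refl h

    shiftD : ∀ {f R B} → DownClosed f (suc R) B → DownClosed (f ∘ suc) R B
    shiftD d = record { leftC = λ r → leftC d (suc r) ; upC = λ r → upC d (suc r)
                      ; boundR = λ r c e → ℕ.≤-pred (boundR d (suc r) c e) ; boundC = λ r → boundC d (suc r) }

  entryAt-tabOf : ∀ {f R B} → DownClosed f R B → ∀ r c → entryAt (tabOf f R B) (r , c) ≡ f r c
  entryAt-tabOf {f} {zero}  {B} d r c = sym (no-just λ e → contradiction (boundR d r c e) λ ())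
  entryAt-tabOf {f} {suc R} {B} d r c with f 0 0 in e
  ... | nothing = sym (no-just λ e′ → contradiction (e₀ r e′) λ ())
    where
    e₀ : ∀ r {c a} → f r c ≡ just a → just 0 ≡ nothing
    e₀ zero    {c} e′ = contradiction (sym e′ ∙ closed-0 (leftC d 0) e c) λ ()
    e₀ (suc r) {c} e′ = e₀ r (proj₂ (upC d r c e′))
  entryAt-tabOf {f} {suc R} {B} d zero c | just _ = nth-rowOfF (f 0) B (leftC d 0) (λ c p → no-just λ e′ → contradiction (boundC d 0 c e′) (ℕ.≤⇒≯ p)) c
  entryAt-tabOf {f} {suc R} {B} d (suc r) c | just _ = entryAt-tabOf (shiftD d) r c

  tabOf-partition : ∀ {f R B} → DownClosed f R B → isPartition (shape (tabOf f R B)) ≡ true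
  tabOf-partition d = cong₂ _∧_ (pos d) (decr d)
    where
    pos : ∀ {f R B} → DownClosed f R B → allᵇ (λ k → 0 <ᵇ k) (shape (tabOf f R B)) ≡ true
    pos {f} {zero}          d = refl
    pos {f} {suc R} {zero}  d with f 0 0 in e
    ... | nothing = refl
    ... | just _  = contradiction (boundC d 0 0 e) λ ()
    pos {f} {suc R} {suc B} d with f 0 0 in e
    ... | nothing = refl
    ... | just _  = cong₂ _∧_ (rowOfF-pos (f 0) e) (pos (shiftD d))
    decr : ∀ {f R B} → DownClosed f R B → weaklyDecr (shape (tabOf f R B)) ≡ true
    decr {f} {zero}  d = refl
    decr {f} {suc R} {B} d with f 0 0 in e
    ... | nothing = refl
    ... | just _ with tabOf (f ∘ suc) R B in e′ | decr (shiftD d)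
    ... | []      | _ = refl
    ... | row ∷ T | w = cong₂ _∧_ (true-≤ᵇ (nth-length (rowOfF (f 0) B) row lem)) w
      where
      lem : ∀ c {a} → nth row c ≡ just a → ∃ λ b → nth (rowOfF (f 0) B) c ≡ just b
      lem c eq with upC d 0 c (sym (entryAt-tabOf (shiftD d) 0 c) ∙ cong (λ T → entryAt T (0 , c)) e′ ∙ eq)
      ... | b , g = b , nth-rowOfF (f 0) B (leftC d 0) (λ c p → no-just λ e′ → contradiction (boundC d 0 c e′) (ℕ.≤⇒≯ p)) c ∙ g

  entryAt-unique : ∀ T → (∀ p q {a} → entryAt T p ≡ just a → entryAt T q ≡ just a → p ≡ q) → Unique (entries T)
  entryAt-unique []        h = []
  entryAt-unique (row ∷ T) h = Unique.++⁺ (nth-unique⁻ row (λ i j e f → cong proj₂ (h (0 , i) (0 , j) e f)))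
      (entryAt-unique T (λ (r , c) (s , d) e f → lem (h (suc r , c) (suc s , d) e f)))
      λ (p , q) → let i , e = ∈-nth p ; (r , c) , f = ∈-entryAt T q in contradiction (cong proj₁ (h (0 , i) (suc r , c) e f)) λ ()
    where
    lem : ∀ {r c s d : ℕ} → (suc r , c) ≡ (suc s , d) → (r , c) ≡ (s , d)
    lem refl = refl
    nth-unique⁻ : (xs : List ℕ) → (∀ i j {a} → nth xs i ≡ just a → nth xs j ≡ just a → i ≡ j) → Unique xs
    nth-unique⁻ []       h = []
    nth-unique⁻ (x ∷ xs) h = All.tabulate (λ { p refl → let i , e = ∈-nth p in contradiction (h 0 (suc i) refl e) λ () }) ∷
      nth-unique⁻ xs (λ i j e f → ℕ.suc-injective (h (suc i) (suc j) e f))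

open Tableaux

-- Fillings with prescribed columns

module Fibres where

  private variable
    m : ℕ

  private
    -- Classes of equal label. The number is fuel; the length of the list suffices.
    groups : (ℕ → ℕ) → ℕ → List ℕ → Tab
    groups ℓ zero    xs       = []
    groups ℓ (suc k) []       = []
    groups ℓ (suc k) (x ∷ xs) = (x ∷ filterᵇ (λ y → ℓ y ≡ᵇ ℓ x) xs) ∷ groups ℓ k (filterᵇ (λ y → not (ℓ y ≡ᵇ ℓ x)) xs)

    ∈-filterᵇ⁻ : ∀ {A : Set} (p : A → Bool) {xs x} → x ∈ filterᵇ p xs → x ∈ xs × p x ≡ true
    ∈-filterᵇ⁻ p {xs} q with ∈.∈-filter⁻ (𝔹.T? ∘ p) {xs = xs} q
    ... | r , t = r , 𝔹.T-≡ .Equivalence.to t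

    filterᵇ-↭ : ∀ {A : Set} (p : A → Bool) xs → filterᵇ p xs ++ filterᵇ (not ∘ p) xs ↭ xs
    filterᵇ-↭ p [] = refl
    filterᵇ-↭ p (x ∷ xs) with p x
    ... | true  = prep x (filterᵇ-↭ p xs)
    ... | false = ↭-trans (↭.shift x (filterᵇ p xs) _) (prep x (filterᵇ-↭ p xs))

    groups-↭ : ∀ ℓ k xs → length xs ≤ k → concat (groups ℓ k xs) ↭ xs
    groups-↭ ℓ zero    []       le       = refl
    groups-↭ ℓ (suc k) []       le       = refl
    groups-↭ ℓ (suc k) (x ∷ xs) (s≤s le) = prep x (↭-trans (↭.++⁺ˡ (filterᵇ (λ y → ℓ y ≡ᵇ ℓ x) xs)
      (groups-↭ ℓ k _ (ℕ.≤-trans (List.length-filter (𝔹.T? ∘ λ y → not (ℓ y ≡ᵇ ℓ x)) xs) le))) (filterᵇ-↭ (λ y → ℓ y ≡ᵇ ℓ x) xs))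

    groups-⊆ : ∀ ℓ k xs {row a} → row ∈ groups ℓ k xs → a ∈ row → a ∈ xs
    groups-⊆ ℓ (suc k) (x ∷ xs) (here refl) (here refl) = here refl
    groups-⊆ ℓ (suc k) (x ∷ xs) (here refl) (there q)   = there (proj₁ (∈-filterᵇ⁻ (λ y → ℓ y ≡ᵇ ℓ x) q))
    groups-⊆ ℓ (suc k) (x ∷ xs) (there p)   q           = there (proj₁ (∈-filterᵇ⁻ (λ y → not (ℓ y ≡ᵇ ℓ x)) (groups-⊆ ℓ k _ p q)))

    Homogeneous : (ℕ → ℕ) → List ℕ → Set
    Homogeneous ℓ row = ∀ a b → a ∈ row → b ∈ row → ℓ a ≡ ℓ b

    Apart : (ℕ → ℕ) → List ℕ → List ℕ → Set
    Apart ℓ row row′ = ∀ a b → a ∈ row → b ∈ row′ → ℓ a ≢ ℓ b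

    head-label : (ℓ : ℕ → ℕ) (x : ℕ) (xs : List ℕ) {a : ℕ} → a ∈ x ∷ filterᵇ (λ y → ℓ y ≡ᵇ ℓ x) xs → ℓ a ≡ ℓ x
    head-label ℓ x xs (here refl) = refl
    head-label ℓ x xs (there p)   = ≡ᵇ-true (proj₂ (∈-filterᵇ⁻ (λ y → ℓ y ≡ᵇ ℓ x) {xs} p))

    groups-homogeneous : ∀ ℓ k xs → All (Homogeneous ℓ) (groups ℓ k xs)
    groups-homogeneous ℓ zero    xs       = []
    groups-homogeneous ℓ (suc k) []       = []
    groups-homogeneous ℓ (suc k) (x ∷ xs) = (λ a b p q → head-label ℓ x xs {a} p ∙ sym (head-label ℓ x xs {b} q)) ∷ groups-homogeneous ℓ k _

    groups-nonEmpty : ∀ ℓ k xs → All (λ row → (0 <ᵇ length row) ≡ true) (groups ℓ k xs)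
    groups-nonEmpty ℓ zero    xs       = []
    groups-nonEmpty ℓ (suc k) []       = []
    groups-nonEmpty ℓ (suc k) (x ∷ xs) = refl ∷ groups-nonEmpty ℓ k _

    groups-apart : ∀ ℓ k xs → AllPairs (Apart ℓ) (groups ℓ k xs)
    groups-apart ℓ zero    xs       = []
    groups-apart ℓ (suc k) []       = []
    groups-apart ℓ (suc k) (x ∷ xs) = All.tabulate (λ p a b a∈ b∈ e → lem (proj₂ (∈-filterᵇ⁻ (λ y → not (ℓ y ≡ᵇ ℓ x)) {xs} (groups-⊆ ℓ k _ p b∈)))
        (sym e ∙ head-label ℓ x xs {a} a∈)) ∷ groups-apart ℓ k _
      where
      lem : ∀ {b} → not (ℓ b ≡ᵇ ℓ x) ≡ true → ℓ b ≢ ℓ x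
      lem {b} e e′ with () ← sym e ∙ cong not (cong (_≡ᵇ ℓ x) e′ ∙ ≡ᵇ-refl (ℓ x))

    insertR : List ℕ → Tab → Tab
    insertR xs []       = xs ∷ []
    insertR xs (ys ∷ T) with length ys ≤ᵇ length xs
    ... | true  = xs ∷ ys ∷ T
    ... | false = ys ∷ insertR xs T

    sortR : Tab → Tab
    sortR []       = []
    sortR (xs ∷ T) = insertR xs (sortR T)

    insertR-↭ : ∀ xs T → insertR xs T ↭ xs ∷ T
    insertR-↭ xs []       = refl
    insertR-↭ xs (ys ∷ T) with length ys ≤ᵇ length xs
    ... | true  = refl
    ... | false = ↭-trans (prep ys (insertR-↭ xs T)) (swap ys xs refl)

    sortR-↭ : ∀ T → sortR T ↭ T
    sortR-↭ []       = refl
    sortR-↭ (xs ∷ T) = ↭-trans (insertR-↭ xs (sortR T)) (prep xs (sortR-↭ T))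

    ≤ᵇ-false : ∀ {a b} → (a ≤ᵇ b) ≡ false → b ≤ a
    ≤ᵇ-false {a} {b} e = ℕ.<⇒≤ (ℕ.≰⇒> λ le → contradiction (sym (true-≤ᵇ le) ∙ e) λ ())

    insertR-decr : ∀ xs T → weaklyDecr (shape T) ≡ true → weaklyDecr (shape (insertR xs T)) ≡ true
    insertR-decr xs []       w = refl
    insertR-decr xs (ys ∷ T) w with length ys ≤ᵇ length xs in e
    ... | true  = cong₂ _∧_ e w
    insertR-decr xs (ys ∷ [])     w | false = cong₂ _∧_ (true-≤ᵇ (≤ᵇ-false {length ys} {length xs} e)) refl
    insertR-decr xs (ys ∷ zs ∷ T) w | false with length zs ≤ᵇ length xs | insertR-decr xs (zs ∷ T) (proj₂ (∧-true {length zs ≤ᵇ length ys} w))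
    ... | true  | w′ = cong₂ _∧_ (true-≤ᵇ (≤ᵇ-false {length ys} {length xs} e)) w′
    ... | false | w′ = cong₂ _∧_ (proj₁ (∧-true w)) w′

    sortR-decr : ∀ T → weaklyDecr (shape (sortR T)) ≡ true
    sortR-decr []       = refl
    sortR-decr (xs ∷ T) = insertR-decr xs (sortR T) (sortR-decr T)

    AllPairs-resp-↭ : ∀ {A : Set} {R : A → A → Set} → (∀ {x y} → R x y → R y x) → ∀ {xs ys} → xs ↭ ys → AllPairs R xs → AllPairs R ys
    AllPairs-resp-↭ s refl u = u
    AllPairs-resp-↭ s (prep x p) (q ∷ u) = ↭.All-resp-↭ p q ∷ AllPairs-resp-↭ s p u
    AllPairs-resp-↭ s (swap x y p) ((r ∷ q) ∷ (q′ ∷ u)) = (s r ∷ ↭.All-resp-↭ p q′) ∷ ↭.All-resp-↭ p q ∷ AllPairs-resp-↭ s p u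
    AllPairs-resp-↭ s (trans p q) u = AllPairs-resp-↭ s q (AllPairs-resp-↭ s p u)

    concat-↭ : {T T′ : Tab} → T ↭ T′ → concat T ↭ concat T′
    concat-↭ refl         = refl
    concat-↭ (prep x p)   = ↭.++⁺ˡ x (concat-↭ p)
    concat-↭ (swap x y p) = ↭-trans (↭.++⁺ˡ x (↭.++⁺ˡ y (concat-↭ p))) (↭.shifts x y)
    concat-↭ (trans p q)  = ↭-trans (concat-↭ p) (concat-↭ q)

    nth-All : ∀ {A : Set} {P : A → Set} {xs} → All P xs → ∀ i {x} → nth xs i ≡ just x → P x
    nth-All (p ∷ ps) zero    refl = p
    nth-All (p ∷ ps) (suc i) e    = nth-All ps i e

    nth-AllPairs : ∀ {A : Set} {R : A → A → Set} {xs} → (∀ {x y} → R x y → R y x) → AllPairs R xs →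
                   ∀ i j {x y} → i ≢ j → nth xs i ≡ just x → nth xs j ≡ just y → R x y
    nth-AllPairs s (p ∷ ps) zero    zero    ne e    f    = contradiction refl ne
    nth-AllPairs s (p ∷ ps) zero    (suc j) ne refl f    = nth-All p j f
    nth-AllPairs s (p ∷ ps) (suc i) zero    ne e    refl = s (nth-All p i e)
    nth-AllPairs s (p ∷ ps) (suc i) (suc j) ne e    f    = nth-AllPairs s ps i j (ne ∘ cong suc) e f

    entryAt-row : ∀ T r {c a} → entryAt T (r , c) ≡ just a → ∃ λ row → nth T r ≡ just row × a ∈ row
    entryAt-row (row ∷ T) zero    e = row , refl , nth-∈ row e
    entryAt-row (row ∷ T) (suc r) e = entryAt-row T r e

    module Rows (c : Vec ℕ m) where

      ℓ : ℕ → ℕ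
      ℓ = at c

      G T′ : Tab
      G  = groups ℓ m (oneTo m)
      T′ = sortR G

      all-pos : ∀ {T} → All (λ row → (0 <ᵇ length row) ≡ true) T → allᵇ (λ k → 0 <ᵇ k) (shape T) ≡ true
      all-pos []       = refl
      all-pos (p ∷ ps) = cong₂ _∧_ p (all-pos ps)

      F′ : Filling m T′
      F′ = record
        { numbers   = ↭-trans (concat-↭ (sortR-↭ G)) (groups-↭ ℓ m (oneTo m) (ℕ.≤-reflexive (length-oneTo m)))
        ; partition = cong₂ _∧_ (all-pos (↭.All-resp-↭ (↭-sym (sortR-↭ G)) (groups-nonEmpty ℓ m (oneTo m)))) (sortR-decr G)
        }

      row⇒label : ∀ x y → lookup (rowV m T′) x ≡ lookup (rowV m T′) y → lookup c x ≡ lookup c y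
      row⇒label x y e with entryAt-row T′ _ (entryAt-cell F′ x) | entryAt-row T′ _ (entryAt-cell F′ y)
      ... | row , f , p | row′ , f′ , q with just-injective (sym f ∙ cong (nth T′) e ∙ f′)
      ... | refl = sym (at-idx c x) ∙ nth-All (↭.All-resp-↭ (↭-sym (sortR-↭ G)) (groups-homogeneous ℓ m (oneTo m))) (lookup (rowV m T′) x) f (idx x) (idx y) p q ∙ at-idx c y

      apart-sym : ∀ {r s} → Apart ℓ r s → Apart ℓ s r
      apart-sym h a b p q e = h b a q p (sym e)

      label⇒row : ∀ x y → lookup c x ≡ lookup c y → lookup (rowV m T′) x ≡ lookup (rowV m T′) y
      label⇒row x y e with lookup (rowV m T′) x ℕ.≟ lookup (rowV m T′) y
      ... | yes eq = eq
      ... | no  ne with entryAt-row T′ _ (entryAt-cell F′ x) | entryAt-row T′ _ (entryAt-cell F′ y)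
      ... | row , f , p | row′ , f′ , q = contradiction (at-idx c x ∙ e ∙ sym (at-idx c y))
              (nth-AllPairs {R = Apart ℓ} (λ {r} {s} → apart-sym {r} {s}) (AllPairs-resp-↭ (λ {r} {s} → apart-sym {r} {s}) (↭-sym (sortR-↭ G)) (groups-apart ℓ m (oneTo m))) _ _ ne f f′ (idx x) (idx y) p q)

  transposeTab : Tab → Tab
  transposeTab T = tabOf (λ r c → entryAt T (c , r)) (length (entries T)) (length T)

  module _ {T : Tab} (F : Filling m T) where

    private
      closed : DownClosed (λ r c → entryAt T (c , r)) (length (entries T)) (length T)
      closed = record
        { leftC  = λ r c e → entryAt-up T (Filling.decreasing F) {c} e
        ; upC    = λ r c e → entryAt-left T {c} e
        ; boundR = λ r c e → bound T {c} e
        ; boundC = λ r c e → rowBound T {c} e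
        }
        where
        bound : ∀ T {r c a} → entryAt T (r , c) ≡ just a → c < length (entries T)
        bound (row ∷ T) {zero}  {c} e = ℕ.<-≤-trans (nth-< row e) (ℕ.≤-trans (ℕ.m≤m+n _ _) (ℕ.≤-reflexive (sym (List.length-++ row))))
        bound (row ∷ T) {suc r} e = ℕ.<-≤-trans (bound T {r} e) (ℕ.≤-trans (ℕ.m≤n+m _ (length row)) (ℕ.≤-reflexive (sym (List.length-++ row))))
        rowBound : ∀ T {r c a} → entryAt T (r , c) ≡ just a → r < length T
        rowBound (row ∷ T) {zero}  e = z<s
        rowBound (row ∷ T) {suc r} e = s<s (rowBound T e)

      transpose-entry : ∀ r c → entryAt (transposeTab T) (r , c) ≡ entryAt T (c , r)
      transpose-entry = entryAt-tabOf closed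

    transpose-filling : Filling m (transposeTab T)
    transpose-filling = record
      { numbers = ↭-trans (unique-↭ (entryAt-unique (transposeTab T) uniq) (Filling.unique F)
          (λ p → let (r , c) , e = ∈-entryAt (transposeTab T) p in entryAt-∈ T {c} (sym (transpose-entry r c) ∙ e))
          (λ p → let (r , c) , e = ∈-entryAt T p in entryAt-∈ (transposeTab T) {c} (transpose-entry c r ∙ e))) (Filling.numbers F)
      ; partition = tabOf-partition closed }
      where
      uniq : ∀ p q {a} → entryAt (transposeTab T) p ≡ just a → entryAt (transposeTab T) q ≡ just a → p ≡ q
      uniq (r , c) (s , d) e f with entryAt-injective T (Filling.unique F) (sym (transpose-entry r c) ∙ e) (sym (transpose-entry s d) ∙ f)
      ... | refl = refl

    transpose-col : ∀ x → lookup (colV m (transposeTab T)) x ≡ lookup (rowV m T) x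
    transpose-col x = cong proj₁ (entryAt-injective T (Filling.unique F)
      (sym (transpose-entry _ _) ∙ entryAt-cell transpose-filling x) (entryAt-cell F x))

  -- The classes of `c`, sorted by size, are the rows of a Young diagram, and transposing makes them
  -- columns. Thus the antisymmetrizer of any set partition is the column antisymmetrizer of a
  -- tableau.
  fibre-filling : (c : Vec ℕ m) → ∃ λ T → Filling m T ×
    (∀ x y → lookup (colV m T) x ≡ lookup (colV m T) y → lookup c x ≡ lookup c y) ×
    (∀ x y → lookup c x ≡ lookup c y → lookup (colV m T) x ≡ lookup (colV m T) y)
  fibre-filling c = transposeTab T′ , transpose-filling F′ ,
      (λ x y e → row⇒label x y (sym (transpose-col F′ x) ∙ e ∙ transpose-col F′ y)) ,
      (λ x y e → transpose-col F′ x ∙ label⇒row x y e ∙ sym (transpose-col F′ y))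
    where open Rows c

open Fibres

-- Garnir relations and a measure of set partitions

module GarnirRelations where

  private variable
    m : ℕ

  unique-⊆-length : {A : Set} {xs ys : List A} → Unique xs → (∀ {x} → x ∈ xs → x ∈ ys) → length xs ≤ length ys
  unique-⊆-length []      h = z≤n
  unique-⊆-length {xs = x ∷ xs} (p ∷ u) h with ∈.∈-∃++ (h (here refl))
  ... | as , bs , refl = ℕ.≤-trans (s≤s (unique-⊆-length u sub)) (ℕ.≤-reflexive (sym (↭.↭-length (↭.shift x as bs))))
    where
    sub : ∀ {z} → z ∈ xs → z ∈ as ++ bs
    sub q with ↭.∈-resp-↭ (↭.shift x as bs) (h (there q))
    ... | here refl = contradiction refl (All.lookup p q)
    ... | there r   = r

  opaque
    fibre : Vec ℕ m → Fin m → List (Fin m)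
    fibre {m} c p = List.filter (λ y → lookup c y ℕ.≟ lookup c p) (List.allFin m)

    ∈-fibre⁻ : (c : Vec ℕ m) (p : Fin m) {y : Fin m} → y ∈ fibre c p → lookup c y ≡ lookup c p
    ∈-fibre⁻ {m} c p q = proj₂ (∈.∈-filter⁻ (λ y → lookup c y ℕ.≟ lookup c p) {xs = List.allFin m} q)

    ∈-fibre⁺ : (c : Vec ℕ m) (p : Fin m) {y : Fin m} → lookup c y ≡ lookup c p → y ∈ fibre c p
    ∈-fibre⁺ c p {y} e = ∈.∈-filter⁺ (λ y → lookup c y ℕ.≟ lookup c p) (∈.∈-allFin y) e

    fibre-unique : (c : Vec ℕ m) (p : Fin m) → Unique (fibre c p)
    fibre-unique {m} c p = Unique.filter⁺ (λ y → lookup c y ℕ.≟ lookup c p) (Unique.allFin⁺ m)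

  fib : Vec ℕ m → Fin m → ℕ
  fib c p = length (fibre c p)

  map-unique : {A B : Set} (g : A → B) {xs : List A} → Unique xs → (∀ {x y} → x ∈ xs → y ∈ xs → g x ≡ g y → x ≡ y) → Unique (map g xs)
  map-unique g []      inj = []
  map-unique g {x ∷ xs} (p ∷ u) inj = All.tabulate (λ q e → let y , r , e′ = ∈.∈-map⁻ g q in All.lookup p r (inj (here refl) (there r) (e ∙ e′))) ∷
    map-unique g u (λ q r → inj (there q) (there r))

  fib-≤ : (c : Vec ℕ m) (p : Fin m) (g : Fin m → ℕ) (a : ℕ) → (∀ y → lookup c y ≡ lookup c p → g y < a) →
          (∀ y z → lookup c y ≡ lookup c p → lookup c z ≡ lookup c p → g y ≡ g z → y ≡ z) → fib c p ≤ a
  fib-≤ c p g a bd inj = subst₂ _≤_ (List.length-map g (fibre c p)) (List.length-upTo a)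
    (unique-⊆-length (map-unique g (fibre-unique c p) (λ q r → inj _ _ (∈-fibre⁻ c p q) (∈-fibre⁻ c p r)))
      λ q → let y , r , e = ∈.∈-map⁻ g q in subst (_∈ upTo a) (sym e) (∈.∈-upTo⁺ (bd y (∈-fibre⁻ c p r))))

  fib-≥ : ∀ {n} (c : Vec ℕ m) (p : Fin m) (f : Fin n → Fin m) → (∀ i → lookup c (f i) ≡ lookup c p) → (∀ i j → f i ≡ f j → i ≡ j) → n ≤ fib c p
  fib-≥ {n = n} c p f h inj = subst (_≤ fib c p) (List.length-map f (List.allFin n) ∙ List.length-tabulate id)
    (unique-⊆-length (Unique.map⁺ {f = f} (λ {i} {j} → inj i j) (Unique.allFin⁺ n))
      λ q → let i , _ , e = ∈.∈-map⁻ f q in subst (_∈ fibre c p) (sym e) (∈-fibre⁺ c p (h i)))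

  fib-cong : (c c′ : Vec ℕ m) (p : Fin m) → (∀ y → lookup c y ≡ lookup c p → lookup c′ y ≡ lookup c′ p) → fib c p ≤ fib c′ p
  fib-cong c c′ p h = unique-⊆-length (fibre-unique c p) λ q → ∈-fibre⁺ c′ p (h _ (∈-fibre⁻ c p q))

  -- The exponential weight makes the largest classes decisive. Replacing the columns of a diagram
  -- by a Garnir labelling raises `μ`, so it can serve for induction.
  μ : Vec ℕ m → ℕ
  μ {m} c = sumF λ p → suc m ^ fib c p

  μ-bound : (c : Vec ℕ m) → μ c ≤ sumF {m} (λ _ → suc m ^ m)
  μ-bound {m} c = sumF-mono λ p → ℕ.^-monoʳ-≤ (suc m) (fib-≤ c p toℕ m (λ y _ → Fin.toℕ<n y) (λ y z _ _ e → Fin.toℕ-injective e))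

  μ-mono : (c c′ : Vec ℕ m) → (∀ x y → lookup c x ≡ lookup c y → lookup c′ x ≡ lookup c′ y) → μ c ≤ μ c′
  μ-mono c c′ h = sumF-mono λ p → ℕ.^-monoʳ-≤ _ (fib-cong c c′ p (λ y → h y p))

  sumF-const : (k : ℕ) → sumF {m} (λ _ → k) ≡ m * k
  sumF-const {zero}  k = sumF-0 λ ()
  sumF-const {suc m} k = sumF-suc (λ _ → k) ∙ cong (_+_ k) (sumF-const {m} k)
    where
    opaque
      unfolding sumF
      sumF-suc : (f : Fin (suc m) → ℕ) → sumF f ≡ f zero + sumF (f ∘ suc)
      sumF-suc f = refl

  opaque
    unfolding sumF
    sumF-+ : (f g : Fin m → ℕ) → sumF (λ i → f i + g i) ≡ sumF f + sumF g
    sumF-+ {zero}  f g = refl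
    sumF-+ {suc m} f g = cong ((f zero + g zero) +_) (sumF-+ (f ∘ suc) (g ∘ suc)) ∙
      solve 4 (λ a b c d → (a :+ b) :+ (c :+ d) := (a :+ c) :+ (b :+ d)) refl (f zero) (g zero) (sumF (f ∘ suc)) (sumF (g ∘ suc))
      where open ℕSolver.+-*-Solver

  -- Fewer than suc m values below B ^ a are outweighed by a single B ^ suc a,
  -- where B = suc m.
  μ-< : (c c′ : Vec ℕ m) (x : Fin m) (a : ℕ) (S : Fin m → Set) → (∀ p → Dec (S p)) → S x →
        (∀ p → S p → fib c p ≤ a) → (∀ p → ¬ S p → fib c p ≤ fib c′ p) → suc a ≤ fib c′ x → μ c < μ c′
  μ-< {m} c c′ x a S S? Sx le le′ big = ℕ.<-≤-trans (ℕ.≤-<-trans (sumF-mono below)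
      (subst (_< sumF h + suc m ^ suc a) (sym (sumF-+ h (λ _ → suc m ^ a) ∙ cong (sumF h +_) (sumF-const {m} (suc m ^ a))))
        (ℕ.+-monoʳ-< (sumF h) (ℕ.*-monoˡ-< (suc m ^ a) {{ℕ.m^n≢0 (suc m) a}} (ℕ.n<1+n m)))))
      (subst (_≤ μ c′) (sumF-+ h single ∙ cong (sumF h +_) (sumF-single single x (λ i ne → off i ne) ∙ on)) (sumF-mono above))
    where
    h single : Fin m → ℕ
    h p with S? p
    ... | yes _ = 0
    ... | no  _ = suc m ^ fib c p
    single p with p Fin.≟ x
    ... | yes _ = suc m ^ suc a
    ... | no  _ = 0
    on : single x ≡ suc m ^ suc a
    on with x Fin.≟ x
    ... | yes _ = refl
    ... | no ne = contradiction refl ne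
    off : ∀ i → i ≢ x → single i ≡ 0
    off i ne with i Fin.≟ x
    ... | yes e = contradiction e ne
    ... | no  _ = refl
    below : ∀ p → suc m ^ fib c p ≤ h p + suc m ^ a
    below p with S? p
    ... | yes s = ℕ.^-monoʳ-≤ (suc m) (le p s)
    ... | no  _ = ℕ.m≤m+n _ _
    above : ∀ p → h p + single p ≤ suc m ^ fib c′ p
    above p with S? p | p Fin.≟ x
    ... | yes _ | yes refl = ℕ.^-monoʳ-≤ (suc m) big
    ... | yes _ | no _     = z≤n
    ... | no ns | yes refl = contradiction Sx ns
    ... | no ns | no _     = ℕ.≤-trans (ℕ.≤-reflexive (ℕ.+-identityʳ _)) (ℕ.^-monoʳ-≤ (suc m) (le′ p ns))

  module Garnir {r k : Vec ℕ m} (D : Diagram r k) (x y : Fin m) (rx≡ry : lookup r x ≡ lookup r y) (ky : lookup k y ≡ suc (lookup k x)) where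

    private
      Dᵀ = transpose D

    -- The Garnir set of x and y.
    InX : Fin m → Set
    InX p = (lookup k p ≡ lookup k x × lookup r x ≤ lookup r p) ⊎ (lookup k p ≡ lookup k y × lookup r p ≤ lookup r x)

    inX? : ∀ p → Dec (InX p)
    inX? p = ((lookup k p ℕ.≟ lookup k x) ×-dec (lookup r x ≤? lookup r p)) ⊎-dec ((lookup k p ℕ.≟ lookup k y) ×-dec (lookup r p ≤? lookup r x))

    InCols : Fin m → Set
    InCols p = lookup k p ≡ lookup k x ⊎ lookup k p ≡ lookup k y

    X⊆Cols : ∀ {p} → InX p → InCols p
    X⊆Cols (inj₁ (e , _)) = inj₁ e
    X⊆Cols (inj₂ (e , _)) = inj₂ e

    private
      glabel : Fin m → ℕ
      glabel p with inX? p
      ... | yes _ = 0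
      ... | no  _ = suc (lookup k p)

      glabel-case : ∀ p → (InX p × glabel p ≡ 0) ⊎ (¬ InX p × glabel p ≡ suc (lookup k p))
      glabel-case p with inX? p
      ... | yes q = inj₁ (q , refl)
      ... | no  q = inj₂ (q , refl)

    -- The Garnir set is one class; the other classes are what remains of the columns. Labelling all
    -- boxes makes the Garnir antisymmetrizer an instance of `κ`.
    gl : Vec ℕ m
    gl = tabulate glabel

    gl-case : ∀ p → (InX p × lookup gl p ≡ 0) ⊎ (¬ InX p × lookup gl p ≡ suc (lookup k p))
    gl-case p with glabel-case p
    ... | inj₁ (q , e) = inj₁ (q , Vec.lookup∘tabulate glabel p ∙ e)
    ... | inj₂ (q , e) = inj₂ (q , Vec.lookup∘tabulate glabel p ∙ e)

    gl-in : ∀ {p} → InX p → lookup gl p ≡ 0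
    gl-in {p} q with gl-case p
    ... | inj₁ (_ , e)  = e
    ... | inj₂ (nq , _) = contradiction q nq

    gl-out : ∀ {p q} → lookup gl p ≡ lookup gl q → (InX p × InX q) ⊎ (¬ InX p × ¬ InX q × lookup k p ≡ lookup k q)
    gl-out {p} {q} e with gl-case p | gl-case q
    ... | inj₁ (i , _)  | inj₁ (j , _)  = inj₁ (i , j)
    ... | inj₁ (_ , e₁) | inj₂ (_ , e₂) = contradiction (sym e₁ ∙ e ∙ e₂) λ ()
    ... | inj₂ (_ , e₁) | inj₁ (_ , e₂) = contradiction (sym e₂ ∙ sym e ∙ e₁) λ ()
    ... | inj₂ (i , e₁) | inj₂ (j , e₂) = inj₂ (i , j , ℕ.suc-injective (sym e₁ ∙ e ∙ e₂))

    private
      -- Found by walking down the column of `x` as far as possible. The row of this box gives the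
      -- height `a` of the column, and the column of `y`, further right, is not higher.
      bottom : ∃ λ b → lookup k b ≡ lookup k x × (∀ p → lookup k p ≡ lookup k x → lookup r p ≤ lookup r b)
      bottom = go x refl (<-wellFounded _)
        where
        go : ∀ b → lookup k b ≡ lookup k x → Acc _<_ (sumF (lookup r) ∸ lookup r b) →
             ∃ λ b → lookup k b ≡ lookup k x × (∀ p → lookup k p ≡ lookup k x → lookup r p ≤ lookup r b)
        go b e (acc rs) with Fin.any? (λ q → (lookup k q ℕ.≟ lookup k x) ×-dec (lookup r q ℕ.≟ suc (lookup r b)))
        ... | yes (q , e₁ , e₂) = go q e₁ (rs (ℕ.∸-monoʳ-< (ℕ.≤-reflexive (sym e₂)) (≤-sumF (lookup r) q)))
        ... | no none = b , e , λ p e′ → ℕ.≮⇒≥ λ lt → let q , e₁ , e₂ = leftwards Dᵀ p lt in none (q , e₂ ∙ e′ , e₁)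

      b = proj₁ bottom

      a : ℕ
      a = suc (lookup r b)

      row<a : ∀ p → InCols p → lookup r p < a
      row<a p (inj₁ e) = s≤s (proj₂ (proj₂ bottom) p e)
      row<a p (inj₂ e) with left D p (e ∙ ky)
      ... | q , e₁ , e₂ = s≤s (subst (_≤ lookup r b) e₂ (proj₂ (proj₂ bottom) q e₁))

      -- InX has more boxes than there are rows.
      box : (t : Fin (suc a)) → ∃ λ p →
            (toℕ t ≤ lookup r x × lookup k p ≡ lookup k y × lookup r p ≡ toℕ t) ⊎
            (lookup r x < toℕ t × lookup k p ≡ lookup k x × suc (lookup r p) ≡ toℕ t)
      -- The column of `y` is used down to the row of `x`, the column of `x` from that row on. The
      -- row of `x` thus counts twice, which gives one box more than there are rows.
      box t with toℕ t ≤? lookup r x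
      ... | yes le with leftwards Dᵀ y (subst (toℕ t ≤_) rx≡ry le)
      ... | p , e₁ , e₂ = p , inj₁ (le , e₂ , e₁)
      box zero    | no nle = contradiction z≤n nle
      box (suc t) | no nle with leftwards Dᵀ b (ℕ.≤-pred (Fin.toℕ<n t))
      ... | p , e₁ , e₂ = p , inj₂ (ℕ.≰⇒> nle , e₂ ∙ proj₁ (proj₂ bottom) , cong suc e₁)

      f : Fin (suc a) → Fin m
      f t = proj₁ (box t)

      f-X : ∀ t → InX (f t)
      f-X t with box t
      ... | p , inj₁ (le , e₁ , e₂) = inj₂ (e₁ , subst (_≤ lookup r x) (sym e₂) le)
      ... | p , inj₂ (lt , e₁ , e₂) = inj₁ (e₁ , ℕ.≤-pred (subst (suc (lookup r x) ≤_) (sym e₂) lt))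

      kx≢ky : lookup k x ≢ lookup k y
      kx≢ky e = ℕ.1+n≢n (sym ky ∙ sym e)

      f-inj : ∀ s t → f s ≡ f t → s ≡ t
      f-inj s t e with box s | box t
      f-inj s t refl | p , inj₁ (_ , _ , e₂)  | q , inj₁ (_ , _ , f₂)  = Fin.toℕ-injective (sym e₂ ∙ f₂)
      f-inj s t refl | p , inj₁ (_ , e₁ , _)  | q , inj₂ (_ , f₁ , _)  = contradiction (sym f₁ ∙ e₁) kx≢ky
      f-inj s t refl | p , inj₂ (_ , e₁ , _)  | q , inj₁ (_ , f₁ , _)  = contradiction (sym e₁ ∙ f₁) kx≢ky
      f-inj s t refl | p , inj₂ (_ , _ , e₂)  | q , inj₂ (_ , _ , f₂)  = Fin.toℕ-injective (sym e₂ ∙ f₂)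

      x∈X : InX x
      x∈X = inj₁ (refl , ℕ.≤-refl)

    -- The boxes of the two columns lie in classes of at most `a` boxes, whereas the Garnir set has
    -- at least `suc a`. The classes of the other columns are unchanged.
    μ-increases : μ k < μ gl
    μ-increases = μ-< k gl x a InCols (λ p → (lookup k p ℕ.≟ lookup k x) ⊎-dec (lookup k p ℕ.≟ lookup k y)) (inj₁ refl)
      (λ p ic → fib-≤ k p (lookup r) a (λ q e → row<a q (resp e ic)) (λ q q′ e e′ er → cell-inj D q q′ er (e ∙ sym e′)))
      (λ p nic → fib-cong k gl p (λ q e → out q p e nic))
      (fib-≥ gl x f (λ t → gl-in (f-X t) ∙ sym (gl-in x∈X)) f-inj)
      where
      resp : ∀ {q p} → lookup k q ≡ lookup k p → InCols p → InCols q
      resp e (inj₁ e′) = inj₁ (e ∙ e′)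
      resp e (inj₂ e′) = inj₂ (e ∙ e′)
      out : ∀ q p → lookup k q ≡ lookup k p → ¬ InCols p → lookup gl q ≡ lookup gl p
      out q p e nic with gl-case q | gl-case p
      ... | inj₁ (i , _)  | _             = contradiction (resp (sym e) (X⊆Cols i)) nic
      ... | inj₂ _        | inj₁ (i , _)  = contradiction (X⊆Cols i) nic
      ... | inj₂ (_ , e₁) | inj₂ (_ , e₂) = e₁ ∙ cong suc e ∙ sym e₂

    -- A column permutation keeps the `suc a` Garnir boxes inside the two columns and so within `a`
    -- rows. Two of them get into one row, and the summand vanishes by `collision`.
    garnir : ∀ u β → κ gl (κ k (ρ r u)) β ≡ 0ℚ
    garnir u β = K-∑ (λ σ → stab k σ *ℚ sgnV σ) (λ σ → act σ (ρ r u)) sgnV gl (els m) β ∙ ∑-0 (els m) λ {σ} q → lem σ (∈-els⁻ q)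
      where
      lem : ∀ σ → IsPerm σ → (stab k σ *ℚ sgnV σ) *ℚ κ gl (act σ (ρ r u)) β ≡ 0ℚ
      lem σ p with k ⊙ σ ≟V k
      ... | no  _ = cong (_*ℚ κ gl (act σ (ρ r u)) β) (ℚ.*-zeroˡ (sgnV σ)) ∙ ℚ.*-zeroˡ (κ gl (act σ (ρ r u)) β)
      ... | yes e = cong (1ℚ *ℚ sgnV σ *ℚ_) zero-image ∙ ℚ.*-zeroʳ (1ℚ *ℚ sgnV σ)
        where
        row : ∀ t → lookup r (lookup (inv σ) (f t)) < a
        row t = row<a _ (resp (X⊆Cols (f-X t)))
          where
          fx = fix-lookup k (stab-fix-inv k p e) (f t)
          resp : InCols (f t) → InCols (lookup (inv σ) (f t))
          resp (inj₁ e′) = inj₁ (fx ∙ e′)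
          resp (inj₂ e′) = inj₂ (fx ∙ e′)
        zero-image : κ gl (act σ (ρ r u)) β ≡ 0ℚ
        zero-image = let s , t , s<t , eq = Fin.pigeonhole (ℕ.n<1+n a) (λ t → fromℕ< (row t)) in
          collision gl r p (λ e′ → ℕ.<-irrefl (cong toℕ (f-inj s t e′)) s<t)
            (gl-in (f-X s) ∙ sym (gl-in (f-X t)))
            (lookup-⊙ r (inv σ) (f s) ∙ sym (Fin.toℕ-fromℕ< (row s)) ∙ cong toℕ eq ∙ Fin.toℕ-fromℕ< (row t) ∙ sym (lookup-⊙ r (inv σ) (f t))) u β

open GarnirRelations

-- Straightening

module Straightening where

  private variable
    m : ℕ

  K-+ : ∀ χ (ℓ : Vec ℕ m) (u v : Fun m) → K χ ℓ (λ α → u α +ℚ v α) ≗ λ α → K χ ℓ u α +ℚ K χ ℓ v α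
  K-+ χ ℓ u v α = ∑-cong (els _) (λ σ → ℚ.*-distribˡ-+ (stab ℓ σ *ℚ χ σ) (u (α ⊙ σ)) (v (α ⊙ σ))) ∙ ∑-+ (els _) _ _

  SSYT? : (r c α : Vec ℕ m) → Dec (SSYT r c α)
  SSYT? r c α =
    (Fin.all? λ x → Fin.all? λ y → (lookup r x ℕ.≟ lookup r y) →-dec ((lookup c x <? lookup c y) →-dec (lookup α x ≤? lookup α y))) ×-dec
    (Fin.all? λ x → Fin.all? λ y → (lookup c x ℕ.≟ lookup c y) →-dec ((lookup r x <? lookup r y) →-dec (lookup α x <? lookup α y)))

  iv-≥0 : {P : Set} (d : Dec P) → 0ℚ ≤ℚ iv d
  iv-≥0 (yes _) = ℚ.nonNegative⁻¹ 1ℚ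
  iv-≥0 (no  _) = ℚ.≤-refl

  -- (b − v) (p′ − p) ≥ 0, with both sides moved so that no subtraction occurs.
  exchange-≤ : ∀ {v b p p′} → v ≤ b → p ≤ p′ → b * p + v * p′ ≤ b * p′ + v * p
  exchange-≤ {v} {b} {p} {p′} v≤b p≤p′ with ℕ.m≤n⇒m<n∨m≡n v≤b | ℕ.m≤n⇒m<n∨m≡n p≤p′
  ... | inj₂ refl | _         = ℕ.≤-reflexive (ℕ.+-comm (b * p) (b * p′))
  ... | inj₁ _    | inj₂ refl = ℕ.≤-refl
  ... | inj₁ lt   | inj₁ lt′  = ℕ.≤-trans (ℕ.<⇒≤ (exchange lt lt′)) (ℕ.≤-reflexive (ℕ.+-comm (v * p) (b * p′)))

  module Span (α₀ : Vec ℕ m) where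

    open InnerProduct α₀

    On : Vec ℕ m → Set
    On β = ∃ λ π → IsPerm π × β ≡ α₀ ⊙ π

    On-⊙ : ∀ {β σ} → IsPerm σ → On β → On (β ⊙ σ)
    On-⊙ {σ = σ} p (π , q , refl) = π ⊙ σ , perm-⊙ q p , ⊙-assoc α₀ π σ

    definite : ∀ u → ⟪ u , u ⟫ ≡ 0ℚ → ∀ {β} → On β → u β ≡ 0ℚ
    definite u h (π , p , refl) = ⟪⟫-definite u h p

    module _ {r k : Vec ℕ m} (D : Diagram r k) where

      -- The properties of `κ k (ρ r u)` on which straightening rests. They are stated for any
      -- function because they are also needed for functions not known to be of this form.
      record Straightenable (z : Fun m) : Set where
        field
          alternating : ∀ {σ} → IsPerm σ → k ⊙ σ ≡ k → ∀ β → z (β ⊙ σ) ≡ sgnV σ *ℚ z β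
          garnir-0    : ∀ x y e e′ → ∀ {β} → On β → κ (Garnir.gl D x y e e′) z β ≡ 0ℚ

      open Straightenable

      private
        B : ℕ
        B = sumF (lookup α₀) * sumF (lookup k)

        Φ≤B : ∀ {β} → On β → Φ k β ≤ B
        Φ≤B {β} (π , p , refl) = subst (λ s → Φ k β ≤ s * sumF (lookup k)) (sumF-⊙ α₀ p) (Φ-bound k β)

        module Step (β : Vec ℕ m) (s : ColStrict r k β) (x y : Fin m) (e : lookup r x ≡ lookup r y) (e′ : lookup k y ≡ suc (lookup k x))
                    (viol : lookup β y < lookup β x) where

          open Garnir D x y e e′

          -- Let `v` be the entry at `x`. Garnir boxes in the column of `x` have entries at least
          -- `v`, those in the column of `y` smaller ones, so `(β q - v) * (k′ q - k q)` is never
          -- negative. As `k` and `k′` have the same sum, `Φ` does not decrease, and equality would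
          -- make `σ` preserve columns.
          Φ-increases : ∀ {σ} → IsPerm σ → gl ⊙ σ ≡ gl → k ⊙ σ ≢ k → Φ k β < Φ k (β ⊙ σ)
          Φ-increases {σ} p fix ne = ℕ.≰⇒> λ le → ne (sym (cong (_⊙ σ) (k⊙τ le)) ∙ inv-⊙ k σ p)
            where
            τ = inv σ
            v = lookup β x
            k′ : Fin m → ℕ
            k′ q = lookup k (lookup τ q)
            Φ′ : Φ k (β ⊙ σ) ≡ sumF (λ q → lookup β q * k′ q)
            Φ′ = sym (sumF-perm (perm-inv p) (λ i → lookup (β ⊙ σ) i * lookup k i)) ∙
              sumF-cong (λ q → cong (_* k′ q) (lookup-⊙ β σ (lookup τ q) ∙ cong (lookup β) (lookup-inv σ p q)))
            Σk : sumF k′ ≡ sumF (lookup k)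
            Σk = sumF-perm (perm-inv p) (lookup k)
            v≤ : ∀ q → lookup k q ≡ lookup k x → lookup r x ≤ lookup r q → v ≤ lookup β q
            v≤ q f le with ℕ.m≤n⇒m<n∨m≡n le
            ... | inj₁ lt = ℕ.<⇒≤ (s x q (sym f) lt)
            ... | inj₂ eq = ℕ.≤-reflexive (cong (lookup β) (cell-inj D x q eq (sym f)))
            <v : ∀ q → lookup k q ≡ lookup k y → lookup r q ≤ lookup r x → lookup β q < v
            <v q f le with ℕ.m≤n⇒m<n∨m≡n le
            ... | inj₁ lt = ℕ.<-trans (s q y f (subst (lookup r q <_) e lt)) viol
            ... | inj₂ eq = subst (λ q → lookup β q < v) (sym (cell-inj D q y (eq ∙ e) f)) viol
            kx≤ : ∀ {q} → InX q → lookup k x ≤ lookup k q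
            kx≤ (inj₁ (f , _)) = ℕ.≤-reflexive (sym f)
            kx≤ (inj₂ (f , _)) = ℕ.≤-trans (ℕ.n≤1+n _) (ℕ.≤-reflexive (sym (f ∙ e′)))
            ≤ky : ∀ {q} → InX q → lookup k q ≤ lookup k y
            ≤ky (inj₁ (f , _)) = ℕ.≤-trans (ℕ.n≤1+n _) (ℕ.≤-reflexive (cong suc f ∙ sym e′))
            ≤ky (inj₂ (f , _)) = ℕ.≤-reflexive f
            case : ∀ q → k′ q ≡ lookup k q ⊎ (lookup k q ≤ k′ q × v ≤ lookup β q) ⊎ (k′ q ≤ lookup k q × lookup β q < v)
            case q with gl-out {lookup τ q} {q} (fix-lookup gl (stab-fix-inv gl p fix) q)
            ... | inj₂ (_ , _ , f)              = inj₁ f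
            ... | inj₁ (i , inj₁ (f , le))      = inj₂ (inj₁ (subst (_≤ k′ q) (sym f) (kx≤ i) , v≤ q f le))
            ... | inj₁ (i , inj₂ (f , le))      = inj₂ (inj₂ (subst (k′ q ≤_) (sym f) (≤ky i) , <v q f le))
            point : ∀ q → lookup β q * lookup k q + v * k′ q ≤ lookup β q * k′ q + v * lookup k q
            point q with case q
            ... | inj₁ f                = ℕ.≤-reflexive (cong₂ (λ a b → lookup β q * a + v * b) (sym f) f)
            ... | inj₂ (inj₁ (le , g))  = exchange-≤ g le
            ... | inj₂ (inj₂ (le , g))  = subst₂ _≤_ (ℕ.+-comm (v * k′ q) (lookup β q * lookup k q)) (ℕ.+-comm (v * lookup k q) (lookup β q * k′ q)) (exchange-≤ (ℕ.<⇒≤ g) le)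
            Σl = sumF-+ (λ q → lookup β q * lookup k q) (λ q → v * k′ q)
            Σr = sumF-+ (λ q → lookup β q * k′ q) (λ q → v * lookup k q)
            v*Σ : sumF (λ q → v * k′ q) ≡ sumF (λ q → v * lookup k q)
            v*Σ = sumF-cong (λ q → ℕ.*-comm v (k′ q)) ∙ sumF-*ʳ k′ v ∙ cong (_* v) Σk ∙ sym (sumF-*ʳ (lookup k) v) ∙ sumF-cong (λ q → ℕ.*-comm (lookup k q) v)
            k⊙τ : Φ k (β ⊙ σ) ≤ Φ k β → k ⊙ τ ≡ k
            k⊙τ le = lookup-fix k λ q → sym (sumF-mono-≡ k≤ (sym Σk) q)
              where
              equal : ∀ q → lookup β q * lookup k q + v * k′ q ≡ lookup β q * k′ q + v * lookup k q
              equal = sumF-mono-≡ point (ℕ.≤-antisym (sumF-mono point)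
                (subst₂ _≤_ (sym Σr) (sym Σl) (ℕ.+-mono-≤ (subst (_≤ Φ k β) Φ′ le) (ℕ.≤-reflexive (sym v*Σ)))))
              k≤ : ∀ q → lookup k q ≤ k′ q
              k≤ q with case q
              ... | inj₁ f                = ℕ.≤-reflexive (sym f)
              ... | inj₂ (inj₁ (le , _))  = le
              ... | inj₂ (inj₂ (_ , g))   = ℕ.≮⇒≥ λ lt → ℕ.<-irrefl (ℕ.+-comm (v * k′ q) (lookup β q * lookup k q) ∙ equal q) (exchange g lt)

          -- In the Garnir relation at `β`, the permutations preserving columns contribute `z β`
          -- each, as two equal signs cancel; all others lead to larger `Φ`, where `z` is 0.
          vanishes : ∀ {z} → Straightenable z → On β → (∀ {γ} → On γ → Φ k β < Φ k γ → z γ ≡ 0ℚ) → z β ≡ 0ℚ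
          vanishes {z} Z on ih = *-≡0 N (z β) (sym (sym (garnir-0 Z x y e e′ on) ∙ ∑-cong∈ (els m) (λ {σ} q → lem σ (∈-els⁻ q)) ∙ ∑-*ʳ (els m) (λ σ → stab gl σ *ℚ stab k σ) (z β))) N≢0
            where
            -- The number of permutations preserving both labellings, positive because of the
            -- identity.
            N = ∑[ σ ← els m ] stab gl σ *ℚ stab k σ
            N≢0 : N ≢ 0ℚ
            N≢0 eq = contradiction (sym (cong₂ _*ℚ_ (iv-yes (gl ⊙ allFin m ≟V gl) (⊙-identityʳ gl)) (iv-yes (k ⊙ allFin m ≟V k) (⊙-identityʳ k))) ∙
              ∑-≡0⇒≡0 (els m) (λ {σ} _ → ℚ.nonNegative⁻¹ _ {{ℚ.nonNeg*nonNeg⇒nonNeg (stab gl σ) {{ℚ.nonNegative (iv-≥0 (gl ⊙ σ ≟V gl))}} (stab k σ) {{ℚ.nonNegative (iv-≥0 (k ⊙ σ ≟V k))}}}}) eq (∈-els⁺ perm-id)) λ ()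
            lem : ∀ σ → IsPerm σ → (stab gl σ *ℚ sgnV σ) *ℚ z (β ⊙ σ) ≡ (stab gl σ *ℚ stab k σ) *ℚ z β
            lem σ p = by (gl ⊙ σ ≟V gl) (k ⊙ σ ≟V k)
              where
              by : (d : Dec (gl ⊙ σ ≡ gl)) (d′ : Dec (k ⊙ σ ≡ k)) → (iv d *ℚ sgnV σ) *ℚ z (β ⊙ σ) ≡ (iv d *ℚ iv d′) *ℚ z β
              by (no _) d′ = cong (_*ℚ z (β ⊙ σ)) (ℚ.*-zeroˡ (sgnV σ)) ∙ ℚ.*-zeroˡ (z (β ⊙ σ)) ∙ sym (cong (_*ℚ z β) (ℚ.*-zeroˡ (iv d′)) ∙ ℚ.*-zeroˡ (z β))
              by (yes _) (yes f) = cong₂ _*ℚ_ (ℚ.*-identityˡ (sgnV σ)) (alternating Z p f β) ∙ sym (ℚ.*-assoc (sgnV σ) (sgnV σ) (z β)) ∙ cong (_*ℚ z β) (sgnV-square σ)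
              by (yes f) (no ne) = cong (1ℚ *ℚ sgnV σ *ℚ_) (ih (On-⊙ p on) (Φ-increases p f ne)) ∙ ℚ.*-zeroʳ (1ℚ *ℚ sgnV σ) ∙ sym (ℚ.*-zeroˡ (z β))

      -- Induction from large to small `Φ`. A repetition within a column makes `z β` its own
      -- negative. Otherwise the columns can be sorted without changing `Φ`, and the result is
      -- semistandard or has a row descent to which `Step` applies.
      straighten : ∀ {z} → Straightenable z → (∀ {β} → On β → SSYT r k β → z β ≡ 0ℚ) → ∀ {β} → On β → z β ≡ 0ℚ
      straighten {z} Z van {β} on = go β on (<-wellFounded _)
        where
        go : ∀ β → On β → Acc _<_ (B ∸ Φ k β) → z β ≡ 0ℚ
        go β on (acc rs) with Fin.any? (λ x → Fin.any? (λ y → ¬? (x Fin.≟ y) ×-dec (lookup k x ℕ.≟ lookup k y) ×-dec (lookup β x ℕ.≟ lookup β y)))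
        ... | yes (x , y , ne , e , e′) = x≡-x⇒x≡0 (z β) (cong z (sym (tr-fix β e′)) ∙ alternating Z (perm-tr x y) (tr-fix k e) β ∙
                cong (_*ℚ z β) (sgnV-tr ne) ∙ sym (ℚ.neg-distribˡ-* 1ℚ (z β)) ∙ cong -ℚ_ (ℚ.*-identityˡ (z β)))
        ... | no inj with col-sort D β (λ x y ne e e′ → inj (x , y , ne , e , e′))
        ... | σ , p , e , s = *-≡0 (sgnV σ) (z β) (sym (alternating Z p e β) ∙ sorted) (λ eq → contradiction (sym (sgnV-square σ) ∙ cong (λ q → q *ℚ q) eq) λ ())
          where
          sorted : z (β ⊙ σ) ≡ 0ℚ
          sorted with Fin.any? (λ x → Fin.any? (λ y → (lookup r x ℕ.≟ lookup r y) ×-dec (lookup k y ℕ.≟ suc (lookup k x)) ×-dec (lookup (β ⊙ σ) y <? lookup (β ⊙ σ) x)))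
          ... | no ¬v = van (On-⊙ p on) (adjacent⇒RowWeak D (β ⊙ σ) (λ x y f f′ → ℕ.≮⇒≥ λ lt → ¬v (x , y , f , f′ , lt)) , s)
          ... | yes (x , y , f , f′ , lt) = Step.vanishes (β ⊙ σ) s x y f f′ lt Z (On-⊙ p on)
                  (λ {γ} on′ lt′ → go γ on′ (rs (ℕ.∸-monoʳ-< (subst (_< Φ k γ) (Φ-invariant k β p e) lt′) (Φ≤B on′))))

      E-straightenable : ∀ α → Straightenable (E r k α)
      E-straightenable α = record
        { alternating = λ p e β → act-K sgn-char k p e (ρ r (δ α)) β
        ; garnir-0    = λ x y e e′ {β} _ → Garnir.garnir D x y e e′ (δ α) β }

      subtract : ∀ {z z′} q → Straightenable z → Straightenable z′ → Straightenable (λ β → z β +ℚ q *ℚ z′ β)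
      subtract {z} {z′} q Z Z′ = record
        { alternating = λ {σ} p e β → cong₂ (λ a b → a +ℚ q *ℚ b) (alternating Z p e β) (alternating Z′ p e β) ∙
            solve 4 (λ s a q b → s :* a :+ q :* (s :* b) := s :* (a :+ q :* b)) refl (sgnV σ) (z β) q (z′ β)
        ; garnir-0    = λ x y e e′ {β} on → K-+ sgnV (Garnir.gl D x y e e′) z (λ β → q *ℚ z′ β) β ∙
            cong₂ _+ℚ_ (garnir-0 Z x y e e′ on) (K-*ˡ sgnV (Garnir.gl D x y e e′) q z′ β ∙ cong (q *ℚ_) (garnir-0 Z′ x y e e′ on) ∙ ℚ.*-zeroʳ q) }
        where open +-*-Solver

      module _ (y : Fun m) (y⊥E : ∀ {α} → On α → SSYT r k α → ⟪ y , E r k α ⟫ ≡ 0ℚ) where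

        private
          VanishFrom : ℕ → Fun m → Set
          VanishFrom b z = ∀ {β} → On β → SSYT r k β → b ≤ Φ k β → z β ≡ 0ℚ

          -- Clears the values of `z` at the semistandard fillings of level `b` by subtracting
          -- multiples of functions `E r k v`, which disturbs neither the higher levels nor the
          -- product with `y`.
          level : ∀ b → (∀ {z} → Straightenable z → VanishFrom b z → ⟪ y , z ⟫ ≡ 0ℚ) →
                  ∀ Y → (∀ {v} → v ∈ Y → On v) → ∀ {z} → Straightenable z → VanishFrom (suc b) z →
                  (∀ {β} → On β → SSYT r k β → Φ k β ≡ b → z β ≡ 0ℚ ⊎ β ∈ Y) → ⟪ y , z ⟫ ≡ 0ℚ
          level b next [] onY {z} Z high mid = next Z λ {β} on ss le → lem on ss (ℕ.m≤n⇒m<n∨m≡n le)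
            where
            lem : ∀ {β} → On β → SSYT r k β → b < Φ k β ⊎ b ≡ Φ k β → z β ≡ 0ℚ
            lem on ss (inj₁ lt) = high on ss lt
            lem on ss (inj₂ eq) with mid on ss (sym eq)
            ... | inj₁ h = h
          level b next (v ∷ Y) onY {z} Z high mid with (Φ k v ℕ.≟ b) ×-dec SSYT? r k v
          ... | no ne = level b next Y (onY ∘ there) Z high mid′
            where
            mid′ : ∀ {β} → On β → SSYT r k β → Φ k β ≡ b → z β ≡ 0ℚ ⊎ β ∈ Y
            mid′ on ss eq with mid on ss eq
            ... | inj₁ h           = inj₁ h
            ... | inj₂ (here refl) = contradiction (eq , ss) ne
            ... | inj₂ (there q)   = inj₂ q
          ... | yes (Φv , ssv) = sym (ℚ.+-identityʳ ⟪ y , z ⟫) ∙ cong (⟪ y , z ⟫ +ℚ_) (sym (cong (q *ℚ_) (y⊥E (onY (here refl)) ssv) ∙ ℚ.*-zeroʳ q)) ∙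
                cong (⟪ y , z ⟫ +ℚ_) (sym (⟪⟫-*ʳ y q (E r k v))) ∙ sym (⟪⟫-+ʳ y z (λ β → q *ℚ E r k v β)) ∙
                level b next Y (onY ∘ there) (subtract q Z (E-straightenable v)) high′ mid′
            where
            s = E r k v v
            instance
              s-nonZero : NonZero s
              s-nonZero = ≢-nonZero (E-diagonal-≢0 D v ssv)
            q = -ℚ (z v *ℚ 1/ s)
            drop-E : ∀ {β} → SSYT r k β → β ≢ v → ¬ Φ k β < Φ k v → z β +ℚ q *ℚ E r k v β ≡ z β
            drop-E {β} ss ne nlt = cong (λ w → z β +ℚ q *ℚ w) (E-triangular D v β ssv ss ne nlt) ∙ cong (z β +ℚ_) (ℚ.*-zeroʳ q) ∙ ℚ.+-identityʳ (z β)
            high′ : VanishFrom (suc b) (λ β → z β +ℚ q *ℚ E r k v β)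
            high′ on ss le = drop-E ss (λ { refl → ℕ.<-irrefl (sym Φv) le }) (λ lt → ℕ.<-asym le (subst (_ <_) Φv lt)) ∙ high on ss le
            at-v : z v +ℚ q *ℚ s ≡ 0ℚ
            at-v = cong (z v +ℚ_) (sym (ℚ.neg-distribˡ-* (z v *ℚ 1/ s) s) ∙ cong -ℚ_ (ℚ.*-assoc (z v) (1/ s) s ∙ cong (z v *ℚ_) (ℚ.*-inverseˡ s) ∙ ℚ.*-identityʳ (z v))) ∙ ℚ.+-inverseʳ (z v)
            mid′ : ∀ {β} → On β → SSYT r k β → Φ k β ≡ b → z β +ℚ q *ℚ E r k v β ≡ 0ℚ ⊎ β ∈ Y
            mid′ {β} on ss eq = lem (β ≟V v) (mid on ss eq)
              where
              lem : Dec (β ≡ v) → z β ≡ 0ℚ ⊎ β ∈ v ∷ Y → z β +ℚ q *ℚ E r k v β ≡ 0ℚ ⊎ β ∈ Y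
              lem (yes refl) _                = inj₁ at-v
              lem (no ne)    (inj₁ h)         = inj₁ (drop-E ss ne (λ lt → ℕ.<-irrefl (eq ∙ sym Φv) lt) ∙ h)
              lem (no ne)    (inj₂ (here e))  = contradiction e ne
              lem (no ne)    (inj₂ (there i)) = inj₂ i

          descend : ∀ b {z} → Straightenable z → VanishFrom b z → ⟪ y , z ⟫ ≡ 0ℚ
          descend zero    Z van = ∑-0 (els m) λ {π} q → cong (y (α₀ ⊙ π) *ℚ_) (straighten Z (λ on ss → van on ss z≤n) (π , ∈-els⁻ q , refl)) ∙ ℚ.*-zeroʳ (y (α₀ ⊙ π))
          descend (suc b) Z van = level b (descend b) (map (α₀ ⊙_) (els m))
            (λ q → let π , p , e = ∈.∈-map⁻ (α₀ ⊙_) q in π , ∈-els⁻ p , e) Z van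
            (λ (π , p , e) _ _ → inj₂ (subst (_∈ map (α₀ ⊙_) (els m)) (sym e) (∈.∈-map⁺ (α₀ ⊙_) (∈-els⁺ p))))

        -- By triangularity and `straighten`, `z` is on the orbit a combination of the `E r k α`.
        -- Following only the product with `y` avoids recording the coefficients.
        orthogonal-to-straightenable : ∀ {z} → Straightenable z → ⟪ y , z ⟫ ≡ 0ℚ
        orthogonal-to-straightenable Z = descend (suc B) Z λ on _ le → contradiction (ℕ.≤-trans le (Φ≤B on)) ℕ.1+n≰n

open Straightening

-- Orthogonal projection and spanning

module GramSchmidt where

  private variable
    m : ℕ

  -- The boxes of the row up to `x` are distinct. The bound leaves only finitely many column
  -- labellings of diagrams.
  diagram-col<m : {r c : Vec ℕ m} → Diagram r c → ∀ x → lookup c x < m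
  diagram-col<m {m} {r} {c} D x = Fin.injective⇒≤ {f = λ t → proj₁ (box t)} λ {s} {t} e →
      Fin.toℕ-injective (sym (proj₁ (proj₂ (box s))) ∙ cong (lookup c) e ∙ proj₁ (proj₂ (box t)))
    where
    box : (t : Fin (suc (lookup c x))) → ∃ λ y → lookup c y ≡ toℕ t × lookup r y ≡ lookup r x
    box t = leftwards D x (ℕ.≤-pred (Fin.toℕ<n t))

  boundedVecs : ∀ n → ℕ → List (Vec ℕ n)
  boundedVecs zero    b = [] ∷ []
  boundedVecs (suc n) b = concatMap (λ v → map (_∷ v) (upTo b)) (boundedVecs n b)

  ∈-boundedVecs : ∀ {n b} (v : Vec ℕ n) → (∀ i → lookup v i < b) → v ∈ boundedVecs n b
  ∈-boundedVecs []      h = here refl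
  ∈-boundedVecs {suc n} {b} (x ∷ v) h = ∈.∈-concat⁺′ (∈.∈-map⁺ (_∷ v) (∈.∈-upTo⁺ (h zero)))
    (∈.∈-map⁺ (λ v → map (_∷ v) (upTo b)) (∈-boundedVecs v (h ∘ suc)))

  module _ (α₀ : Vec ℕ m) where

    open Span α₀
    open InnerProduct α₀

    lin : {I : Set} → (I → Fun m) → List (ℚ × I) → Fun m
    lin F L β = ∑[ t ← L ] proj₁ t *ℚ F (proj₂ t) β

    private
      ⟪⟫-lin : ∀ {I : Set} u (F : I → Fun m) L → (∀ {t} → t ∈ L → ⟪ u , F (proj₂ t) ⟫ ≡ 0ℚ) → ⟪ u , lin F L ⟫ ≡ 0ℚ
      ⟪⟫-lin u F L h = ⟪⟫-∑ʳ u proj₁ (F ∘ proj₂) L ∙ ∑-0 L λ {t} q → cong (proj₁ t *ℚ_) (h q) ∙ ℚ.*-zeroʳ (proj₁ t)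

      lin-scale : ∀ {I : Set} (F : I → Fun m) q L β → lin F (map (λ t → q *ℚ proj₁ t , proj₂ t) L) β ≡ q *ℚ lin F L β
      lin-scale F q L β = ∑-map _ L _ ∙ ∑-cong L (λ t → ℚ.*-assoc q (proj₁ t) (F (proj₂ t) β)) ∙ ∑-*ˡ L q _

      _⊖_ : Fun m → Fun m → Fun m
      (u ⊖ v) β = u β +ℚ -ℚ 1ℚ *ℚ v β

      ⟪⟫-⊖ : ∀ x u v → ⟪ x , u ⊖ v ⟫ ≡ ⟪ x , u ⟫ +ℚ -ℚ 1ℚ *ℚ ⟪ x , v ⟫
      ⟪⟫-⊖ x u v = ⟪⟫-+ʳ x u (λ β → -ℚ 1ℚ *ℚ v β) ∙ cong (⟪ x , u ⟫ +ℚ_) (⟪⟫-*ʳ x (-ℚ 1ℚ) v)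

    -- Gram-Schmidt for a possibly dependent family: if the new vector `g′` has norm 0, it vanishes
    -- on the orbit and is skipped.
    projection : {I : Set} (F : I → Fun m) (Is : List I) (w : Fun m) →
                 ∃ λ L → (∀ {t} → t ∈ L → proj₂ t ∈ Is) × (∀ {i} → i ∈ Is → ⟪ w ⊖ lin F L , F i ⟫ ≡ 0ℚ)
    projection F [] w = [] , (λ ()) , λ ()
    projection {I} F (g ∷ Is) w with projection F Is w | projection F Is (F g)
    ... | Lw , subw , perpw | Lg , subg , perpg = by ((n ℚ.≟ 0ℚ))
      where
      open +-*-Solver
      w′ g′ : Fun m
      w′ = w ⊖ lin F Lw
      g′ = F g ⊖ lin F Lg
      n = ⟪ g′ , g′ ⟫
      split : ∀ x → (∀ {i} → i ∈ Is → ⟪ x , F i ⟫ ≡ 0ℚ) → ⟪ x , g′ ⟫ ≡ 0ℚ → ⟪ x , F g ⟫ ≡ 0ℚ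
      split x h h′ = sym (⟪⟫-⊖ x (F g) (lin F Lg) ∙ cong (λ z → ⟪ x , F g ⟫ +ℚ -ℚ 1ℚ *ℚ z) (⟪⟫-lin x F Lg (λ q → h (subg q))) ∙
        solve 1 (λ a → a :+ (:- con 1ℚ) :* con 0ℚ := a) refl ⟪ x , F g ⟫) ∙ h′
      by : Dec (n ≡ 0ℚ) → ∃ λ L → (∀ {t} → t ∈ L → proj₂ t ∈ g ∷ Is) × (∀ {i} → i ∈ g ∷ Is → ⟪ w ⊖ lin F L , F i ⟫ ≡ 0ℚ)
      by (yes n≡0) = Lw , there ∘ subw , λ where
        (here refl) → split w′ perpw (∑-0 (els m) λ {π} q → cong (w′ (α₀ ⊙ π) *ℚ_) (⟪⟫-definite g′ n≡0 (∈-els⁻ q)) ∙ ℚ.*-zeroʳ (w′ (α₀ ⊙ π)))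
        (there q)   → perpw q
      by (no n≢0) = L , sub , perp
        where
        instance
          n-nonZero : NonZero n
          n-nonZero = ≢-nonZero n≢0
        t : ℚ
        t = ⟪ w′ , g′ ⟫ *ℚ 1/ n
        L = Lw ++ (t , g) ∷ map (λ s → -ℚ t *ℚ proj₁ s , proj₂ s) Lg
        sub : ∀ {s} → s ∈ L → proj₂ s ∈ g ∷ Is
        sub q with ∈.∈-++⁻ Lw q
        ... | inj₁ q′           = there (subw q′)
        ... | inj₂ (here refl)  = here refl
        ... | inj₂ (there q′)   with ∈.∈-map⁻ (λ s → -ℚ t *ℚ proj₁ s , proj₂ s) q′
        ... | s , q″ , refl     = there (subg q″)
        w″ : (w ⊖ lin F L) ≗ λ β → w′ β +ℚ -ℚ t *ℚ g′ β
        w″ β = cong (λ z → w β +ℚ -ℚ 1ℚ *ℚ z) (∑-++ Lw _ _ ∙ cong (λ z → lin F Lw β +ℚ (t *ℚ F g β +ℚ z)) (lin-scale F (-ℚ t) Lg β)) ∙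
          solve 5 (λ w a t g b → w :+ (:- con 1ℚ) :* (a :+ (t :* g :+ (:- t) :* b)) := (w :+ (:- con 1ℚ) :* a) :+ (:- t) :* (g :+ (:- con 1ℚ) :* b)) refl
            (w β) (lin F Lw β) t (F g β) (lin F Lg β)
        expand : ∀ x → ⟪ w ⊖ lin F L , x ⟫ ≡ ⟪ w′ , x ⟫ +ℚ -ℚ t *ℚ ⟪ g′ , x ⟫
        expand x = ⟪⟫-cong {v = x} w″ (λ _ → refl) ∙ ⟪⟫-sym (λ β → w′ β +ℚ -ℚ t *ℚ g′ β) x ∙ ⟪⟫-+ʳ x w′ (λ β → -ℚ t *ℚ g′ β) ∙ cong₂ _+ℚ_ (⟪⟫-sym x w′) (⟪⟫-*ʳ x (-ℚ t) g′ ∙ cong (-ℚ t *ℚ_) (⟪⟫-sym x g′))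
        perpIs : ∀ {i} → i ∈ Is → ⟪ w ⊖ lin F L , F i ⟫ ≡ 0ℚ
        perpIs {i} q = expand (F i) ∙ cong₂ (λ a b → a +ℚ -ℚ t *ℚ b) (perpw q) (perpg q) ∙ solve 1 (λ t → con 0ℚ :+ (:- t) :* con 0ℚ := con 0ℚ) refl t
        perp : ∀ {i} → i ∈ g ∷ Is → ⟪ w ⊖ lin F L , F i ⟫ ≡ 0ℚ
        perp (there q)   = perpIs q
        perp (here refl) = split (w ⊖ lin F L) perpIs (expand g′ ∙ cong (λ z → ⟪ w′ , g′ ⟫ +ℚ z)
            (sym (ℚ.neg-distribˡ-* t n) ∙ cong -ℚ_ (ℚ.*-assoc ⟪ w′ , g′ ⟫ (1/ n) n ∙ cong (⟪ w′ , g′ ⟫ *ℚ_) (ℚ.*-inverseˡ n) ∙ ℚ.*-identityʳ ⟪ w′ , g′ ⟫)) ∙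
            ℚ.+-inverseʳ ⟪ w′ , g′ ⟫)

    record Generator : Set where
      field
        π    : Vec (Fin m) m
        perm : IsPerm π
        tab  : Tab
        F    : Filling m tab
        α    : Vec ℕ m
        on   : On α
        ss   : SSYT (rowV m tab) (colV m tab) α

    genFun : Generator → Fun m
    genFun g = act π (E (rowV m tab) (colV m tab) α)
      where open Generator g

    private
      labels : List (Vec ℕ m)
      labels = boundedVecs m m

      fT : Vec ℕ m → Tab
      fT c = proj₁ (fibre-filling c)

      mk : (π : Vec (Fin m) m) → IsPerm π → (c : Vec ℕ m) (τ : Vec (Fin m) m) → IsPerm τ →
           Dec (SSYT (rowV m (fT c)) (colV m (fT c)) (α₀ ⊙ τ)) → List Generator
      mk π p c τ q (yes s) = record { π = π ; perm = p ; tab = fT c ; F = proj₁ (proj₂ (fibre-filling c)) ; α = α₀ ⊙ τ ; on = τ , q , refl ; ss = s } ∷ []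
      mk π p c τ q (no _)  = []

      mk? : Vec (Fin m) m → Vec ℕ m → Vec (Fin m) m → List Generator
      mk? π c τ with isPerm? π | isPerm? τ
      ... | yes p | yes q = mk π p c τ q (SSYT? (rowV m (fT c)) (colV m (fT c)) (α₀ ⊙ τ))
      ... | _     | _     = []

      -- A finite list: for every bounded labelling the filling `fT c`, with all semistandard
      -- vectors of the orbit and all translates.
      generators : List Generator
      generators = concatMap (λ π → concatMap (λ c → concatMap (mk? π c) (els m)) labels) (els m)

      ∈-generators : ∀ {π τ c} → IsPerm π → IsPerm τ → c ∈ labels → SSYT (rowV m (fT c)) (colV m (fT c)) (α₀ ⊙ τ) →
                     ∃ λ g → g ∈ generators × genFun g ≡ act π (E (rowV m (fT c)) (colV m (fT c)) (α₀ ⊙ τ))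
      ∈-generators {π} {τ} {c} p q c∈ ss = let g , g∈ , e = mem in
          g , ∈.∈-concat⁺′ (∈.∈-concat⁺′ (∈.∈-concat⁺′ g∈ (∈.∈-map⁺ (mk? π c) (∈-els⁺ q))) (∈.∈-map⁺ (λ c → concatMap (mk? π c) (els m)) c∈))
            (∈.∈-map⁺ (λ π → concatMap (λ c → concatMap (mk? π c) (els m)) labels) (∈-els⁺ p)) , e
        where
        one′ : ∀ p q (d : Dec (SSYT (rowV m (fT c)) (colV m (fT c)) (α₀ ⊙ τ))) →
               ∃ λ g → g ∈ mk π p c τ q d × genFun g ≡ act π (E (rowV m (fT c)) (colV m (fT c)) (α₀ ⊙ τ))
        one′ p q (yes s) = _ , here refl , refl
        one′ p q (no ns) = contradiction ss ns
        mem : ∃ λ g → g ∈ mk? π c τ × genFun g ≡ act π (E (rowV m (fT c)) (colV m (fT c)) (α₀ ⊙ τ))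
        mem with isPerm? π | isPerm? τ
        ... | yes p′ | yes q′ = one′ p′ q′ (SSYT? (rowV m (fT c)) (colV m (fT c)) (α₀ ⊙ τ))
        ... | no np  | _      = contradiction p np
        ... | yes _  | no nq  = contradiction q nq

      Perp : Fun m → Set
      Perp u = ∀ {c} → c ∈ labels → ∀ {α} → On α → SSYT (rowV m (fT c)) (colV m (fT c)) α → ∀ {π} → IsPerm π →
               ⟪ u , act π (E (rowV m (fT c)) (colV m (fT c)) α) ⟫ ≡ 0ℚ

      -- `Perp` concerns all translates, so moving the permutations of `κ c` to the other side of
      -- the product does not lead out of it.
      Perp-κ : ∀ u → Perp u → ∀ c → Perp (κ c u)
      Perp-κ u h c {c′} c∈ {α} on ss {π} p = ⟪⟫-sym (κ c u) v ∙ ⟪⟫-∑ʳ v (λ σ → stab c σ *ℚ sgnV σ) (λ σ → act σ u) (els m) ∙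
          ∑-0 (els m) λ {σ} q → cong (stab c σ *ℚ sgnV σ *ℚ_) (⟪⟫-sym v (act σ u) ∙ act-adjoint (∈-els⁻ q) u v ∙
            ⟪⟫-cong {u = u} (λ _ → refl) (act-⊙ (inv σ) π e) ∙ h c∈ on ss (perm-⊙ (perm-inv (∈-els⁻ q)) p)) ∙ ℚ.*-zeroʳ (stab c σ *ℚ sgnV σ)
        where
        e = E (rowV m (fT c′)) (colV m (fT c′)) α
        v = act π e

      -- κ c u satisfies the Garnir relations, since these are instances of the
      -- vanishing for column labellings of larger fibre measure.
      κ-vanishes : ∀ c → Acc _<_ (sumF {m} (λ _ → suc m ^ m) ∸ μ c) → ∀ u → Perp u → ∀ {β} → On β → κ c u β ≡ 0ℚ
      κ-vanishes c (acc rs) u h {β} on = ∑-cong (els m) (λ σ → cong (λ s → (s *ℚ sgnV σ) *ℚ u (β ⊙ σ)) (stab≡ σ)) ∙ definite z zz on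
        where
        -- The labels of `c` can be arbitrarily large. `c*` has the same classes and bounded labels,
        -- so `fT c*` is among the fillings that `Perp` covers.
        c* = colV m (fT c)
        c*∈ : c* ∈ labels
        c*∈ = ∈-boundedVecs c* (diagram-col<m (diagram (proj₁ (proj₂ (fibre-filling c)))))
        r = rowV m (fT c*)
        k = colV m (fT c*)
        D : Diagram r k
        D = diagram (proj₁ (proj₂ (fibre-filling c*)))
        c⇒k : ∀ x y → lookup c x ≡ lookup c y → lookup k x ≡ lookup k y
        c⇒k x y = proj₂ (proj₂ (proj₂ (fibre-filling c*))) x y ∘ proj₂ (proj₂ (proj₂ (fibre-filling c))) x y
        k⇒c : ∀ x y → lookup k x ≡ lookup k y → lookup c x ≡ lookup c y
        k⇒c x y = proj₁ (proj₂ (proj₂ (fibre-filling c))) x y ∘ proj₁ (proj₂ (proj₂ (fibre-filling c*))) x y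
        stab≡ : ∀ σ → stab c σ ≡ stab k σ
        stab≡ σ = iv-cong (c ⊙ σ ≟V c) (k ⊙ σ ≟V k)
          (λ e → lookup-fix k λ i → c⇒k _ _ (fix-lookup c e i)) (λ e → lookup-fix c λ i → k⇒c _ _ (fix-lookup k e i))
        z : Fun m
        z = κ k u
        Z : Straightenable D z
        Z = record
          { alternating = λ p e β → act-K sgn-char k p e u β
          ; garnir-0    = λ x y e e′ → κ-vanishes (Garnir.gl D x y e e′)
              (rs (ℕ.∸-monoʳ-< (ℕ.≤-<-trans (μ-mono c k c⇒k) (Garnir.μ-increases D x y e e′)) (μ-bound _))) z (Perp-κ u h k) }
        zz : ⟪ z , z ⟫ ≡ 0ℚ
        zz = orthogonal-to-straightenable D z (λ {α} on ss → ⟪⟫-cong {u = z} (λ _ → refl) (λ β → cong (E r k α) (sym (⊙-identityʳ β))) ∙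
          Perp-κ u h k c*∈ on ss perm-id) Z

      -- For the injective labelling `toℕ` only the identity preserves labels, so `κ c u` is `u`.
      perp⇒0 : ∀ u → Perp u → ∀ {β} → On β → u β ≡ 0ℚ
      perp⇒0 u h {β} on = sym (∑-single (els m) (els-unique m) (∈-els⁺ perm-id) (λ {σ} _ ne → off σ ne) ∙
          cong₂ _*ℚ_ (cong₂ _*ℚ_ (iv-yes (c ⊙ allFin m ≟V c) (⊙-identityʳ c)) (sgnV-id {m})) (cong u (⊙-identityʳ β)) ∙ ℚ.*-identityˡ (u β)) ∙
        κ-vanishes c (<-wellFounded _) u h on
        where
        c : Vec ℕ m
        c = tabulate toℕ
        off : ∀ σ → σ ≢ allFin m → (stab c σ *ℚ sgnV σ) *ℚ u (β ⊙ σ) ≡ 0ℚ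
        off σ ne = cong (λ s → (s *ℚ sgnV σ) *ℚ u (β ⊙ σ)) (iv-no (c ⊙ σ ≟V c) λ e → ne (vec-ext λ i → Fin.toℕ-injective
            (sym (Vec.lookup∘tabulate toℕ (lookup σ i)) ∙ fix-lookup c e i ∙ Vec.lookup∘tabulate toℕ i) ∙ sym (Vec.lookup-allFin i))) ∙
          cong (_*ℚ u (β ⊙ σ)) (ℚ.*-zeroˡ (sgnV σ)) ∙ ℚ.*-zeroˡ (u (β ⊙ σ))

    opaque
      -- The difference of `w` and its projection is orthogonal to all generators and hence vanishes
      -- on the orbit.
      spanning : (w : Fun m) → ∃ λ (L : List (ℚ × Generator)) → ∀ {β} → On β → w β ≡ lin genFun L β
      spanning w with projection genFun generators w
      ... | L , _ , perp = L , λ {β} on → sym (ℚ.+-identityʳ (w β)) ∙ cong (w β +ℚ_) (sym (ℚ.+-inverseˡ (lin genFun L β))) ∙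
            solve 2 (λ a b → a :+ (:- b :+ b) := (a :+ (:- con 1ℚ) :* b) :+ b) refl (w β) (lin genFun L β) ∙
            cong (_+ℚ lin genFun L β) (perp⇒0 (w ⊖ lin genFun L) P on) ∙ ℚ.+-identityˡ (lin genFun L β)
        where
        open +-*-Solver
        P : Perp (w ⊖ lin genFun L)
        P c∈ (τ , q , refl) ss p with ∈-generators p q c∈ ss
        ... | g , g∈ , e = subst (λ v → ⟪ w ⊖ lin genFun L , v ⟫ ≡ 0ℚ) e (perp g∈)

open GramSchmidt

-- Specht polynomials: relabelling, content and spanning

module SpechtTerms where

  private variable
    m : ℕ

  entries-unique-cell : ∀ {T} (F : Filling m T) i {p} → entryAt T p ≡ just (idx i) → cell F i ≡ p
  entries-unique-cell {T = T} F i {p} e = entryAt-injective T (Filling.unique F) {cell F i} {p} (entryAt-cell F i) e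

  relabel : Vec (Fin m) m → Tab → Tab
  relabel π T = map (map (applyPerm (toL π))) T

  module _ {T : Tab} (F : Filling m T) {π : Vec (Fin m) m} (p : IsPerm π) where

    relabel-filling : Filling m (relabel π T)
    relabel-filling = record
      { numbers   = ↭-trans (↭-reflexive (map-entries (applyPerm (toL π)) T))
          (↭-trans (↭.map⁺ (applyPerm (toL π)) (Filling.numbers F)) (↭-trans (↭-reflexive (sym (toL-oneTo π))) (toL-↭ π p)))
      ; partition = cong isPartition (map-shape (applyPerm (toL π)) T) ∙ Filling.partition F }

    relabel-cell : ∀ i → cell relabel-filling (lookup π i) ≡ cell F i
    relabel-cell i = entries-unique-cell relabel-filling (lookup π i)
      (map-entryAt-just (applyPerm (toL π)) T (entryAt-cell F i) ∙ cong just (applyPerm-toL π i))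

    relabel-row : rowV m (relabel π T) ⊙ π ≡ rowV m T
    relabel-row = vec-ext λ i → lookup-⊙ (rowV m (relabel π T)) π i ∙ cong proj₁ (relabel-cell i)

    relabel-col : colV m (relabel π T) ⊙ π ≡ colV m T
    relabel-col = vec-ext λ i → lookup-⊙ (colV m (relabel π T)) π i ∙ cong proj₂ (relabel-cell i)

    relabel-word : ∀ {M} → shape M ≡ shape T → pMT m M (relabel π T) ⊙ π ≡ pMT m M T
    relabel-word {M} e = vec-ext λ i → lookup-⊙ (pMT m M (relabel π T)) π i ∙ just-injective (
      sym (pMT-cell relabel-filling {M} (e ∙ sym (map-shape (applyPerm (toL π)) T)) (lookup π i)) ∙
      cong (entryAt M) (relabel-cell i) ∙ pMT-cell F {M} e i)

  act-E : {π : Vec (Fin m) m} → IsPerm π → (r k α : Vec ℕ m) → act π (E (r ⊙ π) (k ⊙ π) (α ⊙ π)) ≗ E r k α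
  act-E {π = π} p r k α β = act-K-conj sgn-char k p (ρ (r ⊙ π) (δ (α ⊙ π))) β ∙
    K-cong sgnV k (λ γ → act-K-conj 𝟙-char r p (δ (α ⊙ π)) γ ∙ K-cong 𝟙 r (λ ε → act-δ (α ⊙ π) p ε ∙ cong (λ v → δ v ε) (⊙-inv α π p)) γ) β

  -- `π` carries the row group, the column group and the monomial of `T` to those of the relabelled
  -- filling, so a translate of a Specht polynomial is again one.
  act-E-relabel : ∀ {T} (F : Filling m T) {π} (p : IsPerm π) {M} → shape M ≡ shape T →
                  act π (E (rowV m T) (colV m T) (pMT m M T)) ≗ E (rowV m (relabel π T)) (colV m (relabel π T)) (pMT m M (relabel π T))
  act-E-relabel {m} {T} F {π} p {M} e β =
    cong (λ (r , k , α) → act π (E r k α) β) (sym (cong₂ _,_ (relabel-row F p) (cong₂ _,_ (relabel-col F p) (relabel-word F p {M} e)))) ∙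
    act-E p (rowV m (relabel π T)) (colV m (relabel π T)) (pMT m M (relabel π T)) β

  toList-⊙ : {C : Set} (α : Vec C m) (v : Vec (Fin m) m) → toList (α ⊙ v) ≡ map (lookup α) (toList v)
  toList-⊙ α v = cong toList (vec-ext {β = Vec.map (lookup α) v} λ i → lookup-⊙ α v i ∙ sym (Vec.lookup-map i (lookup α) v)) ∙ Vec.toList-map (lookup α) v

  toList-id : {C : Set} (α : Vec C m) → map (lookup α) (toList (allFin m)) ≡ toList α
  toList-id {m} α = sym (toList-⊙ α (allFin m)) ∙ cong toList (⊙-identityʳ α)

  ⊙-↭ : (α : Vec ℕ m) {π : Vec (Fin m) m} → IsPerm π → toList (α ⊙ π) ↭ toList α
  ⊙-↭ {m} α {π} p = ↭-trans (↭-reflexive (toList-⊙ α π)) (↭-trans (↭.map⁺ (lookup α) π↭) (↭-reflexive (toList-id α)))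
    where
    π↭ : toList π ↭ toList (allFin m)
    π↭ = unique-↭ (lookup-unique π (injective p)) (lookup-unique (allFin m) (injective perm-id))
      (λ {x} _ → subst (_∈ toList (allFin m)) (Vec.lookup-allFin x) (lookup∈toList (allFin m) x))
      (λ {x} _ → let i , eq = finite-surjective (lookup π) (injective p) x in subst (_∈ toList π) eq (lookup∈toList π i))

  -- A rearrangement of the entries of `α` lifts to a rearrangement of its indices. So a content is
  -- the same as an orbit.
  ↭-⊙ : (α β : Vec ℕ m) → toList β ↭ toList α → ∃ λ π → IsPerm π × β ≡ α ⊙ π
  ↭-⊙ {m} α β q with ↭.↭-map-inv (lookup α) (↭-trans (↭-reflexive (toList-id α)) (↭-sym q))
  ... | zs , eq , r with list-vec zs (sym (↭.↭-length r) ∙ Vec.length-toList (allFin m))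
  ... | π , refl = π , mkPerm (unique-lookup π (Unique-resp-↭ r (lookup-unique (allFin m) (injective perm-id)))) ,
        toList-inj (eq ∙ sym (toList-⊙ α π))

  tab-ext : ∀ M M′ → shape M ≡ shape M′ → (∀ p {a} → entryAt M p ≡ just a → entryAt M′ p ≡ just a) → M ≡ M′
  tab-ext []        []          s h = refl
  tab-ext (row ∷ M) (row′ ∷ M′) s h =
      cong₂ _∷_ (go row row′ (List.∷-injectiveˡ s) (λ c → h (0 , c))) (tab-ext M M′ (List.∷-injectiveʳ s) (λ (r , c) → h (suc r , c)))
    where
    go : ∀ (xs ys : List ℕ) → length xs ≡ length ys → (∀ c {a} → nth xs c ≡ just a → nth ys c ≡ just a) → xs ≡ ys
    go []       []       l h = refl
    go (x ∷ xs) (y ∷ ys) l h = cong₂ _∷_ (sym (just-injective (h 0 refl))) (go xs ys (ℕ.suc-injective l) (λ c → h (suc c)))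

  fill-pMT : ∀ {T} (F : Filling m T) {M} → shape M ≡ shape T → M ≡ fill F (pMT m M T)
  fill-pMT {m} {T} F {M} e = tab-ext M (fill F (pMT m M T)) (e ∙ sym (fill-shape F (pMT m M T))) λ p {a} eq →
    let b , eq′ = entryAt-shape {M} {T} e {p} eq
        i , b≡ , c≡ = cell-entryAt F {p} eq′
    in subst (λ q → entryAt (fill F (pMT m M T)) q ≡ just a) c≡
         (fill-cell F (pMT m M T) i ∙ sym (pMT-cell F {M} e i) ∙ cong (entryAt M) c≡ ∙ eq)

  pMT-content : ∀ {T} → Filling m T → ∀ {M} → shape M ≡ shape T → toList (pMT m M T) ↭ entries M
  pMT-content {m} {T} F {M} e = ↭-sym (↭-trans (↭-reflexive (cong entries (fill-pMT F {M} e))) (fill-entries F (pMT m M T)))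

  E-support : {r k α β : Vec ℕ m} → ¬ (toList β ↭ toList α) → E r k α β ≡ 0ℚ
  E-support {m} {r} {k} {α} {β} none = ∑-0 (els m) λ {σ} q → cong (stab k σ *ℚ sgnV σ *ℚ_) (∑-0 (els m) λ {τ} q′ →
    cong (stab r τ *ℚ 1ℚ *ℚ_) (iv-no ((β ⊙ σ) ⊙ τ ≟V α) λ e → none (↭-sym (subst (λ v → toList v ↭ toList β) (sym (⊙-assoc β σ τ) ∙ e)
      (⊙-↭ β (perm-⊙ (∈-els⁻ q) (∈-els⁻ q′)))))) ∙ ℚ.*-zeroʳ (stab r τ *ℚ 1ℚ)) ∙ ℚ.*-zeroʳ (stab k σ *ℚ sgnV σ)

  coeff-F-support : ∀ {T} → Filling m T → ∀ {M} → shape M ≡ shape T → ∀ β → ¬ (toList β ↭ entries M) → coeff (FMT m M T) β ≡ 0ℚ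
  coeff-F-support {m} {T} F {M} e β nq = coeff-F F M β ∙ cong (invℕ (sMT m M T) *ℚ_)
    (E-support {r = rowV m T} {colV m T} {pMT m M T} {β} (λ q → nq (↭-trans q (pMT-content F {M} e)))) ∙ ℚ.*-zeroʳ (invℕ (sMT m M T))

  record SpechtTerm (m : ℕ) (η : List ℕ) : Set where
    field
      c       : ℚ
      N tb    : Tab
      filling : Filling m tb
      same    : shape N ≡ shape tb
      ssyt    : isSSYT N ≡ true
      content : entries N ↭ η

    value : Vec ℕ m → ℚ
    value β = c *ℚ coeff (FMT m N tb) β

  -- On the orbit this is `spanning`, with translates rewritten as relabelled fillings and the
  -- factor `invℕ (sMT ...)` divided out. Off the orbit both sides are 0.
  specht-spanning : (α₀ : Vec ℕ m) → ∃ λ (L : List (SpechtTerm m (toList α₀))) → ∀ β → δ α₀ β ≡ (∑[ t ← L ] SpechtTerm.value t β)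
  specht-spanning {m} α₀ = map toTerm L , λ β → all β ∙ sym (∑-map toTerm L (λ t → SpechtTerm.value t β))
    where
    open Generator
    L : List (ℚ × Generator α₀)
    L = proj₁ (spanning α₀ (δ α₀))
    eq : ∀ {β} → Span.On α₀ β → δ α₀ β ≡ lin α₀ (genFun α₀) L β
    eq = proj₂ (spanning α₀ (δ α₀))
    invs : Generator α₀ → ℚ
    invs g = invℕ (sMT m (fill (F g) (α g)) (relabel (π g) (tab g)))
    toTerm : ℚ × Generator α₀ → SpechtTerm m (toList α₀)
    toTerm (q , g) = record
      { c = q *ℚ (1/ invs g) {{≢-nonZero (invℕ-sMT-≢0 (relabel-filling (F g) (perm g)) (fill (F g) (α g)))}}
      ; N = fill (F g) (α g) ; tb = relabel (π g) (tab g) ; filling = relabel-filling (F g) (perm g)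
      ; same = fill-shape (F g) (α g) ∙ sym (map-shape (applyPerm (toL (π g))) (tab g)) ; ssyt = fill-SSYT (F g) (α g) (ss g)
      ; content = ↭-trans (fill-entries (F g) (α g)) (content (on g)) }
      where
      content : ∀ {v} → Span.On α₀ v → toList v ↭ toList α₀
      content (π , p , refl) = ⊙-↭ α₀ p
    term-value : ∀ t β → proj₁ t *ℚ genFun α₀ (proj₂ t) β ≡ SpechtTerm.value (toTerm t) β
    term-value (q , g) β = cong (q *ℚ_) (cong (λ v → act (π g) (E (rowV m (tab g)) (colV m (tab g)) v) β) (sym (pMT-fill (F g) (α g))) ∙
        act-E-relabel (F g) (perm g) {fill (F g) (α g)} (fill-shape (F g) (α g)) β) ∙
      cong (q *ℚ_) (sym (ℚ.*-identityˡ e) ∙ cong (_*ℚ e) (sym (ℚ.*-inverseˡ s)) ∙ ℚ.*-assoc (1/ s) s e) ∙ sym (ℚ.*-assoc q (1/ s) (s *ℚ e)) ∙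
      cong (q *ℚ 1/ s *ℚ_) (sym (coeff-F (relabel-filling (F g) (perm g)) (fill (F g) (α g)) β))
      where
      s = invs g
      e = E (rowV m (relabel (π g) (tab g))) (colV m (relabel (π g) (tab g))) (pMT m (fill (F g) (α g)) (relabel (π g) (tab g))) β
      instance
        s-nonZero : NonZero s
        s-nonZero = ≢-nonZero (invℕ-sMT-≢0 (relabel-filling (F g) (perm g)) (fill (F g) (α g)))
    off : ∀ β → ¬ (toList β ↭ toList α₀) → ∀ t → SpechtTerm.value (toTerm t) β ≡ 0ℚ
    off β nq t = cong (SpechtTerm.c (toTerm t) *ℚ_) (coeff-F-support (SpechtTerm.filling (toTerm t)) {SpechtTerm.N (toTerm t)} (SpechtTerm.same (toTerm t)) β
      (λ q → nq (↭-trans q (SpechtTerm.content (toTerm t))))) ∙ ℚ.*-zeroʳ (SpechtTerm.c (toTerm t))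
    all : ∀ β → δ α₀ β ≡ (∑[ t ← L ] SpechtTerm.value (toTerm t) β)
    all β = lem (toList β ↭? toList α₀)
      where
      lem : Dec (toList β ↭ toList α₀) → δ α₀ β ≡ (∑[ t ← L ] SpechtTerm.value (toTerm t) β)
      lem (yes q) = eq (↭-⊙ α₀ β q) ∙ ∑-cong L (λ t → term-value t β)
      lem (no nq) = iv-no (β ≟V α₀) (λ { refl → nq ↭-refl }) ∙ sym (∑-0 L (λ {t} _ → off β nq t))

open SpechtTerms

-- Directness of the sum of the spaces spanned by Specht polynomials

module SpechtDirectness where

  private variable
    C : Set
    m : ℕ

  -- Numbers from `suc k` on, row by row. For `k = 0` this is the filling chosen to represent its
  -- shape.
  readTab : ℕ → List ℕ → Tab
  readTab k []       = []
  readTab k (l ∷ ls) = List.applyUpTo (λ j → suc (k + j)) l ∷ readTab (k + l) ls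

  length-entries : ∀ T → length (entries T) ≡ sum (shape T)
  length-entries []        = refl
  length-entries (row ∷ T) = List.length-++ row ∙ cong (length row +_) (length-entries T)

  private
    applyUpTo-++ : (f : ℕ → C) (a b : ℕ) → List.applyUpTo f (a + b) ≡ List.applyUpTo f a ++ List.applyUpTo (λ j → f (a + j)) b
    applyUpTo-++ f zero    b = refl
    applyUpTo-++ f (suc a) b = cong (f 0 ∷_) (applyUpTo-++ (f ∘ suc) a b)

    applyUpTo-cong : {f g : ℕ → C} → f ≗ g → ∀ n → List.applyUpTo f n ≡ List.applyUpTo g n
    applyUpTo-cong h zero    = refl
    applyUpTo-cong h (suc n) = cong₂ _∷_ (h 0) (applyUpTo-cong (h ∘ suc) n)

    read-shape : ∀ k ls → shape (readTab k ls) ≡ ls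
    read-shape k []       = refl
    read-shape k (l ∷ ls) = cong₂ _∷_ (List.length-applyUpTo _ l) (read-shape (k + l) ls)

    read-entries : ∀ k ls → entries (readTab k ls) ≡ List.applyUpTo (λ j → suc (k + j)) (sum ls)
    read-entries k []       = refl
    read-entries k (l ∷ ls) = cong (List.applyUpTo (λ j → suc (k + j)) l ++_)
        (read-entries (k + l) ls ∙ applyUpTo-cong (λ j → cong suc (ℕ.+-assoc k l j)) (sum ls)) ∙
      sym (applyUpTo-++ (λ j → suc (k + j)) l (sum ls))

    read-oneTo : ∀ ls → sum ls ≡ m → entries (readTab 0 ls) ≡ oneTo m
    read-oneTo ls refl = read-entries 0 ls ∙ sym (List.map-applyUpTo id suc (sum ls))

  entries-AllPairs : ∀ {R : ℕ → ℕ → Set} T → AllPairs R (entries T) → ∀ {r c r′ c′ a b} → entryAt T (r , c) ≡ just a → entryAt T (r′ , c′) ≡ just b →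
                     r < r′ ⊎ (r ≡ r′ × c < c′) → R a b
  entries-AllPairs {R} (row ∷ T) h {zero} {c} {zero} {c′} e f (inj₂ (_ , lt)) = go row (proj₁ (split row h)) c c′ e f lt
    where
    split : ∀ xs {ys} → AllPairs R (xs ++ ys) → AllPairs R xs × AllPairs R ys
    split []       h       = [] , h
    split (x ∷ xs) (p ∷ h) = All.++⁻ˡ xs p ∷ proj₁ (split xs h) , proj₂ (split xs h)
    go : ∀ xs → AllPairs R xs → ∀ c c′ {a b} → nth xs c ≡ just a → nth xs c′ ≡ just b → c < c′ → R a b
    go (x ∷ xs) (p ∷ h) zero    (suc c′) refl f lt       = All.lookup p (nth-∈ xs f)
    go (x ∷ xs) (p ∷ h) (suc c) (suc c′) e    f (s≤s lt) = go xs h c c′ e f lt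
  entries-AllPairs {R} (row ∷ T) h {zero} {c} {suc r′} {c′} e f _ = go row h (nth-∈ row e)
    where
    go : ∀ xs → AllPairs R (xs ++ entries T) → ∀ {a} → a ∈ xs → R a _
    go (x ∷ xs) (p ∷ h) (here refl) = All.lookup (All.++⁻ʳ xs p) (entryAt-∈ T {r′} f)
    go (x ∷ xs) (p ∷ h) (there q)   = go xs h q
  entries-AllPairs {R} (row ∷ T) h {suc r} {c} {suc r′} {c′} e f lt = entries-AllPairs T (drop row h) {r} {c} {r′} {c′} e f (lower lt)
    where
    drop : ∀ xs {ys} → AllPairs R (xs ++ ys) → AllPairs R ys
    drop []       h       = h
    drop (x ∷ xs) (p ∷ h) = drop xs h
    lower : suc r < suc r′ ⊎ (suc r ≡ suc r′ × c < c′) → r < r′ ⊎ (r ≡ r′ × c < c′)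
    lower (inj₁ (s≤s p))  = inj₁ p
    lower (inj₂ (refl , p)) = inj₂ (refl , p)
  entries-AllPairs {R} (row ∷ T) h {suc r} {c} {zero} {c′} e f (inj₁ ())
  entries-AllPairs {R} (row ∷ T) h {suc r} {c} {zero} {c′} e f (inj₂ (() , _))

  module Reading (ls : List ℕ) (size : sum ls ≡ m) (part : isPartition ls ≡ true) where

    T₀ : Tab
    T₀ = readTab 0 ls

    T₀-shape : shape T₀ ≡ ls
    T₀-shape = read-shape 0 ls

    T₀-entries : entries T₀ ≡ oneTo m
    T₀-entries = read-oneTo ls size

    F₀ : Filling m T₀
    F₀ = record { numbers = ↭-reflexive T₀-entries ; partition = cong isPartition T₀-shape ∙ part }

    private
      increasing : AllPairs _<_ (entries T₀)
      increasing = subst (AllPairs _<_) (sym (read-entries 0 ls)) (AllPairs.applyUpTo⁺₁ suc (sum ls) (λ p _ → s<s p))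

      before : ∀ x y → lookup (rowV m T₀) x < lookup (rowV m T₀) y ⊎ (lookup (rowV m T₀) x ≡ lookup (rowV m T₀) y × lookup (colV m T₀) x < lookup (colV m T₀) y) → toℕ x < toℕ y
      before x y h = ℕ.≤-pred (entries-AllPairs T₀ increasing (entryAt-cell F₀ x) (entryAt-cell F₀ y) h)

    row-order : ∀ x y → toℕ x < toℕ y → lookup (rowV m T₀) x ≤ lookup (rowV m T₀) y
    row-order x y lt = ℕ.≮⇒≥ λ lt′ → ℕ.<-asym lt (before y x (inj₁ lt′))

    col-order : ∀ x y → lookup (rowV m T₀) x ≡ lookup (rowV m T₀) y → lookup (colV m T₀) x < lookup (colV m T₀) y → toℕ x < toℕ y
    col-order x y e lt = before x y (inj₂ (e , lt))

    -- The reading word of `T`, as a permutation, carries the row filling to `T`. So Specht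
    -- polynomials for `T` are translates of those for `T₀`.
    relabel-T₀ : ∀ {T} → Filling m T → shape T ≡ ls → relabel (fromL (entries T)) T₀ ≡ T
    relabel-T₀ {T} F e = shape-entries-ext (relabel (fromL (entries T)) T₀) T (map-shape (applyPerm (toL (fromL {m} (entries T)))) T₀ ∙ T₀-shape ∙ sym e)
        (map-entries (applyPerm (toL (fromL {m} (entries T)))) T₀ ∙ cong (map _) T₀-entries ∙ sym (toL-oneTo (fromL {m} (entries T))) ∙ toL-fromL (Filling.numbers F))
      where
      ++-split : ∀ (xs ys : List ℕ) {as bs} → length xs ≡ length ys → xs ++ as ≡ ys ++ bs → xs ≡ ys × as ≡ bs
      ++-split []       []       l e = refl , e
      ++-split (x ∷ xs) (y ∷ ys) l e with ++-split xs ys (ℕ.suc-injective l) (List.∷-injectiveʳ e)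
      ... | e₁ , e₂ = cong₂ _∷_ (List.∷-injectiveˡ e) e₁ , e₂
      shape-entries-ext : ∀ T T′ → shape T ≡ shape T′ → entries T ≡ entries T′ → T ≡ T′
      shape-entries-ext []        []          s e = refl
      shape-entries-ext (row ∷ T) (row′ ∷ T′) s e with ++-split row row′ (List.∷-injectiveˡ s) e
      ... | e₁ , e₂ = cong₂ _∷_ e₁ (shape-entries-ext T T′ (List.∷-injectiveʳ s) e₂)

  -- Induction along a row: the left neighbour of `x` is a smaller number, so it also lies to the
  -- left of `x` with respect to `c′`.
  columns-≤ : {r c c′ : Vec ℕ m} → Diagram r c → Diagram r c′ →
              (∀ x y → lookup r x ≡ lookup r y → lookup c x < lookup c y → toℕ x < toℕ y) →
              (∀ x y → lookup r x ≡ lookup r y → lookup c′ x < lookup c′ y → toℕ x < toℕ y) → ∀ x → lookup c x ≤ lookup c′ x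
  columns-≤ {r = r} {c} {c′} D D′ o o′ x = go x (<-wellFounded _)
    where
    go : ∀ x → Acc _<_ (toℕ x) → lookup c x ≤ lookup c′ x
    go x (acc rs) with lookup c x in e
    ... | zero  = z≤n
    ... | suc j with left D x e
    ... | y , cy , ry = ℕ.≤-trans (s≤s (subst (_≤ lookup c′ y) cy (go y (rs y<x)))) lt
      where
      y<x : toℕ y < toℕ x
      y<x = o y x ry (subst₂ _<_ (sym cy) (sym e) (ℕ.n<1+n j))
      lt : lookup c′ y < lookup c′ x
      lt with ℕ.<-cmp (lookup c′ y) (lookup c′ x)
      ... | tri< a _ _ = a
      ... | tri≈ _ b _ = contradiction (cong toℕ (cell-inj D′ y x ry b)) (ℕ.<⇒≢ y<x)
      ... | tri> _ _ a = contradiction (o′ x y (sym ry) a) (ℕ.<-asym y<x)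

  shape-ext : ∀ T T′ → isPartition (shape T) ≡ true → isPartition (shape T′) ≡ true →
              (∀ p {a} → entryAt T p ≡ just a → ∃ λ b → entryAt T′ p ≡ just b) → (∀ p {a} → entryAt T′ p ≡ just a → ∃ λ b → entryAt T p ≡ just b) → shape T ≡ shape T′
  shape-ext T T′ p p′ = go T T′ (proj₁ (∧-true p)) (proj₁ (∧-true p′))
    where
    go : ∀ T T′ → allᵇ (λ k → 0 <ᵇ k) (shape T) ≡ true → allᵇ (λ k → 0 <ᵇ k) (shape T′) ≡ true →
         (∀ p {a} → entryAt T p ≡ just a → ∃ λ b → entryAt T′ p ≡ just b) → (∀ p {a} → entryAt T′ p ≡ just a → ∃ λ b → entryAt T p ≡ just b) → shape T ≡ shape T′
    go []        []          p p′ h h′ = refl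
    go []        ((x ∷ row) ∷ T′) p p′ h h′ with () ← proj₂ (h′ (0 , 0) refl)
    go ((x ∷ row) ∷ T) []         p p′ h h′ with () ← proj₂ (h (0 , 0) refl)
    go (row ∷ T) (row′ ∷ T′) p p′ h h′ = cong₂ _∷_ (ℕ.≤-antisym (nth-length row′ row (λ c → h (0 , c))) (nth-length row row′ (λ c → h′ (0 , c))))
      (go T T′ (proj₂ (∧-true {0 <ᵇ length row} p)) (proj₂ (∧-true {0 <ᵇ length row′} p′)) (λ (r , c) → h (suc r , c)) (λ (r , c) → h′ (suc r , c)))

  module SpechtDirect (α₀ : Vec ℕ m) where

    record Index : Set where
      field
        N       : Tab
        ssyt    : isSSYT N ≡ true
        size    : sum (shape N) ≡ m
        content : entries N ↭ toList α₀

      open Reading (shape N) size (isSSYT-partition N ssyt) public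

    open Index

    private
      rr cc αα : Index → Vec ℕ m
      rr a = rowV m (T₀ a)
      cc a = colV m (T₀ a)
      αα a = pMT m (N a) (T₀ a)

      line : Diagram (Vec.replicate m 0) (tabulate {n = m} toℕ)
      line = record
        { cell-inj = λ x y _ e → Fin.toℕ-injective (sym (Vec.lookup∘tabulate toℕ x) ∙ e ∙ Vec.lookup∘tabulate toℕ y)
        ; up       = λ x e → contradiction (sym (Vec.lookup-replicate x 0) ∙ e) λ ()
        ; left     = λ x {j} e → let lt = ℕ.<-trans (ℕ.n<1+n j) (subst (_< m) (sym (Vec.lookup∘tabulate toℕ x) ∙ e) (Fin.toℕ<n x)) in
                     fromℕ< lt , Vec.lookup∘tabulate toℕ (fromℕ< lt) ∙ Fin.toℕ-fromℕ< lt , Vec.lookup-replicate (fromℕ< lt) 0 ∙ sym (Vec.lookup-replicate x 0) }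

      line-weak : ∀ (v : Vec ℕ m) → (∀ x y → toℕ x < toℕ y → lookup v x ≤ lookup v y) → RowWeak (Vec.replicate m 0) (tabulate toℕ) v
      line-weak v h x y _ lt = h x y (subst₂ _<_ (Vec.lookup∘tabulate toℕ x) (Vec.lookup∘tabulate toℕ y) lt)

      -- Both row labellings are weakly increasing, and a sorted rearrangement is unique; the
      -- one-row diagram `line` makes this a case of `sorted-unique`. The order of the numbers
      -- within the rows then determines the columns.
      canonical : ∀ a b {σ} → IsPerm σ → rr b ⊙ σ ≡ rr a → rr b ≡ rr a × cc b ≡ cc a
      canonical a b {σ} p e = rr≡ , vec-ext λ x → ℕ.≤-antisym
          (columns-≤ Db (diagram (F₀ a)) ob (col-order a) x) (columns-≤ (diagram (F₀ a)) Db (col-order a) ob x)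
        where
        rr≡ : rr b ≡ rr a
        rr≡ = sym (sorted-unique line (rr b) p (lookup-fix _ λ i → Vec.lookup-replicate (lookup σ i) 0 ∙ sym (Vec.lookup-replicate i 0))
          (line-weak (rr b) (row-order b)) (subst (RowWeak (Vec.replicate m 0) (tabulate toℕ)) (sym e) (line-weak (rr a) (row-order a)))) ∙ e
        Db : Diagram (rr a) (cc b)
        Db = subst (λ r → Diagram r (cc b)) rr≡ (diagram (F₀ b))
        ob : ∀ x y → lookup (rr a) x ≡ lookup (rr a) y → lookup (cc b) x < lookup (cc b) y → toℕ x < toℕ y
        ob = subst (λ r → ∀ x y → lookup r x ≡ lookup r y → lookup (cc b) x < lookup (cc b) y → toℕ x < toℕ y) rr≡ (col-order b)

      N-shape : ∀ a → shape (N a) ≡ shape (T₀ a)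
      N-shape a = sym (T₀-shape a)

      N-determined : ∀ a b → rr b ≡ rr a → cc b ≡ cc a → αα b ≡ αα a → N b ≡ N a
      N-determined a b e e′ e″ = tab-ext (N b) (N a) (N-shape b ∙ sh ∙ sym (N-shape a)) λ p eq →
          let q , eq′ = entryAt-shape {N b} {T₀ b} (N-shape b) {p} eq
              i , _ , c≡ = cell-entryAt (F₀ b) {p} eq′
          in cong (entryAt (N a)) (sym c≡ ∙ cell≡ i) ∙ pMT-cell (F₀ a) {N a} (N-shape a) i ∙
             cong (λ v → just (lookup v i)) (sym e″) ∙ sym (pMT-cell (F₀ b) {N b} (N-shape b) i) ∙ cong (entryAt (N b)) c≡ ∙ eq
        where
        cell≡ : ∀ i → cell (F₀ b) i ≡ cell (F₀ a) i
        cell≡ i = cong₂ _,_ (cong (λ v → lookup v i) e) (cong (λ v → lookup v i) e′)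
        sub : ∀ a b → (∀ i → cell (F₀ b) i ≡ cell (F₀ a) i) → ∀ p {x} → entryAt (T₀ b) p ≡ just x → entryAt (T₀ a) p ≡ just x
        sub a b h p {x} eq = let i , x≡ , c≡ = cell-entryAt (F₀ b) {p} eq in cong (entryAt (T₀ a)) (sym c≡ ∙ h i) ∙ entryAt-cell (F₀ a) i ∙ cong just (sym x≡)
        sh : shape (T₀ b) ≡ shape (T₀ a)
        sh = shape-ext (T₀ b) (T₀ a) (Filling.partition (F₀ b)) (Filling.partition (F₀ a)) (λ p {x} eq → x , sub a b cell≡ p eq) (λ p {x} eq → x , sub b a (λ i → sym (cell≡ i)) p eq)

      open Directness α₀ rr cc αα (λ a → diagram (F₀ a)) (λ a → pMT-SSYT (F₀ a) {N a} (N-shape a) (ssyt a))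
        (λ a → ↭-⊙ α₀ (αα a) (↭-trans (pMT-content (F₀ a) {N a} (N-shape a)) (content a))) canonical

      module S = SpechtTerm

      index : SpechtTerm m (toList α₀) → Index
      index t = record { N = S.N t ; ssyt = S.ssyt t ; content = S.content t
                       ; size = cong sum (S.same t) ∙ sym (length-entries (S.tb t)) ∙ ↭.↭-length (Filling.numbers (S.filling t)) ∙ length-oneTo m }

      toTerm : SpechtTerm m (toList α₀) → Term Index m
      toTerm t = term (S.c t *ℚ invℕ (sMT m (S.N t) (S.tb t))) (fromL (entries (S.tb t))) (perm-fromL (Filling.numbers (S.filling t))) (index t)

      term-value : ∀ t β → S.value t β ≡ (Term.coef (toTerm t)) *ℚ act (Term.by (toTerm t)) (G (index t)) β
      term-value t β = cong (S.c t *ℚ_) (coeff-F (S.filling t) (S.N t) β) ∙ sym (ℚ.*-assoc (S.c t) s _) ∙ cong (S.c t *ℚ s *ℚ_) (sym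
          (act-E-relabel (F₀ (index t)) (perm-fromL (Filling.numbers (S.filling t))) {S.N t} (N-shape (index t)) β ∙
           cong (λ T → E (rowV m T) (colV m T) (pMT m (S.N t) T) β) (relabel-T₀ (index t) (S.filling t) (sym (S.same t)))))
        where s = invℕ (sMT m (S.N t) (S.tb t))

    -- Each filling is replaced by a permutation acting on the row filling of its shape; then the
    -- indicator of `P` is a weight as in `direct`.
    specht-direct : (L : List (SpechtTerm m (toList α₀))) → (∀ β → toList β ↭ toList α₀ → (∑[ t ← L ] SpechtTerm.value t β) ≡ 0ℚ) →
                    (P : Tab → Bool) → ∀ β → (∑[ t ← L ] (if P (SpechtTerm.N t) then SpechtTerm.value t β else 0ℚ)) ≡ 0ℚ
    specht-direct L vanish P β with toList β ↭? toList α₀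
    ... | no nq = ∑-0 L λ {t} _ → off (P (S.N t)) t
      where
      off : ∀ b t → (if b then S.value t β else 0ℚ) ≡ 0ℚ
      off false t = refl
      off true  t = cong (S.c t *ℚ_) (coeff-F-support (S.filling t) {S.N t} (S.same t) β (λ q → nq (↭-trans q (S.content t)))) ∙ ℚ.*-zeroʳ (S.c t)
    ... | yes q with ↭-⊙ α₀ β q
    ... | π , p , refl = ∑-cong L (λ t → weight (P (S.N t)) t) ∙ sym (∑-map toTerm L _) ∙
          direct (map toTerm L)
            (λ {τ} r → ∑-map toTerm L _ ∙ ∑-cong L (λ t → cong (_*ℚ act (Term.by (toTerm t)) (G (index t)) (α₀ ⊙ τ)) (ℚ.*-identityʳ (Term.coef (toTerm t))) ∙ sym (term-value t (α₀ ⊙ τ))) ∙ vanish (α₀ ⊙ τ) (⊙-↭ α₀ r))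
            f (λ a b (e , e′) e″ → cong (λ M → if P M then 1ℚ else 0ℚ) (N-determined a b e e′ e″)) p
      where
      f : Index → ℚ
      f a = if P (N a) then 1ℚ else 0ℚ
      weight : ∀ b t → (if b then S.value t (α₀ ⊙ π) else 0ℚ) ≡
               (Term.coef (toTerm t) *ℚ (if b then 1ℚ else 0ℚ)) *ℚ act (Term.by (toTerm t)) (G (index t)) (α₀ ⊙ π)
      weight true  t = term-value t (α₀ ⊙ π) ∙ cong (_*ℚ act (Term.by (toTerm t)) (G (index t)) (α₀ ⊙ π)) (sym (ℚ.*-identityʳ (Term.coef (toTerm t))))
      weight false t = sym (cong (_*ℚ act (Term.by (toTerm t)) (G (index t)) (α₀ ⊙ π)) (ℚ.*-zeroʳ (Term.coef (toTerm t))) ∙ ℚ.*-zeroˡ (act (Term.by (toTerm t)) (G (index t)) (α₀ ⊙ π)))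

open SpechtDirectness

-- Jeu de taquin and evacuation on sequences of boxes

module CellSequences where

  -- Standard tableaux as sequences of boxes

  Cell : Set
  Cell = ℕ × ℕ

  _≟C_ : (p q : Cell) → Dec (p ≡ q)
  (r , c) ≟C (s , d) = map′ (λ (e , f) → cong₂ _,_ e f) (λ { refl → refl , refl }) ((r ℕ.≟ s) ×-dec (c ℕ.≟ d))

  data Adj : Cell → Cell → Set where
    right : ∀ {r c} → Adj (r , c) (r , suc c)
    below : ∀ {r c} → Adj (r , c) (suc r , c)

  adj? : ∀ p q → Dec (Adj p q)
  adj? (r , c) q with q ≟C (r , suc c) | q ≟C (suc r , c)
  ... | yes refl | _        = yes right
  ... | no _     | yes refl = yes below
  ... | no nr    | no nb    = no λ { right → nr refl ; below → nb refl }

  record Addable (P : List Cell) (x : Cell) : Set where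
    constructor addable
    field
      new   : x ∉ P
      preds : ∀ {p} → Adj p x → p ∈ P

  open Addable public

  -- `P` holds the boxes already placed. For empty `P` the sequence is a standard tableau, with the
  -- box of `i + 1` at index `i`.
  Std : List Cell → List Cell → Set
  Std P []       = ⊤
  Std P (x ∷ xs) = Addable P x × Std (x ∷ P) xs

  Closed : List Cell → Set
  Closed P = ∀ {p q} → Adj p q → q ∈ P → p ∈ P

  closed-∷ : ∀ {P x} → Closed P → Addable P x → Closed (x ∷ P)
  closed-∷ cl a adj (here refl) = there (preds a adj)
  closed-∷ cl a adj (there q)   = there (cl adj q)

  _⊆_ : List Cell → List Cell → Set
  P ⊆ Q = ∀ {p} → p ∈ P → p ∈ Q

  Addable-resp : ∀ {P Q x} → P ⊆ Q → Q ⊆ P → Addable P x → Addable Q x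
  Addable-resp f g a = addable (new a ∘ g) (f ∘ preds a)

  ∷-⊆ : ∀ {P Q x} → P ⊆ Q → (x ∷ P) ⊆ (x ∷ Q)
  ∷-⊆ f (here e)  = here e
  ∷-⊆ f (there q) = there (f q)

  Std-resp : ∀ {P Q} → P ⊆ Q → Q ⊆ P → ∀ xs → Std P xs → Std Q xs
  Std-resp f g []       s       = tt
  Std-resp f g (x ∷ xs) (a , s) = Addable-resp f g a , Std-resp (∷-⊆ f) (∷-⊆ g) xs s

  exchange-⊆ : ∀ {P x y} → (x ∷ y ∷ P) ⊆ (y ∷ x ∷ P)
  exchange-⊆ (here e)          = there (here e)
  exchange-⊆ (there (here e))  = here e
  exchange-⊆ (there (there q)) = there (there q)

  Std-exchange : ∀ {P x y} xs → Std (x ∷ y ∷ P) xs → Std (y ∷ x ∷ P) xs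
  Std-exchange = Std-resp exchange-⊆ exchange-⊆

  Std-++ : ∀ {P} xs {ys} → Std P (xs ++ ys) → Std P xs × Std (List.reverse xs ++ P) ys
  Std-++ []       s = tt , s
  Std-++ {P} (x ∷ xs) {ys} (a , s) with Std-++ xs s
  ... | s₁ , s₂ = (a , s₁) , subst (λ Q → Std Q ys) (sym (cong (_++ P) (List.unfold-reverse x xs) ∙ List.++-assoc (List.reverse xs) (x ∷ []) P)) s₂

  Std-append : ∀ {P} xs {ys} → Std P xs → Std (List.reverse xs ++ P) ys → Std P (xs ++ ys)
  Std-append []       s       s′ = s′
  Std-append {P} (x ∷ xs) {ys} (a , s) s′ = a , Std-append xs s (subst (λ Q → Std Q ys) (cong (_++ P) (List.unfold-reverse x xs) ∙ List.++-assoc (List.reverse xs) (x ∷ []) P) s′)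

  -- Jeu de taquin on sequences, h being the hole.

  slideL : Cell → List Cell → List Cell × Cell
  slideL h []       = [] , h
  -- Boxes come in the order of their entries, so the first one found adjacent to the hole has the
  -- smaller of the neighbouring entries and is the one to move.
  slideL h (b ∷ xs) with adj? h b
  ... | yes _ = h ∷ proj₁ (slideL b xs) , proj₂ (slideL b xs)
  ... | no  _ = b ∷ proj₁ (slideL h xs) , proj₂ (slideL h xs)

  -- `b` does not rest on `h`, so it can be placed first. This is the case of an entry that the hole
  -- passes without moving.
  before-exchange : ∀ {P h b} → ¬ Adj h b → Addable P h → Addable (h ∷ P) b → Addable P b × Addable (b ∷ P) h
  before-exchange {P} {h} {b} na ah ab =
      addable (new ab ∘ there) (λ adj → lem adj (preds ab adj))
    , addable (λ { (here e) → new ab (here (sym e)) ; (there q) → new ah q }) (λ adj → there (preds ah adj))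
    where
    lem : ∀ {p} → Adj p b → p ∈ h ∷ P → p ∈ P
    lem adj (here refl) = contradiction adj na
    lem adj (there q)   = q

  slideL-Std : ∀ {P} h xs → Std P (h ∷ xs) → Std P (proj₁ (slideL h xs) ++ proj₂ (slideL h xs) ∷ [])
  slideL-Std h []       s = s
  slideL-Std h (b ∷ xs) (ah , ab , s) with adj? h b
  ... | yes _ = ah , slideL-Std b xs (ab , s)
  ... | no na = let ab′ , ah′ = before-exchange na ah ab in ab′ , slideL-Std h xs (ah′ , Std-exchange xs s)

  slideL-↭ : ∀ h xs → proj₁ (slideL h xs) ++ proj₂ (slideL h xs) ∷ [] ↭ h ∷ xs
  slideL-↭ h []       = refl
  slideL-↭ h (b ∷ xs) with adj? h b
  ... | yes _ = prep h (slideL-↭ b xs)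
  ... | no  _ = ↭-trans (prep b (slideL-↭ h xs)) (swap b h refl)

  slideL-length : ∀ h xs → length (proj₁ (slideL h xs)) ≡ length xs
  slideL-length h []       = refl
  slideL-length h (b ∷ xs) with adj? h b
  ... | yes _ = cong suc (slideL-length b xs)
  ... | no  _ = cong suc (slideL-length h xs)

  -- Rows are numbered downwards: for successive boxes of a standard tableau this says that the
  -- smaller entry is a descent.
  desc : Cell → Cell → Bool
  desc p q = proj₁ p <ᵇ proj₁ q

  descs : List Cell → List Bool
  descs []           = []
  descs (x ∷ [])     = []
  descs (x ∷ y ∷ xs) = desc x y ∷ descs (y ∷ xs)

  private
    leftwards-closed : ∀ {P} → Closed P → ∀ {r c} k → (r , k + c) ∈ P → (r , c) ∈ P
    leftwards-closed cl zero    q = q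
    leftwards-closed cl (suc k) q = leftwards-closed cl k (cl right q)

    same-row : ∀ {P r c d} → Closed P → Addable P (r , c) → Addable ((r , c) ∷ P) (r , d) → d ≡ suc c
    same-row {P} {r} {c} {d} cl a a′ with ℕ.<-cmp c d
    ... | tri≈ _ refl _ = contradiction (here refl) (new a′)
    same-row {P} {r} {suc c} {d} cl a a′ | tri> _ _ (s≤s d≤c) = contradiction
      (there (leftwards-closed cl (c ∸ d) (subst (λ z → (r , z) ∈ P) (sym (ℕ.m∸n+n≡m d≤c)) (preds a right)))) (new a′)
    same-row {P} {r} {c} {suc d} cl a a′ | tri< (s≤s c≤d) _ _ with preds a′ right
    ... | here refl = refl
    ... | there q   = contradiction (leftwards-closed cl (d ∸ c) (subst (λ z → (r , z) ∈ P) (sym (ℕ.m∸n+n≡m c≤d)) q)) (new a)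

    <ᵇ-suc : ∀ a b → a ≢ b → (a <ᵇ b) ≡ (a <ᵇ suc b)
    <ᵇ-suc a b ne with ℕ.<-cmp a b
    ... | tri< lt _ _ = <ᵇ-true lt ∙ sym (<ᵇ-true (ℕ.m<n⇒m<1+n lt))
    ... | tri≈ _ e _  = contradiction e ne
    ... | tri> nlt _ gt = <ᵇ-false nlt ∙ sym (<ᵇ-false (ℕ.≤⇒≯ gt))

    suc-<ᵇ : ∀ a b → suc a ≢ b → (a <ᵇ b) ≡ (suc a <ᵇ b)
    suc-<ᵇ a zero    ne = refl
    suc-<ᵇ a (suc b) ne = sym (<ᵇ-suc a b (ne ∘ cong suc))

    -- A turn would need the fourth box of the square to be in `P`, and then `h` as well, since `P`
    -- is closed.
    straight : ∀ {P h a b} → Closed P → Addable P h → Addable (h ∷ P) a → Addable (a ∷ h ∷ P) b → Adj h a → Adj a b → desc h a ≡ desc a b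
    straight cl ah aa ab right right = refl
    straight cl ah aa ab (below {r}) below = refl
    straight {P} {r , c} cl ah aa ab right below with preds ab right
    ... | there (there q) = contradiction (cl below q) (new ah)
    straight {P} {r , c} cl ah aa ab below right with preds ab below
    ... | there (there q) = contradiction (cl right q) (new ah)

    rows-differ : ∀ {P x y} → Closed P → Addable P x → Addable (x ∷ P) y → ¬ Adj x y → proj₁ x ≢ proj₁ y
    rows-differ {x = r , c} {_ , d} cl ax ay na refl with same-row cl ax ay
    ... | refl = na right

    -- (box left behind , new position of the hole)
    out : Cell → Cell → Cell × Cell
    out h b with adj? h b
    ... | yes _ = h , b
    ... | no  _ = b , h

    -- Only a vertical move changes a row, and only by one. If one of the entries moves, the
    -- comparison could change only if successive non-adjacent boxes shared a row, which
    -- `rows-differ` excludes; if both move, `straight` applies.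
    desc-slide : ∀ {P h a b} → Closed P → Std P (h ∷ a ∷ b ∷ []) → desc (proj₁ (out h a)) (proj₁ (out (proj₂ (out h a)) b)) ≡ desc a b
    desc-slide {P} {h} {a} {b} cl (ah , aa , ab , _) with adj? h a
    ... | yes adj with adj? a b
    ...   | yes adj′ = straight cl ah aa ab adj adj′
    ...   | no na    = lem adj
      where
      lem : Adj h a → desc h b ≡ desc a b
      lem right       = refl
      lem (below {r}) = suc-<ᵇ r (proj₁ b) (rows-differ (closed-∷ cl ah) aa ab na)
    desc-slide {P} {h} {a} {b} cl (ah , aa , ab , _) | no na with adj? h b
    ...   | no _     = refl
    ...   | yes adj  = lem adj
      where
      lem : Adj h b → desc a h ≡ desc a b
      lem right       = refl
      lem (below {r}) = <ᵇ-suc (proj₁ a) r (λ e → rows-differ cl ah aa na (sym e))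

    slideL-∷ : ∀ h b xs → slideL h (b ∷ xs) ≡ (proj₁ (out h b) ∷ proj₁ (slideL (proj₂ (out h b)) xs) , proj₂ (slideL (proj₂ (out h b)) xs))
    slideL-∷ h b xs with adj? h b
    ... | yes _ = refl
    ... | no  _ = refl

    out-Std : ∀ {P h b xs} → Std P (h ∷ b ∷ xs) → Addable P (proj₁ (out h b)) × Std (proj₁ (out h b) ∷ P) (proj₂ (out h b) ∷ xs)
    out-Std {h = h} {b} {xs} (ah , ab , s) with adj? h b
    ... | yes _ = ah , ab , s
    ... | no na = let ab′ , ah′ = before-exchange na ah ab in ab′ , ah′ , Std-exchange xs s

  slideL-descs : ∀ {P} → Closed P → ∀ h xs → Std P (h ∷ xs) → descs (proj₁ (slideL h xs)) ≡ descs xs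
  slideL-descs cl h []           s = refl
  slideL-descs cl h (a ∷ [])     s rewrite slideL-∷ h a [] = refl
  slideL-descs cl h (a ∷ b ∷ xs) s@(ah , aa , ab , s′) = cong (λ z → descs (proj₁ z)) (slideL-∷ h a (b ∷ xs)) ∙
      cong (λ z → descs (proj₁ (out h a) ∷ proj₁ z)) (slideL-∷ (proj₂ (out h a)) b xs) ∙
      cong₂ _∷_ (desc-slide cl (ah , aa , ab , tt))
        (sym (cong (λ z → descs (proj₁ z)) (slideL-∷ (proj₂ (out h a)) b xs)) ∙
         slideL-descs (closed-∷ cl (proj₁ (out-Std s))) (proj₂ (out h a)) (b ∷ xs) (proj₂ (out-Std s)))

  private
    desc-holes : ∀ {P h₂ h₁ b} → Closed P → Std P (h₂ ∷ h₁ ∷ b ∷ []) →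
                 desc (proj₂ (out h₂ (proj₁ (out h₁ b)))) (proj₂ (out h₁ b)) ≡ desc h₂ h₁
    desc-holes {P} {h₂} {h₁} {b} cl (a₂ , a₁ , ab , _) with adj? h₁ b
    ... | yes adj with adj? h₂ h₁
    ...   | yes adj′ = sym (straight cl a₂ a₁ ab adj′ adj)
    ...   | no na    = lem adj
      where
      lem : Adj h₁ b → desc h₂ b ≡ desc h₂ h₁
      lem right       = refl
      lem (below {r}) = sym (<ᵇ-suc (proj₁ h₂) r (rows-differ cl a₂ a₁ na))
    desc-holes {P} {h₂} {h₁} {b} cl (a₂ , a₁ , ab , _) | no na with adj? h₂ b
    ...   | no _     = refl
    ...   | yes adj  = lem adj
      where
      lem : Adj h₂ b → desc b h₁ ≡ desc h₂ h₁
      lem right       = refl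
      lem (below {r}) = sym (suc-<ᵇ r (proj₁ h₁) (λ e → rows-differ (closed-∷ cl a₂) a₁ ab na (sym e)))

    -- The second slide runs on the output of the first, so both can be followed entry by entry.
    -- Passing one entry preserves the comparison of the two holes.
    two-holes : ∀ {P} → Closed P → ∀ h₂ h₁ xs → Std P (h₂ ∷ h₁ ∷ xs) →
                desc (proj₂ (slideL h₂ (proj₁ (slideL h₁ xs)))) (proj₂ (slideL h₁ xs)) ≡ desc h₂ h₁
    two-holes cl h₂ h₁ []       s = refl
    two-holes cl h₂ h₁ (b ∷ xs) (a₂ , a₁ , ab , s′) =
      let ao , so = out-Std {h = h₁} {b} {xs} (a₁ , ab , s′)
          ao′ , so′ = out-Std {h = h₂} {proj₁ (out h₁ b)} {proj₂ (out h₁ b) ∷ xs} (a₂ , ao , so) in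
        cong (λ z → desc (proj₂ (slideL h₂ (proj₁ z))) (proj₂ z)) (slideL-∷ h₁ b xs) ∙
        cong (λ z → desc (proj₂ z) (proj₂ (slideL (proj₂ (out h₁ b)) xs))) (slideL-∷ h₂ (proj₁ (out h₁ b)) (proj₁ (slideL (proj₂ (out h₁ b)) xs))) ∙
        two-holes (closed-∷ cl ao′) (proj₂ (out h₂ (proj₁ (out h₁ b)))) (proj₂ (out h₁ b)) xs so′ ∙ desc-holes cl (a₂ , a₁ , ab , tt)

  closed-[] : Closed []
  closed-[] _ ()

  first-adjacent : ∀ {h a} → Addable [] h → Addable (h ∷ []) a → Adj h a
  first-adjacent {suc r , c} ah aa with () ← preds ah below
  first-adjacent {zero , suc c} ah aa with () ← preds ah right
  first-adjacent {zero , zero} {zero , zero}  ah aa = contradiction (here refl) (new aa)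
  first-adjacent {zero , zero} {zero , suc c} ah aa with preds aa right
  ... | here refl = right
  first-adjacent {zero , zero} {suc r , c}    ah aa with preds aa below
  ... | here refl = below

  -- The first two boxes are adjacent, so the first slide moves its hole to `a` and leaves `h` as
  -- the start of the second. The two holes then set out from `h` and `a`, and `two-holes` compares
  -- their ends.
  two-slides : ∀ h a xs → Std [] (h ∷ a ∷ xs) → ∃₂ λ y ys → proj₁ (slideL h (a ∷ xs)) ≡ y ∷ ys ×
               desc (proj₂ (slideL y ys)) (proj₂ (slideL h (a ∷ xs))) ≡ desc h a
  two-slides h a xs s@(ah , aa , s′) with adj? h a
  ... | no na = contradiction (first-adjacent ah aa) na
  ... | yes _ = h , _ , refl , two-holes closed-[] h a xs s

  evL : ℕ → List Cell → List Cell
  evL zero    xs       = []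
  evL (suc k) []       = []
  evL (suc k) (h ∷ xs) = evL k (proj₁ (slideL h xs)) ++ proj₂ (slideL h xs) ∷ []

  evL-↭ : ∀ k xs → length xs ≡ k → evL k xs ↭ xs
  evL-↭ zero    []       e = refl
  evL-↭ (suc k) (h ∷ xs) e = ↭-trans (↭.++⁺ʳ _ (evL-↭ k (proj₁ (slideL h xs)) (slideL-length h xs ∙ ℕ.suc-injective e))) (slideL-↭ h xs)

  ∈-reverse-++ : ∀ {xs ys : List Cell} → xs ↭ ys → (List.reverse xs ++ []) ⊆ (List.reverse ys ++ [])
  ∈-reverse-++ {xs} {ys} p {z} q = subst (z ∈_) (sym (List.++-identityʳ (List.reverse ys)))
    (↭.∈-resp-↭ (↭-trans (↭.↭-reverse xs) (↭-trans p (↭-sym (↭.↭-reverse ys)))) (subst (z ∈_) (List.++-identityʳ (List.reverse xs)) q))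

  evL-Std : ∀ k xs → length xs ≡ k → Std [] xs → Std [] (evL k xs)
  evL-Std zero    []       e s = tt
  evL-Std (suc k) (h ∷ xs) e s with Std-++ (proj₁ (slideL h xs)) (slideL-Std h xs s)
  ... | s₁ , s₂ = Std-append (evL k ys) (evL-Std k ys e′ s₁)
      (Std-resp (∈-reverse-++ (↭-sym (evL-↭ k ys e′))) (∈-reverse-++ (evL-↭ k ys e′)) _ s₂)
    where
    ys = proj₁ (slideL h xs)
    e′ = slideL-length h xs ∙ ℕ.suc-injective e

  descs-snoc : ∀ xs y z → descs ((xs ++ y ∷ []) ++ z ∷ []) ≡ descs (xs ++ y ∷ []) ++ desc y z ∷ []
  descs-snoc []           y z = refl
  descs-snoc (x ∷ [])     y z = refl
  descs-snoc (x ∷ w ∷ xs) y z = cong (desc x w ∷_) (descs-snoc (w ∷ xs) y z)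

  evL-descs : ∀ k xs → length xs ≡ k → Std [] xs → descs (evL k xs) ≡ List.reverse (descs xs)
  evL-descs zero    []           e s = refl
  evL-descs (suc zero) (h ∷ [])  e s = refl
  evL-descs (suc (suc k)) (h ∷ a ∷ xs) e s = step (two-slides h a xs s)
      (evL-descs (suc k) (proj₁ (slideL h (a ∷ xs))) (slideL-length h (a ∷ xs) ∙ ℕ.suc-injective e)
        (proj₁ (Std-++ (proj₁ (slideL h (a ∷ xs))) (slideL-Std h (a ∷ xs) s))))
    where
    c₁ = proj₂ (slideL h (a ∷ xs))
    step : (∃₂ λ y ys → proj₁ (slideL h (a ∷ xs)) ≡ y ∷ ys × desc (proj₂ (slideL y ys)) c₁ ≡ desc h a) →
           descs (evL (suc k) (proj₁ (slideL h (a ∷ xs)))) ≡ List.reverse (descs (proj₁ (slideL h (a ∷ xs)))) →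
           descs (evL (suc (suc k)) (h ∷ a ∷ xs)) ≡ List.reverse (descs (h ∷ a ∷ xs))
    step (y , ys , eq , d) ih = cong (λ z → descs (evL (suc k) z ++ c₁ ∷ [])) eq ∙ descs-snoc (evL k (proj₁ (slideL y ys))) (proj₂ (slideL y ys)) c₁ ∙
      cong₂ (λ u v → u ++ v ∷ []) (cong (λ z → descs (evL (suc k) z)) (sym eq) ∙ ih ∙
        cong List.reverse (slideL-descs closed-[] h (a ∷ xs) s)) d ∙
      sym (List.unfold-reverse (desc h a) (descs (a ∷ xs)))

  -- The reverse slide, worked out from the end of the sequence. The first component is the box from
  -- which the hole started.
  unslide : List Cell → Cell → Cell × List Cell
  unslide []       c = c , []
  unslide (y ∷ ys) c with adj? y (proj₁ (unslide ys c))
  ... | yes _ = y , proj₁ (unslide ys c) ∷ proj₂ (unslide ys c)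
  ... | no  _ = proj₁ (unslide ys c) , y ∷ proj₂ (unslide ys c)

  unslide-Std : ∀ {P} ys c → Std P (ys ++ c ∷ []) → Std P (proj₁ (unslide ys c) ∷ proj₂ (unslide ys c)) ×
                slideL (proj₁ (unslide ys c)) (proj₂ (unslide ys c)) ≡ (ys , c)
  unslide-Std []       c s = s , refl
  unslide-Std {P} (y ∷ ys) c (ay , s) with unslide-Std ys c s
  ... | (ah , s′) , eq with adj? y (proj₁ (unslide ys c))
  ... | yes adj = (ay , ah , s′) , lem
    where
    lem : slideL y (proj₁ (unslide ys c) ∷ proj₂ (unslide ys c)) ≡ (y ∷ ys , c)
    lem with adj? y (proj₁ (unslide ys c))
    ... | yes _ = cong (λ z → y ∷ proj₁ z , proj₂ z) eq
    ... | no na = contradiction adj na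
  ... | no na = (proj₁ (before-exchange na ay ah) , proj₂ (before-exchange na ay ah) , Std-exchange (proj₂ (unslide ys c)) s′) , lem
    where
    lem : slideL (proj₁ (unslide ys c)) (y ∷ proj₂ (unslide ys c)) ≡ (y ∷ ys , c)
    lem with adj? (proj₁ (unslide ys c)) y
    ... | no _    = cong (λ z → y ∷ proj₁ z , proj₂ z) eq
    ... | yes adj = contradiction (there (preds ay adj)) (new ah)

  -- The last box of `zs` must be the one vacated first. The others have a preimage by induction,
  -- and sliding back from the last box extends it.
  evL-surjective : ∀ zs → Std [] zs → ∃ λ xs → Std [] xs × length xs ≡ length zs × evL (length zs) xs ≡ zs
  evL-surjective zs s = go (length zs) zs refl s
    where
    go : ∀ k zs → length zs ≡ k → Std [] zs → ∃ λ xs → Std [] xs × length xs ≡ k × evL k xs ≡ zs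
    go zero    []  e s = [] , tt , refl , refl
    go (suc k) zs  e s with List.initLast zs
    go (suc k) .[] () s | List.[]
    go (suc k) .(zs ++ c ∷ []) e s | zs List.∷ʳ′ c with Std-++ zs s
    ... | s₁ , s₂ with go k zs (ℕ.suc-injective (ℕ.+-comm 1 (length zs) ∙ sym (List.length-++ zs) ∙ e)) s₁
    ... | xs′ , t , l , refl with unslide-Std xs′ c (Std-append xs′ t (Std-resp (∈-reverse-++ (evL-↭ k xs′ l)) (∈-reverse-++ (↭-sym (evL-↭ k xs′ l))) _ s₂))
    ... | u , eq = proj₁ (unslide xs′ c) ∷ proj₂ (unslide xs′ c) , u ,
        cong suc (sym (slideL-length (proj₁ (unslide xs′ c)) (proj₂ (unslide xs′ c))) ∙ cong (length ∘ proj₁) eq ∙ l) ,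
        cong (λ z → evL k (proj₁ z) ++ proj₂ z ∷ []) eq

open CellSequences

-- Slides and evacuation of tableaux

module Slides where

  -- The local functions of removeLastIn, evacuation and EC, recovered by
  -- unification: each equation below is made to apply the local function to
  -- distinct variables.

  mutual
    remGo : Tab → ℕ → Tab → ℕ → Tab
    remGo = _

    remGo-eq : ∀ row T r → removeLastIn (row ∷ T) (suc r) ≡ filterᵇ nonEmpty (row ∷ remGo (row ∷ T) (suc r) T r)
    remGo-eq row T r with row ∷ T | suc r
    ... | L | s = refl

  mutual
    evGo : Tab → ℕ → Tab → Tab → Tab
    evGo = _

    evStart : Tab → ℕ → Tab
    evStart S zero    = S
    evStart S (suc k) = evGo S k (proj₁ (slide (length (entries S)) S (0 , 0))) (setEntry S (proj₂ (slide (length (entries S)) S (0 , 0))) (suc k))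

    evGo-eq : ∀ S → evacuation S ≡ evStart S (length (entries S))
    evGo-eq S with length (entries S)
    ... | zero  = refl
    ... | suc k with slide (length (entries S)) S (0 , 0)
    ... | T′ , c with setEntry S c (suc k)
    ... | R = refl

  mutual
    ecGo : List ℕ → List ℕ → ℕ → Maybe ℕ → List Cell
    ecGo = _

    ecGo-eq : ∀ x xs → EC (x ∷ xs) ≡ (0 , x) ∷ ecGo (x ∷ xs) xs 1 (just x)
    ecGo-eq x xs with x ∷ xs | 1 | just x
    ... | L | r | p = refl

  AllPos : Tab → Set
  AllPos T = allᵇ (λ k → 0 <ᵇ k) (shape T) ≡ true

  remL : Tab → ℕ → Tab
  remL []        _       = []
  remL (row ∷ T) zero    = dropLast row ∷ T
  remL (row ∷ T) (suc r) = row ∷ remL T r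

  remGo≡ : ∀ L s T r → remGo L s T r ≡ remL T r
  remGo≡ L s []        r       = refl
  remGo≡ L s (row ∷ T) zero    = refl
  remGo≡ L s (row ∷ T) (suc r) = cong (row ∷_) (remGo≡ L s T r)

  removeLastIn≡ : ∀ T r → removeLastIn T r ≡ filterᵇ nonEmpty (remL T r)
  removeLastIn≡ []        r       = refl
  removeLastIn≡ (row ∷ T) zero    = refl
  removeLastIn≡ (row ∷ T) (suc r) = remGo-eq row T r ∙ cong (λ z → filterᵇ nonEmpty (row ∷ z)) (remGo≡ (row ∷ T) (suc r) T r)

  filter-pos : ∀ T → AllPos T → filterᵇ nonEmpty T ≡ T
  filter-pos []              p = refl
  filter-pos ((x ∷ row) ∷ T) p = cong ((x ∷ row) ∷_) (filter-pos T p)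

  nth-dropLast : ∀ xs j {a} → nth xs j ≡ just a → nth xs (suc j) ≡ nothing → ∀ c {b} →
                 (c ≢ j → nth xs c ≡ just b → nth (dropLast xs) c ≡ just b) × (nth (dropLast xs) c ≡ just b → c ≢ j × nth xs c ≡ just b)
  nth-dropLast (x ∷ [])     zero    e e′ zero    = (λ ne → contradiction refl ne) , λ ()
  nth-dropLast (x ∷ [])     zero    e e′ (suc c) = (λ _ ()) , λ ()
  nth-dropLast (x ∷ y ∷ xs) (suc j) e e′ zero    = (λ _ f → f) , λ f → (λ ()) , f
  nth-dropLast (x ∷ y ∷ xs) (suc j) e e′ (suc c) with nth-dropLast (y ∷ xs) j e e′ c
  ... | f , g = (λ ne → f (ne ∘ cong suc)) , λ q → let ne , q′ = g q in ne ∘ ℕ.suc-injective , q′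

  record Removed (T : Tab) (h : Cell) (T′ : Tab) : Set where
    constructor removed
    field
      allPos : AllPos T′
      keeps  : ∀ p {b} → p ≢ h → entryAt T p ≡ just b → entryAt T′ p ≡ just b
      only   : ∀ p {b} → entryAt T′ p ≡ just b → p ≢ h × entryAt T p ≡ just b

  open Removed

  removed-∷ : ∀ {T i j T′} row → (0 <ᵇ length row) ≡ true → Removed T (i , j) T′ → Removed (row ∷ T) (suc i , j) (row ∷ T′)
  removed-∷ row pos (removed ap f g) = removed (cong₂ _∧_ pos ap)
    (λ { (zero , c) ne e → e ; (suc r , c) ne e → f (r , c) (λ { refl → ne refl }) e })
    (λ { (zero , c) e → (λ ()) , e ; (suc r , c) e → let ne , e′ = g (r , c) e in (λ { refl → ne refl }) , e′ })

  remL-removed : ∀ T i j {a} → AllPos T → entryAt T (i , j) ≡ just a → entryAt T (i , suc j) ≡ nothing → entryAt T (suc i , j) ≡ nothing →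
                 Removed T (i , j) (filterᵇ nonEmpty (remL T i))
  remL-removed ((x ∷ []) ∷ [])        zero zero    ap e e₁ e₂ = removed refl
    (λ { (zero , zero) ne e → contradiction refl ne }) (λ p ())
  remL-removed ((x ∷ []) ∷ (y ∷ row) ∷ T) zero zero ap e e₁ ()
  remL-removed ((x ∷ y ∷ row) ∷ T)    zero j       ap e e₁ e₂ = subst (Removed ((x ∷ y ∷ row) ∷ T) (0 , j)) (sym (cong ((x ∷ dropLast (y ∷ row)) ∷_) (filter-pos T ap)))
    (removed ap
      (λ { (zero , c) ne f → proj₁ (nth-dropLast (x ∷ y ∷ row) j e e₁ c) (λ { refl → ne refl }) f ; (suc r , c) ne f → f })
      (λ { (zero , c) f → let ne , f′ = proj₂ (nth-dropLast (x ∷ y ∷ row) j e e₁ c) f in (λ { refl → ne refl }) , f′ ; (suc r , c) f → (λ ()) , f }))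
  remL-removed ((x ∷ row) ∷ T)        (suc i) j    ap e e₁ e₂ = removed-∷ (x ∷ row) refl (remL-removed T i j ap e e₁ e₂)

  removeLastIn-removed : ∀ T i j {a} → AllPos T → entryAt T (i , j) ≡ just a → entryAt T (i , suc j) ≡ nothing → entryAt T (suc i , j) ≡ nothing →
                         Removed T (i , j) (removeLastIn T i)
  removeLastIn-removed T i j ap e e₁ e₂ = subst (Removed T (i , j)) (sym (removeLastIn≡ T i)) (remL-removed T i j ap e e₁ e₂)

  setEntry-same : ∀ T h a {b} → entryAt T h ≡ just b → entryAt (setEntry T h a) h ≡ just a
  setEntry-same (row ∷ T) (zero , c) a e = go row c e
    where
    go : ∀ xs c {b} → nth xs c ≡ just b → nth (setL xs c a) c ≡ just a
    go (x ∷ xs) zero    e = refl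
    go (x ∷ xs) (suc c) e = go xs c e
  setEntry-same (row ∷ T) (suc r , c) a e = setEntry-same T (r , c) a e

  setEntry-other : ∀ T h a p → p ≢ h → entryAt (setEntry T h a) p ≡ entryAt T p
  setEntry-other []        h           a p           ne = refl
  setEntry-other (row ∷ T) (zero , c)  a (zero , d)  ne = go row c d (λ { refl → ne refl })
    where
    go : ∀ xs c d → d ≢ c → nth (setL xs c a) d ≡ nth xs d
    go []       c       d       ne = refl
    go (x ∷ xs) zero    zero    ne = contradiction refl ne
    go (x ∷ xs) zero    (suc d) ne = refl
    go (x ∷ xs) (suc c) zero    ne = refl
    go (x ∷ xs) (suc c) (suc d) ne = go xs c d (ne ∘ cong suc)
  setEntry-other (row ∷ T) (zero , c)  a (suc s , d) ne = refl
  setEntry-other (row ∷ T) (suc r , c) a (zero , d)  ne = refl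
  setEntry-other (row ∷ T) (suc r , c) a (suc s , d) ne = setEntry-other T (r , c) a (s , d) (λ { refl → ne refl })

  setEntry-shape : ∀ T h a → shape (setEntry T h a) ≡ shape T
  setEntry-shape []        h           a = refl
  setEntry-shape (row ∷ T) (zero , c)  a = cong (_∷ shape T) (go row c)
    where
    go : ∀ xs c → length (setL xs c a) ≡ length xs
    go []       c       = refl
    go (x ∷ xs) zero    = refl
    go (x ∷ xs) (suc c) = cong suc (go xs c)
  setEntry-shape (row ∷ T) (suc r , c) a = cong (length row ∷_) (setEntry-shape T (r , c) a)

  Entry : Set
  Entry = Cell × ℕ

  -- `slideL` with the entries carried along: the boxes change, the sequence of entries does not.
  slideA : Cell → List Entry → List Entry × Cell
  slideA h []             = [] , h
  slideA h ((b , v) ∷ zs) with adj? h b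
  ... | yes _ = (h , v) ∷ proj₁ (slideA b zs) , proj₂ (slideA b zs)
  ... | no  _ = (b , v) ∷ proj₁ (slideA h zs) , proj₂ (slideA h zs)

  slideA-cells : ∀ h zs → (map proj₁ (proj₁ (slideA h zs)) , proj₂ (slideA h zs)) ≡ slideL h (map proj₁ zs)
  slideA-cells h []             = refl
  slideA-cells h ((b , v) ∷ zs) with adj? h b
  ... | yes _ = cong (λ z → h ∷ proj₁ z , proj₂ z) (slideA-cells b zs)
  ... | no  _ = cong (λ z → b ∷ proj₁ z , proj₂ z) (slideA-cells h zs)

  slideA-values : ∀ h zs → map proj₂ (proj₁ (slideA h zs)) ≡ map proj₂ zs
  slideA-values h []             = refl
  slideA-values h ((b , v) ∷ zs) with adj? h b
  ... | yes _ = cong (v ∷_) (slideA-values b zs)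
  ... | no  _ = cong (v ∷_) (slideA-values h zs)

  Std-new : ∀ {P} xs → Std P xs → ∀ {x} → x ∈ xs → x ∉ P
  Std-new (x ∷ xs) (a , s) (here refl) = new a
  Std-new (x ∷ xs) (a , s) (there q)   = λ p → Std-new xs s q (there p)

  record Holds (T : Tab) (zs : List Entry) : Set where
    field
      inside  : ∀ {p a} → (p , a) ∈ zs → entryAt T p ≡ just a
      outside : ∀ p {a} → entryAt T p ≡ just a → (p , a) ∈ zs

  open Holds public

  -- The invariant of `slide`. The entries in `os` have been passed and are in their final boxes,
  -- those in `zs` are still in their old ones, and the entry stored at the hole is stale.
  record Hole (T : Tab) (h : Cell) (os zs : List Entry) : Set where
    field
      hole   : ∃ λ a → entryAt T h ≡ just a
      done   : ∀ {p a} → (p , a) ∈ os → entryAt T p ≡ just a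
      todo   : ∀ {p a} → (p , a) ∈ zs → entryAt T p ≡ just a
      others : ∀ p {a} → entryAt T p ≡ just a → p ≡ h ⊎ (p , a) ∈ os ⊎ (p , a) ∈ zs

  open Hole

  cells : List Entry → List Cell
  cells = map proj₁

  ∈-cells : ∀ {zs p a} → (p , a) ∈ zs → p ∈ cells zs
  ∈-cells = ∈.∈-map⁺ proj₁

  module _ {T h os zs} (H : Hole T h os zs) (cl : Closed (cells os)) (s : Std (cells os) (h ∷ cells zs)) where

    neighbour : ∀ {q} → Adj h q → ∀ {a} → entryAt T q ≡ just a → (q , a) ∈ zs
    neighbour {q} adj e with others H q e
    ... | inj₁ refl        = contradiction adj (irr q)
      where
      irr : ∀ p → ¬ Adj p p
      irr (r , c) ()
    ... | inj₂ (inj₁ i)    = contradiction (cl adj (∈-cells i)) (new (proj₁ s))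
    ... | inj₂ (inj₂ i)    = i

  move : ∀ {T h os b v zs} → Hole T h os ((b , v) ∷ zs) → Std (cells os) (h ∷ b ∷ cells zs) → Hole (setEntry T h v) b ((h , v) ∷ os) zs
  move {T} {h} {os} {b} {v} {zs} H (ah , ab , s) = record
    { hole   = v , (setEntry-other T h v b (λ { refl → new ab (here refl) }) ∙ todo H (here refl))
    ; done   = λ { (here refl) → setEntry-same T h v (proj₂ (hole H))
                 ; (there i)   → setEntry-other T h v _ (λ { refl → new ah (∈-cells i) }) ∙ done H i }
    ; todo   = λ {p} i → setEntry-other T h v p (λ { refl → Std-new (cells zs) s (∈-cells i) (there (here refl)) }) ∙ todo H (there i)
    ; others = oth }
    where
    oth : ∀ p {a} → entryAt (setEntry T h v) p ≡ just a → p ≡ b ⊎ (p , a) ∈ (h , v) ∷ os ⊎ (p , a) ∈ zs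
    oth p {a} e with p ≟C h
    ... | yes refl = inj₂ (inj₁ (here (cong (h ,_) (just-injective (sym e ∙ setEntry-same T h v (proj₂ (hole H)))))))
    ... | no ne with others H p (sym (setEntry-other T h v p ne) ∙ e)
    ... | inj₁ e′                  = contradiction e′ ne
    ... | inj₂ (inj₁ i)            = inj₂ (inj₁ (there i))
    ... | inj₂ (inj₂ (here refl))  = inj₁ refl
    ... | inj₂ (inj₂ (there i))    = inj₂ (inj₂ i)

  setEntry-pos : ∀ T h a → AllPos T → AllPos (setEntry T h a)
  setEntry-pos T h a = subst (λ ls → allᵇ (λ k → 0 <ᵇ k) ls ≡ true) (sym (setEntry-shape T h a))

  record Slid (Tc : Tab × Cell) (os : List Entry) (yc : List Entry × Cell) : Set where
    constructor slid
    field
      vacated : proj₂ Tc ≡ proj₂ yc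
      posS    : AllPos (proj₁ Tc)
      holds   : Holds (proj₁ Tc) (os ++ proj₁ yc)

  open Slid

  slid-∷ : ∀ {Tc o os ys c} → Slid Tc (o ∷ os) (ys , c) → Slid Tc os (o ∷ ys , c)
  slid-∷ {o = o} {os} {ys} (slid e ap H) = slid e ap record
    { inside  = λ i → inside H (↭.∈-resp-↭ (↭.shift o os ys) i)
    ; outside = λ p e → ↭.∈-resp-↭ (↭-sym (↭.shift o os ys)) (outside H p e) }

  slide-last : ∀ f T i j → entryAt T (i , suc j) ≡ nothing → entryAt T (suc i , j) ≡ nothing → slide f T (i , j) ≡ (removeLastIn T i , (i , j))
  slide-last zero    T i j e₁ e₂ = refl
  slide-last (suc f) T i j e₁ e₂ rewrite e₁ | e₂ = refl

  slide-right : ∀ f T i j {v} → entryAt T (i , suc j) ≡ just v → (∀ {w} → entryAt T (suc i , j) ≡ just w → v < w) →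
                slide (suc f) T (i , j) ≡ slide f (setEntry T (i , j) v) (i , suc j)
  slide-right f T i j {v} e h with entryAt T (i , suc j) | entryAt T (suc i , j)
  slide-right f T i j refl h | just v | nothing = refl
  slide-right f T i j refl h | just v | just w rewrite <ᵇ-true (h refl) = refl

  slide-below : ∀ f T i j {v} → entryAt T (suc i , j) ≡ just v → (∀ {w} → entryAt T (i , suc j) ≡ just w → v < w) →
                slide (suc f) T (i , j) ≡ slide f (setEntry T (i , j) v) (suc i , j)
  slide-below f T i j {v} e h with entryAt T (i , suc j) | entryAt T (suc i , j)
  slide-below f T i j refl h | nothing | just v = refl
  slide-below f T i j refl h | just w  | just v rewrite <ᵇ-false (ℕ.<⇒≯ (h refl)) = refl

  nothing-if : ∀ {m : Maybe ℕ} → (∀ {a} → m ≢ just a) → m ≡ nothing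
  nothing-if {nothing} h = refl
  nothing-if {just a}  h = contradiction refl h

  -- `slide` looks only at the two neighbours of the hole, `slideA` at all entries in turn; entries
  -- increase along `zs`, so both select the same neighbour. Every move of `slide` consumes at least
  -- one entry of `zs`, so its length bounds the fuel.
  slide-spec : ∀ zs f T h os → length zs ≤ f → AllPos T → Hole T h os zs → Closed (cells os) → Std (cells os) (h ∷ cells zs) →
               AllPairs _<_ (map proj₂ zs) → Slid (slide f T h) os (slideA h zs)
  slide-spec [] f T (i , j) os le ap H cl s inc = subst (λ z → Slid z os ([] , (i , j))) (sym (slide-last f T i j r b)) (slid refl (allPos rem) record
      { inside  = λ q → let q′ = subst (_ ∈_) (List.++-identityʳ os) q in keeps rem _ (λ { refl → new (proj₁ s) (∈-cells q′) }) (done H q′)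
      ; outside = λ p e → subst (_ ∈_) (sym (List.++-identityʳ os)) (let ne , e′ = only rem p e in out′ ne (others H p e′)) })
    where
    r : entryAt T (i , suc j) ≡ nothing
    r = nothing-if λ e → case neighbour H cl s right e of λ ()
    b : entryAt T (suc i , j) ≡ nothing
    b = nothing-if λ e → case neighbour H cl s below e of λ ()
    rem = removeLastIn-removed T i j ap (proj₂ (hole H)) r b
    out′ : ∀ {p a} → p ≢ (i , j) → p ≡ (i , j) ⊎ (p , a) ∈ os ⊎ (p , a) ∈ [] → (p , a) ∈ os
    out′ ne (inj₁ e)        = contradiction e ne
    out′ ne (inj₂ (inj₁ q)) = q
  slide-spec ((b , v) ∷ zs) f T h os le ap H cl s@(ah , ab , s′) (lt ∷ inc) with adj? h b
  slide-spec ((b , v) ∷ zs) (suc f) T (i , j) os (s≤s le) ap H cl s@(ah , ab , s′) (lt ∷ inc) | yes right =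
    slid-∷ (subst (λ z → Slid z (((i , j) , v) ∷ os) (slideA b zs)) (sym (slide-right f T i j (todo H (here refl)) λ e → smaller (neighbour H cl s below e)))
      (slide-spec zs f (setEntry T (i , j) v) b ((( i , j) , v) ∷ os) le (setEntry-pos T (i , j) v ap) (move H s) (closed-∷ cl ah) (ab , s′) inc))
    where
    smaller : ∀ {w} → ((suc i , j) , w) ∈ (b , v) ∷ zs → v < w
    smaller (there q) = All.lookup lt (∈.∈-map⁺ proj₂ q)
  slide-spec ((b , v) ∷ zs) (suc f) T (i , j) os (s≤s le) ap H cl s@(ah , ab , s′) (lt ∷ inc) | yes below =
    slid-∷ (subst (λ z → Slid z (((i , j) , v) ∷ os) (slideA b zs)) (sym (slide-below f T i j (todo H (here refl)) λ e → smaller (neighbour H cl s right e)))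
      (slide-spec zs f (setEntry T (i , j) v) b ((( i , j) , v) ∷ os) le (setEntry-pos T (i , j) v ap) (move H s) (closed-∷ cl ah) (ab , s′) inc))
    where
    smaller : ∀ {w} → ((i , suc j) , w) ∈ (b , v) ∷ zs → v < w
    smaller (there q) = All.lookup lt (∈.∈-map⁺ proj₂ q)
  slide-spec ((b , v) ∷ zs) f T h os le ap H cl s@(ah , ab , s′) (lt ∷ inc) | no na =
    slid-∷ (slide-spec zs f T h ((b , v) ∷ os) (ℕ.≤-trans (ℕ.n≤1+n _) le) ap
      (record { hole = hole H ; done = λ { (here refl) → todo H (here refl) ; (there q) → done H q } ; todo = todo H ∘ there ; others = oth })
      (closed-∷ cl (proj₁ be)) (proj₂ be , Std-exchange (cells zs) s′) inc)
    where
    be = before-exchange na ah ab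
    oth : ∀ p {a} → entryAt T p ≡ just a → p ≡ h ⊎ (p , a) ∈ (b , v) ∷ os ⊎ (p , a) ∈ zs
    oth p e with others H p e
    ... | inj₁ q                   = inj₁ q
    ... | inj₂ (inj₁ q)            = inj₂ (inj₁ (there q))
    ... | inj₂ (inj₂ (here refl))  = inj₂ (inj₁ (here refl))
    ... | inj₂ (inj₂ (there q))    = inj₂ (inj₂ q)

  evGo-step : ∀ S k T R → evGo S (suc k) T R ≡ evGo S k (proj₁ (slide (length (entries S)) T (0 , 0))) (setEntry R (proj₂ (slide (length (entries S)) T (0 , 0))) (suc k))
  evGo-step S k T R with slide (length (entries S)) T (0 , 0)
  ... | T′ , c = refl

  evacuation≡ : ∀ S → evacuation S ≡ evGo S (length (entries S)) S S
  evacuation≡ S = evGo-eq S ∙ lem (length (entries S))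
    where
    lem : ∀ n → evStart S n ≡ evGo S n S S
    lem zero    = refl
    lem (suc k) = sym (evGo-step S k S S)

  origin : ∀ {h} → Addable [] h → h ≡ (0 , 0)
  origin {zero , zero}  a = refl
  origin {zero , suc c} a with () ← preds a right
  origin {suc r , c}    a with () ← preds a below

  Evacuated : Tab → Tab → List Cell → Set
  Evacuated R R′ es = shape R′ ≡ shape R × (∀ i {p} → nth es i ≡ just p → entryAt R′ p ≡ just (suc i)) × (∀ p → p ∉ es → entryAt R′ p ≡ entryAt R p)

  -- `T` shrinks by one box per step, while `R` keeps its shape and receives the labels from the
  -- largest down. Labels already written survive because a vacated box does not occur again.
  evGo-spec : ∀ S k zs T R → k ≤ length (entries S) → length zs ≡ k → AllPos T → Holds T zs → Std [] (cells zs) → AllPairs _<_ (map proj₂ zs) →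
              (∀ {p} → p ∈ cells zs → ∃ λ a → entryAt R p ≡ just a) → Evacuated R (evGo S k T R) (evL k (cells zs))
  evGo-spec S zero    []             T R le e ap H s inc sup = refl , (λ i ()) , λ p _ → refl
  evGo-spec S (suc k) ((h , v) ∷ zs) T R le e ap H s@(ah , s′) (_ ∷ inc) sup with origin ah
  ... | refl = subst₂ (λ Z es → Evacuated R Z es) (sym (evGo-step S k T R ∙ cong (λ z → evGo S k T′ (setEntry R z (suc k))) c≡))
        (cong (λ z → evL k (proj₁ z) ++ proj₂ z ∷ []) (slideA-cells h zs))
        ( proj₁ ih ∙ setEntry-shape R c (suc k) , filled , other )
    where
    N = length (entries S)
    T′ = proj₁ (slide N T (0 , 0))
    ys = proj₁ (slideA h zs)
    c = proj₂ (slideA h zs)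
    H₀ : Hole T h [] zs
    H₀ = record { hole = v , inside H (here refl) ; done = λ () ; todo = inside H ∘ there ; others = λ p e → oth (outside H p e) }
      where
      oth : ∀ {p a} → (p , a) ∈ (h , v) ∷ zs → p ≡ h ⊎ (p , a) ∈ [] ⊎ (p , a) ∈ zs
      oth (here refl) = inj₁ refl
      oth (there q)   = inj₂ (inj₂ q)
    spec : Slid (slide N T (0 , 0)) [] (slideA h zs)
    spec = slide-spec zs N T h [] (ℕ.≤-trans (ℕ.≤-trans (ℕ.≤-reflexive (ℕ.suc-injective e)) (ℕ.n≤1+n k)) le) ap H₀ closed-[] s inc
    c≡ : proj₂ (slide N T (0 , 0)) ≡ c
    c≡ = vacated spec
    cells-ys : cells ys ++ c ∷ [] ≡ proj₁ (slideL h (cells zs)) ++ proj₂ (slideL h (cells zs)) ∷ []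
    cells-ys = cong (λ z → proj₁ z ++ proj₂ z ∷ []) (slideA-cells h zs)
    perm′ : cells ys ++ c ∷ [] ↭ h ∷ cells zs
    perm′ = ↭-trans (↭-reflexive cells-ys) (slideL-↭ h (cells zs))
    std′ : Std [] (cells ys ++ c ∷ [])
    std′ = subst (Std []) (sym cells-ys) (slideL-Std h (cells zs) s)
    len : length ys ≡ k
    len = sym (List.length-map proj₁ ys) ∙ cong (length ∘ proj₁) (slideA-cells h zs) ∙ slideL-length h (cells zs) ∙ List.length-map proj₁ zs ∙ ℕ.suc-injective e
    lenc : length (cells ys) ≡ k
    lenc = List.length-map proj₁ ys ∙ len
    c-sup : ∃ λ a → entryAt R c ≡ just a
    c-sup = sup (↭.∈-resp-↭ perm′ (∈.∈-++⁺ʳ (cells ys) (here refl)))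
    R₁ = setEntry R c (suc k)
    sup₁ : ∀ {p} → p ∈ cells ys → ∃ λ a → entryAt R₁ p ≡ just a
    sup₁ {p} q with p ≟C c
    ... | yes refl = suc k , setEntry-same R c (suc k) (proj₂ c-sup)
    ... | no ne    = let a , e = sup (↭.∈-resp-↭ perm′ (∈.∈-++⁺ˡ q)) in a , setEntry-other R c (suc k) p ne ∙ e
    ih : Evacuated R₁ (evGo S k T′ R₁) (evL k (cells ys))
    ih = evGo-spec S k ys T′ R₁ (ℕ.≤-trans (ℕ.n≤1+n k) le) len (posS spec) (holds spec) (proj₁ (Std-++ (cells ys) std′))
      (subst (AllPairs _<_) (sym (slideA-values h zs)) inc) sup₁
    ev↭ : evL k (cells ys) ↭ cells ys
    ev↭ = evL-↭ k (cells ys) lenc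
    c∉ : c ∉ evL k (cells ys)
    c∉ q = new (proj₁ (proj₂ (Std-++ (cells ys) std′))) (subst (c ∈_) (sym (List.++-identityʳ (List.reverse (cells ys))))
      (↭.∈-resp-↭ (↭-sym (↭.↭-reverse (cells ys))) (↭.∈-resp-↭ ev↭ q)))
    lenev : length (evL k (cells ys)) ≡ k
    lenev = ↭.↭-length ev↭ ∙ lenc
    nth-snoc : ∀ (xs : List Cell) {x} i {p} → nth (xs ++ x ∷ []) i ≡ just p → nth xs i ≡ just p ⊎ (i ≡ length xs × p ≡ x)
    nth-snoc []       zero    refl = inj₂ (refl , refl)
    nth-snoc (y ∷ xs) zero    e    = inj₁ e
    nth-snoc (y ∷ xs) (suc i) e with nth-snoc xs i e
    ... | inj₁ q         = inj₁ q
    ... | inj₂ (q , q′)  = inj₂ (cong suc q , q′)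
    filled : ∀ i {p} → nth (evL k (cells ys) ++ c ∷ []) i ≡ just p → entryAt (evGo S k T′ R₁) p ≡ just (suc i)
    filled i e with nth-snoc (evL k (cells ys)) i e
    ... | inj₁ q             = proj₁ (proj₂ ih) i q
    ... | inj₂ (refl , refl) = proj₂ (proj₂ ih) c c∉ ∙ setEntry-same R c (suc k) (proj₂ c-sup) ∙ cong (just ∘ suc) (sym lenev)
    other : ∀ p → p ∉ evL k (cells ys) ++ c ∷ [] → entryAt (evGo S k T′ R₁) p ≡ entryAt R p
    other p np = proj₂ (proj₂ ih) p (np ∘ ∈.∈-++⁺ˡ) ∙ setEntry-other R c (suc k) p (λ { refl → np (∈.∈-++⁺ʳ (evL k (cells ys)) (here refl)) })

open Slides

-- Standard tableaux and their addable boxes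

module StandardTableaux where

  -- Ties a table to its sequence of boxes. The index is one less than the entry, since entries
  -- start at 1.
  record SYT (T : Tab) (xs : List Cell) : Set where
    field
      pos : AllPos T
      at⁺ : ∀ i {p} → nth xs i ≡ just p → entryAt T p ≡ just (suc i)
      at⁻ : ∀ p {a} → entryAt T p ≡ just a → ∃ λ i → a ≡ suc i × nth xs i ≡ just p
      std : Std [] xs

  open SYT public

  Std-preds : ∀ {P} xs → Std P xs → ∀ j {p q} → nth xs j ≡ just p → Adj q p → q ∈ P ⊎ ∃ λ i → i < j × nth xs i ≡ just q
  Std-preds (x ∷ xs) (a , s) zero    refl adj = inj₁ (preds a adj)
  Std-preds (x ∷ xs) (a , s) (suc j) e    adj with Std-preds xs s j e adj
  ... | inj₁ (here refl)   = inj₂ (0 , z<s , refl)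
  ... | inj₁ (there q)     = inj₁ q
  ... | inj₂ (i , lt , e′) = inj₂ (suc i , s<s lt , e′)

  Std-unique : ∀ {P} xs → Std P xs → Unique xs
  Std-unique []       s       = []
  Std-unique (x ∷ xs) (a , s) = All.tabulate (λ { q refl → Std-new xs s q (here refl) }) ∷ Std-unique xs s

  shape-partition : ∀ T → AllPos T → (∀ r c {a} → entryAt T (suc r , c) ≡ just a → ∃ λ b → entryAt T (r , c) ≡ just b) → isPartition (shape T) ≡ true
  shape-partition T p h = cong₂ _∧_ p (go T h)
    where
    go : ∀ T → (∀ r c {a} → entryAt T (suc r , c) ≡ just a → ∃ λ b → entryAt T (r , c) ≡ just b) → weaklyDecr (shape T) ≡ true
    go []               h = refl
    go (row ∷ [])       h = refl
    go (row ∷ row′ ∷ T) h = cong₂ _∧_ (true-≤ᵇ (nth-length row row′ (h 0))) (go (row′ ∷ T) (λ r → h (suc r)))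

  module _ {T : Tab} {xs : List Cell} (S : SYT T xs) where

    syt-preds : ∀ {p q a} → entryAt T p ≡ just a → Adj q p → ∃ λ b → entryAt T q ≡ just b × b < a
    syt-preds {p} e adj with at⁻ S p e
    ... | j , refl , e′ with Std-preds xs (std S) j e′ adj
    ... | inj₂ (i , lt , e″) = suc i , at⁺ S i e″ , s<s lt

    syt-unique : Unique (entries T)
    syt-unique = entryAt-unique T λ p q e f → same (at⁻ S p e) (at⁻ S q f)
      where
      same : ∀ {p q a} → (∃ λ i → a ≡ suc i × nth xs i ≡ just p) → (∃ λ i → a ≡ suc i × nth xs i ≡ just q) → p ≡ q
      same (i , refl , e) (j , refl , f) = just-injective (sym e ∙ f)

    syt-numbers : entries T ↭ oneTo (length xs)
    syt-numbers = unique-↭ syt-unique (oneTo-unique (length xs)) to from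
      where
      to : ∀ {a} → a ∈ entries T → a ∈ oneTo (length xs)
      to q with ∈-entryAt T q
      ... | p , e with at⁻ S p e
      ... | i , refl , e′ = ∈.∈-map⁺ suc (∈.∈-upTo⁺ (nth-< xs e′))
      from : ∀ {a} → a ∈ oneTo (length xs) → a ∈ entries T
      from q with ∈.∈-map⁻ suc q
      ... | i , i∈ , refl with <-nth xs (∈.∈-upTo⁻ i∈)
      ... | p , e = entryAt-∈ T {proj₁ p} (at⁺ S i e)

    syt-length : length (entries T) ≡ length xs
    syt-length = ↭.↭-length syt-numbers ∙ length-oneTo (length xs)

    syt-partition : isPartition (shape T) ≡ true
    syt-partition = shape-partition T (pos S) λ r c e → let b , e′ , _ = syt-preds {suc r , c} e below in b , e′

    syt-posOf : ∀ i {p} → nth xs i ≡ just p → posOf T (suc i) ≡ just p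
    syt-posOf i e = posOf-entryAt T syt-unique (at⁺ S i e)

  syt-ext : ∀ {T T′ xs} → SYT T xs → SYT T′ xs → T ≡ T′
  syt-ext {T} {T′} {xs} S S′ = tab-ext T T′ (shape-ext T T′ (syt-partition S) (syt-partition S′) (λ p {a} e → a , sub S S′ p e) (λ p {a} e → a , sub S′ S p e)) (sub S S′)
    where
    sub : ∀ {T T′} → SYT T xs → SYT T′ xs → ∀ p {a} → entryAt T p ≡ just a → entryAt T′ p ≡ just a
    sub S S′ p e with at⁻ S p e
    ... | i , refl , e′ = at⁺ S′ i e′

  private
    assoc : ℕ → List Cell → List Entry
    assoc k []       = []
    assoc k (x ∷ xs) = (x , suc k) ∷ assoc (suc k) xs

    assoc-cells : ∀ k xs → map proj₁ (assoc k xs) ≡ xs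
    assoc-cells k []       = refl
    assoc-cells k (x ∷ xs) = cong (x ∷_) (assoc-cells (suc k) xs)

    assoc-values : ∀ k xs → All (λ v → k < v) (map proj₂ (assoc k xs)) × AllPairs _<_ (map proj₂ (assoc k xs))
    assoc-values k []       = [] , []
    assoc-values k (x ∷ xs) with assoc-values (suc k) xs
    ... | a , p = ℕ.n<1+n k ∷ All.map (ℕ.<-trans (ℕ.n<1+n k)) a , a ∷ p

    assoc-∈ : ∀ k xs {p a} → (p , a) ∈ assoc k xs → ∃ λ i → a ≡ suc (k + i) × nth xs i ≡ just p
    assoc-∈ k (x ∷ xs) (here refl) = 0 , cong suc (sym (ℕ.+-identityʳ k)) , refl
    assoc-∈ k (x ∷ xs) (there q) with assoc-∈ (suc k) xs q
    ... | i , e , e′ = suc i , e ∙ cong suc (sym (ℕ.+-suc k i)) , e′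

    ∈-assoc : ∀ k xs i {p} → nth xs i ≡ just p → (p , suc (k + i)) ∈ assoc k xs
    ∈-assoc k (x ∷ xs) zero    refl = here (cong (λ z → x , suc z) (ℕ.+-identityʳ k))
    ∈-assoc k (x ∷ xs) (suc i) {p} e = there (subst (λ z → (p , suc z) ∈ assoc (suc k) xs) (sym (ℕ.+-suc k i)) (∈-assoc (suc k) xs i e))

  syt-evacuation : ∀ {S xs} → SYT S xs → SYT (evacuation S) (evL (length xs) xs)
  syt-evacuation {S} {xs} Y = subst₂ SYT (sym (evacuation≡ S)) (cong (λ n → evL n xs) (syt-length Y)) record
    { pos = subst (λ ls → allᵇ (λ k → 0 <ᵇ k) ls ≡ true) (sym (proj₁ ev)) (pos Y)
    ; at⁺ = λ i → proj₁ (proj₂ ev) i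
    ; at⁻ = back
    ; std = evL-Std n xs (sym (syt-length Y)) (std Y) }
    where
    n = length (entries S)
    es = evL n xs
    es↭ : es ↭ xs
    es↭ = evL-↭ n xs (sym (syt-length Y))
    ev : Evacuated S (evGo S n S S) es
    ev = subst (λ cs → Evacuated S (evGo S n S S) (evL n cs)) (assoc-cells 0 xs)
      (evGo-spec S n (assoc 0 xs) S S ℕ.≤-refl (sym (List.length-map proj₁ (assoc 0 xs)) ∙ cong length (assoc-cells 0 xs) ∙ sym (syt-length Y)) (pos Y)
        (record { inside  = λ {p} q → let i , e , e′ = assoc-∈ 0 xs q in at⁺ Y i e′ ∙ cong just (sym e)
                ; outside = λ p e → let i , e′ , e″ = at⁻ Y p e in subst (λ a → (p , a) ∈ assoc 0 xs) (sym e′) (∈-assoc 0 xs i e″) })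
        (subst (Std []) (sym (assoc-cells 0 xs)) (std Y)) (proj₂ (assoc-values 0 xs))
        (λ q → let i , e = ∈-nth (subst (_ ∈_) (assoc-cells 0 xs) q) in suc i , at⁺ Y i e))
    back : ∀ p {a} → entryAt (evGo S n S S) p ≡ just a → ∃ λ i → a ≡ suc i × nth es i ≡ just p
    back p {a} e = by (Any.any? (λ q → p ≟C q) es)
      where
      import Data.List.Relation.Unary.Any as Any
      by : Dec (p ∈ es) → ∃ λ i → a ≡ suc i × nth es i ≡ just p
      by (yes q) = let i , e′ = ∈-nth q in i , just-injective (sym e ∙ proj₁ (proj₂ ev) i e′) , e′
      by (no nq) = let i , _ , e′ = at⁻ Y p (sym (proj₂ (proj₂ ev) p nq) ∙ e) in contradiction (↭.∈-resp-↭ (↭-sym es↭) (nth-∈ xs e′)) nq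

  private
    find : Cell → List Cell → Maybe ℕ
    find p [] = nothing
    find p (x ∷ xs) with p ≟C x
    ... | yes _ = just 1
    ... | no  _ = Maybe.map suc (find p xs)

    find-just : ∀ p xs {a} → find p xs ≡ just a → ∃ λ i → a ≡ suc i × nth xs i ≡ just p
    find-just p (x ∷ xs) e with p ≟C x
    find-just p (x ∷ xs) refl | yes refl = 0 , refl , refl
    ... | no _ with find p xs in e′
    find-just p (x ∷ xs) refl | no _ | just a with find-just p xs e′
    ... | i , e₁ , e₂ = suc i , cong suc e₁ , e₂

    just-find : ∀ {p} xs → Unique xs → ∀ i → nth xs i ≡ just p → find p xs ≡ just (suc i)
    just-find {p} (x ∷ xs) (q ∷ u) i e with p ≟C x
    just-find (x ∷ xs) (q ∷ u) zero    e | yes _    = refl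
    just-find (x ∷ xs) (q ∷ u) (suc i) e | yes refl = contradiction refl (All.lookup q (nth-∈ xs e))
    just-find (x ∷ xs) (q ∷ u) zero refl | no ne    = contradiction refl ne
    just-find (x ∷ xs) (q ∷ u) (suc i) e | no _ rewrite just-find xs u i e = refl

    bnd : List Cell → ℕ
    bnd []             = 0
    bnd ((r , c) ∷ xs) = suc (r + c) + bnd xs

    bnd-∈ : ∀ xs {r c} → (r , c) ∈ xs → r < bnd xs × c < bnd xs
    bnd-∈ ((r , c) ∷ xs) (here refl) = ℕ.≤-trans (s≤s (ℕ.m≤m+n r c)) (ℕ.m≤m+n _ (bnd xs)) , ℕ.≤-trans (s≤s (ℕ.m≤n+m c r)) (ℕ.m≤m+n _ (bnd xs))
    bnd-∈ ((r , c) ∷ xs) (there q) with bnd-∈ xs q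
    ... | p , p′ = ℕ.≤-trans p (ℕ.m≤n+m (bnd xs) (suc (r + c))) , ℕ.≤-trans p′ (ℕ.m≤n+m (bnd xs) (suc (r + c)))

  tabulation : ∀ xs → Std [] xs → ∃ λ T → SYT T xs
  tabulation xs s = tabOf f (bnd xs) (bnd xs) , record
      { pos = proj₁ (∧-true (tabOf-partition closed))
      ; at⁺ = λ i {p} e → entryAt-tabOf closed (proj₁ p) (proj₂ p) ∙ just-find xs (Std-unique xs s) i e
      ; at⁻ = λ (r , c) e → find-just (r , c) xs (sym (entryAt-tabOf closed r c) ∙ e)
      ; std = s }
    where
    f : ℕ → ℕ → Maybe ℕ
    f r c = find (r , c) xs
    pred′ : ∀ {p q a} → find p xs ≡ just a → Adj q p → ∃ λ b → find q xs ≡ just b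
    pred′ {p} e adj with find-just p xs e
    ... | j , _ , e′ with Std-preds xs s j e′ adj
    ... | inj₂ (i , _ , e″) = suc i , just-find xs (Std-unique xs s) i e″
    in-xs : ∀ {p a} → find p xs ≡ just a → p ∈ xs
    in-xs {p} e = nth-∈ xs (proj₂ (proj₂ (find-just p xs e)))
    closed : DownClosed f (bnd xs) (bnd xs)
    closed = record { leftC = λ r c e → pred′ {r , suc c} e right ; upC = λ r c e → pred′ {suc r , c} e below
                    ; boundR = λ r c e → proj₁ (bnd-∈ xs (in-xs {r , c} e)) ; boundC = λ r c e → proj₂ (bnd-∈ xs (in-xs {r , c} e)) }

  -- Addability read off from the table alone; for a nonempty tableau of partition shape it agrees
  -- with membership in `EC`.
  record Extends (T : Tab) (v : Cell) : Set where
    field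
      free     : entryAt T v ≡ nothing
      supports : ∀ {p} → Adj p v → ∃ λ a → entryAt T p ≡ just a

  open Extends public

  private
    nth-snoc-last : ∀ (xs : List ℕ) c a → nth xs c ≡ nothing → (∀ {d} → c ≡ suc d → ∃ λ b → nth xs d ≡ just b) → nth (xs ++ a ∷ []) c ≡ just a
    nth-snoc-last []           zero    a e h = refl
    nth-snoc-last []           (suc c) a e h with () ← proj₂ (h refl)
    nth-snoc-last (x ∷ xs)     (suc zero)    a e h = nth-snoc-last xs 0 a e λ ()
    nth-snoc-last (x ∷ xs)     (suc (suc c)) a e h = nth-snoc-last xs (suc c) a e λ { refl → h refl }

    nth-snoc-other : ∀ (xs : List ℕ) c a d → nth xs c ≡ nothing → (∀ {e} → c ≡ suc e → ∃ λ b → nth xs e ≡ just b) → d ≢ c → nth (xs ++ a ∷ []) d ≡ nth xs d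
    nth-snoc-other []       zero    a zero    e h ne = contradiction refl ne
    nth-snoc-other []       zero    a (suc d) e h ne = refl
    nth-snoc-other []       (suc c) a d       e h ne with () ← proj₂ (h refl)
    nth-snoc-other (x ∷ xs) (suc c) a zero    e h ne = refl
    nth-snoc-other (x ∷ xs) (suc zero) a (suc d) e h ne = nth-snoc-other xs 0 a d e (λ ()) (ne ∘ cong suc)
    nth-snoc-other (x ∷ xs) (suc (suc c)) a (suc d) e h ne = nth-snoc-other xs (suc c) a d e (λ { refl → h refl }) (ne ∘ cong suc)

  addCell-spec : ∀ T r c a → AllPos T → Extends T (r , c) → AllPos (addCell T r a) × entryAt (addCell T r a) (r , c) ≡ just a ×
                 (∀ p → p ≢ (r , c) → entryAt (addCell T r a) p ≡ entryAt T p)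
  addCell-spec [] zero zero a ap ex = refl , refl , λ { (zero , zero) ne → contradiction refl ne ; (zero , suc d) ne → refl ; (suc s , d) ne → refl }
  addCell-spec [] zero (suc c) a ap ex with () ← proj₂ (supports ex right)
  addCell-spec [] (suc r) c a ap ex with () ← proj₂ (supports ex below)
  addCell-spec (row ∷ T) zero c a ap ex = cong₂ _∧_ (pos′ row) (proj₂ (∧-true {0 <ᵇ length row} ap)) , nth-snoc-last row c a (free ex) (λ { refl → supports ex right }) ,
      λ { (zero , d) ne → nth-snoc-other row c a d (free ex) (λ { refl → supports ex right }) (λ { refl → ne refl }) ; (suc s , d) ne → refl }
    where
    pos′ : ∀ (xs : List ℕ) → (0 <ᵇ length (xs ++ a ∷ [])) ≡ true
    pos′ []       = refl
    pos′ (x ∷ xs) = refl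
  addCell-spec (row ∷ T) (suc r) c a ap ex with addCell-spec T r c a (proj₂ (∧-true {0 <ᵇ length row} ap)) (record { free = free ex ; supports = lower })
    where
    lower : ∀ {p} → Adj p (r , c) → ∃ λ b → entryAt T p ≡ just b
    lower right = supports ex right
    lower below = supports ex below
  ... | ap′ , e , o = cong₂ _∧_ (proj₁ (∧-true ap)) ap′ , e , λ { (zero , d) ne → refl ; (suc s , d) ne → o (s , d) (λ { refl → ne refl }) }

  nth-++ˡ : ∀ {A : Set} (xs : List A) {ys} i {x} → nth xs i ≡ just x → nth (xs ++ ys) i ≡ just x
  nth-++ˡ (x ∷ xs) zero    e = e
  nth-++ˡ (x ∷ xs) (suc i) e = nth-++ˡ xs i e

  nth-last : ∀ {A : Set} (xs : List A) {x} → nth (xs ++ x ∷ []) (length xs) ≡ just x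
  nth-last []       = refl
  nth-last (x ∷ xs) = nth-last xs

  nth-snoc⁻ : ∀ {A : Set} (xs : List A) {x} i {p} → nth (xs ++ x ∷ []) i ≡ just p → nth xs i ≡ just p ⊎ (i ≡ length xs × p ≡ x)
  nth-snoc⁻ []       zero    refl = inj₂ (refl , refl)
  nth-snoc⁻ (y ∷ xs) zero    e    = inj₁ e
  nth-snoc⁻ (y ∷ xs) (suc i) e with nth-snoc⁻ xs i e
  ... | inj₁ q         = inj₁ q
  ... | inj₂ (q , q′)  = inj₂ (cong suc q , q′)

  ∈-reverse⁻ : ∀ (xs : List Cell) {z} → z ∈ List.reverse xs ++ [] → z ∈ xs
  ∈-reverse⁻ xs {z} q = ↭.∈-resp-↭ (↭.↭-reverse xs) (subst (z ∈_) (List.++-identityʳ (List.reverse xs)) q)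

  ∈-reverse⁺ : ∀ (xs : List Cell) {z} → z ∈ xs → z ∈ List.reverse xs ++ []
  ∈-reverse⁺ xs {z} q = subst (z ∈_) (sym (List.++-identityʳ (List.reverse xs))) (↭.∈-resp-↭ (↭-sym (↭.↭-reverse xs)) q)

  syt-addable : ∀ {T xs v} → SYT T xs → Extends T v → Std [] (xs ++ v ∷ [])
  syt-addable {T} {xs} {v} S ex = Std-append xs (std S) (addable
      (λ q → let i , e = ∈-nth (∈-reverse⁻ xs q) in contradiction (sym (free ex) ∙ at⁺ S i e) λ ())
      (λ {p} adj → let a , e = supports ex adj ; i , _ , e′ = at⁻ S p e in ∈-reverse⁺ xs (nth-∈ xs e′)) , tt)

  syt-extends : ∀ {T xs v} → SYT T xs → Std [] (xs ++ v ∷ []) → Extends T v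
  syt-extends {T} {xs} {v} S s = record
      { free     = nothing-if λ e → let i , _ , e′ = at⁻ S v e in new a (∈-reverse⁺ xs (nth-∈ xs e′))
      ; supports = λ adj → let i , e = ∈-nth (∈-reverse⁻ xs (preds a adj)) in suc i , at⁺ S i e }
    where
    a = proj₁ (proj₂ (Std-++ xs s))

  syt-addCell : ∀ {T xs r c} → SYT T xs → Extends T (r , c) → SYT (addCell T r (suc (length xs))) (xs ++ (r , c) ∷ [])
  syt-addCell {T} {xs} {r} {c} S ex with addCell-spec T r c (suc (length xs)) (pos S) ex
  ... | ap , e , o = record
    { pos = ap
    ; at⁺ = λ i q → to i (nth-snoc⁻ xs i q)
    ; at⁻ = back
    ; std = syt-addable S ex }
    where
    T′ = addCell T r (suc (length xs))
    to : ∀ i {p} → nth xs i ≡ just p ⊎ (i ≡ length xs × p ≡ (r , c)) → entryAt T′ p ≡ just (suc i)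
    to i (inj₂ (refl , refl)) = e
    to i {p} (inj₁ q) = o p (λ { refl → contradiction (sym (free ex) ∙ at⁺ S i q) λ () }) ∙ at⁺ S i q
    back : ∀ p {a} → entryAt T′ p ≡ just a → ∃ λ i → a ≡ suc i × nth (xs ++ (r , c) ∷ []) i ≡ just p
    back p f with p ≟C (r , c)
    ... | yes refl = length xs , just-injective (sym f ∙ e) , nth-last xs
    ... | no ne with at⁻ S p (sym (o p ne) ∙ f)
    ... | i , e₁ , e₂ = i , e₁ , nth-++ˡ xs i e₂

  private
    -- Addability to a lower part `T` of a tableau. The length `p` of the row just above it matters
    -- only for a box in the first row of `T`.
    Ok : ℕ → Tab → ℕ → ℕ → Set
    Ok p T i c = entryAt T (i , c) ≡ nothing × (i ≡ 0 → c < p) × (∀ {i′} → i ≡ suc i′ → ∃ λ a → entryAt T (i′ , c) ≡ just a) ×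
                 (∀ {c′} → c ≡ suc c′ → ∃ λ a → entryAt T (i , c′) ≡ just a)

    nth-length-nothing : ∀ (xs : List ℕ) → nth xs (length xs) ≡ nothing
    nth-length-nothing []       = refl
    nth-length-nothing (x ∷ xs) = nth-length-nothing xs

    nth-nothing-≥ : ∀ (xs : List ℕ) c → nth xs c ≡ nothing → length xs ≤ c
    nth-nothing-≥ []       c       e = z≤n
    nth-nothing-≥ (x ∷ xs) (suc c) e = s≤s (nth-nothing-≥ xs c e)

    ecGo-sound : ∀ L T r p {s c} → (s , c) ∈ ecGo L (shape T) r (just p) → ∃ λ i → s ≡ r + i × Ok p T i c
    ecGo-sound L [] r p q with 0 <ᵇ p in lt
    ecGo-sound L [] r p (here refl) | true = 0 , sym (ℕ.+-identityʳ r) , refl , (λ _ → <ᵇ-true⁻ lt) , (λ ()) , λ ()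
    ecGo-sound L (row ∷ T) r p {s} {c} q with ∈.∈-++⁻ (if length row <ᵇ p then (r , length row) ∷ [] else []) q
    ... | inj₂ q′ with ecGo-sound L T (suc r) (length row) q′
    ... | i , e , free , h₀ , hs , hc = suc i , e ∙ sym (ℕ.+-suc r i) , free , (λ ()) , up′ i h₀ hs , hc
      where
      up′ : ∀ i → (i ≡ 0 → c < length row) → (∀ {i′} → i ≡ suc i′ → ∃ λ a → entryAt T (i′ , c) ≡ just a) →
            ∀ {i′} → suc i ≡ suc i′ → ∃ λ a → entryAt (row ∷ T) (i′ , c) ≡ just a
      up′ zero    h₀ hs refl = <-nth row (h₀ refl)
      up′ (suc i) h₀ hs refl = hs refl
    ecGo-sound L (row ∷ T) r p q | inj₁ q′ with length row <ᵇ p in lt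
    ecGo-sound L (row ∷ T) r p q | inj₁ (here refl) | true = 0 , sym (ℕ.+-identityʳ r) , nth-length-nothing row , (λ _ → <ᵇ-true⁻ lt) , (λ ()) ,
      λ e → <-nth row (ℕ.≤-reflexive (sym e))

    ecGo-complete : ∀ L T r p i c → Ok p T i c → (r + i , c) ∈ ecGo L (shape T) r (just p)
    ecGo-complete L [] r p zero zero    (_ , h₀ , _ , _) rewrite <ᵇ-true (h₀ refl) = here (cong (_, 0) (ℕ.+-identityʳ r))
    ecGo-complete L [] r p zero (suc c) (_ , _ , _ , hc) with () ← proj₂ (hc refl)
    ecGo-complete L [] r p (suc i) c    (_ , _ , hs , _) with () ← proj₂ (hs refl)
    ecGo-complete L (row ∷ T) r p zero c (free , h₀ , _ , hc) = ∈.∈-++⁺ˡ (lem (c≡ c free hc))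
      where
      c≡ : ∀ c → nth row c ≡ nothing → (∀ {c′} → c ≡ suc c′ → ∃ λ a → nth row c′ ≡ just a) → c ≡ length row
      c≡ zero    f h = sym (ℕ.n≤0⇒n≡0 (nth-nothing-≥ row 0 f))
      c≡ (suc c) f h = ℕ.≤-antisym (nth-< row (proj₂ (h refl))) (nth-nothing-≥ row (suc c) f)
      lem : c ≡ length row → (r + 0 , c) ∈ (if length row <ᵇ p then (r , length row) ∷ [] else [])
      lem refl rewrite <ᵇ-true (h₀ refl) = here (cong (_, length row) (ℕ.+-identityʳ r))
    ecGo-complete L (row ∷ T) r p (suc i) c (free , _ , hs , hc) = ∈.∈-++⁺ʳ _ (subst (λ z → (z , c) ∈ ecGo L (shape T) (suc r) (just (length row))) (sym (ℕ.+-suc r i))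
      (ecGo-complete L T (suc r) (length row) i c (free , (λ { refl → nth-< row (proj₂ (hs refl)) }) , (λ { refl → hs refl }) , hc)))

  EC-sound : ∀ T {v} → 0 < length T → v ∈ EC (shape T) → Extends T v
  EC-sound (row ∷ T) {s , c} _ q with subst ((s , c) ∈_) (ecGo-eq (length row) (shape T)) q
  ... | here refl = record { free = nth-length-nothing row ; supports = sup₀ (length row) ℕ.≤-refl }
    where
    sup₀ : ∀ c → c ≤ length row → ∀ {p} → Adj p (0 , c) → ∃ λ a → entryAt (row ∷ T) p ≡ just a
    sup₀ c le right = <-nth row le
  ... | there q′ with ecGo-sound (length row ∷ shape T) T 1 (length row) q′
  ... | i , refl , free , h₀ , hs , hc = record { free = free ; supports = sup i h₀ hs hc }
    where
    sup : ∀ i → (i ≡ 0 → c < length row) → (∀ {i′} → i ≡ suc i′ → ∃ λ a → entryAt T (i′ , c) ≡ just a) → (∀ {c′} → c ≡ suc c′ → ∃ λ a → entryAt T (i , c′) ≡ just a) →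
          ∀ {p} → Adj p (suc i , c) → ∃ λ a → entryAt (row ∷ T) p ≡ just a
    sup i       h₀ hs hc right = hc refl
    sup zero    h₀ hs hc below = <-nth row (h₀ refl)
    sup (suc i) h₀ hs hc below = hs refl

  EC-complete : ∀ T {v} → 0 < length T → Extends T v → v ∈ EC (shape T)
  EC-complete (row ∷ T) {zero , c} _ ex = subst ((0 , c) ∈_) (sym (ecGo-eq (length row) (shape T))) (here (cong (0 ,_) (c≡ c (free ex) (λ { refl → supports ex right }))))
    where
    c≡ : ∀ c → nth row c ≡ nothing → (∀ {c′} → c ≡ suc c′ → ∃ λ a → nth row c′ ≡ just a) → c ≡ length row
    c≡ zero    f h = sym (ℕ.n≤0⇒n≡0 (nth-nothing-≥ row 0 f))
    c≡ (suc c) f h = ℕ.≤-antisym (nth-< row (proj₂ (h refl))) (nth-nothing-≥ row (suc c) f)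
  EC-complete (row ∷ T) {suc i , c} _ ex = subst ((suc i , c) ∈_) (sym (ecGo-eq (length row) (shape T))) (there (ecGo-complete (length row ∷ shape T) T 1 (length row) i c
    (free ex , (λ { refl → nth-< row (proj₂ (supports ex below)) }) , (λ { refl → supports ex below }) , λ { refl → supports ex right })))

open StandardTableaux

-- Standardization as the inverse of compatible relabelling

module Compatibility where

  private variable
    A : Set

  if-one : Bool → ℕ
  if-one b = if b then 1 else 0

  if-one-mono : ∀ {a b} → (a ≡ true → b ≡ true) → if-one a ≤ if-one b
  if-one-mono {true}  f rewrite f refl = ℕ.≤-refl
  if-one-mono {false} f = z≤n

  count-mono : (p q : A → Bool) (xs : List A) → (∀ {x} → x ∈ xs → p x ≡ true → q x ≡ true) → count p xs ≤ count q xs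
  count-mono p q []       h = z≤n
  count-mono p q (x ∷ xs) h = subst₂ _≤_ (sym (count-∷ p x xs)) (sym (count-∷ q x xs))
      (ℕ.+-mono-≤ (if-one-mono (h (here refl))) (count-mono p q xs (h ∘ there)))

  count-< : (p q : A → Bool) (xs : List A) → (∀ {x} → x ∈ xs → p x ≡ true → q x ≡ true) → ∀ {y} → y ∈ xs → p y ≡ false → q y ≡ true → count p xs < count q xs
  count-< p q (x ∷ xs) h (here refl) py qy = subst₂ _<_ (sym (count-∷ p x xs ∙ cong (λ b → if-one b + count p xs) py)) (sym (count-∷ q x xs ∙ cong (λ b → if-one b + count q xs) qy))
    (s≤s (count-mono p q xs (h ∘ there)))
  count-< p q (x ∷ xs) h (there i) py qy = subst₂ _<_ (sym (count-∷ p x xs)) (sym (count-∷ q x xs))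
      (ℕ.+-mono-≤-< (if-one-mono (h (here refl))) (count-< p q xs (h ∘ there) i py qy))

  count-cong∈ : (p q : A → Bool) (xs : List A) → (∀ {x} → x ∈ xs → p x ≡ q x) → count p xs ≡ count q xs
  count-cong∈ p q xs h = ℕ.≤-antisym (count-mono p q xs (λ i e → sym (h i) ∙ e)) (count-mono q p xs (λ i e → h i ∙ e))

  count-map : ∀ {B : Set} (p : B → Bool) (f : A → B) xs → count p (map f xs) ≡ count (p ∘ f) xs
  count-map p f []       = refl
  count-map p f (x ∷ xs) = count-∷ p (f x) (map f xs) ∙ cong (if-one (p (f x)) +_) (count-map p f xs) ∙ sym (count-∷ (p ∘ f) x xs)

  count-disjoint : (p q r : A → Bool) (xs : List A) → (∀ x → if-one (p x) + if-one (q x) ≡ if-one (r x)) → count p xs + count q xs ≡ count r xs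
  count-disjoint p q r []       h = refl
  count-disjoint p q r (x ∷ xs) h = cong₂ _+_ (count-∷ p x xs) (count-∷ q x xs) ∙
    solve 4 (λ a b c d → (a :+ b) :+ (c :+ d) := (a :+ c) :+ (b :+ d)) refl (if-one (p x)) (count p xs) (if-one (q x)) (count q xs) ∙
    cong₂ _+_ (h x) (count-disjoint p q r xs h) ∙ sym (count-∷ r x xs)
    where open ℕSolver.+-*-Solver

  count-all : (p : A → Bool) (xs : List A) → count p xs ≤ length xs
  count-all p []       = z≤n
  count-all p (x ∷ xs) with p x
  ... | true  = s≤s (count-all p xs)
  ... | false = ℕ.m≤n⇒m≤1+n (count-all p xs)

  count-applyUpTo : (q : A → Bool) (f : ℕ → A) (K e : ℕ) → e ≤ K → (∀ j → j < K → q (f j) ≡ (j <ᵇ e)) → count q (List.applyUpTo f K) ≡ e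
  count-applyUpTo q f zero    zero    le       h = refl
  count-applyUpTo q f (suc K) zero    le       h = count-∷ q (f 0) _ ∙ cong₂ (λ a b → if-one a + b) (h 0 z<s) (count-applyUpTo q (f ∘ suc) K 0 z≤n (λ j lt → h (suc j) (s<s lt)))
  count-applyUpTo q f (suc K) (suc e) (s≤s le) h = count-∷ q (f 0) _ ∙ cong₂ (λ a b → if-one a + b) (h 0 z<s) (count-applyUpTo q (f ∘ suc) K e le (λ j lt → h (suc j) (s<s lt)))

  nth-map-indexed : ∀ {B : Set} (f : ℕ × A → B) (g : ℕ → ℕ) (xs : List A) i →
                    nth (map f (zip (List.applyUpTo g (length xs)) xs)) i ≡ Maybe.map (λ x → f (g i , x)) (nth xs i)
  nth-map-indexed f g []       i       = refl
  nth-map-indexed f g (x ∷ xs) zero    = refl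
  nth-map-indexed f g (x ∷ xs) (suc i) = nth-map-indexed f (g ∘ suc) xs i

  -- Value, column and row of a box, in the order used by `standardize`.
  Key : Set
  Key = ℕ × ℕ × ℕ

  cellList : Tab → List Key
  cellList M = concatMap (λ rr → map (λ ce → proj₂ ce , proj₁ ce , proj₁ rr) (indexed (proj₂ rr))) (indexed M)

  private
    rowKeys : ℕ → List ℕ → List Key
    rowKeys r row = map (λ ce → proj₂ ce , proj₁ ce , r) (indexed row)

    keysFrom : (ℕ → ℕ) → Tab → List Key
    keysFrom f M = concatMap (λ rr → rowKeys (proj₁ rr) (proj₂ rr)) (zip (List.applyUpTo f (length M)) M)

    rowKeys-values : ∀ r row → map proj₁ (rowKeys r row) ≡ row
    rowKeys-values r row = go row id
      where
      go : ∀ row (g : ℕ → ℕ) → map proj₁ (map (λ ce → proj₂ ce , proj₁ ce , r) (zip (List.applyUpTo g (length row)) row)) ≡ row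
      go []        g = refl
      go (x ∷ row) g = cong (x ∷_) (go row (g ∘ suc))

    keys-values : ∀ f M → map proj₁ (keysFrom f M) ≡ entries M
    keys-values f []        = refl
    keys-values f (row ∷ M) = List.map-++ proj₁ (rowKeys (f 0) row) _ ∙ cong₂ _++_ (rowKeys-values (f 0) row) (keys-values (f ∘ suc) M)

    rowKeys-∈ : ∀ {r row v c s} → (v , c , s) ∈ rowKeys r row → s ≡ r × nth row c ≡ just v
    rowKeys-∈ {r} {row} q with ∈-nth q
    ... | i , e with nth row i in e′ | sym (nth-map-indexed (λ ce → proj₂ ce , proj₁ ce , r) id row i) ∙ e
    ... | just x | refl = refl , e′

    ∈-rowKeys : ∀ {r row v c} → nth row c ≡ just v → (v , c , r) ∈ rowKeys r row
    ∈-rowKeys {r} {row} {v} {c} e = nth-∈ (rowKeys r row) {c} (nth-map-indexed (λ ce → proj₂ ce , proj₁ ce , r) id row c ∙ cong (Maybe.map (λ x → x , c , r)) e)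

    keys-∈ : ∀ f M {v c s} → (v , c , s) ∈ keysFrom f M → ∃ λ r → s ≡ f r × entryAt M (r , c) ≡ just v
    keys-∈ f (row ∷ M) q with ∈.∈-++⁻ (rowKeys (f 0) row) q
    ... | inj₁ q′ = let e , e′ = rowKeys-∈ {row = row} q′ in 0 , e , e′
    ... | inj₂ q′ = let r , e , e′ = keys-∈ (f ∘ suc) M q′ in suc r , e , e′

    ∈-keys : ∀ f M {r c v} → entryAt M (r , c) ≡ just v → (v , c , f r) ∈ keysFrom f M
    ∈-keys f (row ∷ M) {zero}  e = ∈.∈-++⁺ˡ (∈-rowKeys {row = row} e)
    ∈-keys f (row ∷ M) {suc r} e = ∈.∈-++⁺ʳ (rowKeys (f 0) row) (∈-keys (f ∘ suc) M {r} e)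

    keys-map : ∀ (m : ℕ → ℕ) f T → keysFrom f (map (map m) T) ≡ map (λ k → m (proj₁ k) , proj₂ k) (keysFrom f T)
    keys-map m f []        = refl
    keys-map m f (row ∷ T) = cong₂ _++_ (go row id) (keys-map m (f ∘ suc) T) ∙ sym (List.map-++ _ (rowKeys (f 0) row) _)
      where
      go : ∀ row (g : ℕ → ℕ) → map (λ ce → proj₂ ce , proj₁ ce , f 0) (zip (List.applyUpTo g (length (map m row))) (map m row)) ≡
           map (λ k → m (proj₁ k) , proj₂ k) (map (λ ce → proj₂ ce , proj₁ ce , f 0) (zip (List.applyUpTo g (length row)) row))
      go []        g = refl
      go (x ∷ row) g = cong ((m x , g 0 , f 0) ∷_) (go row (g ∘ suc))

  cellList-∈ : ∀ M {v c r} → (v , c , r) ∈ cellList M → entryAt M (r , c) ≡ just v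
  cellList-∈ M q with keys-∈ id M q
  ... | r , refl , e = e

  ∈-cellList : ∀ M {v c r} → entryAt M (r , c) ≡ just v → (v , c , r) ∈ cellList M
  ∈-cellList M {r = r} = ∈-keys id M {r}

  count-cellList : ∀ (p : ℕ → Bool) M → count (p ∘ proj₁) (cellList M) ≡ count p (entries M)
  count-cellList p M = sym (count-map p proj₁ (cellList M)) ∙ cong (count p) (keys-values id M)

  -- The order in which standardize numbers the boxes.
  _⊑_ : ℕ × ℕ → ℕ × ℕ → Bool
  (v , d) ⊑ (e , c) = (v <ᵇ e) ∨ ((v ≡ᵇ e) ∧ (d ≤ᵇ c))

  rank : Tab → ℕ × ℕ → ℕ
  rank M k = count (λ x → (proj₁ x , proj₁ (proj₂ x)) ⊑ k) (cellList M)

  private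
    label : Tab → ℕ → ℕ → ℕ
    label M e c = count (λ x → x <ᵇ e) (entries M) + count (λ vcr → (proj₁ vcr ≡ᵇ e) ∧ (proj₁ (proj₂ vcr) ≤ᵇ c)) (cellList M)

    label≡rank : ∀ M e c → label M e c ≡ rank M (e , c)
    label≡rank M e c = cong (_+ count q (cellList M)) (sym (count-cellList (_<ᵇ e) M)) ∙ count-disjoint ((_<ᵇ e) ∘ proj₁) q _ (cellList M) λ (v , d , _) → lem v d
      where
      q : Key → Bool
      q = λ vcr → (proj₁ vcr ≡ᵇ e) ∧ (proj₁ (proj₂ vcr) ≤ᵇ c)
      lem : ∀ v d → if-one (v <ᵇ e) + if-one ((v ≡ᵇ e) ∧ (d ≤ᵇ c)) ≡ if-one ((v <ᵇ e) ∨ ((v ≡ᵇ e) ∧ (d ≤ᵇ c)))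
      lem v d with ℕ.<-cmp v e
      ... | tri< a ne _ rewrite <ᵇ-true a | ≢⇒≡ᵇ ne = refl
      ... | tri≈ na _ _ rewrite <ᵇ-false na = refl
      ... | tri> na _ _ rewrite <ᵇ-false na = refl

    rowF : Tab → ℕ × List ℕ → List ℕ
    rowF M (_ , row) = map (λ ce → label M (proj₂ ce) (proj₁ ce)) (indexed row)

  standardize-entry : ∀ M {r c e} → entryAt M (r , c) ≡ just e → entryAt (standardize M) (r , c) ≡ just (rank M (e , c))
  standardize-entry M {r} {c} {e} eq = go M id r eq ∙ cong just (label≡rank M e c)
    where
    go : ∀ T (f : ℕ → ℕ) r → entryAt T (r , c) ≡ just e → entryAt (map (rowF M) (zip (List.applyUpTo f (length T)) T)) (r , c) ≡ just (label M e c)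
    go (row ∷ T) f zero    eq = nth-map-indexed (λ ce → label M (proj₂ ce) (proj₁ ce)) id row c ∙ cong (Maybe.map (λ x → label M x c)) eq
    go (row ∷ T) f (suc r) eq = go T (f ∘ suc) r eq

  standardize-shape : ∀ M → shape (standardize M) ≡ shape M
  standardize-shape M = go M id
    where
    len : ∀ (row : List ℕ) (f : ℕ × ℕ → ℕ) (g : ℕ → ℕ) → length (map f (zip (List.applyUpTo g (length row)) row)) ≡ length row
    len []        f g = refl
    len (x ∷ row) f g = cong suc (len row f (g ∘ suc))
    go : ∀ T (f : ℕ → ℕ) → shape (map (rowF M) (zip (List.applyUpTo f (length T)) T)) ≡ shape T
    go []        f = refl
    go (row ∷ T) f = cong₂ _∷_ (len row _ id) (go T (f ∘ suc))

  standardize-entry⁻ : ∀ M {p a} → entryAt (standardize M) p ≡ just a → ∃ λ e → entryAt M p ≡ just e × a ≡ rank M (e , proj₂ p)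
  standardize-entry⁻ M {r , c} {a} eq with entryAt-shape {standardize M} {M} (standardize-shape M) {r , c} eq
  ... | e , eq′ = e , eq′ , just-injective (sym eq ∙ standardize-entry M {r} eq′)

  -- Weakly increasing, and strictly across descents: replacing each entry `i` by `m i` then gives a
  -- semistandard tableau that standardizes to the original one.
  record Compatible (m : ℕ → ℕ) (xs : List Cell) : Set where
    field
      mono   : ∀ {a b} → a ≤ b → m a ≤ m b
      strict : ∀ i {p q} → nth xs i ≡ just p → nth xs (suc i) ≡ just q → proj₁ p < proj₁ q → m (suc i) < m (suc (suc i))

  open Compatible public

  ⊑-true : ∀ {v d e c} → (v , d) ⊑ (e , c) ≡ true → v < e ⊎ (v ≡ e × d ≤ c)
  ⊑-true {v} {d} {e} {c} h with v <ᵇ e in lt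
  ... | true  = inj₁ (<ᵇ-true⁻ lt)
  ... | false = inj₂ (≡ᵇ-true (proj₁ (∧-true h)) , ≤ᵇ-true (proj₂ (∧-true {v ≡ᵇ e} h)))

  true-⊑ : ∀ {v d e c} → v < e ⊎ (v ≡ e × d ≤ c) → (v , d) ⊑ (e , c) ≡ true
  true-⊑ (inj₁ lt) rewrite <ᵇ-true lt = refl
  true-⊑ {v} {d} {e} {c} (inj₂ (refl , le)) rewrite <ᵇ-false (ℕ.<-irrefl {v} refl) | ≡ᵇ-refl v = true-≤ᵇ le

  bool-⇔ : ∀ {a b : Bool} → (a ≡ true → b ≡ true) → (b ≡ true → a ≡ true) → a ≡ b
  bool-⇔ {true}  f g = sym (f refl)
  bool-⇔ {false} {true}  f g = g refl
  bool-⇔ {false} {false} f g = refl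

  module _ {T : Tab} {xs : List Cell} (S : SYT T xs) where

    syt-monotone : ∀ {r c s d a} → entryAt T (r , c) ≡ just a → s ≤ r → d ≤ c → ∃ λ b → entryAt T (s , d) ≡ just b × b ≤ a
    syt-monotone {r} {c} {s} {d} {a} e s≤r d≤c with rows (r ∸ s) a (subst (λ z → entryAt T (z , c) ≡ just a) (sym (ℕ.m∸n+n≡m s≤r)) e)
      where
      rows : ∀ k a → entryAt T (k + s , c) ≡ just a → ∃ λ b → entryAt T (s , c) ≡ just b × b ≤ a
      rows zero    a e = a , e , ℕ.≤-refl
      rows (suc k) a e with syt-preds S {suc (k + s) , c} e below
      ... | b , e′ , lt with rows k b e′
      ... | b′ , e″ , le = b′ , e″ , ℕ.≤-trans le (ℕ.<⇒≤ lt)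
    ... | a′ , e′ , le with cols (c ∸ d) a′ (subst (λ z → entryAt T (s , z) ≡ just a′) (sym (ℕ.m∸n+n≡m d≤c)) e′)
      where
      cols : ∀ k a → entryAt T (s , k + d) ≡ just a → ∃ λ b → entryAt T (s , d) ≡ just b × b ≤ a
      cols zero    a e = a , e , ℕ.≤-refl
      cols (suc k) a e with syt-preds S {s , suc (k + d)} e right
      ... | b , e′ , lt with cols k b e′
      ... | b′ , e″ , le = b′ , e″ , ℕ.≤-trans le (ℕ.<⇒≤ lt)
    ... | b , e″ , le′ = b , e″ , ℕ.≤-trans le′ le

    -- Otherwise the later box would lie weakly above and weakly to the left of the earlier one,
    -- where entries are not larger.
    later-not-below : ∀ {i j p q} → i < j → nth xs i ≡ just p → nth xs j ≡ just q → proj₁ q ≤ proj₁ p → proj₂ p < proj₂ q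
    later-not-below {i} {j} {r , c} {s , d} i<j e f s≤r = ℕ.≰⇒> λ d≤c → contradiction-at (syt-monotone (at⁺ S i e) s≤r d≤c)
      where
      contradiction-at : (∃ λ b → entryAt T (s , d) ≡ just b × b ≤ suc i) → ⊥
      contradiction-at (b , e′ , le) = ℕ.<⇒≱ i<j (ℕ.≤-pred (subst (_≤ suc i) (just-injective (sym e′ ∙ at⁺ S j f)) le))

    module _ {m : ℕ → ℕ} (C : Compatible m xs) where

      -- A run of equal values contains no descent, so each of its boxes lies to the right of the
      -- one before.
      equal-columns : ∀ k i {p q} → nth xs i ≡ just p → nth xs (suc (k + i)) ≡ just q → m (suc i) ≡ m (suc (suc (k + i))) → proj₂ p < proj₂ q
      equal-columns zero i {p} {q} e f eq with proj₁ p <? proj₁ q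
      ... | yes lt = contradiction eq (ℕ.<⇒≢ (strict C i e f lt))
      ... | no nlt = later-not-below (ℕ.n<1+n i) e f (ℕ.≮⇒≥ nlt)
      equal-columns (suc k) i {p} {q} e f eq with <-nth xs (ℕ.<-trans (ℕ.n<1+n (suc (k + i))) (nth-< xs f))
      ... | w , g = ℕ.<-trans (equal-columns k i e g eq₁) (equal-columns zero (suc (k + i)) g f (sym eq₁ ∙ eq))
        where
        eq₁ : m (suc i) ≡ m (suc (suc (k + i)))
        eq₁ = ℕ.≤-antisym (mono C (s≤s (ℕ.m≤n⇒m≤1+n (ℕ.m≤n+m i k)))) (ℕ.≤-trans (mono C (ℕ.n≤1+n _)) (ℕ.≤-reflexive (sym eq)))

      -- Equal values run from left to right in the order of `T`, and `standardize` breaks ties in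
      -- the same way. So the rank of a box is its entry in `T`.
      standardize-unique : standardize (map (map m) T) ≡ T
      standardize-unique = sym (tab-ext T (standardize M) (sym (standardize-shape M ∙ map-shape m T)) same)
        where
        M = map (map m) T
        columns : ∀ i j {p q} → i < j → nth xs i ≡ just p → nth xs j ≡ just q → m (suc i) ≡ m (suc j) → proj₂ p < proj₂ q
        columns i j {p} {q} i<j e f eq with ℕ.m≤n⇒∃[o]m+o≡n i<j
        ... | k , refl = equal-columns k i e (subst (λ z → nth xs (suc z) ≡ just q) (ℕ.+-comm i k) f) (eq ∙ cong (λ z → m (suc (suc z))) (ℕ.+-comm i k))
        same : ∀ p {a} → entryAt T p ≡ just a → entryAt (standardize M) p ≡ just a
        same (r , c) {a} e with at⁻ S (r , c) e
        ... | i , refl , f = standardize-entry M {r} (map-entryAt-just m T {r , c} e) ∙ cong just (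
              cong (count _) (keys-map m id T) ∙ count-map _ (λ k → m (proj₁ k) , proj₂ k) (cellList T) ∙
              count-cong∈ _ (λ x → proj₁ x ≤ᵇ suc i) (cellList T) (λ {x} q → pred≡ x q) ∙ count-cellList (_≤ᵇ suc i) T ∙
              count-↭ (_≤ᵇ suc i) (syt-numbers S) ∙ count-map (_≤ᵇ suc i) suc (upTo (length xs)) ∙
              count-applyUpTo _ id (length xs) (suc i) (nth-< xs f) (λ j _ → refl))
          where
          pred≡ : ∀ x → x ∈ cellList T → ((m (proj₁ x) , proj₁ (proj₂ x)) ⊑ (m (suc i) , c)) ≡ (proj₁ x ≤ᵇ suc i)
          pred≡ (l , d , s) q with at⁻ S (s , d) (cellList-∈ T q)
          ... | j , refl , g = bool-⇔ fwd bwd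
            where
            fwd : (m (suc j) , d) ⊑ (m (suc i) , c) ≡ true → (suc j ≤ᵇ suc i) ≡ true
            fwd h with ℕ.<-cmp i j
            ... | tri≈ _ refl _ = true-≤ᵇ (ℕ.≤-refl {suc i})
            ... | tri> _ _ j<i  = true-≤ᵇ (ℕ.<⇒≤ (s≤s j<i))
            ... | tri< i<j _ _ with ⊑-true {m (suc j)} {d} h
            ... | inj₁ lt       = contradiction (mono C (ℕ.<⇒≤ (s≤s i<j))) (ℕ.<⇒≱ lt)
            ... | inj₂ (eq , le) = contradiction le (ℕ.<⇒≱ (columns i j i<j f g (sym eq)))
            bwd : (suc j ≤ᵇ suc i) ≡ true → (m (suc j) , d) ⊑ (m (suc i) , c) ≡ true
            bwd h with ℕ.m≤n⇒m<n∨m≡n (mono C {suc j} {suc i} (≤ᵇ-true h))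
            ... | inj₁ lt = true-⊑ {m (suc j)} {d} (inj₁ lt)
            ... | inj₂ eq = true-⊑ {m (suc j)} {d} (inj₂ (eq , le (ℕ.m≤n⇒m<n∨m≡n (ℕ.≤-pred (≤ᵇ-true {suc j} {suc i} h)))))
              where
              le : j < i ⊎ j ≡ i → d ≤ c
              le (inj₁ lt)   = ℕ.<⇒≤ (columns j i lt g f eq)
              le (inj₂ refl) = ℕ.≤-reflexive (cong proj₂ (just-injective (sym g ∙ f)))

open Compatibility

-- Standardization of a semistandard tableau and its thresholds

module Standardization where

  private variable
    A : Set

  std-intro : ∀ P xs → Unique xs → (∀ {x} → x ∈ xs → x ∉ P) →
              (∀ j {p q} → nth xs j ≡ just p → Adj q p → q ∈ P ⊎ ∃ λ i → i < j × nth xs i ≡ just q) → Std P xs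
  std-intro P []       u       d h = tt
  std-intro P (x ∷ xs) (n ∷ u) d h = addable (d (here refl)) first , std-intro (x ∷ P) xs u disj step
    where
    first : ∀ {p} → Adj p x → p ∈ P
    first adj with h 0 refl adj
    ... | inj₁ q = q
    disj : ∀ {y} → y ∈ xs → y ∉ x ∷ P
    disj q (here refl) = All.lookup n q refl
    disj q (there r)   = d (there q) r
    step : ∀ j {p q} → nth xs j ≡ just p → Adj q p → q ∈ x ∷ P ⊎ ∃ λ i → i < j × nth xs i ≡ just q
    step j e adj with h (suc j) e adj
    ... | inj₁ q                      = inj₁ (there q)
    ... | inj₂ (zero , _ , refl)      = inj₁ (here refl)
    ... | inj₂ (suc i , s≤s lt , e′)  = inj₂ (i , lt , e′)

  nth-applyUpTo : (f : ℕ → A) (n i : ℕ) → i < n → nth (List.applyUpTo f n) i ≡ just (f i)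
  nth-applyUpTo f (suc n) zero    lt       = refl
  nth-applyUpTo f (suc n) (suc i) (s≤s lt) = nth-applyUpTo (f ∘ suc) n i lt

  nth-applyUpTo⁻ : (f : ℕ → A) (n i : ℕ) {x : A} → nth (List.applyUpTo f n) i ≡ just x → i < n × x ≡ f i
  nth-applyUpTo⁻ f (suc n) zero    refl = z<s , refl
  nth-applyUpTo⁻ f (suc n) (suc i) e with nth-applyUpTo⁻ (f ∘ suc) n i e
  ... | lt , eq = s<s lt , eq

  filling-syt : ∀ {n T} → Filling n T → (∀ {p q a b} → Adj p q → entryAt T p ≡ just a → entryAt T q ≡ just b → a < b) →
                ∃ λ xs → SYT T xs × length xs ≡ n
  filling-syt {n} {T} F inc = xs , record { pos = proj₁ (∧-true (Filling.partition F)) ; at⁺ = to ; at⁻ = from ; std = s } , List.length-applyUpTo f n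
    where
    f : ℕ → Cell
    f i = posOrigin (posOf T (suc i))
    xs = List.applyUpTo f n
    f-entry : ∀ i → i < n → entryAt T (f i) ≡ just (suc i)
    f-entry i lt with posOf-∈ T (↭.∈-resp-↭ (↭-sym (Filling.numbers F)) (∈.∈-map⁺ suc (∈.∈-upTo⁺ lt)))
    ... | p , e = cong (entryAt T ∘ posOrigin) e ∙ posOf-just T e
    to : ∀ i {p} → nth xs i ≡ just p → entryAt T p ≡ just (suc i)
    to i e with nth-applyUpTo⁻ f n i e
    ... | lt , refl = f-entry i lt
    from : ∀ p {a} → entryAt T p ≡ just a → ∃ λ i → a ≡ suc i × nth xs i ≡ just p
    from p e with ∈.∈-map⁻ suc (↭.∈-resp-↭ (Filling.numbers F) (entryAt-∈ T {proj₁ p} e))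
    ... | i , i∈ , refl = i , refl , nth-applyUpTo f n i (∈.∈-upTo⁻ i∈) ∙ cong just (entryAt-injective T (Filling.unique F) (f-entry i (∈.∈-upTo⁻ i∈)) e)
    uniq : Unique xs
    uniq = nth-inj xs λ i j e e′ → ℕ.suc-injective (just-injective (sym (to i e) ∙ to j e′))
      where
      nth-inj : (ys : List Cell) → (∀ i j {a} → nth ys i ≡ just a → nth ys j ≡ just a → i ≡ j) → Unique ys
      nth-inj []       h = []
      nth-inj (y ∷ ys) h = All.tabulate (λ { q refl → let i , e = ∈-nth q in contradiction (h 0 (suc i) refl e) λ () }) ∷
        nth-inj ys (λ i j e e′ → ℕ.suc-injective (h (suc i) (suc j) e e′))
    s : Std [] xs
    s = std-intro [] xs uniq (λ _ ()) λ j {p} {q} e adj → let b , e′ = below-left adj (to j e) ; i , b≡ , e″ = from q e′ in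
        inj₂ (i , ℕ.≤-pred (subst (_< suc j) b≡ (inc adj e′ (to j e))) , e″)
      where
      below-left : ∀ {p q a} → Adj q p → entryAt T p ≡ just a → ∃ λ b → entryAt T q ≡ just b
      below-left (right {r} {c}) e = entryAt-left T {r} {c} e
      below-left (below {r} {c}) e = entryAt-up T (Filling.decreasing F) {r} {c} e

  maxL-≥ : ∀ xs {x} → x ∈ xs → x ≤ maxL xs
  maxL-≥ (y ∷ xs) q with maxL xs <ᵇ y in lt
  maxL-≥ (y ∷ xs) (here refl) | true  = ℕ.≤-refl
  maxL-≥ (y ∷ xs) (there q)   | true  = ℕ.≤-trans (maxL-≥ xs q) (ℕ.<⇒≤ (<ᵇ-true⁻ lt))
  maxL-≥ (y ∷ xs) (here refl) | false = ℕ.≮⇒≥ λ p → contradiction (sym (<ᵇ-true p) ∙ lt) λ ()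
  maxL-≥ (y ∷ xs) (there q)   | false = maxL-≥ xs q

  -- The map that `ct J` applies to every entry.
  below-count : List ℕ → ℕ → ℕ
  below-count J p = count (λ j → j <ᵇ p) J

  below-count-mono : ∀ J {a b} → a ≤ b → below-count J a ≤ below-count J b
  below-count-mono J le = count-mono _ _ J λ _ e → <ᵇ-true (ℕ.<-≤-trans (<ᵇ-true⁻ e) le)

  module Semistandard (M : Tab) (ssyt : isSSYT M ≡ true) where

    private
      L = cellList M

      col-values : ∀ k {r c a b} → entryAt M (r , c) ≡ just a → entryAt M (suc (k + r) , c) ≡ just b → a < b
      col-values zero    {r} {c} e f = isSSYT-cols M ssyt r c e f
      col-values (suc k) {r} {c} e f with entryAt-up M (proj₂ (∧-true {allᵇ (λ k → 0 <ᵇ k) (shape M)} (isSSYT-partition M ssyt))) {suc (k + r)} f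
      ... | v , g = ℕ.<-trans (col-values k e g) (isSSYT-cols M ssyt (suc (k + r)) c g f)

      row-values : ∀ k {r c a b} → entryAt M (r , c) ≡ just a → entryAt M (r , suc (k + c)) ≡ just b → a ≤ b
      row-values zero    {r} {c} e f = isSSYT-rows M ssyt r c e f
      row-values (suc k) {r} {c} e f with entryAt-left M {r} f
      ... | v , g = ℕ.≤-trans (row-values k {r} e g) (isSSYT-rows M ssyt r (suc (k + c)) g f)

      up-by : ∀ k {r c b} → entryAt M (k + r , c) ≡ just b → ∃ λ a → entryAt M (r , c) ≡ just a
      up-by zero    e = _ , e
      up-by (suc k) {r} e = up-by k (proj₂ (entryAt-up M (proj₂ (∧-true {allᵇ (λ k → 0 <ᵇ k) (shape M)} (isSSYT-partition M ssyt))) {k + r} e))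

      lower-value : ∀ {r s c a b} → r < s → entryAt M (r , c) ≡ just a → entryAt M (s , c) ≡ just b → a < b
      lower-value {r} {s} {c} {a} {b} lt e f with ℕ.m≤n⇒∃[o]m+o≡n lt
      ... | k , refl = col-values k e (subst (λ z → entryAt M (suc z , c) ≡ just b) (ℕ.+-comm r k) f)

      righter-value : ∀ {r c d a b} → c < d → entryAt M (r , c) ≡ just a → entryAt M (r , d) ≡ just b → a ≤ b
      righter-value {r} {c} {d} {a} {b} lt e f with ℕ.m≤n⇒∃[o]m+o≡n lt
      ... | k , refl = row-values k {r} e (subst (λ z → entryAt M (r , suc z) ≡ just b) (ℕ.+-comm c k) f)

      Before : Cell → ℕ → Cell → ℕ → Set
      Before p a q b = a < b ⊎ (a ≡ b × proj₂ p < proj₂ q)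

      rank-< : ∀ {p q a b} → entryAt M q ≡ just b → Before p a q b → rank M (a , proj₂ p) < rank M (b , proj₂ q)
      rank-< {r , c} {s , d} {a} {b} f bef = count-< _ _ L (λ {x} _ → incl x bef) (∈-cellList M {r = s} f) (excl bef) (true-⊑ {b} {d} (inj₂ (refl , ℕ.≤-refl)))
        where
        incl : ∀ x → Before (r , c) a (s , d) b → (proj₁ x , proj₁ (proj₂ x)) ⊑ (a , c) ≡ true → (proj₁ x , proj₁ (proj₂ x)) ⊑ (b , d) ≡ true
        incl (v , w , _) bef h with ⊑-true {v} {w} h | bef
        ... | inj₁ lt          | inj₁ lt′          = true-⊑ {v} {w} (inj₁ (ℕ.<-trans lt lt′))
        ... | inj₁ lt          | inj₂ (refl , _)   = true-⊑ {v} {w} (inj₁ lt)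
        ... | inj₂ (refl , _)  | inj₁ lt′          = true-⊑ {v} {w} (inj₁ lt′)
        ... | inj₂ (refl , le) | inj₂ (refl , lt′) = true-⊑ {v} {w} (inj₂ (refl , ℕ.≤-trans le (ℕ.<⇒≤ lt′)))
        excl : Before (r , c) a (s , d) b → (b , d) ⊑ (a , c) ≡ false
        excl bef with (b , d) ⊑ (a , c) in h
        ... | false = refl
        ... | true with ⊑-true {b} {d} h | bef
        ... | inj₁ lt          | inj₁ lt′          = contradiction lt (ℕ.<-asym lt′)
        ... | inj₁ lt          | inj₂ (refl , _)   = contradiction lt (ℕ.<-irrefl refl)
        ... | inj₂ (refl , _)  | inj₁ lt′          = contradiction lt′ (ℕ.<-irrefl refl)
        ... | inj₂ (_ , le)    | inj₂ (_ , lt′)    = contradiction le (ℕ.<⇒≱ lt′)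

      -- Ties between different boxes are decided by the column, as equal values in one column would
      -- violate strictness.
      compare : ∀ {p q a b} → entryAt M p ≡ just a → entryAt M q ≡ just b → p ≢ q → Before p a q b ⊎ Before q b p a
      compare {r , c} {s , d} {a} {b} e f ne with ℕ.<-cmp a b
      ... | tri< lt _ _ = inj₁ (inj₁ lt)
      ... | tri> _ _ gt = inj₂ (inj₁ gt)
      ... | tri≈ _ refl _ with ℕ.<-cmp c d
      ... | tri< lt _ _ = inj₁ (inj₂ (refl , lt))
      ... | tri> _ _ gt = inj₂ (inj₂ (refl , gt))
      ... | tri≈ _ refl _ with ℕ.<-cmp r s
      ... | tri< lt _ _ = contradiction (lower-value lt e f) (ℕ.<-irrefl refl)
      ... | tri> _ _ gt = contradiction (lower-value gt f e) (ℕ.<-irrefl refl)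
      ... | tri≈ _ refl _ = contradiction refl ne

      n = length (entries M)
      S = standardize M

      S-entry-< : ∀ {p q a b x y} → entryAt M p ≡ just a → entryAt M q ≡ just b → entryAt S p ≡ just x → entryAt S q ≡ just y → Before p a q b → x < y
      S-entry-< {p} {q} e f g h bef = subst₂ _<_ (just-injective (sym (standardize-entry M {proj₁ p} e) ∙ g)) (just-injective (sym (standardize-entry M {proj₁ q} f) ∙ h)) (rank-< {p} {q} f bef)

      adj-before : ∀ {p q a b} → Adj p q → entryAt M p ≡ just a → entryAt M q ≡ just b → Before p a q b
      adj-before (right {r} {c}) e f with ℕ.m≤n⇒m<n∨m≡n (isSSYT-rows M ssyt r c e f)
      ... | inj₁ lt = inj₁ lt
      ... | inj₂ eq = inj₂ (eq , ℕ.n<1+n c)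
      adj-before (below {r} {c}) e f = inj₁ (isSSYT-cols M ssyt r c e f)

      S-unique : Unique (entries S)
      S-unique = entryAt-unique S λ p q g h → by p q g h (standardize-entry⁻ M {p} g) (standardize-entry⁻ M {q} h)
        where
        by : ∀ p q {x} → entryAt S p ≡ just x → entryAt S q ≡ just x → (∃ λ a → entryAt M p ≡ just a × _) → (∃ λ b → entryAt M q ≡ just b × _) → p ≡ q
        by p q g h (a , e , _) (b , f , _) with p ≟C q
        ... | yes eq = eq
        ... | no ne with compare e f ne
        ... | inj₁ bef = contradiction (S-entry-< {p} {q} e f g h bef) (ℕ.<-irrefl refl)
        ... | inj₂ bef = contradiction (S-entry-< {q} {p} f e h g bef) (ℕ.<-irrefl refl)

      rank-bounds : ∀ {p a} → entryAt M p ≡ just a → 1 ≤ rank M (a , proj₂ p) × rank M (a , proj₂ p) ≤ n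
      rank-bounds {r , c} {a} e =
          subst (_< rank M (a , c)) (count-none L) (count-< (λ _ → false) _ L (λ _ ()) (∈-cellList M {r = r} e) refl (true-⊑ {a} {c} (inj₂ (refl , ℕ.≤-refl))))
        , ℕ.≤-trans (count-all _ L) (ℕ.≤-reflexive (sym (count-true L) ∙ count-cellList (λ _ → true) M ∙ count-true (entries M)))
        where
        count-none : ∀ {A : Set} (xs : List A) → count (λ _ → false) xs ≡ 0
        count-none []       = refl
        count-none (x ∷ xs) = count-none xs
        count-true : ∀ {A : Set} (xs : List A) → count (λ _ → true) xs ≡ length xs
        count-true []       = refl
        count-true (x ∷ xs) = cong suc (count-true xs)

      S-numbers : entries S ↭ oneTo n
      S-numbers = unique-↭ S-unique (oneTo-unique n) sub sup
        where
        sub : ∀ {x} → x ∈ entries S → x ∈ oneTo n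
        sub q with ∈-entryAt S q
        ... | p , g with standardize-entry⁻ M {p} g
        ... | a , e , refl with rank M (a , proj₂ p) | rank-bounds {p} e
        ... | suc k | _ , le = ∈.∈-map⁺ suc (∈.∈-upTo⁺ le)
        len : length (entries S) ≡ n
        len = length-entries S ∙ cong sum (standardize-shape M) ∙ sym (length-entries M)
        open import Data.List.Membership.DecPropositional ℕ._≟_ using (_∈?_)
        sup : ∀ {x} → x ∈ oneTo n → x ∈ entries S
        sup {x} q with x ∈? entries S
        ... | yes p = p
        -- `S` has `n` distinct entries from `oneTo n`; a missing number together with them would be
        -- too many.
        ... | no np = contradiction (unique-⊆-length {xs = x ∷ entries S} (All.tabulate (λ { r refl → np r }) ∷ S-unique) (λ { (here refl) → q ; (there r) → sub r }))
                (ℕ.<⇒≱ (subst₂ _<_ (sym (length-oneTo n)) refl (s≤s (ℕ.≤-reflexive (sym len)))))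

      F : Filling n S
      F = record { numbers = S-numbers ; partition = cong isPartition (standardize-shape M) ∙ isSSYT-partition M ssyt }

      increasing : ∀ {p q a b} → Adj p q → entryAt S p ≡ just a → entryAt S q ≡ just b → a < b
      increasing {p} {q} adj g h = let a , e , _ = standardize-entry⁻ M {p} g ; b , f , _ = standardize-entry⁻ M {q} h in
        S-entry-< {p} {q} e f g h (adj-before adj e f)

    boxes : List Cell
    boxes = proj₁ (filling-syt F increasing)

    standard : SYT (standardize M) boxes
    standard = proj₁ (proj₂ (filling-syt F increasing))

    boxes-length : length boxes ≡ length (entries M)
    boxes-length = proj₂ (proj₂ (filling-syt F increasing))

    -- The threshold for `h` counts the entries below `h`, so it is smaller than the rank of a box
    -- with entry `a` exactly if `h ≤ a`. As `h` starts at 1, there are `a` such thresholds.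
    JM-rank : ∀ {p a} → entryAt M p ≡ just a → below-count (JM M) (rank M (a , proj₂ p)) ≡ a
    JM-rank {r , c} {a} e = count-map _ _ (oneTo mx) ∙ count-map _ suc (upTo mx) ∙ count-applyUpTo _ id mx a (maxL-≥ (entries M) (entryAt-∈ M {r} e)) λ j _ → bool-⇔ (fwd j) (bwd j)
      where
      mx = maxL (entries M)
      k = rank M (a , c)
      cnt : ℕ → ℕ
      cnt h = count (λ x → x <ᵇ h) (entries M)
      cnt≡ : ∀ h → cnt h ≡ count ((_<ᵇ h) ∘ proj₁) L
      cnt≡ h = sym (count-cellList (_<ᵇ h) M)
      low : ∀ {j} → j < a → cnt (suc j) < k
      low {j} lt = subst (_< k) (sym (cnt≡ (suc j))) (count-< _ _ L (λ {x} _ h → true-⊑ {proj₁ x} {proj₁ (proj₂ x)} (inj₁ (ℕ.≤-<-trans (ℕ.≤-pred (<ᵇ-true⁻ h)) lt)))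
        (∈-cellList M {r = r} e) (<ᵇ-false (ℕ.≤⇒≯ lt)) (true-⊑ {a} {c} (inj₂ (refl , ℕ.≤-refl))))
      high : ∀ {j} → a ≤ j → k ≤ cnt (suc j)
      high {j} le = subst (k ≤_) (sym (cnt≡ (suc j))) (count-mono _ _ L λ {x} _ h → <ᵇ-true (s≤s (ℕ.≤-trans (lem (⊑-true {proj₁ x} {proj₁ (proj₂ x)} h)) le)))
        where
        lem : ∀ {v d} → v < a ⊎ (v ≡ a × d ≤ c) → v ≤ a
        lem (inj₁ lt)         = ℕ.<⇒≤ lt
        lem (inj₂ (refl , _)) = ℕ.≤-refl
      fwd : ∀ j → (cnt (suc j) <ᵇ k) ≡ true → (j <ᵇ a) ≡ true
      fwd j h = <ᵇ-true (ℕ.≰⇒> λ le → ℕ.<⇒≱ (<ᵇ-true⁻ h) (high le))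
      bwd : ∀ j → (j <ᵇ a) ≡ true → (cnt (suc j) <ᵇ k) ≡ true
      bwd j h = <ᵇ-true (low (<ᵇ-true⁻ h))

    ct-standardize : ct (JM M) (standardize M) ≡ M
    ct-standardize = sym (tab-ext M (ct (JM M) S) (sym (map-shape (below-count (JM M)) S ∙ standardize-shape M)) λ p e →
      map-entryAt-just (below-count (JM M)) S {p} (standardize-entry M {proj₁ p} e) ∙ cong just (JM-rank {p} e))

    -- If the values across a descent were equal, the later box would be further to the right. The
    -- box above it in the row of the earlier one would then hold a smaller value by its column, but
    -- not a smaller one by its row.
    compatible : Compatible (below-count (JM M)) boxes
    compatible = record { mono = below-count-mono (JM M) ; strict = st }
      where
      st : ∀ i {p q} → nth boxes i ≡ just p → nth boxes (suc i) ≡ just q → proj₁ p < proj₁ q → below-count (JM M) (suc i) < below-count (JM M) (suc (suc i))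
      st i {r , c} {s , d} g h r<s =
        let a , e , ea = standardize-entry⁻ M {r , c} (at⁺ standard i g)
            b , f , fb = standardize-entry⁻ M {s , d} (at⁺ standard (suc i) h)
        in subst₂ _<_ (sym (cong (below-count (JM M)) ea ∙ JM-rank {r , c} e)) (sym (cong (below-count (JM M)) fb ∙ JM-rank {s , d} f)) (ℕ.≰⇒> (not≥ e f))
        where
        not≥ : ∀ {a b} → entryAt M (r , c) ≡ just a → entryAt M (s , d) ≡ just b → ¬ b ≤ a
        not≥ {a} {b} e f b≤a with compare {r , c} {s , d} e f (λ eq → ℕ.<-irrefl (cong proj₁ eq) r<s)
        ... | inj₂ bef = ℕ.<-asym (S-entry-< {s , d} {r , c} f e (at⁺ standard (suc i) h) (at⁺ standard i g) bef) (ℕ.n<1+n (suc i))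
        ... | inj₁ (inj₁ lt) = ℕ.<⇒≱ lt b≤a
        ... | inj₁ (inj₂ (refl , c<d)) with ℕ.m≤n⇒∃[o]m+o≡n (ℕ.<⇒≤ r<s)
        ... | k , refl with up-by k {r} {d} (subst (λ z → entryAt M (z , d) ≡ just a) (ℕ.+-comm r k) f)
        ... | v , g′ = ℕ.<⇒≱ (lower-value r<s g′ f) (righter-value c<d e g′)

open Standardization

-- The operations that add a box

module Operations where

  private
    nth-descs : ∀ xs k {p q} → nth xs k ≡ just p → nth xs (suc k) ≡ just q → nth (descs xs) k ≡ just (desc p q)
    nth-descs (x ∷ y ∷ xs) zero    refl refl = refl
    nth-descs (x ∷ y ∷ xs) (suc k) e    f    = nth-descs (y ∷ xs) k e f

    descs-nth : ∀ xs k {b} → nth (descs xs) k ≡ just b → ∃₂ λ p q → nth xs k ≡ just p × nth xs (suc k) ≡ just q × b ≡ desc p q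
    descs-nth (x ∷ y ∷ xs) zero    refl = x , y , refl , refl , refl
    descs-nth (x ∷ y ∷ xs) (suc k) e    = descs-nth (y ∷ xs) k e

    map-cong∈ : ∀ {A B : Set} {f g : A → B} xs → (∀ {x} → x ∈ xs → f x ≡ g x) → map f xs ≡ map g xs
    map-cong∈ []       h = refl
    map-cong∈ (x ∷ xs) h = cong₂ _∷_ (h (here refl)) (map-cong∈ xs (h ∘ there))

    snoc-view : ∀ {A : Set} {k} (zs : List A) → length zs ≡ suc k → ∃₂ λ ys y → zs ≡ ys ++ y ∷ [] × length ys ≡ k
    snoc-view {k = k} zs e with List.initLast zs
    snoc-view .[] () | List.[]
    snoc-view .(ys ++ y ∷ []) e | ys List.∷ʳ′ y = ys , y , refl , ℕ.suc-injective (ℕ.+-comm 1 (length ys) ∙ sym (List.length-++ ys) ∙ e)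

  module _ {T : Tab} {xs : List Cell} (S : SYT T xs) {m : ℕ → ℕ} (C : Compatible m xs) where

    compatible-SSYT : isSSYT (map (map m) T) ≡ true
    compatible-SSYT = isSSYT-intro (map (map m) T) (cong isPartition (map-shape m T) ∙ syt-partition S) rows cols
      where
      rows : RowsWeak (map (map m) T)
      rows r c e f with map-entryAt-just⁻ m T {r , c} e | map-entryAt-just⁻ m T {r , suc c} f
      ... | a , e′ , refl | b , f′ , refl with syt-preds S {r , suc c} f′ right
      ... | b′ , e″ , lt = mono C (ℕ.≤-trans (ℕ.≤-reflexive (just-injective (sym e′ ∙ e″))) (ℕ.<⇒≤ lt))
      cols : ColsStrict (map (map m) T)
      cols r c e f with map-entryAt-just⁻ m T {r , c} e | map-entryAt-just⁻ m T {suc r , c} f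
      ... | a , e′ , refl | b , f′ , refl with syt-preds S {suc r , c} f′ below
      ... | b′ , e″ , lt with just-injective (sym e′ ∙ e″)
      ... | refl with at⁻ S (r , c) e′ | at⁻ S (suc r , c) f′
      ... | i , refl , g | j , refl , h with ℕ.m≤n⇒m<n∨m≡n (mono C (ℕ.<⇒≤ lt))
      ... | inj₁ lt′ = lt′
      ... | inj₂ eq with ℕ.m≤n⇒∃[o]m+o≡n (ℕ.≤-pred lt)
      ... | k , refl = contradiction (equal-columns S C k i g (subst (λ z → nth xs (suc z) ≡ just (suc r , c)) (ℕ.+-comm i k) h)
            (eq ∙ cong (λ z → m (suc (suc z))) (ℕ.+-comm i k))) (ℕ.<-irrefl refl)

  module Plus {S : Tab} {xs : List Cell} {n : ℕ} (Y : SYT S xs) (len : length xs ≡ suc n) where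

    es : List Cell
    es = evL (suc n) xs

    evac : SYT (evacuation S) es
    evac = subst (λ k → SYT (evacuation S) (evL k xs)) len (syt-evacuation Y)

    es-length : length es ≡ suc n
    es-length = ↭.↭-length (evL-↭ (suc n) xs len) ∙ len

    es-descs : descs es ≡ List.reverse (descs xs)
    es-descs = evL-descs (suc n) xs len (std Y)

    last : Cell
    last = proj₁ (proj₂ (snoc-view es es-length))

    init : List Cell
    init = proj₁ (snoc-view es es-length)

    es≡ : es ≡ init ++ last ∷ []
    es≡ = proj₁ (proj₂ (proj₂ (snoc-view es es-length)))

    nth-last′ : nth es n ≡ just last
    nth-last′ = cong₂ nth es≡ (sym (proj₂ (proj₂ (proj₂ (snoc-view es es-length))))) ∙ nth-last init

    row-last : rowOf (evacuation S) (suc n) ≡ just (proj₁ last)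
    row-last = rowOf-just (evacuation S) (syt-posOf evac n nth-last′)

    evacuation-shape : shape (evacuation S) ≡ shape S
    evacuation-shape = shape-ext (evacuation S) S (syt-partition evac) (syt-partition Y)
        (λ p e → let i , _ , e′ = at⁻ evac p e ; j , f = ∈-nth (↭.∈-resp-↭ es↭ (nth-∈ es e′)) in suc j , at⁺ Y j f)
        (λ p e → let i , _ , e′ = at⁻ Y p e ; j , f = ∈-nth (↭.∈-resp-↭ (↭-sym es↭) (nth-∈ xs e′)) in suc j , at⁺ evac j f)
      where
      es↭ : es ↭ xs
      es↭ = evL-↭ (suc n) xs len

    module Add (v : Cell) (ex : Extends (evacuation S) v) where

      ys : List Cell
      ys = evL (suc (suc n)) (es ++ v ∷ [])

      length-es-v : length (es ++ v ∷ []) ≡ suc (suc n)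
      length-es-v = List.length-++ es ∙ cong (_+ 1) es-length ∙ ℕ.+-comm (suc n) 1

      plus : SYT (evPlus S v) (es ++ v ∷ [])
      plus = subst (λ k → SYT (addCell (evacuation S) (proj₁ v) (suc k)) (es ++ v ∷ [])) (es-length ∙ sym len ∙ sym (syt-length Y)) (syt-addCell evac ex)

      tilde : SYT (tildePlus S v) ys
      tilde = subst (λ k → SYT (tildePlus S v) (evL k (es ++ v ∷ []))) length-es-v (syt-evacuation plus)

      ys-length : length ys ≡ suc (suc n)
      ys-length = ↭.↭-length (evL-↭ (suc (suc n)) (es ++ v ∷ []) length-es-v) ∙ length-es-v

      -- The new box, placed last, adds one comparison at the end of the descents of the evacuation.
      -- Reversing them again restores the descents of `xs` and puts the new comparison in front.
      ys-descs : descs ys ≡ desc last v ∷ descs xs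
      ys-descs = evL-descs (suc (suc n)) (es ++ v ∷ []) length-es-v (std plus) ∙
        cong List.reverse (cong (λ z → descs (z ++ v ∷ [])) es≡ ∙ descs-snoc init last v ∙ cong (λ z → descs z ++ desc last v ∷ []) (sym es≡) ∙ cong (_++ desc last v ∷ []) es-descs) ∙
        List.reverse-++ (List.reverse (descs xs)) (desc last v ∷ []) ∙ cong (desc last v ∷_) (List.reverse-involutive (descs xs))

      -- 1 is in the first row, and so is 2 unless 1 is a descent. By `ys-descs` it is one exactly
      -- if `v` lies strictly below the last box of the evacuation.
      second-row : eqMaybe (rowOf (tildePlus S v) 2) (just 0) ≡ not (desc last v)
      second-row with <-nth ys {0} (subst (0 <_) (sym ys-length) z<s) | <-nth ys {1} (subst (1 <_) (sym ys-length) (s<s z<s))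
      ... | p , e | q , f = cong (λ z → eqMaybe z (just 0)) (rowOf-just (tildePlus S v) (syt-posOf tilde 1 f)) ∙ zero-row (proj₁ q) ∙
            cong not (cong (_<ᵇ proj₁ q) (sym (first-row ys (std tilde) e)) ∙ just-injective (sym (nth-descs ys 0 e f) ∙ cong (λ z → nth z 0) ys-descs))
        where
        zero-row : ∀ r → (r ≡ᵇ 0) ≡ not (0 <ᵇ r)
        zero-row zero    = refl
        zero-row (suc r) = refl
        first-row : ∀ ys → Std [] ys → ∀ {p} → nth ys 0 ≡ just p → proj₁ p ≡ 0
        first-row (y ∷ ys) (a , _) refl = cong proj₁ (origin a)

  below-count-suc : ∀ J x → below-count (map suc J) (suc x) ≡ below-count J x
  below-count-suc J x = count-map (_<ᵇ suc x) suc J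

  below-count-1 : ∀ J → below-count (map suc J) 1 ≡ 0
  below-count-1 []      = refl
  below-count-1 (j ∷ J) = below-count-1 J

  thresholds : Bool → List ℕ → List ℕ
  thresholds b J = if b then map suc J else 1 ∷ map suc J

  -- The additional threshold 1 is passed by every label except 1 itself, so for `δ = 0` all old
  -- entries rise by one.
  bump : Bool → ℕ → ℕ
  bump b k = if b then k else suc k

  thresholds-1 : ∀ b J → below-count (thresholds b J) 1 ≡ 0
  thresholds-1 true  J = below-count-1 J
  thresholds-1 false J = below-count-1 J

  thresholds-suc : ∀ b J x → below-count (thresholds b J) (suc (suc x)) ≡ bump b (below-count J (suc x))
  thresholds-suc true  J x = below-count-suc J (suc x)
  thresholds-suc false J x = cong suc (below-count-suc J (suc x))

  oneTo-suc : ∀ n → oneTo (suc n) ≡ 1 ∷ map suc (oneTo n)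
  oneTo-suc n = cong (1 ∷_) (cong (map suc) (sym (List.map-upTo suc n)))

  rows-nonempty : ∀ T {n} → sum (shape T) ≡ suc n → 0 < length T
  rows-nonempty (row ∷ T) _ = z<s

  -- Recovers `δ` from the resulting tableau alone, so no tableau arises with both values of `δ`.
  typeOf : Tab → Bool
  typeOf N = eqMaybe (rowOf (standardize N) 2) (just 0)

  module HatPlus (M : Tab) (ssyt : isSSYT M ≡ true) {n : ℕ} (size : sum (shape M) ≡ suc n) (v : Cell) (v∈ : v ∈ EC (shape M)) where

    open Semistandard M ssyt

    private
      S = standardize M
      J = JM M

      entries-length : length (entries M) ≡ suc n
      entries-length = length-entries M ∙ size

      len : length boxes ≡ suc n
      len = boxes-length ∙ entries-length

      open Plus standard len

      nonempty : 0 < length M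
      nonempty = rows-nonempty M size

      ex : Extends (evacuation S) v
      ex = record { free = nothing-if λ e → contradiction (sym (free exM) ∙ proj₂ (entryAt-shape {evacuation S} {M} sh {v} e)) λ ()
                  ; supports = λ {p} adj → entryAt-shape {M} {evacuation S} (sym sh) {p} (proj₂ (supports exM adj)) }
        where
        exM : Extends M v
        exM = EC-sound M nonempty v∈
        sh : shape (evacuation S) ≡ shape M
        sh = evacuation-shape ∙ standardize-shape M

      open Add v ex

      b : Bool
      b = not (desc last v)

    delta : deltaᵇ M v ≡ not (desc last v)
    delta = lem (cong (rowOf (evacuation S)) entries-length ∙ row-last)
      where
      lem : rowOf (evacuation (standardize M)) (length (entries M)) ≡ just (proj₁ last) → deltaᵇ M v ≡ not (desc last v)
      lem e rewrite e = refl

    private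
      m′ : ℕ → ℕ
      m′ = below-count (thresholds b J)

      comp : Compatible m′ ys
      comp = record { mono = below-count-mono (thresholds b J) ; strict = st }
        where
        st : ∀ i {p q} → nth ys i ≡ just p → nth ys (suc i) ≡ just q → proj₁ p < proj₁ q → m′ (suc i) < m′ (suc (suc i))
        -- A descent at 1 means `δ = 0`, and then the additional threshold separates the labels 1
        -- and 2.
        st zero    e f lt = subst₂ _<_ (sym (thresholds-1 b J)) (sym (thresholds-suc b J 0 ∙ cong (λ z → bump z (below-count J 1)) b≡)) z<s
          where
          b≡ : b ≡ false
          b≡ = cong not (just-injective (cong (λ z → nth z 0) (sym ys-descs) ∙ nth-descs ys 0 e f) ∙ <ᵇ-true lt)
        st (suc i) {p} {q} e f lt = subst₂ _<_ (sym (thresholds-suc b J i)) (sym (thresholds-suc b J (suc i))) (bump-< b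
            (let p′ , q′ , e′ , f′ , d = descs-nth boxes i (cong (λ z → nth z (suc i)) (sym ys-descs) ∙ nth-descs ys (suc i) e f) in
             strict compatible i e′ f′ (<ᵇ-true⁻ (sym d ∙ <ᵇ-true lt))))
          where
          bump-< : ∀ b {x y} → x < y → bump b x < bump b y
          bump-< true  lt = lt
          bump-< false lt = s<s lt

      hat : hatPlus M v ≡ map (map m′) (tildePlus S v)
      hat = cong (λ z → ct (thresholds z J) (tildePlus S v)) delta

    hat-SSYT : isSSYT (hatPlus M v) ≡ true
    hat-SSYT = cong isSSYT hat ∙ compatible-SSYT tilde comp

    hat-standardize : standardize (hatPlus M v) ≡ tildePlus S v
    hat-standardize = cong standardize hat ∙ standardize-unique tilde comp

    hat-type : typeOf (hatPlus M v) ≡ deltaᵇ M v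
    hat-type = cong (λ T → eqMaybe (rowOf T 2) (just 0)) hat-standardize ∙ second-row ∙ sym delta

    -- The label 1 passes no threshold and yields the new 0. The label `suc x` passes those that `x`
    -- passes in `M`, and one more if `δ = 0`.
    hat-content : entries (hatPlus M v) ↭ 0 ∷ map (bump (deltaᵇ M v)) (entries M)
    hat-content = ↭-trans (↭-reflexive (cong entries hat ∙ map-entries m′ (tildePlus S v)))
      (↭-trans (↭.map⁺ m′ (↭-trans (syt-numbers tilde) (↭-reflexive (cong oneTo ys-length ∙ oneTo-suc (suc n)))))
      (↭-trans (↭-reflexive (cong₂ _∷_ (thresholds-1 b J) (sym (List.map-∘ (oneTo (suc n))) ∙ map-cong∈ (oneTo (suc n)) shifted ∙ List.map-∘ (oneTo (suc n)))))
      (prep 0 (↭-trans (↭-reflexive (cong (λ z → map (bump z) (map (below-count J) (oneTo (suc n)))) (sym delta)))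
        (↭.map⁺ (bump (deltaᵇ M v)) (↭-trans (↭.map⁺ (below-count J) (↭-sym (↭-trans (syt-numbers standard) (↭-reflexive (cong oneTo len)))))
          (↭-reflexive (sym (map-entries (below-count J) S) ∙ cong entries ct-standardize))))))))
      where
      shifted : ∀ {x} → x ∈ oneTo (suc n) → m′ (suc x) ≡ bump b (below-count J x)
      shifted q with ∈.∈-map⁻ suc q
      ... | i , _ , refl = thresholds-suc b J i

  hatPlus-from : ∀ M v {b S R} → deltaᵇ M v ≡ b → standardize M ≡ S → tildePlus S v ≡ R → hatPlus M v ≡ ct (thresholds b (JM M)) R
  hatPlus-from M v refl refl refl = refl

  ct-cong : ∀ J (f : ℕ → ℕ) T → (∀ {x} → x ∈ entries T → below-count J x ≡ f x) → ct J T ≡ map (map f) T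
  ct-cong J f []        h = refl
  ct-cong J f (row ∷ T) h = cong₂ _∷_ (map-cong∈ row (h ∘ ∈.∈-++⁺ˡ)) (ct-cong J f T (h ∘ ∈.∈-++⁺ʳ row))

  oneTo-cong : ∀ (f g : ℕ → ℕ) {n} → f 1 ≡ g 1 → (∀ i → i < n → f (suc (suc i)) ≡ g (suc (suc i))) → ∀ {x} → x ∈ oneTo (suc n) → f x ≡ g x
  oneTo-cong f g e h q with ∈.∈-map⁻ suc q
  ... | zero  , _  , refl = e
  ... | suc i , i∈ , refl = h i (ℕ.≤-pred (∈.∈-upTo⁻ i∈))

  unbump : Bool → ℕ → ℕ
  unbump b k = if b then k else pred k

  bump-unbump : ∀ b k → (b ≡ false → 1 ≤ k) → bump b (unbump b k) ≡ k
  bump-unbump true  k       h = refl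
  bump-unbump false zero    h with () ← h refl
  bump-unbump false (suc k) h = refl

  unbump-mono : ∀ b {x y} → x ≤ y → unbump b x ≤ unbump b y
  unbump-mono true  le = le
  unbump-mono false le = ℕ.pred-mono-≤ le

  bump-cancel : ∀ b {x y} → bump b x < bump b y → x < y
  bump-cancel true  lt       = lt
  bump-cancel false (s≤s lt) = lt

  -- Both evacuations are undone: a preimage of the sequence of `N` ends with `v`, and a preimage of
  -- the rest is the sequence of `S`. The values of `M` are those of `N` with the labels shifted by
  -- one, lowered by 1 if `δ = 0`.
  module HatSurjective (N : Tab) (ssyt : isSSYT N ≡ true) {n : ℕ} (size : sum (shape N) ≡ suc (suc n)) (0∈ : 0 ∈ entries N) where

    open Semistandard N ssyt

    private
      opaque
        surj : ∃ λ zs → Std [] zs × length zs ≡ length boxes × evL (length boxes) zs ≡ boxes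
        surj = evL-surjective boxes (std standard)

        snoc : ∃₂ λ es′ v → proj₁ surj ≡ es′ ++ v ∷ [] × length es′ ≡ suc n
        snoc = snoc-view (proj₁ surj) (proj₁ (proj₂ (proj₂ surj)) ∙ boxes-length ∙ length-entries N ∙ size)

      es′ : List Cell
      es′ = proj₁ snoc

    v : Cell
    v = proj₁ (proj₂ snoc)

    private
      zs-std : Std [] (es′ ++ v ∷ [])
      zs-std = subst (Std []) (proj₁ (proj₂ (proj₂ snoc))) (proj₁ (proj₂ surj))

      zs≡ : evL (length boxes) (es′ ++ v ∷ []) ≡ boxes
      zs≡ = cong (evL (length boxes)) (sym (proj₁ (proj₂ (proj₂ snoc)))) ∙ proj₂ (proj₂ (proj₂ surj))

      opaque
        surj′ : ∃ λ xs → Std [] xs × length xs ≡ length es′ × evL (length es′) xs ≡ es′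
        surj′ = evL-surjective es′ (proj₁ (Std-++ es′ zs-std))

      xs : List Cell
      xs = proj₁ surj′

      opaque
        tab : ∃ λ S → SYT S xs
        tab = tabulation xs (proj₁ (proj₂ surj′))

      S : Tab
      S = proj₁ tab

      Y : SYT S xs
      Y = proj₂ tab

      ys-len : length boxes ≡ suc (suc n)
      ys-len = boxes-length ∙ length-entries N ∙ size

      len : length xs ≡ suc n
      len = proj₁ (proj₂ (proj₂ surj′)) ∙ proj₂ (proj₂ (proj₂ snoc))

      open Plus Y len

      es-es′ : es ≡ es′
      es-es′ = cong (λ k → evL k xs) (sym (proj₂ (proj₂ (proj₂ snoc)))) ∙ proj₂ (proj₂ (proj₂ surj′))

      ex : Extends (evacuation S) v
      ex = syt-extends evac (subst (λ z → Std [] (z ++ v ∷ [])) (sym es-es′) zs-std)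

      open Add v ex

      ys≡ : ys ≡ boxes
      ys≡ = cong₂ (λ k z → evL k (z ++ v ∷ [])) (sym ys-len) es-es′ ∙ zs≡

      tilde≡ : tildePlus S v ≡ standardize N
      tilde≡ = syt-ext tilde (subst (SYT (standardize N)) (sym ys≡) standard)

      b : Bool
      b = not (desc last v)

      m′ m : ℕ → ℕ
      m′ = below-count (JM N)
      m x = unbump b (m′ (suc x))

      -- Some box holds 0, and values grow with labels, so the label 1 has value 0.
      m′-1 : m′ 1 ≡ 0
      m′-1 with ∈-entryAt N 0∈
      ... | p , e with standardize-entry N {proj₁ p} e
      ... | g with at⁻ standard p g
      ... | i , eq , _ = ℕ.n≤0⇒n≡0 (ℕ.≤-trans (below-count-mono (JM N) (s≤s z≤n)) (ℕ.≤-reflexive (cong m′ (sym eq) ∙ JM-rank {p} e)))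

      -- For `δ = 0` the label 1 is a descent of the standardization of `N`. The value at label 2 is
      -- then positive, so lowering by 1 truncates nothing.
      first-strict : b ≡ false → 1 ≤ m′ 2
      first-strict eq with <-nth boxes {0} (subst (0 <_) (sym ys-len) z<s) | <-nth boxes {1} (subst (1 <_) (sym ys-len) (s<s z<s))
      ... | p , e | q , f = ℕ.≤-<-trans z≤n (strict compatible 0 e f (<ᵇ-true⁻ (just-injective (sym (nth-descs boxes 0 e f) ∙ cong (λ z → nth (descs z) 0) (sym ys≡) ∙
              cong (λ z → nth z 0) ys-descs) ∙ sym (𝔹.not-involutive (desc last v)) ∙ cong not eq)))

    M : Tab
    M = map (map m) S

    private
      bump-m : ∀ x → bump b (m (suc x)) ≡ m′ (suc (suc x))
      bump-m x = bump-unbump b (m′ (suc (suc x))) λ eq → ℕ.≤-trans (first-strict eq) (below-count-mono (JM N) (s≤s (s≤s z≤n)))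

      comp : Compatible m xs
      comp = record { mono = λ le → unbump-mono b (below-count-mono (JM N) (s≤s le)) ; strict = st }
        where
        st : ∀ i {p q} → nth xs i ≡ just p → nth xs (suc i) ≡ just q → proj₁ p < proj₁ q → m (suc i) < m (suc (suc i))
        st i e f lt with descs-nth boxes (suc i) (cong (λ z → nth (descs z) (suc i)) (sym ys≡) ∙ cong (λ z → nth z (suc i)) ys-descs ∙ nth-descs xs i e f)
        ... | p′ , q′ , e′ , f′ , d = bump-cancel b (subst₂ _<_ (sym (bump-m i)) (sym (bump-m (suc i))) (strict compatible (suc i) e′ f′ (<ᵇ-true⁻ (sym d ∙ <ᵇ-true lt))))

    M-SSYT : isSSYT M ≡ true
    M-SSYT = compatible-SSYT Y comp

    private
      M-std : standardize M ≡ S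
      M-std = standardize-unique Y comp

    M-size : sum (shape M) ≡ suc n
    M-size = cong sum (map-shape m S) ∙ sym (length-entries S) ∙ syt-length Y ∙ len

    private
      M-nonempty : 0 < length M
      M-nonempty = rows-nonempty M M-size

      sh : shape (evacuation S) ≡ shape M
      sh = evacuation-shape ∙ sym (map-shape m S)

    v∈ : v ∈ EC (shape M)
    v∈ = EC-complete M M-nonempty (record
      { free = nothing-if λ e → contradiction (sym (free ex) ∙ proj₂ (entryAt-shape {M} {evacuation S} (sym sh) {v} e)) λ ()
      ; supports = λ {p} adj → entryAt-shape {evacuation S} {M} sh {p} (proj₂ (supports ex adj)) })

    private
      delta : deltaᵇ M v ≡ b
      delta = lem (cong₂ (λ T k → rowOf (evacuation T) k) M-std (length-entries M ∙ M-size) ∙ row-last)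
        where
        lem : rowOf (evacuation (standardize M)) (length (entries M)) ≡ just (proj₁ last) → deltaᵇ M v ≡ b
        lem e rewrite e = refl

      JM-m : ∀ i → i < suc n → below-count (JM M) (suc i) ≡ m (suc i)
      JM-m i lt with <-nth xs (subst (i <_) (sym len) lt)
      ... | p , e = just-injective (sym (map-entryAt-just (below-count (JM M)) S {p} (at⁺ Y i e)) ∙
            cong (λ T → entryAt T p) (cong (ct (JM M)) (sym M-std) ∙ Semistandard.ct-standardize M M-SSYT) ∙ map-entryAt-just m S {p} (at⁺ Y i e))

      thr-suc : ∀ i → i < suc n → below-count (thresholds b (JM M)) (suc (suc i)) ≡ m′ (suc (suc i))
      thr-suc i lt = thresholds-suc b (JM M) i ∙ cong (bump b) (JM-m i lt) ∙ bump-m i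

      thr : ∀ {x} → x ∈ entries (standardize N) → below-count (thresholds b (JM M)) x ≡ m′ x
      thr q = oneTo-cong (below-count (thresholds b (JM M))) m′ (thresholds-1 b (JM M) ∙ sym m′-1) thr-suc (↭.∈-resp-↭ (↭-trans (syt-numbers standard) (↭-reflexive (cong oneTo ys-len))) q)

    hat : hatPlus M v ≡ N
    hat = hatPlus-from M v delta M-std tilde≡ ∙ ct-cong (thresholds b (JM M)) m′ (standardize N) thr ∙ ct-standardize

open Operations

-- The three summands and their content parts

module Summands where

  private variable
    m n : ℕ

  0∈? : (xs : List ℕ) → Dec (0 ∈ xs)
  0∈? = Any∃.any? (0 ℕ.≟_)

  restrict : (Vec ℕ m → Bool) → Poly m → Poly m
  restrict Q = filterᵇ (Q ∘ proj₁)

  private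
    if-0 : ∀ b {q} → q ≡ 0ℚ → (if b then q else 0ℚ) ≡ 0ℚ
    if-0 true  e = e
    if-0 false e = refl

    ∑-if : ∀ {A : Set} b (xs : List A) (f : A → ℚ) → (∑[ x ← xs ] (if b then f x else 0ℚ)) ≡ (if b then ∑ xs f else 0ℚ)
    ∑-if true  xs f = refl
    ∑-if false xs f = ∑-0 xs λ _ → refl

    δ-if : (Q : Vec ℕ m → Bool) (α β : Vec ℕ m) (c : ℚ) → (if Q α then c *ℚ δ α β else 0ℚ) ≡ (if Q β then c *ℚ δ α β else 0ℚ)
    δ-if Q α β c = lem (β ≟V α)
      where
      lem : Dec (β ≡ α) → (if Q α then c *ℚ δ α β else 0ℚ) ≡ (if Q β then c *ℚ δ α β else 0ℚ)
      lem (yes refl) = refl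
      lem (no  ne)   = if-0 (Q α) z ∙ sym (if-0 (Q β) z)
        where
        z : c *ℚ δ α β ≡ 0ℚ
        z = cong (c *ℚ_) (iv-no (β ≟V α) ne) ∙ ℚ.*-zeroʳ c

  coeff-restrict : (Q : Vec ℕ m → Bool) (p : Poly m) (β : Vec ℕ m) → coeff (restrict Q p) β ≡ (if Q β then coeff p β else 0ℚ)
  coeff-restrict Q p β = coeff≡∑ (restrict Q p) β ∙ ∑-filterᵇ (Q ∘ proj₁) p _ ∙ ∑-cong p (λ t → δ-if Q (proj₁ t) β (proj₂ t)) ∙
    ∑-if (Q β) p _ ∙ cong (if Q β then_else 0ℚ) (sym (coeff≡∑ p β))

  restrict-≈ : (Q : Vec ℕ m → Bool) (p : Poly m) → (∀ α → coeff p α ≢ 0ℚ → Q α ≡ true) → p ≈P restrict Q p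
  restrict-≈ Q p h α = lem (coeff p α ℚ.≟ 0ℚ) ∙ sym (coeff-restrict Q p α)
    where
    lem : Dec (coeff p α ≡ 0ℚ) → coeff p α ≡ (if Q α then coeff p α else 0ℚ)
    lem (yes e) = e ∙ sym (if-0 (Q α) e)
    lem (no ne) = sym (cong (if_then coeff p α else 0ℚ) (h α ne))

  map-pred-suc : (α : Vec ℕ m) → Vec.map pred (Vec.map suc α) ≡ α
  map-pred-suc []      = refl
  map-pred-suc (a ∷ α) = cong (a ∷_) (map-pred-suc α)

  map-suc-pred : (α : Vec ℕ m) → 0 ∉ toList α → Vec.map suc (Vec.map pred α) ≡ α
  map-suc-pred []          h = refl
  map-suc-pred (zero ∷ α)  h = contradiction (here refl) h
  map-suc-pred (suc a ∷ α) h = cong (suc a ∷_) (map-suc-pred α (h ∘ there))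

  0∉map-suc : (xs : List ℕ) → 0 ∉ map suc xs
  0∉map-suc (x ∷ xs) (there q) = 0∉map-suc xs q

  0∉toList-map-suc : (α : Vec ℕ m) → 0 ∉ toList (Vec.map suc α)
  0∉toList-map-suc α q = 0∉map-suc (toList α) (subst (0 ∈_) (Vec.toList-map suc α) q)

  coeff-mulE : (q : Poly m) (α : Vec ℕ m) → coeff (mulE q) (Vec.map suc α) ≡ coeff q α
  coeff-mulE q α = coeff≡∑ (mulE q) (Vec.map suc α) ∙ ∑-map _ q _ ∙ ∑-cong q (λ t → cong (proj₂ t *ℚ_) (iv-cong (Vec.map suc α ≟V Vec.map suc (proj₁ t)) (α ≟V proj₁ t)
    (λ e → sym (map-pred-suc α) ∙ cong (Vec.map pred) e ∙ map-pred-suc (proj₁ t)) (cong (Vec.map suc)))) ∙ sym (coeff≡∑ q α)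

  coeff-mulE-0 : (q : Poly m) (β : Vec ℕ m) → 0 ∈ toList β → coeff (mulE q) β ≡ 0ℚ
  coeff-mulE-0 q β 0∈ = coeff≡∑ (mulE q) β ∙ ∑-map _ q _ ∙ ∑-0 q λ {t} _ → cong (proj₂ t *ℚ_) (iv-no (β ≟V Vec.map suc (proj₁ t))
    λ e → 0∉toList-map-suc (proj₁ t) (subst (λ z → 0 ∈ toList z) e 0∈)) ∙ ℚ.*-zeroʳ (proj₂ t)

  mulE-support : (q : Poly m) (β : Vec ℕ m) → coeff (mulE q) β ≢ 0ℚ → 0 ∉ toList β × coeff q (Vec.map pred β) ≢ 0ℚ
  mulE-support q β ne = 0∉ , λ e → ne (cong (coeff (mulE q)) (sym (map-suc-pred β 0∉)) ∙ coeff-mulE q (Vec.map pred β) ∙ e)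
    where
    0∉ : 0 ∉ toList β
    0∉ 0∈ = ne (coeff-mulE-0 q β 0∈)

  -- Terms with an exponent 0 are dropped before the division, so `pred` never acts on 0.
  divE : Poly m → Poly m
  divE p = map (λ t → Vec.map pred (proj₁ t) , proj₂ t) (restrict (λ α → not (does (0∈? (toList α)))) p)

  coeff-divE : (p : Poly m) (α : Vec ℕ m) → coeff (divE p) α ≡ coeff p (Vec.map suc α)
  coeff-divE {m} p α = coeff≡∑ (divE p) α ∙ ∑-map _ (restrict Q p) _ ∙ ∑-filterᵇ (Q ∘ proj₁) p _ ∙
      ∑-cong p (λ t → lem (proj₁ t) (proj₂ t) (0∈? (toList (proj₁ t)))) ∙ sym (coeff≡∑ p (Vec.map suc α))
    where
    Q : Vec ℕ m → Bool
    Q γ = not (does (0∈? (toList γ)))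
    lem : ∀ γ c (d : Dec (0 ∈ toList γ)) → (if not (does d) then c *ℚ δ (Vec.map pred γ) α else 0ℚ) ≡ c *ℚ δ γ (Vec.map suc α)
    lem γ c (yes 0∈) = sym (cong (c *ℚ_) (iv-no (Vec.map suc α ≟V γ) λ { refl → 0∉toList-map-suc α 0∈ }) ∙ ℚ.*-zeroʳ c)
    lem γ c (no 0∉)  = cong (c *ℚ_) (iv-cong (α ≟V Vec.map pred γ) (Vec.map suc α ≟V γ)
      (λ e → cong (Vec.map suc) e ∙ map-suc-pred γ 0∉) (λ e → sym (map-pred-suc α) ∙ cong (Vec.map pred) e))

  unbump-bump : ∀ b k → unbump b (bump b k) ≡ k
  unbump-bump true  k = refl
  unbump-bump false k = refl

  bump-↭⁻ : ∀ b {xs ys} → map (bump b) xs ↭ map (bump b) ys → xs ↭ ys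
  bump-↭⁻ b {xs} {ys} r = ↭-trans (↭-reflexive (sym (un xs))) (↭-trans (↭.map⁺ (unbump b) r) (↭-reflexive (un ys)))
    where
    un : ∀ zs → map (unbump b) (map (bump b) zs) ≡ zs
    un zs = sym (List.map-∘ zs) ∙ List.map-cong (unbump-bump b) zs ∙ List.map-id zs

  open SpechtTerm using (value)

  value-support : ∀ {η} (t : SpechtTerm m η) β → ¬ (toList β ↭ η) → value t β ≡ 0ℚ
  value-support t β h = cong (SpechtTerm.c t *ℚ_) (coeff-F-support (SpechtTerm.filling t) (SpechtTerm.same t) β
    λ r → h (↭-trans r (SpechtTerm.content t))) ∙ ℚ.*-zeroʳ (SpechtTerm.c t)

  InV-terms : ∀ {N p η} → isSSYT N ≡ true → entries N ↭ η → InV m N p →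
              ∃ λ (L : List (SpechtTerm m η)) → All (λ t → SpechtTerm.N t ≡ N) L × (∀ β → coeff p β ≡ (∑[ t ← L ] value t β))
  InV-terms {m} {N} {p} {η} ssyt c (L , fs , p≈) = let ts , a , e = go L fs in ts , a , λ β → p≈ β ∙ coeff-sumP _ L β ∙ e β
    where
    go : ∀ L → All (λ tc → IsFilling m (shape N) (proj₁ tc)) L →
         ∃ λ (ts : List (SpechtTerm m η)) → All (λ t → SpechtTerm.N t ≡ N) ts × (∀ β → (∑[ tc ← L ] coeff (scaleP (proj₂ tc) (FMT m N (proj₁ tc))) β) ≡ (∑[ t ← ts ] value t β))
    go []             []                  = [] , [] , λ _ → refl
    go ((tb , k) ∷ L) ((sh , nums) ∷ fs′) = let ts , a , e = go L fs′ in
      record { c = k ; N = N ; tb = tb ; filling = record { numbers = nums ; partition = cong isPartition sh ∙ proj₁ (∧-true ssyt) } ; same = sym sh ; ssyt = ssyt ; content = c } ∷ ts ,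
      refl ∷ a , λ β → cong₂ _+ℚ_ (coeff-scale k (FMT m N tb) β) (e β)

  -- What directness uses of a piece: the space `V_N` and the type of `N`, without `M` and `v`.
  record Block (m : ℕ) (b : Bool) : Set where
    field
      N    : Tab
      q    : Poly m
      ssyt : isSSYT N ≡ true
      type : typeOf N ≡ b
      inV  : InV m N q

  Block-support : ∀ {b} (B : Block m b) β → ¬ (toList β ↭ entries (Block.N B)) → coeff (Block.q B) β ≡ 0ℚ
  Block-support B β h = let ts , _ , e = InV-terms {p = Block.q B} (Block.ssyt B) ↭-refl (Block.inV B) in e β ∙ ∑-0 ts λ {t} _ → value-support t β h

  -- Membership in Ext or LE restricted to one content, the form to which `specht-direct` applies.
  Spanned : Bool → Vec ℕ m → (Vec ℕ m → ℚ) → Set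
  Spanned {m} b α f = ∃ λ (L : List (SpechtTerm m (toList α))) → All (λ t → typeOf (SpechtTerm.N t) ≡ b) L × (∀ β → toList β ↭ toList α → f β ≡ (∑[ t ← L ] value t β))

  Spanned-+ : ∀ {b} {α : Vec ℕ m} {f g} → Spanned b α f → Spanned b α g → Spanned b α (λ β → f β +ℚ g β)
  Spanned-+ (L , a , e) (L′ , a′ , e′) = L ++ L′ , All.++⁺ a a′ , λ β r → cong₂ _+ℚ_ (e β r) (e′ β r) ∙ sym (∑-++ L L′ _)

  Spanned-neg : ∀ {b} {α : Vec ℕ m} {f} → Spanned b α f → Spanned b α (λ β → -ℚ f β)
  Spanned-neg {m} {α = α} (L , a , e) = map neg L , All.map⁺ a , λ β r → cong -ℚ_ (e β r) ∙ ∑-neg L β ∙ sym (∑-map neg L _)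
    where
    neg : SpechtTerm m (toList α) → SpechtTerm m (toList α)
    neg t = record t { c = -ℚ SpechtTerm.c t }
    ∑-neg : ∀ L β → -ℚ (∑[ t ← L ] value t β) ≡ (∑[ t ← L ] value (neg t) β)
    ∑-neg []      β = refl
    ∑-neg (t ∷ L) β = ℚ.neg-distrib-+ (value t β) _ ∙ cong₂ _+ℚ_ (ℚ.neg-distribˡ-* (SpechtTerm.c t) _) (∑-neg L β)

  -- The type is a function of the tableau, so `typeOf` can select from a vanishing combination, and
  -- what it selects is `f`.
  Spanned-direct : {α : Vec ℕ m} {f g : Vec ℕ m → ℚ} → Spanned true α f → Spanned false α g → (∀ β → toList β ↭ toList α → f β +ℚ g β ≡ 0ℚ) → f α ≡ 0ℚ
  Spanned-direct {m} {α} {f} {g} (L , a , e) (L′ , a′ , e′) h = e α ↭-refl ∙ sym (ℚ.+-identityʳ _) ∙ sym (cong₂ _+ℚ_ (select L a) (drop L′ a′)) ∙ sym (∑-++ L L′ _) ∙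
      SpechtDirect.specht-direct α (L ++ L′) (λ β r → ∑-++ L L′ _ ∙ sym (cong₂ _+ℚ_ (e β r) (e′ β r)) ∙ h β r) typeOf α
    where
    masked : SpechtTerm m (toList α) → ℚ
    masked t = if typeOf (SpechtTerm.N t) then value t α else 0ℚ
    select : ∀ L → All (λ t → typeOf (SpechtTerm.N t) ≡ true) L → ∑ L masked ≡ (∑[ t ← L ] value t α)
    select []      []       = refl
    select (t ∷ L) (x ∷ xs) = cong₂ _+ℚ_ (cong (if_then value t α else 0ℚ) x) (select L xs)
    drop : ∀ L → All (λ t → typeOf (SpechtTerm.N t) ≡ false) L → ∑ L masked ≡ 0ℚ
    drop []      []       = refl
    drop (t ∷ L) (x ∷ xs) = cong₂ _+ℚ_ (cong (if_then value t α else 0ℚ) x) (drop L xs)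

  Block-spanned : ∀ {b} (L : List (Block m b)) (α : Vec ℕ m) → Spanned b α (λ β → ∑[ B ← L ] coeff (Block.q B) β)
  Block-spanned []              α = [] , [] , λ _ _ → refl
  Block-spanned {m} {b} (B ∷ L) α = Spanned-+ (one (entries (Block.N B) ↭? toList α)) (Block-spanned L α)
    where
    one : Dec (entries (Block.N B) ↭ toList α) → Spanned b α (coeff (Block.q B))
    one (yes r) = let ts , a , e = InV-terms {p = Block.q B} (Block.ssyt B) r (Block.inV B) in ts , All.map (λ x → cong typeOf x ∙ Block.type B) a , λ β _ → e β
    one (no ¬r) = [] , [] , λ β r → Block-support B β λ r′ → ¬r (↭-trans (↭-sym r′) r)

  block : ∀ {cond b} → Piece (suc n) cond b → Block (suc (suc n)) b
  block P = record { N = hatPlus M v ; q = q ; ssyt = hat-SSYT ; type = hat-type ∙ dlt ; inV = inV }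
    where
    open Piece P renaming (addable to corner)
    open HatPlus M ssyt size v corner

  block-content : ∀ {cond b} (P : Piece (suc n) cond b) → entries (Block.N (block P)) ↭ 0 ∷ map (bump b) (entries (Piece.M P))
  block-content P = subst (λ z → entries (hatPlus M v) ↭ 0 ∷ map (bump z) (entries M)) dlt hat-content
    where
    open Piece P renaming (addable to corner)
    open HatPlus M ssyt size v corner

  Piece-support : ∀ {cond b} (P : Piece (suc n) cond b) β → ¬ (toList β ↭ 0 ∷ map (bump b) (entries (Piece.M P))) → coeff (Piece.q P) β ≡ 0ℚ
  Piece-support P β h = Block-support (block P) β λ r → h (↭-trans r (block-content P))

  ExtLE-spanned : ∀ {cond b p} → ExtLE (suc n) cond b p → (α : Vec ℕ (suc (suc n))) → Spanned b α (coeff p)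
  ExtLE-spanned (L , p≈) α = let ts , a , e = Block-spanned (map block L) α in
    ts , a , λ β r → p≈ β ∙ coeff-sumP Piece.q L β ∙ sym (∑-map block L _) ∙ e β r

  ExtLE-support : ∀ {cond b p} → ExtLE (suc n) cond b p → ∀ β → coeff p β ≢ 0ℚ →
                  ∃ λ M → cond M × sum (shape M) ≡ suc n × toList β ↭ 0 ∷ map (bump b) (entries M)
  ExtLE-support {n} {cond} {b} (L , p≈) β ne = go L (λ e → ne (p≈ β ∙ coeff-sumP Piece.q L β ∙ e))
    where
    go : (L : List (Piece (suc n) cond b)) → (∑[ P ← L ] coeff (Piece.q P) β) ≢ 0ℚ → ∃ λ M → cond M × sum (shape M) ≡ suc n × toList β ↭ 0 ∷ map (bump b) (entries M)
    go []      ne = contradiction refl ne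
    go (P ∷ L) ne = one (toList β ↭? 0 ∷ map (bump b) (entries (Piece.M P)))
      where
      one : Dec (toList β ↭ 0 ∷ map (bump b) (entries (Piece.M P))) → ∃ λ M → cond M × sum (shape M) ≡ suc n × toList β ↭ 0 ∷ map (bump b) (entries M)
      one (yes r) = Piece.M P , Piece.cnd P , Piece.size P , r
      one (no ¬r) = go L λ e → ne (cong₂ _+ℚ_ (Piece-support P β ¬r) e)

  ExtLE-map : ∀ {cond cond′ b p} → (∀ M → sum (shape M) ≡ n → cond M → cond′ M) → ExtLE n cond b p → ExtLE n cond′ b p
  ExtLE-map {n} {cond} {cond′} {b} h (L , p≈) = map conv L , λ β → p≈ β ∙ cong (λ z → coeff (sumP z) β) (List.map-∘ L)
    where
    conv : Piece n cond b → Piece n cond′ b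
    conv P = record { M = M ; v = v ; q = q ; ssyt = ssyt ; size = size ; cnd = h M size cnd ; addable = corner ; dlt = dlt ; inV = inV }
      where open Piece P renaming (addable to corner)

  ExtLE-content : ∀ {cond b p η μ} → η ↭ 0 ∷ map (bump b) μ → HasContent (suc (suc n)) η p → ExtLE (suc n) cond b p → ExtLE (suc n) (ContCond μ) b p
  ExtLE-content {n} {cond} {b} {p} {η} {μ} η↭ hc (L , p≈) = keep L , λ β → eq β (toList β ↭? η)
    where
    conv : (P : Piece (suc n) cond b) → entries (Piece.M P) ↭ μ → Piece (suc n) (ContCond μ) b
    conv P r = record { M = M ; v = v ; q = q ; ssyt = ssyt ; size = size ; cnd = r ; addable = corner ; dlt = dlt ; inV = inV }
      where open Piece P renaming (addable to corner)
    keep₁ : (P : Piece (suc n) cond b) → Dec (entries (Piece.M P) ↭ μ) → List (Piece (suc n) (ContCond μ) b)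
    keep₁ P (yes r) = conv P r ∷ []
    keep₁ P (no _)  = []
    keep : List (Piece (suc n) cond b) → List (Piece (suc n) (ContCond μ) b)
    keep = concatMap (λ P → keep₁ P (entries (Piece.M P) ↭? μ))
    kept : ∀ β → toList β ↭ η → ∀ P d → coeff (Piece.q P) β ≡ (∑[ P′ ← keep₁ P d ] coeff (Piece.q P′) β)
    kept β r P (yes _) = sym (ℚ.+-identityʳ _)
    kept β r P (no ¬r) = Piece-support P β λ r′ → ¬r (bump-↭⁻ b (↭.drop-∷ (↭-trans (↭-sym r′) (↭-trans r η↭))))
    eq : ∀ β → Dec (toList β ↭ η) → coeff p β ≡ coeff (sumP (map Piece.q (keep L))) β
    eq β (yes r) = p≈ β ∙ coeff-sumP Piece.q L β ∙ ∑-cong L (λ P → kept β r P (entries (Piece.M P) ↭? μ)) ∙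
      sym (∑-concatMap (λ P → keep₁ P (entries (Piece.M P) ↭? μ)) L (λ P → coeff (Piece.q P) β)) ∙ sym (coeff-sumP Piece.q (keep L) β)
    eq β (no ¬r) = zero-or (coeff p β ℚ.≟ 0ℚ) ∙ sym (coeff-sumP Piece.q (keep L) β ∙ ∑-0 (keep L) λ {P} _ →
        Piece-support P β λ r → ¬r (↭-trans r (↭-trans (prep 0 (↭.map⁺ (bump b) (Piece.cnd P))) (↭-sym η↭))))
      where
      zero-or : Dec (coeff p β ≡ 0ℚ) → coeff p β ≡ 0ℚ
      zero-or (yes e) = e
      zero-or (no ne) = contradiction (hc β ne) ¬r

  record Origin (n : ℕ) (N : Tab) : Set where
    field
      M       : Tab
      v       : ℕ × ℕ
      ssyt    : isSSYT M ≡ true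
      size    : sum (shape M) ≡ suc n
      corner  : v ∈ EC (shape M)
      hat     : hatPlus M v ≡ N
      content : entries N ↭ 0 ∷ map (bump (deltaᵇ M v)) (entries M)

  opaque
    hatPlus-onto : ∀ N → isSSYT N ≡ true → sum (shape N) ≡ suc (suc n) → 0 ∈ entries N → Origin n N
    hatPlus-onto N ssyt size 0∈ = record
      { M = M ; v = v ; ssyt = M-SSYT ; size = M-size ; corner = v∈ ; hat = hat
      ; content = subst (λ z → entries z ↭ 0 ∷ map (bump (deltaᵇ M v)) (entries M)) hat (HatPlus.hat-content M M-SSYT M-size v v∈) }
      where open HatSurjective N ssyt size 0∈

  private
    ℚ-swap : ∀ x y z → x +ℚ (y +ℚ z) ≡ y +ℚ (x +ℚ z)
    ℚ-swap x y z = sym (ℚ.+-assoc x y z) ∙ cong (_+ℚ z) (ℚ.+-comm x y) ∙ ℚ.+-assoc y x z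

    ℚ-collect : ∀ k x y z → k *ℚ x +ℚ (k *ℚ y +ℚ z) ≡ k *ℚ (x +ℚ y) +ℚ z
    ℚ-collect k x y z = sym (ℚ.+-assoc (k *ℚ x) (k *ℚ y) z) ∙ cong (_+ℚ z) (sym (ℚ.*-distribˡ-+ k x y))

  -- `cond` depends on the type: degrees differ between Ext and LE, and an impossible condition for
  -- `false` expresses that no LE part occurs.
  module Decompose (cond : Bool → Tab → Set) where

    Pieces : ℕ → Set
    Pieces n = List (Piece (suc n) (cond true) true) × List (Piece (suc n) (cond false) false)

    total : Pieces n → Vec ℕ (suc (suc n)) → ℚ
    total (A , B) β = (∑[ P ← A ] coeff (Piece.q P) β) +ℚ (∑[ P ← B ] coeff (Piece.q P) β)

    add : ∀ b → Piece (suc n) (cond b) b → Pieces n → Pieces n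
    add true  P (A , B) = P ∷ A , B
    add false P (A , B) = A , P ∷ B

    total-add : ∀ b (P : Piece (suc n) (cond b) b) X β → total (add b P X) β ≡ coeff (Piece.q P) β +ℚ total X β
    total-add true  P (A , B) β = ℚ.+-assoc (coeff (Piece.q P) β) (∑[ P ← A ] coeff (Piece.q P) β) (∑[ P ← B ] coeff (Piece.q P) β)
    total-add false P (A , B) β = ℚ-swap (∑[ P ← A ] coeff (Piece.q P) β) (coeff (Piece.q P) β) (∑[ P ← B ] coeff (Piece.q P) β)

    module _ {n : ℕ} (α : Vec ℕ (suc (suc n))) (0∈ : 0 ∈ toList α)
             (h : ∀ M b → sum (shape M) ≡ suc n → toList α ↭ 0 ∷ map (bump b) (entries M) → cond b M) where

      -- The tableau of the term contains 0 and so comes from some `M` and `v`; the value of `δ`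
      -- decides between Ext and LE.
      term-piece : (k : ℚ) (t : SpechtTerm (suc (suc n)) (toList α)) → ∃ λ b → ∃ λ (P : Piece (suc n) (cond b) b) → ∀ β → coeff (Piece.q P) β ≡ k *ℚ value t β
      term-piece k t = deltaᵇ M v , record { M = M ; v = v ; q = q ; ssyt = ssyt ; size = size ; addable = corner ; dlt = refl
          ; cnd = h M (deltaᵇ M v) size (↭-trans (↭-sym t.content) content) ; inV = subst (λ z → InV (suc (suc n)) z q) (sym hat) inV } ,
          λ β → coeff-scale (k *ℚ t.c) (FMT (suc (suc n)) t.N t.tb) β ∙ ℚ.*-assoc k t.c _
        where
        module t = SpechtTerm t
        t-size : sum (shape t.N) ≡ suc (suc n)
        t-size = sym (length-entries t.N) ∙ ↭.↭-length t.content ∙ Vec.length-toList α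
        open Origin (hatPlus-onto t.N t.ssyt t-size (↭.∈-resp-↭ (↭-sym t.content) 0∈))
        q : Poly (suc (suc n))
        q = scaleP (k *ℚ t.c) (FMT (suc (suc n)) t.N t.tb)
        inV : InV (suc (suc n)) t.N q
        inV = (t.tb , k *ℚ t.c) ∷ [] , (sym t.same , Filling.numbers t.filling) ∷ [] , λ β → cong (λ z → coeff z β) (sym (List.++-identityʳ q))

      terms-pieces : (k : ℚ) (L : List (SpechtTerm (suc (suc n)) (toList α))) (X : Pieces n) →
                     ∃ λ (Y : Pieces n) → ∀ β → total Y β ≡ k *ℚ (∑[ t ← L ] value t β) +ℚ total X β
      terms-pieces k []      X = X , λ β → sym (cong (_+ℚ total X β) (ℚ.*-zeroʳ k) ∙ ℚ.+-identityˡ _)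
      terms-pieces k (t ∷ L) X = let b , P , e = term-piece k t ; Y , e′ = terms-pieces k L X in
        add b P Y , λ β → total-add b P Y β ∙ cong₂ _+ℚ_ (e β) (e′ β) ∙ ℚ-collect k (value t β) (∑[ t ← L ] value t β) (total X β)

    pieces : (p : Poly (suc (suc n))) → (∀ {t} → t ∈ p → 0 ∈ toList (proj₁ t)) →
             (∀ {t} → t ∈ p → ∀ M b → sum (shape M) ≡ suc n → toList (proj₁ t) ↭ 0 ∷ map (bump b) (entries M) → cond b M) →
             ∃ λ (X : Pieces n) → ∀ β → total X β ≡ coeff p β
    pieces []            z h = ([] , []) , λ β → refl
    pieces ((α , c) ∷ p) z h =
      let X , e = pieces p (z ∘ there) (h ∘ there)
          L , sp = specht-spanning α
          Y , e′ = terms-pieces α (z (here refl)) (h (here refl)) c L X in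
      Y , λ β → e′ β ∙ cong₂ _+ℚ_ (cong (c *ℚ_) (sym (sp β))) (e β ∙ coeff≡∑ p β) ∙ sym (coeff≡∑ ((α , c) ∷ p) β)

  ℚ-sum-zero : ∀ {x y z} → x ≡ 0ℚ → y ≡ 0ℚ → x +ℚ (y +ℚ z) ≡ 0ℚ → z ≡ 0ℚ
  ℚ-sum-zero {z = z} refl refl e = sym (ℚ.+-identityˡ z) ∙ sym (ℚ.+-identityˡ (0ℚ +ℚ z)) ∙ e

  ℚ-difference : ∀ x y → x +ℚ -ℚ y ≡ 0ℚ → x ≡ y
  ℚ-difference x y e = sym (ℚ.+-identityʳ x) ∙ cong (x +ℚ_) (sym (ℚ.+-inverseˡ y)) ∙ sym (ℚ.+-assoc x (-ℚ y) y) ∙ cong (_+ℚ y) e ∙ ℚ.+-identityˡ y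

  split-E : (p : Poly m) (β : Vec ℕ m) → coeff p β ≡ coeff (restrict (λ α → does (0∈? (toList α))) p) β +ℚ coeff (mulE (divE p)) β
  split-E p β = lem (0∈? (toList β)) refl
    where
    lem : (d : Dec (0 ∈ toList β)) → does (0∈? (toList β)) ≡ does d → coeff p β ≡ coeff (restrict (λ α → does (0∈? (toList α))) p) β +ℚ coeff (mulE (divE p)) β
    lem (yes 0∈) e = sym (cong₂ _+ℚ_ (coeff-restrict _ p β ∙ cong (if_then coeff p β else 0ℚ) e) (coeff-mulE-0 (divE p) β 0∈) ∙ ℚ.+-identityʳ _)
    lem (no 0∉)  e = sym (cong₂ _+ℚ_ (coeff-restrict _ p β ∙ cong (if_then coeff p β else 0ℚ) e)
      (cong (coeff (mulE (divE p))) (sym β≡) ∙ coeff-mulE (divE p) (Vec.map pred β) ∙ coeff-divE p (Vec.map pred β) ∙ cong (coeff p) β≡) ∙ ℚ.+-identityˡ _)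
      where
      β≡ : Vec.map suc (Vec.map pred β) ≡ β
      β≡ = map-suc-pred β 0∉

  decompose : (cond : Bool → Tab → Set) (p : Poly (suc (suc n))) →
              (∀ {t} → t ∈ p → 0 ∈ toList (proj₁ t) → ∀ M b → sum (shape M) ≡ suc n → toList (proj₁ t) ↭ 0 ∷ map (bump b) (entries M) → cond b M) →
              ∃₂ λ a b → ExtLE (suc n) (cond true) true a × ExtLE (suc n) (cond false) false b × p ≈P a +P (b +P mulE (divE p))
  decompose {n} cond p h = a , b , (A , λ _ → refl) , (B , λ _ → refl) , λ β → split-E p β ∙ cong (_+ℚ coeff (mulE (divE p)) β) (sym (proj₂ X β)) ∙
      ℚ.+-assoc (∑[ P ← A ] coeff (Piece.q P) β) (∑[ P ← B ] coeff (Piece.q P) β) (coeff (mulE (divE p)) β) ∙ sym (coeff-++ a _ β ∙ cong₂ _+ℚ_ (coeff-sumP Piece.q A β) (coeff-++ b _ β ∙ cong (_+ℚ coeff (mulE (divE p)) β) (coeff-sumP Piece.q B β)))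
    where
    open Decompose cond
    mem : ∀ {t} → t ∈ restrict (λ α → does (0∈? (toList α))) p → t ∈ p × 0 ∈ toList (proj₁ t)
    mem {t} t∈ = let t∈p , w = ∈.∈-filter⁻ (λ t → 𝔹.T? (does (0∈? (toList (proj₁ t))))) {xs = p} t∈ in t∈p , lem (0∈? (toList (proj₁ t))) w
      where
      lem : ∀ {P : Set} (d : Dec P) → T (does d) → P
      lem (yes x) _ = x
    X : ∃ λ (X : Pieces n) → ∀ β → total X β ≡ coeff (restrict (λ α → does (0∈? (toList α))) p) β
    X = pieces _ (λ t∈ → proj₂ (mem t∈)) (λ t∈ → h (proj₁ (mem t∈)) (proj₂ (mem t∈)))
    A : List (Piece (suc n) (cond true) true)
    A = proj₁ (proj₁ X)
    B : List (Piece (suc n) (cond false) false)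
    B = proj₂ (proj₁ X)
    a b : Poly (suc (suc n))
    a = sumP (map Piece.q A)
    b = sumP (map Piece.q B)

  ExtLE-0 : ∀ {cond b p} → ExtLE (suc n) cond b p → ∀ β → 0 ∉ toList β → coeff p β ≡ 0ℚ
  ExtLE-0 {p = p} e β 0∉ = lem (coeff p β ℚ.≟ 0ℚ)
    where
    lem : Dec (coeff p β ≡ 0ℚ) → coeff p β ≡ 0ℚ
    lem (yes z) = z
    lem (no ne) = let _ , _ , _ , r = ExtLE-support {p = p} e β ne in contradiction (↭.∈-resp-↭ (↭-sym r) (here refl)) 0∉

  -- Exponent vectors without 0 occur only in the third summand, those with a 0 only in the first
  -- two, where the type separates Ext from LE.
  sum-unique : ∀ {condA condB a b c a′ b′ c′ q q′} →
    ExtLE (suc n) condA true a → ExtLE (suc n) condB false b → c ≈P mulE q →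
    ExtLE (suc n) condA true a′ → ExtLE (suc n) condB false b′ → c′ ≈P mulE q′ →
    a +P (b +P c) ≈P a′ +P (b′ +P c′) → (a ≈P a′) × (b ≈P b′) × (c ≈P c′)
  sum-unique {n} {a = a} {b} {c} {a′} {b′} {c′} {q} {q′} A B C A′ B′ C′ e =
      (λ α → ℚ-difference _ _ (proj₁ (zeros α))) , (λ α → ℚ-difference _ _ (proj₁ (proj₂ (zeros α)))) , (λ α → ℚ-difference _ _ (proj₂ (proj₂ (zeros α))))
    where
    f g h : Vec ℕ (suc (suc n)) → ℚ
    f α = coeff a α +ℚ -ℚ coeff a′ α
    g α = coeff b α +ℚ -ℚ coeff b′ α
    h α = coeff c α +ℚ -ℚ coeff c′ α
    rearrange : ∀ x y z x′ y′ z′ → (x +ℚ -ℚ x′) +ℚ ((y +ℚ -ℚ y′) +ℚ (z +ℚ -ℚ z′)) ≡ (x +ℚ (y +ℚ z)) +ℚ -ℚ (x′ +ℚ (y′ +ℚ z′))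
    rearrange = solve 6 (λ x y z x′ y′ z′ → (x :+ :- x′) :+ ((y :+ :- y′) :+ (z :+ :- z′)) := (x :+ (y :+ z)) :+ :- (x′ :+ (y′ :+ z′))) refl
      where open +-*-Solver
    total : ∀ α → f α +ℚ (g α +ℚ h α) ≡ 0ℚ
    total α = rearrange (coeff a α) (coeff b α) (coeff c α) (coeff a′ α) (coeff b′ α) (coeff c′ α) ∙
      cong (λ z → (coeff a α +ℚ (coeff b α +ℚ coeff c α)) +ℚ -ℚ z) (sym (split a′ b′ c′ α) ∙ sym (e α) ∙ split a b c α) ∙ ℚ.+-inverseʳ (coeff a α +ℚ (coeff b α +ℚ coeff c α))
      where
      split : ∀ (x y z : Poly (suc (suc n))) α → coeff (x +P (y +P z)) α ≡ coeff x α +ℚ (coeff y α +ℚ coeff z α)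
      split x y z α = coeff-++ x (y +P z) α ∙ cong (coeff x α +ℚ_) (coeff-++ y z α)
    zeros : ∀ α → f α ≡ 0ℚ × g α ≡ 0ℚ × h α ≡ 0ℚ
    zeros α = lem (0∈? (toList α))
      where
      lem : Dec (0 ∈ toList α) → f α ≡ 0ℚ × g α ≡ 0ℚ × h α ≡ 0ℚ
      lem (no 0∉)  = f0 , g0 , ℚ-sum-zero f0 g0 (total α)
        where
        f0 : f α ≡ 0ℚ
        f0 = cong₂ (λ x y → x +ℚ -ℚ y) (ExtLE-0 {p = a} A α 0∉) (ExtLE-0 {p = a′} A′ α 0∉)
        g0 : g α ≡ 0ℚ
        g0 = cong₂ (λ x y → x +ℚ -ℚ y) (ExtLE-0 {p = b} B α 0∉) (ExtLE-0 {p = b′} B′ α 0∉)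
      lem (yes 0∈) = f0 , sym (ℚ.+-identityˡ (g α)) ∙ cong (_+ℚ g α) (sym f0) ∙ fg α ↭-refl , h0 α ↭-refl
        where
        h0 : ∀ β → toList β ↭ toList α → h β ≡ 0ℚ
        h0 β r = cong₂ (λ x y → x +ℚ -ℚ y) (C β ∙ coeff-mulE-0 q β 0∈β) (C′ β ∙ coeff-mulE-0 q′ β 0∈β)
          where
          0∈β : 0 ∈ toList β
          0∈β = ↭.∈-resp-↭ (↭-sym r) 0∈
        fg : ∀ β → toList β ↭ toList α → f β +ℚ g β ≡ 0ℚ
        fg β r = cong (f β +ℚ_) (sym (ℚ.+-identityʳ (g β)) ∙ cong (g β +ℚ_) (sym (h0 β r))) ∙ total β
        f0 : f α ≡ 0ℚ
        f0 = Spanned-direct {α = α} {f} {g} (Spanned-+ (ExtLE-spanned {p = a} A α) (Spanned-neg (ExtLE-spanned {p = a′} A′ α)))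
               (Spanned-+ (ExtLE-spanned {p = b} B α) (Spanned-neg (ExtLE-spanned {p = b′} B′ α))) fg

  shift⁻ : ∀ x y z → x ≡ y ℤ.- z → x ℤ.+ z ≡ y
  shift⁻ x y z refl = ℤ.+-assoc y (ℤ.- z) z ∙ cong (ℤ._+_ y) (ℤ.+-inverseˡ z) ∙ ℤ.+-identityʳ y

  shift⁺ : ∀ x y z → x ℤ.+ z ≡ y → x ≡ y ℤ.- z
  shift⁺ x y z refl = sym (ℤ.+-assoc x z (ℤ.- z) ∙ cong (ℤ._+_ x) (ℤ.+-inverseʳ z) ∙ ℤ.+-identityʳ x)

  -- The degree of `M`: for `δ = 0` each of its `n` entries has been raised by one.
  target : ℕ → ℕ → Bool → ℤ.ℤ
  target d n true  = ℤ.+ d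
  target d n false = ℤ.+ d ℤ.- ℤ.+ n

  sum-map-suc : ∀ xs → sum (map suc xs) ≡ sum xs + length xs
  sum-map-suc []       = refl
  sum-map-suc (x ∷ xs) = cong suc (cong (λ z → x + z) (sum-map-suc xs) ∙ sym (ℕ.+-assoc x (sum xs) (length xs))) ∙ sym (ℕ.+-suc (x + sum xs) (length xs))

  degree⁺ : ∀ b {η} xs {d} → η ↭ 0 ∷ map (bump b) xs → length xs ≡ n → sum η ≡ d → ℤ.+ sum xs ≡ target d n b
  degree⁺ true      xs r refl refl = cong ℤ.+_ (sym (sum-↭ r ∙ cong sum (List.map-id xs)))
  degree⁺ false {η} xs r refl refl = shift⁺ (ℤ.+ sum xs) (ℤ.+ sum η) (ℤ.+ length xs) (cong ℤ.+_ (sym (sum-↭ r ∙ sum-map-suc xs)))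

  degree⁻ : ∀ b {η} xs {d} → η ↭ 0 ∷ map (bump b) xs → length xs ≡ n → ℤ.+ sum xs ≡ target d n b → sum η ≡ d
  degree⁻ true  xs     r refl e = sum-↭ r ∙ cong sum (List.map-id xs) ∙ ℤ.+-injective e
  degree⁻ false xs {d} r refl e = sum-↭ r ∙ sum-map-suc xs ∙ ℤ.+-injective (shift⁻ (ℤ.+ sum xs) (ℤ.+ d) (ℤ.+ length xs) e)

  degree-E⁺ : ∀ n xs {d} → length xs ≡ suc n → sum (map suc xs) ≡ d → ℤ.+ sum xs ≡ ℤ.+ d ℤ.- ℤ.+ n ℤ.- ℤ.+ 1
  degree-E⁺ n xs len refl = shift⁺ (ℤ.+ sum xs) _ (ℤ.+ 1) (shift⁺ (ℤ.+ (sum xs + 1)) (ℤ.+ sum (map suc xs)) (ℤ.+ n)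
    (cong ℤ.+_ (ℕ.+-assoc (sum xs) 1 n ∙ cong (λ z → sum xs + z) (sym len) ∙ sym (sum-map-suc xs))))

  degree-E⁻ : ∀ n xs {d} → length xs ≡ suc n → ℤ.+ sum xs ≡ ℤ.+ d ℤ.- ℤ.+ n ℤ.- ℤ.+ 1 → sum (map suc xs) ≡ d
  degree-E⁻ n xs {d} len e = sum-map-suc xs ∙ cong (λ z → sum xs + z) len ∙ sym (ℕ.+-assoc (sum xs) 1 n) ∙
    ℤ.+-injective (shift⁻ (ℤ.+ (sum xs + 1)) (ℤ.+ d) (ℤ.+ n) (shift⁻ (ℤ.+ sum xs) _ (ℤ.+ 1) e))

  remove0-↭ : ∀ {η} → 0 ∈ η → η ↭ 0 ∷ remove0 η
  remove0-↭ {zero ∷ η}  _         = ↭-refl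
  remove0-↭ {suc k ∷ η} (there q) = ↭-trans (prep (suc k) (remove0-↭ q)) (swap (suc k) 0 ↭-refl)

  map-suc-map-pred : ∀ {xs} → All (λ k → 0 < k) xs → map suc (map pred xs) ≡ xs
  map-suc-map-pred []                = refl
  map-suc-map-pred (_∷_ {suc k} _ h) = cong (suc k ∷_) (map-suc-map-pred h)

  toList-suc-pred : (β : Vec ℕ m) → 0 ∉ toList β → toList β ≡ map suc (toList (Vec.map pred β))
  toList-suc-pred β 0∉ = cong toList (sym (map-suc-pred β 0∉)) ∙ Vec.toList-map suc (Vec.map pred β)

  ≢-resp : {x y : ℚ} → x ≡ y → x ≢ 0ℚ → y ≢ 0ℚ
  ≢-resp refl ne = ne

  HasContent-ExtLE : ∀ {b η μ} → η ↭ 0 ∷ map (bump b) μ → length μ ≡ suc n →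
    (HasContent (suc (suc n)) η ∩ ExtLE (suc n) (DegCond (target (sum η) (suc n) b)) b) ≐ ExtLE (suc n) (ContCond μ) b
  HasContent-ExtLE {b = b} r len p = (λ (hc , e) → ExtLE-content {p = p} r hc e) , λ e →
    (λ β ne → let M , c , _ , r′ = ExtLE-support {p = p} e β ne in ↭-trans r′ (↭-trans (prep 0 (↭.map⁺ (bump b) c)) (↭-sym r))) ,
    ExtLE-map {p = p} (λ M s c → degree⁺ b (entries M) (↭-trans r (prep 0 (↭.map⁺ (bump b) (↭-sym c)))) (length-entries M ∙ s) refl) e

  Hom-ExtLE : ∀ {b d p} → ExtLE (suc n) (DegCond (target d (suc n) b)) b p → Hom (suc (suc n)) (ℤ.+ d) p
  Hom-ExtLE {b = b} {p = p} e β ne = let M , c , s , r = ExtLE-support {p = p} e β ne in cong ℤ.+_ (degree⁻ b (entries M) r (length-entries M ∙ s) c)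

  Hom-E : ∀ {n d p} → EDeg (suc n) (ℤ.+ d ℤ.- ℤ.+ n ℤ.- ℤ.+ 1) p → Hom (suc n) (ℤ.+ d) p
  Hom-E {n} (q , hq , p≈) β ne = let 0∉ , ne′ = mulE-support q β (≢-resp (p≈ β) ne) in
    cong ℤ.+_ (cong sum (toList-suc-pred β 0∉) ∙ degree-E⁻ n (toList (Vec.map pred β)) (Vec.length-toList (Vec.map pred β)) (hq _ ne′))

  Hom-divE : ∀ {n d p} → Hom (suc n) (ℤ.+ d) p → Hom (suc n) (ℤ.+ d ℤ.- ℤ.+ n ℤ.- ℤ.+ 1) (divE p)
  Hom-divE {n} {p = p} hp α ne = degree-E⁺ n (toList α) (Vec.length-toList α) (cong sum (sym (Vec.toList-map suc α)) ∙ ℤ.+-injective (hp _ (≢-resp (coeff-divE p α) ne)))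

  HasContent-E : ∀ {n η} → length η ≡ suc n → All (λ k → 0 < k) η →
    (HasContent (suc n) η ∩ EDeg (suc n) (ℤ.+ sum η ℤ.- ℤ.+ n ℤ.- ℤ.+ 1)) ≐ ECont (suc n) (map pred η)
  HasContent-E {n} {η} len pos p = to , from
    where
    to : (HasContent (suc n) η ∩ EDeg (suc n) (ℤ.+ sum η ℤ.- ℤ.+ n ℤ.- ℤ.+ 1)) p → ECont (suc n) (map pred η) p
    to (hc , q , hq , p≈) = q , (λ α ne → ↭-trans (↭-reflexive (cong toList (sym (map-pred-suc α)) ∙ Vec.toList-map pred (Vec.map suc α)))
      (↭.map⁺ pred (hc (Vec.map suc α) (≢-resp (sym (p≈ (Vec.map suc α) ∙ coeff-mulE q α)) ne)))) , p≈
    from : ECont (suc n) (map pred η) p → (HasContent (suc n) η ∩ EDeg (suc n) (ℤ.+ sum η ℤ.- ℤ.+ n ℤ.- ℤ.+ 1)) p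
    from (q , hq , p≈) = (λ β ne → let 0∉ , ne′ = mulE-support q β (≢-resp (p≈ β) ne) in
        ↭-trans (↭-reflexive (toList-suc-pred β 0∉)) (↭-trans (↭.map⁺ suc (hq _ ne′)) (↭-reflexive (map-suc-map-pred pos)))) ,
      q , (λ α ne → degree-E⁺ n (toList α) (Vec.length-toList α) (sum-↭ (↭.map⁺ suc (hq α ne)) ∙ cong sum (map-suc-map-pred pos))) , p≈

  restrict-∈ : ∀ {A : Vec ℕ m → Set} (A? : ∀ α → Dec (A α)) (p : Poly m) {t} → t ∈ restrict (λ α → does (A? α)) p → A (proj₁ t)
  restrict-∈ A? p {t} t∈ = lem (A? (proj₁ t)) (proj₂ (∈.∈-filter⁻ (λ t → 𝔹.T? (does (A? (proj₁ t)))) {xs = p} t∈))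
    where
    lem : ∀ {P : Set} (d : Dec P) → T (does d) → P
    lem (yes x) _ = x

  restrict-⊆ : ∀ {A : Vec ℕ m → Set} (A? : ∀ α → Dec (A α)) (p : Poly m) → (∀ α → coeff p α ≢ 0ℚ → A α) → p ≈P restrict (λ α → does (A? α)) p
  restrict-⊆ {A = A} A? p h = restrict-≈ _ p λ α ne → lem (A? α) (h α ne)
    where
    lem : ∀ {P : Set} (d : Dec P) → P → does d ≡ true
    lem (yes _) _ = refl
    lem (no ¬x) x = contradiction x ¬x

  ≈-Hom : ∀ {d} {p p′ : Poly m} → p ≈P p′ → Hom m d p → Hom m d p′
  ≈-Hom e h α ne = h α (≢-resp (sym (e α)) ne)

  Hom-spanned : ∀ d (p : Poly (suc (suc n))) → Hom (suc (suc n)) (ℤ.+ d) p →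
    Σ (Poly (suc (suc n))) λ a → Σ (Poly (suc (suc n))) λ b → Σ (Poly (suc (suc n))) λ c →
    ExtDeg (suc n) (ℤ.+ d) a × LEDeg (suc n) (ℤ.+ d ℤ.- ℤ.+ suc n) b × EDeg (suc (suc n)) (ℤ.+ d ℤ.- ℤ.+ suc n ℤ.- ℤ.+ 1) c × (p ≈P a +P (b +P c))
  Hom-spanned {n} d p hp =
    let a , b , A , B , e = decompose (λ b → DegCond (target d (suc n) b)) p₁ (λ t∈ _ M b s r → degree⁺ b (entries M) r (length-entries M ∙ s) (restrict-∈ degree? p t∈))
    in a , b , mulE (divE p₁) , A , B , (divE p₁ , Hom-divE {p = p₁} (≈-Hom {p = p} {p₁} p≈ hp) , λ _ → refl) , λ α → p≈ α ∙ e α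
    where
    degree? : (α : Vec ℕ (suc (suc n))) → Dec (sum (toList α) ≡ d)
    degree? α = sum (toList α) ℕ.≟ d
    -- `decompose` works on single terms, and the list `p` may contain terms of other degrees that
    -- cancel; they are removed beforehand.
    p₁ : Poly (suc (suc n))
    p₁ = restrict (λ α → does (degree? α)) p
    p≈ : p ≈P p₁
    p≈ = restrict-⊆ degree? p λ α ne → ℤ.+-injective (hp α ne)

  -- For `δ = 0` the only exponent 0 is the new one, so a second 0 excludes LE. The condition `⊥`
  -- for type `false` records this, and the first exponent 0 excludes the multiples of `e_m`.
  many-zeros : ∀ {η} → 0 ∈ η → 0 ∈ remove0 η → ∀ p → HasContent (suc (suc n)) η p → ExtDeg (suc n) (ℤ.+ sum η) p
  many-zeros {n} {η} 0∈ 0∈′ p hc =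
    let a , b , A , B , e = decompose cond p₁ valid in proj₁ A , λ β → p≈ β ∙ e β ∙ coeff-++ a _ β ∙
      cong (coeff a β +ℚ_) (coeff-++ b _ β ∙ cong₂ _+ℚ_ (empty b B β) (no-E β)) ∙ ℚ.+-identityʳ (coeff a β) ∙ proj₂ A β
    where
    content? : (α : Vec ℕ (suc (suc n))) → Dec (toList α ↭ η)
    content? α = toList α ↭? η
    p₁ : Poly (suc (suc n))
    p₁ = restrict (λ α → does (content? α)) p
    p≈ : p ≈P p₁
    p≈ = restrict-⊆ content? p hc
    cond : Bool → Tab → Set
    cond true  = DegCond (ℤ.+ sum η)
    cond false = λ _ → ⊥
    valid : ∀ {t} → t ∈ p₁ → 0 ∈ toList (proj₁ t) → ∀ M b → sum (shape M) ≡ suc n → toList (proj₁ t) ↭ 0 ∷ map (bump b) (entries M) → cond b M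
    valid t∈ _ M true  s r = degree⁺ true (entries M) (↭-trans (↭-sym (restrict-∈ content? p t∈)) r) (length-entries M ∙ s) refl
    valid t∈ _ M false s r = 0∉map-suc (entries M) (↭.∈-resp-↭ (↭.drop-∷ (↭-trans (↭-sym (remove0-↭ 0∈)) (↭-trans (↭-sym (restrict-∈ content? p t∈)) r))) 0∈′)
    empty : ∀ b → ExtLE (suc n) (cond false) false b → b ≈P []
    empty b ([]    , e) β = e β
    empty b (P ∷ _ , _) β = ⊥-elim (Piece.cnd P)
    no-E : ∀ β → coeff (mulE (divE p₁)) β ≡ 0ℚ
    no-E β = lem (coeff (mulE (divE p₁)) β ℚ.≟ 0ℚ)
      where
      lem : Dec (coeff (mulE (divE p₁)) β ≡ 0ℚ) → coeff (mulE (divE p₁)) β ≡ 0ℚ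
      lem (yes z) = z
      lem (no ne) = let 0∉ , ne′ = mulE-support (divE p₁) β ne in contradiction
        (↭.∈-resp-↭ (↭-sym (hc β (≢-resp (coeff-divE p₁ (Vec.map pred β) ∙ cong (coeff p₁) (map-suc-pred β 0∉) ∙ sym (p≈ β)) ne′))) 0∈) 0∉

open Summands

open import Data.Integer using (+_; _-_)

theorem3p25 : (d n : ℕ) → 1 ≤ n →
    DirectSum3 (suc n) (Hom (suc n) (+ d))
    (ExtDeg n (+ d)) (LEDeg n (+ d - + n)) (EDeg (suc n) (+ d - + n - + 1))
    ×
    ((η : List ℕ) → length η ≡ suc n →
    (0 ∈ η →
    ((HasContent (suc n) η ∩ ExtDeg n (+ sum η)) ≐ ExtCont n (remove0 η))
    × (0 ∈ remove0 η → ∀ p → HasContent (suc n) η p → ExtDeg n (+ sum η) p))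
    × (0 ∈ η → All (λ k → 0 < k) (remove0 η) →
    (HasContent (suc n) η ∩ LEDeg n (+ sum η - + n))
    ≐ LECont n (map pred (remove0 η)))
    × (All (λ k → 0 < k) η →
    (HasContent (suc n) η ∩ EDeg (suc n) (+ sum η - + n - + 1))
    ≐ ECont (suc n) (map pred η)))
theorem3p25 d (suc n) 1≤n =
  ((λ p → Hom-ExtLE {b = true} {p = p}) , (λ p → Hom-ExtLE {b = false} {p = p}) , (λ p → Hom-E {p = p}) , Hom-spanned d ,
   λ a b c a′ b′ c′ A B (q , _ , C) A′ B′ (q′ , _ , C′) e → sum-unique {a = a} {b} {c} {a′} {b′} {c′} {q} {q′} A B C A′ B′ C′ e) ,
  λ η len →
    (λ 0∈ → HasContent-ExtLE {b = true} (↭-trans (remove0-↭ 0∈) (↭-reflexive (cong (0 ∷_) (sym (List.map-id (remove0 η)))))) (remove0-length len 0∈) , many-zeros 0∈) ,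
    (λ 0∈ pos → HasContent-ExtLE {b = false} (↭-trans (remove0-↭ 0∈) (↭-reflexive (cong (0 ∷_) (sym (map-suc-map-pred pos)))))
      (List.length-map pred (remove0 η) ∙ remove0-length len 0∈)) ,
    HasContent-E len
  where
  remove0-length : ∀ {η k} → length η ≡ suc k → 0 ∈ η → length (remove0 η) ≡ k
  remove0-length len 0∈ = ℕ.suc-injective (sym (↭.↭-length (remove0-↭ 0∈)) ∙ len)
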